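{- Let $\epsilon=\epsilon(n)$ and $p=p(n)$ satisfy $\epsilon^{11} n p^{8} \gg \log^{5} n$. Then for every sufficiently large even integer $n$, every $(\epsilon,p)$-uniform digraph $D$ on $n$ vertices has a collection of pairwise edge-disjoint directed Hamilton cycles whose union contains all edges of $D$ except at most an $\epsilon^{1/8}$-fraction of them.
   Context: Digraphs have no loops and no repeated edges in the same direction, but may contain both $\overrightarrow{ab}$ and $\overrightarrow{ba}$. We write $A=(1\pm\epsilon)B$ for $(1-\epsilon)B\le A\le(1+\epsilon)B$. An $n$-vertex digraph is $(\epsilon,p)$-uniform if: (i) every vertex has out-degree and in-degree $(1\pm\epsilon)np$; (ii) for every pair of distinct vertices $a,b$, the number of common out-neighbours, the number of common in-neighbours, and the number of out-neighbours of $a$ that are in-neighbours of $b$ are each $(1\pm\epsilon)np^2$; (iii) for any four vertices $a,b,c,d$, all distinct except that possibly $b=c$, the number of vertices $x$ such that $\overrightarrow{ax},\overrightarrow{xb},\overrightarrow{cx},\overrightarrow{xd}$ are all edges is $(1\pm\epsilon)np^4$. Here $\epsilon,p$ are functions of $n$, $f\gg g$ means $f/g\to\infty$ as $n\to\infty$, and $\epsilon,p$ are implicitly assumed small (e.g. less than $1/10$).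
   Formalization: The functions ε(n) and p(n), real-valued in the statement, are taken to be rational-valued. -}

module Defs where

open import Data.Nat as ℕ using (ℕ; zero; suc)
open import Data.Nat.Logarithm using (⌊log₂_⌋)
open import Data.Bool using (Bool; true; false; if_then_else_)
open import Data.Fin using (Fin; toℕ)
open import Data.List using (List; map; allFin; length)
open import Data.Nat.ListAction using (sum)
open import Data.List.Membership.Propositional using (_∈_)
open import Data.Product using (Σ; _×_; _,_; ∃; ∃-syntax)
open import Data.Sum using (_⊎_)
open import Data.Integer using (+_)
open import Data.Rational using (ℚ; _+_; _*_; _-_; _≤_; _<_; 0ℚ; 1ℚ; _/_)
open import Function.Definitions using (Injective)
open import Relation.Binary.PropositionalEquality using (_≡_)
open import Relation.Nullary using (¬_)

ℕ→ℚ : ℕ → ℚ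
ℕ→ℚ k = + k / 1

_^ℚ_ : ℚ → ℕ → ℚ
x ^ℚ zero = 1ℚ
x ^ℚ suc k = x * (x ^ℚ k)

_≈[1±_]_ : ℚ → ℚ → ℚ → Set
A ≈[1± ε ] B = ((1ℚ - ε) * B ≤ A) × (A ≤ (1ℚ + ε) * B)

count : ∀ {n} → (Fin n → Bool) → ℕ
count {n} P = sum (map (λ x → if P x then 1 else 0) (allFin n))

record Digraph (n : ℕ) : Set where
  field
    adj     : Fin n → Fin n → Bool
    loopless : ∀ a → adj a a ≡ false
open Digraph public

_∧_ : Bool → Bool → Bool
true ∧ b = b
false ∧ b = false

edgeCount : ∀ {n} → Digraph n → ℕ
edgeCount D = sum (map (λ a → count (λ b → adj D a b)) (allFin _))

outDeg inDeg : ∀ {n} → Digraph n → Fin n → ℕ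
outDeg D a = count (λ x → adj D a x)
inDeg  D a = count (λ x → adj D x a)

record Uniform {n : ℕ} (ε p : ℚ) (D : Digraph n) : Set where
  field
    outDeg-ok : ∀ a → ℕ→ℚ (outDeg D a) ≈[1± ε ] (ℕ→ℚ n * p)
    inDeg-ok  : ∀ a → ℕ→ℚ (inDeg D a)  ≈[1± ε ] (ℕ→ℚ n * p)
    commonOut : ∀ a b → ¬ a ≡ b →
      ℕ→ℚ (count (λ x → adj D a x ∧ adj D b x)) ≈[1± ε ] (ℕ→ℚ n * (p ^ℚ 2))
    commonIn  : ∀ a b → ¬ a ≡ b →
      ℕ→ℚ (count (λ x → adj D x a ∧ adj D x b)) ≈[1± ε ] (ℕ→ℚ n * (p ^ℚ 2))
    outIn     : ∀ a b → ¬ a ≡ b →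
      ℕ→ℚ (count (λ x → adj D a x ∧ adj D x b)) ≈[1± ε ] (ℕ→ℚ n * (p ^ℚ 2))
    fourCount : ∀ a b c d → ¬ a ≡ b → ¬ a ≡ c → ¬ a ≡ d → ¬ b ≡ d → ¬ c ≡ d →
      ℕ→ℚ (count (λ x → adj D a x ∧ (adj D x b ∧ (adj D c x ∧ adj D x d))))
        ≈[1± ε ] (ℕ→ℚ n * (p ^ℚ 4))

-- A directed Hamilton cycle on Fin n, given by an injective (hence bijective)
-- enumeration σ of the vertices: σ 0 → σ 1 → … → σ (n-1) → σ 0.
HamCycle : ℕ → Set
HamCycle n = Σ (Fin n → Fin n) (λ σ → Injective _≡_ _≡_ σ)

IsNext : ∀ {n} → Fin n → Fin n → Set
IsNext {n} i j = (toℕ j ≡ suc (toℕ i)) ⊎ ((toℕ j ≡ 0) × (suc (toℕ i) ≡ n))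

CycleEdge : ∀ {n} → HamCycle n → Fin n → Fin n → Set
CycleEdge (σ , _) a b = ∃[ i ] ∃[ j ] (IsNext i j × (σ i ≡ a) × (σ j ≡ b))

CycleIn : ∀ {n} → Digraph n → HamCycle n → Set
CycleIn D C = ∀ a b → CycleEdge C a b → adj D a b ≡ true

data PairwiseEdgeDisjoint {n : ℕ} : List (HamCycle n) → Set where
  []  : PairwiseEdgeDisjoint Data.List.[]
  _∷_ : ∀ {C Cs} →
        (∀ C' → C' ∈ Cs → ∀ a b → CycleEdge C a b → ¬ CycleEdge C' a b) →
        PairwiseEdgeDisjoint Cs → PairwiseEdgeDisjoint (C Data.List.∷ Cs)

-- the hypothesis  ε^11 n p^8 ≫ log^5 n  (log taken as ⌊log₂ n⌋)
GrowthHyp : (ℕ → ℚ) → (ℕ → ℚ) → Set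
GrowthHyp ε p = ∀ (M : ℚ) → ∃[ N ] ∀ n → N ℕ.≤ n →
  M * (ℕ→ℚ ⌊log₂ n ⌋ ^ℚ 5) ≤ (ε n ^ℚ 11) * ℕ→ℚ n * (p n ^ℚ 8)

{-# OPTIONS --safe #-}
module Submission where

-- Apart from a few leftover vertices, V is split into K = 2^κ classes, each subdivided into Q² labelled
-- fine classes on which all degrees and codegrees stay close to their expectation; the splitting halves
-- repeatedly by the method of conditional expectations.  A cycle of type t visits the classes in the
-- order t + k(k+1)/2, so every ordered pair of classes is consecutive for at most one type and cycles of
-- different types are edge-disjoint for free.  For a fixed type the bipartite graphs between consecutive
-- classes are pseudorandom, hence contain almost as many disjoint perfect matchings as their degree
-- allows: by an uncrossing argument it suffices to check cuts, and these are controlled by counting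
-- codegrees.  Following the matchings gives paths through all but the last ω classes.  The remaining
-- vertices are gadgets: some join the end of one path to the start of the next, the others are inserted
-- in place of a matching edge of a host position.  The labels reserve disjoint sets of edges for these
-- purposes, and the gadgets are attached greedily with the host positions balancing the load.

-- Which gadgets become connectors is known only after the matchings are fixed, since that depends
-- on where the paths end; yet the matchings must already make room for inserting all the others.
-- The way out is a deferred choice: every gadget g from a class receives in advance vertices u and
-- v at its host position such that u → g, g → v and also u → v are edges, and the matching is
-- forced to send u to v. If g turns out to be a connector, the cycle takes the shortcut u → v,
-- otherwise u → g → v. Leftover vertices are never connectors and need no shortcut. Beyond the
-- order of the classes, cycles are kept apart by the role of an edge, which can be read off its two
-- ends, and by greedy choices within each role. All estimates are integral: R stands for 1/ε, P for
-- 1/p, L for log n, and the eighth root becomes a comparison of eighth powers. The hypotheses admit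
-- ε up to 1/10, and the constants 31, 640 and 28 are fitted to this end of the range; for smaller ε
-- there is ever more room.

module Combinatorics where

 open import Data.Nat
 open import Data.Nat.Properties
 open import Data.Nat.DivMod using (_/_; _%_; m≡m%n+[m/n]*n; m%n<n; m/n*n≤m; m<n⇒m%n≡m; m<n*o⇒m/o<n; [m+n]%n≡m%n; [m+kn]%n≡m%n; %-distribˡ-+; /-mono-≤)
 open import Data.Bool using (Bool; true; false; not; if_then_else_; _∧_; _∨_)
 open import Data.Bool.Properties using (¬-not)
 open import Data.Fin using (Fin; zero; suc; toℕ; fromℕ<; _↑ˡ_; _↑ʳ_; combine; remQuot; splitAt)
 import Data.Fin.Properties as FP
 open import Data.List using (List; []; _∷_; _++_; length; map; concatMap; tabulate; allFin)
 open import Data.List.Properties using (length-++; length-map; length-tabulate; map-tabulate)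
 open import Data.List.Membership.Propositional using (_∈_; _∉_)
 open import Data.List.Membership.Propositional.Properties using (∈-map⁺; ∈-map⁻; ∈-++⁺ˡ; ∈-++⁺ʳ; ∈-++⁻; ∈-allFin)
 open import Data.List.Relation.Unary.Any using (Any; here; there)
 import Data.List.Relation.Unary.Any as Any
 open import Data.List.Relation.Unary.All using (All; []; _∷_)
 import Data.List.Relation.Unary.All as All
 open import Data.Product using (_×_; _,_; proj₁; proj₂; ∃; ∃₂)
 open import Data.Product.Properties using (,-injectiveˡ; ,-injectiveʳ)
 open import Data.Sum using (_⊎_; inj₁; inj₂; [_,_]′)
 open import Data.Empty using (⊥; ⊥-elim)
 open import Data.Unit using (⊤; tt)
 open import Function using (_∘_; id; case_of_)
 open import Relation.Nullary using (¬_; Dec; yes; no; ¬?; _×-dec_)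
 open import Relation.Nullary.Decidable using (⌊_⌋; map′)
 open import Relation.Binary.PropositionalEquality using (_≡_; _≢_; refl; sym; trans; cong; cong₂; subst; subst₂; module ≡-Reasoning)
 open import Relation.Binary.Definitions using (DecidableEquality)
 open import Data.Vec using (Vec; lookup; zipWith; replicate; _[_]≔_)
 open import Data.Vec.Properties using (lookup-zipWith; lookup-replicate; lookup∘update; lookup∘update′)
 open import Data.Fin.Subset.Properties using (anySubset?)
 open import Data.List.Relation.Unary.Unique.Propositional using (Unique)
 import Data.List.Relation.Unary.AllPairs as AP
 open import Data.Bool.Properties using () renaming (_≟_ to _≟B_)
 open import Data.List using (cartesianProduct)
 open import Data.List.Membership.Propositional.Properties using (∈-cartesianProduct⁺)
 import Data.Product.Properties as ×P
 import Data.Sum.Properties as ⊎P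
 import Data.List.Relation.Unary.Unique.Propositional.Properties as UP
 open import Data.List using (filter)
 open import Data.List.Membership.Propositional.Properties using (∈-filter⁺; ∈-filter⁻)
 open import Relation.Binary.Definitions using (Tri; tri<; tri≈; tri>)
 open import Data.Nat.Divisibility using (_∣_; divides; ∣m+n∣m⇒∣n; m∣m*n; ∣⇒≤; *-cancelˡ-∣; *-monoʳ-∣; ∣-trans)
 open import Relation.Nullary.Decidable using (toWitness)
 import Defs as D
 import Data.Nat.ListAction as LA
 open import Data.Nat.Solver using (module +-*-Solver)
 open +-*-Solver using (solve; _:=_; _:+_; _:*_; con)

 -- Finite sums, counting and greedy choice.

 𝟙 : Bool → ℕ
 𝟙 b = if b then 1 else 0

 ∑ : ∀ n → (Fin n → ℕ) → ℕ
 ∑ zero    f = 0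
 ∑ (suc n) f = f zero + ∑ n (f ∘ suc)

 cnt : ∀ n → (Fin n → Bool) → ℕ
 cnt n P = ∑ n (λ i → 𝟙 (P i))

 𝟙≤1 : ∀ b → 𝟙 b ≤ 1
 𝟙≤1 true  = ≤-refl
 𝟙≤1 false = z≤n

 ∑-cong : ∀ n {f g : Fin n → ℕ} → (∀ i → f i ≡ g i) → ∑ n f ≡ ∑ n g
 ∑-cong zero    eq = refl
 ∑-cong (suc n) eq = cong₂ _+_ (eq zero) (∑-cong n (eq ∘ suc))

 ∑-mono : ∀ n {f g : Fin n → ℕ} → (∀ i → f i ≤ g i) → ∑ n f ≤ ∑ n g
 ∑-mono zero    le = z≤n
 ∑-mono (suc n) le = +-mono-≤ (le zero) (∑-mono n (le ∘ suc))

 ∑-zero : ∀ n → ∑ n (λ _ → 0) ≡ 0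
 ∑-zero zero    = refl
 ∑-zero (suc n) = ∑-zero n

 ∑-const : ∀ n c → ∑ n (λ _ → c) ≡ n * c
 ∑-const zero    c = refl
 ∑-const (suc n) c = cong (c +_) (∑-const n c)

 ∑-+ : ∀ n (f g : Fin n → ℕ) → ∑ n (λ i → f i + g i) ≡ ∑ n f + ∑ n g
 ∑-+ zero    f g = refl
 ∑-+ (suc n) f g = trans (cong (f zero + g zero +_) (∑-+ n (f ∘ suc) (g ∘ suc)))
   (interchange (f zero) (g zero) _ _)
   where
   interchange : ∀ a b c d → a + b + (c + d) ≡ a + c + (b + d)
   interchange = solve 4 (λ a b c d → a :+ b :+ (c :+ d) := a :+ c :+ (b :+ d)) refl

 ∑-*ˡ : ∀ n c (f : Fin n → ℕ) → ∑ n (λ i → c * f i) ≡ c * ∑ n f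
 ∑-*ˡ zero    c f = sym (*-zeroʳ c)
 ∑-*ˡ (suc n) c f = trans (cong (c * f zero +_) (∑-*ˡ n c (f ∘ suc))) (sym (*-distribˡ-+ c (f zero) _))

 ∑-*ʳ : ∀ n c (f : Fin n → ℕ) → ∑ n (λ i → f i * c) ≡ ∑ n f * c
 ∑-*ʳ n c f = trans (∑-cong n (λ i → *-comm (f i) c)) (trans (∑-*ˡ n c f) (*-comm c _))

 ∑-comm : ∀ a b (f : Fin a → Fin b → ℕ) → ∑ a (λ i → ∑ b (f i)) ≡ ∑ b (λ j → ∑ a (λ i → f i j))
 ∑-comm zero    b f = sym (∑-zero b)
 ∑-comm (suc a) b f = trans (cong (∑ b (f zero) +_) (∑-comm a b (f ∘ suc)))
   (sym (∑-+ b (f zero) (λ j → ∑ a (λ i → f (suc i) j))))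

 ≤∑ : ∀ {n} (f : Fin n → ℕ) i → f i ≤ ∑ n f
 ≤∑ f zero    = m≤m+n _ _
 ≤∑ f (suc i) = ≤-trans (≤∑ (f ∘ suc) i) (m≤n+m _ _)

 ∑-++ : ∀ a b (f : Fin (a + b) → ℕ) → ∑ (a + b) f ≡ ∑ a (λ i → f (i ↑ˡ b)) + ∑ b (λ j → f (a ↑ʳ j))
 ∑-++ zero    b f = refl
 ∑-++ (suc a) b f = trans (cong (f zero +_) (∑-++ a b (f ∘ suc))) (sym (+-assoc (f zero) _ _))

 ∑-combine : ∀ a b (f : Fin (a * b) → ℕ) → ∑ (a * b) f ≡ ∑ a (λ i → ∑ b (λ j → f (combine i j)))
 ∑-combine zero    b f = refl
 ∑-combine (suc a) b f = trans (∑-++ b (a * b) f)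
   (cong (∑ b (λ i → f (i ↑ˡ (a * b))) +_) (∑-combine a b (f ∘ (b ↑ʳ_))))

 eqF : ∀ {n} → Fin n → Fin n → Bool
 eqF i j = ⌊ i FP.≟ j ⌋

 eqF-refl : ∀ {n} (i : Fin n) → eqF i i ≡ true
 eqF-refl i with i FP.≟ i
 ... | yes _ = refl
 ... | no ne = ⊥-elim (ne refl)

 eqF-≡ : ∀ {n} {i j : Fin n} → eqF i j ≡ true → i ≡ j
 eqF-≡ {i = i} {j} eq with i FP.≟ j
 ... | yes p = p
 eqF-≡ () | no _

 ∑-δ : ∀ n (j : Fin n) → ∑ n (λ i → 𝟙 (eqF i j)) ≡ 1
 ∑-δ (suc n) zero    = cong suc (∑-zero n)
 ∑-δ (suc n) (suc j) = trans (∑-cong n (λ i → cong 𝟙 (step i j))) (∑-δ n j)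
   where
   step : ∀ (i j : Fin n) → eqF (suc i) (suc j) ≡ eqF i j
   step i j with i FP.≟ j
   ... | yes _ = refl
   ... | no  _ = refl

 -- Multiplicity is used instead of membership because its sum over all vertices is exactly the
 -- length of the list, with or without repetitions.
 occ : ∀ {n} → Fin n → List (Fin n) → ℕ
 occ x []      = 0
 occ x (y ∷ l) = 𝟙 (eqF x y) + occ x l

 ∑-occ : ∀ n (l : List (Fin n)) → ∑ n (λ x → occ x l) ≡ length l
 ∑-occ n []      = ∑-zero n
 ∑-occ n (y ∷ l) = trans (∑-+ n _ _) (cong₂ _+_ (∑-δ n y) (∑-occ n l))

 ∈⇒occ : ∀ {n} {x : Fin n} {l} → x ∈ l → 1 ≤ occ x l
 ∈⇒occ {x = x} (here refl) rewrite eqF-refl x = s≤s z≤n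
 ∈⇒occ (there p) = ≤-trans (∈⇒occ p) (m≤n+m _ _)

 mem : ∀ {n} → Fin n → List (Fin n) → Bool
 mem x l = ⌊ Any.any? (x FP.≟_) l ⌋

 mem-true : ∀ {n} {x : Fin n} {l} → x ∈ l → mem x l ≡ true
 mem-true {x = x} {l} p with Any.any? (x FP.≟_) l
 ... | yes _ = refl
 ... | no ¬p = ⊥-elim (¬p p)

 mem-∈ : ∀ {n} {x : Fin n} {l} → mem x l ≡ true → x ∈ l
 mem-∈ {x = x} {l} p with Any.any? (x FP.≟_) l
 ... | yes q = q
 mem-∈ () | no _

 mem-false : ∀ {n} {x : Fin n} {l} → mem x l ≡ false → x ∉ l
 mem-false {x = x} {l} eq p with Any.any? (x FP.≟_) l
 mem-false () p | yes _
 ... | no ¬p = ¬p p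

 mem≤occ : ∀ {n} (x : Fin n) l → 𝟙 (mem x l) ≤ occ x l
 mem≤occ x l with Any.any? (x FP.≟_) l
 ... | yes p = ∈⇒occ p
 ... | no _  = z≤n

 ∧-true : ∀ {a b} → a ∧ b ≡ true → a ≡ true × b ≡ true
 ∧-true {true} {true} refl = refl , refl

 not-true : ∀ {b} → not b ≡ true → b ≡ false
 not-true {false} refl = refl

 cnt-mono : ∀ n {P R : Fin n → Bool} → (∀ i → P i ≡ true → R i ≡ true) → cnt n P ≤ cnt n R
 cnt-mono n {P} {R} imp = ∑-mono n (λ i → le (P i) (R i) (imp i))
   where
   le : ∀ p r → (p ≡ true → r ≡ true) → 𝟙 p ≤ 𝟙 r
   le false r f = z≤n
   le true  r f rewrite f refl = ≤-refl

 cnt-remove : ∀ n (P : Fin n → Bool) (l : List (Fin n)) → cnt n P ≤ cnt n (λ i → P i ∧ not (mem i l)) + length l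
 cnt-remove n P l = begin
   cnt n P ≤⟨ ∑-mono n (λ i → le (P i) (mem i l) (mem≤occ i l)) ⟩
   ∑ n (λ i → 𝟙 (P i ∧ not (mem i l)) + occ i l) ≡⟨ ∑-+ n _ _ ⟩
   cnt n (λ i → P i ∧ not (mem i l)) + ∑ n (λ i → occ i l) ≡⟨ cong (cnt n (λ i → P i ∧ not (mem i l)) +_) (∑-occ n l) ⟩
   cnt n (λ i → P i ∧ not (mem i l)) + length l ∎
   where
   open ≤-Reasoning
   le : ∀ p q {o} → 𝟙 q ≤ o → 𝟙 p ≤ 𝟙 (p ∧ not q) + o
   le false q     h = z≤n
   le true  false h = s≤s z≤n
   le true  true  h = h

 cnt-witness : ∀ n (P : Fin n → Bool) → 0 < cnt n P → ∃ λ i → P i ≡ true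
 cnt-witness (suc n) P pos with P zero in eq
 ... | true  = zero , eq
 ... | false with cnt-witness n (P ∘ suc) pos
 ...   | i , p = suc i , p

 -- The engine of every greedy step: a large candidate set is not exhausted by a short list.
 abstract
   avoid : ∀ {n} (P : Fin n → Bool) (l : List (Fin n)) → length l < cnt n P → ∃ λ x → P x ≡ true × x ∉ l
   avoid {n} P l lt with cnt-witness n (λ i → P i ∧ not (mem i l))
     (+-cancelʳ-< (length l) 0 _ (<-≤-trans lt (cnt-remove n P l)))
   ... | i , p = i , proj₁ (∧-true p) , mem-false (not-true (proj₂ (∧-true {P i} p)))

 -- Sequential choice: if every item can avoid conflicts with arbitrary choices for all other
 -- items, then conflict-free choices exist simultaneously.
 abstract
   greedy : ∀ {a c d e} {I : Set a} {Val : Set c} (_≟I_ : DecidableEquality I)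
     (Ok : I → Val → Set d) (Conf : I → I → Val → Val → Set e) →
     (∀ {i i′ v v′} → Conf i i′ v v′ → Conf i′ i v′ v) →
     (∀ i (f : I → Val) → ∃ λ v → Ok i v × (∀ i′ → i′ ≢ i → ¬ Conf i i′ v (f i′))) →
     (I → Val) → (xs : List I) →
     ∃ λ (f : I → Val) → (∀ i → i ∈ xs → Ok i (f i)) ×
       (∀ i i′ → i ∈ xs → i′ ∈ xs → i′ ≢ i → ¬ Conf i i′ (f i) (f i′))
   greedy _≟I_ Ok Conf csym step f₀ [] = f₀ , (λ _ ()) , (λ _ _ ())
   greedy {I = I} {Val} _≟I_ Ok Conf csym step f₀ (x ∷ xs) with greedy _≟I_ Ok Conf csym step f₀ xs
   ... | f , ok , nc with step x f
   ...   | v , okv , ncv = g , okg , ncg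
     where
     g : I → Val
     g i with i ≟I x
     ... | yes _ = v
     ... | no  _ = f i
     okg : ∀ i → i ∈ x ∷ xs → Ok i (g i)
     okg i p with i ≟I x
     okg i p         | yes refl = okv
     okg i (here q)  | no i≢x   = ⊥-elim (i≢x q)
     okg i (there p) | no i≢x   = ok i p
     ncg : ∀ i i′ → i ∈ x ∷ xs → i′ ∈ x ∷ xs → i′ ≢ i → ¬ Conf i i′ (g i) (g i′)
     ncg i i′ p p′ ne with i ≟I x | i′ ≟I x
     ncg i i′ p p′ ne | yes refl | yes refl = ⊥-elim (ne refl)
     ncg i i′ p p′ ne | yes refl | no ne′ = ncv i′ ne′
     ncg i i′ p p′ ne | no ne′ | yes refl = ncv i ne′ ∘ csym
     ncg i i′ (here q) p′ ne | no ne₁ | no ne₂ = ⊥-elim (ne₁ q)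
     ncg i i′ (there p) (here q) ne | no ne₁ | no ne₂ = ⊥-elim (ne₂ q)
     ncg i i′ (there p) (there p′) ne | no ne₁ | no ne₂ = nc i i′ p p′ ne

 -- Bipartite graphs with prescribed degrees.

 module _ {M N : ℕ} where

   rowSum : (Fin M → ℕ) → (Fin M → Bool) → ℕ
   rowSum a S = ∑ M (λ x → if S x then a x else 0)

   coSum : (Fin N → ℕ) → (Fin N → Bool) → ℕ
   coSum b T = ∑ N (λ y → if T y then 0 else b y)

   edges : (Fin M → Fin N → Bool) → (Fin M → Bool) → (Fin N → Bool) → ℕ
   edges G S T = ∑ M (λ x → cnt N (λ y → G x y ∧ (S x ∧ T y)))

   -- Min-cut condition for the network source → rows → columns → sink with capacities `a`, 1 and
   -- `b`, for the cut that has S and the complement of T on the source side. Subsets are Boolean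
   -- vectors, so that a violated cut can be found by finite search.
   Feasible : (Fin M → Fin N → Bool) → (Fin M → ℕ) → (Fin N → ℕ) → Set
   Feasible G a b = ∀ (S : Vec Bool M) (T : Vec Bool N) →
     rowSum a (lookup S) ≤ edges G (lookup S) (lookup T) + coSum b (lookup T)

   feasible? : ∀ G a b → Feasible G a b ⊎
     (∃₂ λ (S : Vec Bool M) (T : Vec Bool N) →
       edges G (lookup S) (lookup T) + coSum b (lookup T) < rowSum a (lookup S))
   feasible? G a b with anySubset? {M} (λ S → anySubset? {N} (λ T →
       suc (edges G (lookup S) (lookup T) + coSum b (lookup T)) ≤? rowSum a (lookup S)))
   ... | yes (S , T , p) = inj₂ (S , T , p)
   ... | no ¬p = inj₁ (λ S T → ≮⇒≥ (λ lt → ¬p (S , T , lt)))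

   edges-cong : ∀ {G S S′ T T′} → (∀ x → S x ≡ S′ x) → (∀ y → T y ≡ T′ y) → edges G S T ≡ edges G S′ T′
   edges-cong {G} p q = ∑-cong M (λ x → ∑-cong N (λ y → cong 𝟙 (cong (G x y ∧_) (cong₂ _∧_ (p x) (q y)))))

   rowSum-cong : ∀ {a S S′} → (∀ x → S x ≡ S′ x) → rowSum a S ≡ rowSum a S′
   rowSum-cong {a} p = ∑-cong M (λ x → cong (λ s → if s then a x else 0) (p x))

   coSum-cong : ∀ {b T T′} → (∀ x → T x ≡ T′ x) → coSum b T ≡ coSum b T′
   coSum-cong {b} p = ∑-cong N (λ x → cong (λ s → if s then 0 else b x) (p x))

   module _ (G : Fin M → Fin N → Bool) where

     -- Cut capacities are submodular. Since T counts on the sink side of a cut, intersecting the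
     -- source sides means S₁ ∩ S₂ together with T₁ ∪ T₂; hence the two operations run in opposite
     -- directions.
     edges-uncross : ∀ S₁ S₂ T₁ T₂ →
       edges G (λ x → S₁ x ∧ S₂ x) (λ y → T₁ y ∨ T₂ y) + edges G (λ x → S₁ x ∨ S₂ x) (λ y → T₁ y ∧ T₂ y)
         ≤ edges G S₁ T₁ + edges G S₂ T₂
     edges-uncross S₁ S₂ T₁ T₂ = subst₂ _≤_ (∑-+ M _ _) (∑-+ M _ _)
       (∑-mono M (λ x → subst₂ _≤_ (∑-+ N _ _) (∑-+ N _ _)
         (∑-mono N (λ y → pt (G x y) (S₁ x) (S₂ x) (T₁ y) (T₂ y)))))
       where
       pt : ∀ g s₁ s₂ t₁ t₂ → 𝟙 (g ∧ ((s₁ ∧ s₂) ∧ (t₁ ∨ t₂))) + 𝟙 (g ∧ ((s₁ ∨ s₂) ∧ (t₁ ∧ t₂)))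
         ≤ 𝟙 (g ∧ (s₁ ∧ t₁)) + 𝟙 (g ∧ (s₂ ∧ t₂))
       pt false _ _ _ _ = z≤n
       pt true true true true true = ≤-refl
       pt true true true true false = ≤-refl
       pt true true true false true = ≤-refl
       pt true true true false false = ≤-refl
       pt true true false true true = ≤-refl
       pt true true false true false = z≤n
       pt true true false false true = ≤-refl
       pt true true false false false = ≤-refl
       pt true false true true true = ≤-refl
       pt true false true true false = ≤-refl
       pt true false true false true = z≤n
       pt true false true false false = ≤-refl
       pt true false false _ _ = z≤n

   rowSum-modular : ∀ a S₁ S₂ → rowSum a (λ x → S₁ x ∧ S₂ x) + rowSum a (λ x → S₁ x ∨ S₂ x) ≡ rowSum a S₁ + rowSum a S₂
   rowSum-modular a S₁ S₂ = trans (sym (∑-+ M _ _)) (trans (∑-cong M (λ x → pt (S₁ x) (S₂ x) (a x))) (∑-+ M _ _))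
     where
     pt : ∀ s t c → (if s ∧ t then c else 0) + (if s ∨ t then c else 0) ≡ (if s then c else 0) + (if t then c else 0)
     pt true  true  c = refl
     pt true  false c = sym (+-identityʳ c)
     pt false true  c = refl
     pt false false c = refl

   coSum-modular : ∀ b T₁ T₂ → coSum b (λ x → T₁ x ∨ T₂ x) + coSum b (λ x → T₁ x ∧ T₂ x) ≡ coSum b T₁ + coSum b T₂
   coSum-modular b T₁ T₂ = trans (sym (∑-+ N _ _)) (trans (∑-cong N (λ x → pt (T₁ x) (T₂ x) (b x))) (∑-+ N _ _))
     where
     pt : ∀ s t c → (if s ∨ t then 0 else c) + (if s ∧ t then 0 else c) ≡ (if s then 0 else c) + (if t then 0 else c)
     pt true  true  c = refl
     pt true  false c = refl
     pt false true  c = sym (+-identityʳ c)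
     pt false false c = refl

   delete : (Fin M → Fin N → Bool) → Fin M → Fin N → Fin M → Fin N → Bool
   delete G x₀ y₀ x y = G x y ∧ not (eqF x x₀ ∧ eqF y y₀)

   ∑-δ∧ : ∀ n (j : Fin n) (P : Fin n → Bool) → ∑ n (λ i → 𝟙 (eqF i j ∧ P i)) ≡ 𝟙 (P j)
   ∑-δ∧ n j P = begin
     ∑ n (λ i → 𝟙 (eqF i j ∧ P i))       ≡⟨ ∑-cong n pt ⟩
     ∑ n (λ i → 𝟙 (P j) * 𝟙 (eqF i j))   ≡⟨ ∑-*ˡ n (𝟙 (P j)) (λ i → 𝟙 (eqF i j)) ⟩
     𝟙 (P j) * ∑ n (λ i → 𝟙 (eqF i j))   ≡⟨ cong (𝟙 (P j) *_) (∑-δ n j) ⟩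
     𝟙 (P j) * 1                         ≡⟨ *-identityʳ _ ⟩
     𝟙 (P j) ∎
     where
     open ≡-Reasoning
     pt : ∀ i → 𝟙 (eqF i j ∧ P i) ≡ 𝟙 (P j) * 𝟙 (eqF i j)
     pt i with i FP.≟ j
     ... | yes refl = sym (*-identityʳ _)
     ... | no _     = sym (*-zeroʳ (𝟙 (P j)))

   edges-delete : ∀ G x₀ y₀ S T → G x₀ y₀ ≡ true →
     edges G S T ≡ edges (delete G x₀ y₀) S T + 𝟙 (S x₀ ∧ T y₀)
   edges-delete G x₀ y₀ S T g = begin
     edges G S T
       ≡⟨ ∑-cong M (λ x → trans (∑-cong N (λ y → pt x y)) (∑-+ N _ _)) ⟩
     ∑ M (λ x → cnt N (λ y → delete G x₀ y₀ x y ∧ (S x ∧ T y)) + cnt N (λ y → eqF y y₀ ∧ (eqF x x₀ ∧ (S x ∧ T y))))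
       ≡⟨ ∑-+ M _ _ ⟩
     edges (delete G x₀ y₀) S T + ∑ M (λ x → cnt N (λ y → eqF y y₀ ∧ (eqF x x₀ ∧ (S x ∧ T y))))
       ≡⟨ cong (edges (delete G x₀ y₀) S T +_) (trans (∑-cong M (λ x → ∑-δ∧ N y₀ _)) (∑-δ∧ M x₀ _)) ⟩
     edges (delete G x₀ y₀) S T + 𝟙 (S x₀ ∧ T y₀) ∎
     where
     open ≡-Reasoning
     pt : ∀ x y → 𝟙 (G x y ∧ (S x ∧ T y)) ≡
       𝟙 (delete G x₀ y₀ x y ∧ (S x ∧ T y)) + 𝟙 (eqF y y₀ ∧ (eqF x x₀ ∧ (S x ∧ T y)))
     pt x y with x FP.≟ x₀ | y FP.≟ y₀
     ... | yes refl | yes refl rewrite g = refl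
     ... | yes refl | no _  with G x y
     ...   | true  = sym (+-identityʳ _)
     ...   | false = refl
     pt x y | no _ | yes _ with G x y
     ...   | true  = sym (+-identityʳ _)
     ...   | false = refl
     pt x y | no _ | no _ with G x y
     ...   | true  = sym (+-identityʳ _)
     ...   | false = refl

   record Factor (G : Fin M → Fin N → Bool) (a : Fin M → ℕ) (b : Fin N → ℕ) : Set where
     field
       F    : Fin M → Fin N → Bool
       F⊆G  : ∀ x y → F x y ≡ true → G x y ≡ true
       rows : ∀ x → cnt N (F x) ≡ a x
       cols : ∀ y → cnt M (λ x → F x y) ≡ b y

   decr : ∀ {n} → (Fin n → ℕ) → Fin n → Fin n → ℕ
   decr a x₀ x = a x ∸ 𝟙 (eqF x x₀)

   decr-+ : ∀ {n} (a : Fin n → ℕ) x₀ → 1 ≤ a x₀ → ∀ x → decr a x₀ x + 𝟙 (eqF x x₀) ≡ a x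
   decr-+ a x₀ pos x with x FP.≟ x₀
   ... | yes refl = m∸n+n≡m pos
   ... | no _     = +-identityʳ _

   rowSum-decr : ∀ a x₀ → 1 ≤ a x₀ → ∀ S → rowSum (decr a x₀) S + 𝟙 (S x₀) ≡ rowSum a S
   rowSum-decr a x₀ pos S = trans (cong (rowSum (decr a x₀) S +_) (sym (∑-δ∧ M x₀ S)))
     (trans (sym (∑-+ M _ _)) (∑-cong M pt))
     where
     pt : ∀ x → (if S x then decr a x₀ x else 0) + 𝟙 (eqF x x₀ ∧ S x) ≡ (if S x then a x else 0)
     pt x with S x
     ... | true  = trans (cong (λ z → decr a x₀ x + 𝟙 z) (∧-id (eqF x x₀))) (decr-+ a x₀ pos x)
       where
       ∧-id : ∀ b → b ∧ true ≡ b
       ∧-id true = refl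
       ∧-id false = refl
     ... | false = cong 𝟙 (∧-z (eqF x x₀))
       where
       ∧-z : ∀ b → b ∧ false ≡ false
       ∧-z true = refl
       ∧-z false = refl

   coSum-decr : ∀ b y₀ → 1 ≤ b y₀ → ∀ T → coSum (decr b y₀) T + 𝟙 (not (T y₀)) ≡ coSum b T
   coSum-decr b y₀ pos T = trans (cong (coSum (decr b y₀) T +_) (sym (∑-δ∧ N y₀ (not ∘ T))))
     (trans (sym (∑-+ N _ _)) (∑-cong N pt))
     where
     pt : ∀ x → (if T x then 0 else decr b y₀ x) + 𝟙 (eqF x y₀ ∧ not (T x)) ≡ (if T x then 0 else b x)
     pt x with T x
     ... | false  = trans (cong (λ z → decr b y₀ x + 𝟙 z) (∧-id (eqF x y₀))) (decr-+ b y₀ pos x)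
       where
       ∧-id : ∀ b → b ∧ true ≡ b
       ∧-id true = refl
       ∧-id false = refl
     ... | true = cong 𝟙 (∧-z (eqF x y₀))
       where
       ∧-z : ∀ b → b ∧ false ≡ false
       ∧-z true = refl
       ∧-z false = refl

   ∑-decr : ∀ {n} (a : Fin n → ℕ) x₀ → 1 ≤ a x₀ → ∑ n (decr a x₀) + 1 ≡ ∑ n a
   ∑-decr {n} a x₀ pos = trans (cong (∑ n (decr a x₀) +_) (sym (∑-δ n x₀)))
     (trans (sym (∑-+ n _ _)) (∑-cong n (decr-+ a x₀ pos)))

   private
     size : (Fin M → Fin N → Bool) → ℕ
     size G = ∑ M (λ x → cnt N (G x))

     all-edges : ∀ G → edges G (lookup (replicate M true)) (lookup (replicate N true)) ≡ size G
     all-edges G = trans (edges-cong {G} {S′ = λ _ → true} {T′ = λ _ → true} (λ x → lookup-replicate x true) (λ y → lookup-replicate y true))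
       (∑-cong M (λ x → ∑-cong N (λ y → cong 𝟙 (∧-id (G x y)))))
       where
       ∧-id : ∀ b → b ∧ true ≡ b
       ∧-id true = refl
       ∧-id false = refl

   module _ (G : Fin M → Fin N → Bool) (a : Fin M → ℕ) (b : Fin N → ℕ) (feas : Feasible G a b)
            (x₀ : Fin M) (y₀ : Fin N) (g : G x₀ y₀ ≡ true) where

     private
       G′ = delete G x₀ y₀

       a⟨_⟩ : Vec Bool M → ℕ
       a⟨ S ⟩ = rowSum a (lookup S)
       b⟨_⟩ : Vec Bool N → ℕ
       b⟨ T ⟩ = coSum b (lookup T)
       e′ : Vec Bool M → Vec Bool N → ℕ
       e′ S T = edges G′ (lookup S) (lookup T)

       feas′ : ∀ S T → a⟨ S ⟩ ≤ e′ S T + 𝟙 (lookup S x₀ ∧ lookup T y₀) + b⟨ T ⟩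
       feas′ S T = subst (λ z → a⟨ S ⟩ ≤ z + b⟨ T ⟩) (edges-delete G x₀ y₀ (lookup S) (lookup T) g) (feas S T)

       module Tight (S : Vec Bool M) (T : Vec Bool N) (lt : e′ S T + b⟨ T ⟩ < a⟨ S ⟩) where

         -- Were `a x₀` zero, x₀ could be dropped from S without changing the demand of S; the
         -- smaller cut avoids the deleted edge and would be violated in G itself. `b-pos` drops y₀
         -- from T in the same way.
         a-pos : 1 ≤ a x₀
         a-pos with a x₀ in eq
         ... | suc _ = s≤s z≤n
         ... | zero = ⊥-elim (<⇒≱ lt (begin
             a⟨ S ⟩  ≡⟨ ∑-cong M pt ⟩
             a⟨ S′ ⟩ ≤⟨ feas S′ T ⟩
             edges G (lookup S′) (lookup T) + b⟨ T ⟩ ≤⟨ +-monoˡ-≤ _ (∑-mono M (λ x → ∑-mono N (λ y → pe x y))) ⟩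
             e′ S T + b⟨ T ⟩ ∎))
           where
           open ≤-Reasoning
           S′ = S [ x₀ ]≔ false
           pt : ∀ x → (if lookup S x then a x else 0) ≡ (if lookup S′ x then a x else 0)
           pt x with x FP.≟ x₀
           ... | yes refl rewrite lookup∘update x S false | eq with lookup S x
           ...   | true = refl
           ...   | false = refl
           pt x | no ne rewrite lookup∘update′ ne S false = refl
           pe : ∀ x y → 𝟙 (G x y ∧ (lookup S′ x ∧ lookup T y)) ≤ 𝟙 (G′ x y ∧ (lookup S x ∧ lookup T y))
           pe x y with x FP.≟ x₀
           ... | yes refl rewrite lookup∘update x S false with G x y
           ...   | true = z≤n
           ...   | false = z≤n
           pe x y | no ne rewrite lookup∘update′ ne S false with G x y
           ...   | true = ≤-refl
           ...   | false = z≤n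

         b-pos : 1 ≤ b y₀
         b-pos with b y₀ in eq
         ... | suc _ = s≤s z≤n
         ... | zero = ⊥-elim (<⇒≱ lt (begin
             a⟨ S ⟩  ≤⟨ feas S T′ ⟩
             edges G (lookup S) (lookup T′) + b⟨ T′ ⟩ ≤⟨ +-mono-≤ (∑-mono M (λ x → ∑-mono N (λ y → pe x y))) (≤-reflexive (∑-cong N pt)) ⟩
             e′ S T + b⟨ T ⟩ ∎))
           where
           open ≤-Reasoning
           T′ = T [ y₀ ]≔ false
           pt : ∀ x → (if lookup T′ x then 0 else b x) ≡ (if lookup T x then 0 else b x)
           pt x with x FP.≟ y₀
           ... | yes refl rewrite lookup∘update x T false | eq with lookup T x
           ...   | true = refl
           ...   | false = refl
           pt x | no ne rewrite lookup∘update′ ne T false = refl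
           pe : ∀ x y → 𝟙 (G x y ∧ (lookup S x ∧ lookup T′ y)) ≤ 𝟙 (G′ x y ∧ (lookup S x ∧ lookup T y))
           pe x y with x FP.≟ x₀ | y FP.≟ y₀
           ... | _ | yes refl rewrite lookup∘update y T false with G x y | lookup S x
           ...   | true | true = z≤n
           ...   | true | false = z≤n
           ...   | false | _ = z≤n
           pe x y | yes _ | no ne rewrite lookup∘update′ ne T false with G x y
           ...   | true = ≤-refl
           ...   | false = z≤n
           pe x y | no _ | no ne rewrite lookup∘update′ ne T false with G x y
           ...   | true = ≤-refl
           ...   | false = z≤n

     -- Two violated cuts, one for deleting the edge and one for using it, would uncross
     -- to a violated cut of the original graph.
     uncross : ∀ S₁ T₁ S₂ T₂ → e′ S₁ T₁ + b⟨ T₁ ⟩ < a⟨ S₁ ⟩ →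
       1 ≤ a x₀ → 1 ≤ b y₀ →
       e′ S₂ T₂ + coSum (decr b y₀) (lookup T₂) < rowSum (decr a x₀) (lookup S₂) → ⊥
     uncross S₁ T₁ S₂ T₂ lt₁ a-pos b-pos lt₂ = <⇒≱ (+-mono-<-≤ lt₁ tight₂) (begin
       a⟨ S₁ ⟩ + a⟨ S₂ ⟩
         ≡⟨ rowSum-modular a (lookup S₁) (lookup S₂) ⟨
       rowSum a s∩ + rowSum a s∪
         ≡⟨ cong₂ _+_ (rowSum-cong (λ x → sym (lookup-zipWith _∧_ x S₁ S₂))) (rowSum-cong (λ x → sym (lookup-zipWith _∨_ x S₁ S₂))) ⟩
       a⟨ S∩ ⟩ + a⟨ S∪ ⟩
         ≤⟨ +-mono-≤ (feas-off S∩ T∪ off₁) (feas-off S∪ T∩ off₂) ⟩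
       (e′ S∩ T∪ + b⟨ T∪ ⟩) + (e′ S∪ T∩ + b⟨ T∩ ⟩)
         ≡⟨ cong₂ _+_ (cong₂ _+_ (edges-cong {G′} (λ x → lookup-zipWith _∧_ x S₁ S₂) (λ y → lookup-zipWith _∨_ y T₁ T₂)) (coSum-cong (λ y → lookup-zipWith _∨_ y T₁ T₂)))
                      (cong₂ _+_ (edges-cong {G′} (λ x → lookup-zipWith _∨_ x S₁ S₂) (λ y → lookup-zipWith _∧_ y T₁ T₂)) (coSum-cong (λ y → lookup-zipWith _∧_ y T₁ T₂))) ⟩
       (edges G′ s∩ t∪ + coSum b t∪) + (edges G′ s∪ t∩ + coSum b t∩)
         ≡⟨ interchange (edges G′ s∩ t∪) _ _ _ ⟩
       (edges G′ s∩ t∪ + edges G′ s∪ t∩) + (coSum b t∪ + coSum b t∩)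
         ≤⟨ +-mono-≤ (edges-uncross G′ (lookup S₁) (lookup S₂) (lookup T₁) (lookup T₂)) (≤-reflexive (coSum-modular b (lookup T₁) (lookup T₂))) ⟩
       (e′ S₁ T₁ + e′ S₂ T₂) + (b⟨ T₁ ⟩ + b⟨ T₂ ⟩)
         ≡⟨ interchange (e′ S₁ T₁) _ _ _ ⟩
       (e′ S₁ T₁ + b⟨ T₁ ⟩) + (e′ S₂ T₂ + b⟨ T₂ ⟩) ∎)
       where
       open ≤-Reasoning
       interchange : ∀ a b c d → a + b + (c + d) ≡ a + c + (b + d)
       interchange = solve 4 (λ a b c d → a :+ b :+ (c :+ d) := a :+ c :+ (b :+ d)) refl
       s∩ = λ x → lookup S₁ x ∧ lookup S₂ x
       s∪ = λ x → lookup S₁ x ∨ lookup S₂ x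
       t∩ = λ x → lookup T₁ x ∧ lookup T₂ x
       t∪ = λ x → lookup T₁ x ∨ lookup T₂ x
       S∩ = zipWith _∧_ S₁ S₂
       S∪ = zipWith _∨_ S₁ S₂
       T∩ = zipWith _∧_ T₁ T₂
       T∪ = zipWith _∨_ T₁ T₂
       feas-off : ∀ S T → lookup S x₀ ∧ lookup T y₀ ≡ false → a⟨ S ⟩ ≤ e′ S T + b⟨ T ⟩
       feas-off S T off = subst (λ z → a⟨ S ⟩ ≤ z + b⟨ T ⟩)
         (trans (cong (λ z → e′ S T + 𝟙 z) off) (+-identityʳ _)) (feas′ S T)
       sum₂ : suc (e′ S₂ T₂ + coSum (decr b y₀) (lookup T₂)) + 𝟙 (lookup S₂ x₀) ≤
              e′ S₂ T₂ + 𝟙 (lookup S₂ x₀ ∧ lookup T₂ y₀) + (coSum (decr b y₀) (lookup T₂) + 𝟙 (not (lookup T₂ y₀)))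
       sum₂ = begin
         suc (e′ S₂ T₂ + coSum (decr b y₀) (lookup T₂)) + 𝟙 (lookup S₂ x₀) ≤⟨ +-monoˡ-≤ _ lt₂ ⟩
         rowSum (decr a x₀) (lookup S₂) + 𝟙 (lookup S₂ x₀) ≡⟨ rowSum-decr a x₀ a-pos (lookup S₂) ⟩
         a⟨ S₂ ⟩ ≤⟨ feas′ S₂ T₂ ⟩
         e′ S₂ T₂ + 𝟙 (lookup S₂ x₀ ∧ lookup T₂ y₀) + b⟨ T₂ ⟩ ≡⟨ cong (e′ S₂ T₂ + 𝟙 (lookup S₂ x₀ ∧ lookup T₂ y₀) +_) (coSum-decr b y₀ b-pos (lookup T₂)) ⟨
         _ ∎
       corner₂ : ∀ s t p q → suc (p + q) + 𝟙 s ≤ p + 𝟙 (s ∧ t) + (q + 𝟙 (not t)) → s ≡ false × t ≡ false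
       corner₂ false false p q le = refl , refl
       corner₂ false true  p q le = ⊥-elim (<-irrefl refl (subst₂ _≤_ (+-identityʳ _) (cong₂ _+_ (+-identityʳ p) (+-identityʳ q)) le))
       corner₂ true  false p q le = ⊥-elim (<-irrefl refl (≤-trans (≤-reflexive (e₁ p q)) (≤-trans le (≤-reflexive (e₂ p q)))))
         where
         e₁ : ∀ p q → suc (suc (p + q)) ≡ suc (p + q) + 1
         e₁ = solve 2 (λ p q → (con 1 :+ ((con 1 :+ (p :+ q)))) := (con 1 :+ (p :+ q)) :+ con 1) refl
         e₂ : ∀ p q → p + 0 + (q + 1) ≡ suc (p + q)
         e₂ = solve 2 (λ p q → p :+ con 0 :+ (q :+ con 1) := (con 1 :+ (p :+ q))) refl
       corner₂ true  true  p q le = ⊥-elim (<-irrefl refl (≤-trans (≤-reflexive (e₁ p q)) (≤-trans le (≤-reflexive (e₂ p q)))))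
         where
         e₁ : ∀ p q → suc (suc (p + q)) ≡ suc (p + q) + 1
         e₁ = solve 2 (λ p q → (con 1 :+ ((con 1 :+ (p :+ q)))) := (con 1 :+ (p :+ q)) :+ con 1) refl
         e₂ : ∀ p q → p + 1 + (q + 0) ≡ suc (p + q)
         e₂ = solve 2 (λ p q → p :+ con 1 :+ (q :+ con 0) := (con 1 :+ (p :+ q))) refl
       corner = corner₂ _ _ (e′ S₂ T₂) (coSum (decr b y₀) (lookup T₂)) sum₂
       Sx = proj₁ corner
       Ty = proj₂ corner
       tight₂ : e′ S₂ T₂ + b⟨ T₂ ⟩ ≤ a⟨ S₂ ⟩
       tight₂ = begin
         e′ S₂ T₂ + b⟨ T₂ ⟩ ≡⟨ cong (e′ S₂ T₂ +_) (coSum-decr b y₀ b-pos (lookup T₂)) ⟨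
         e′ S₂ T₂ + (coSum (decr b y₀) (lookup T₂) + 𝟙 (not (lookup T₂ y₀))) ≡⟨ cong (λ t → e′ S₂ T₂ + (coSum (decr b y₀) (lookup T₂) + 𝟙 (not t))) Ty ⟩
         e′ S₂ T₂ + (coSum (decr b y₀) (lookup T₂) + 1) ≡⟨ trans (sym (+-assoc (e′ S₂ T₂) _ 1)) (+-comm _ 1) ⟩
         suc (e′ S₂ T₂ + coSum (decr b y₀) (lookup T₂)) ≤⟨ lt₂ ⟩
         rowSum (decr a x₀) (lookup S₂) ≤⟨ m≤m+n _ _ ⟩
         rowSum (decr a x₀) (lookup S₂) + 𝟙 (lookup S₂ x₀) ≡⟨ rowSum-decr a x₀ a-pos (lookup S₂) ⟩
         a⟨ S₂ ⟩ ∎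
       ∧ʳf : ∀ p → p ∧ false ≡ false
       ∧ʳf true = refl
       ∧ʳf false = refl
       -- Because x₀ ∉ S₂ and y₀ ∉ T₂, both uncrossed cuts miss the edge and satisfy the inequality
       -- without it, whereas a violated and a tight cut add up to a violation.
       off₁ : lookup S∩ x₀ ∧ lookup T∪ y₀ ≡ false
       off₁ = cong (_∧ lookup T∪ y₀) (trans (lookup-zipWith _∧_ x₀ S₁ S₂) (trans (cong (lookup S₁ x₀ ∧_) Sx) (∧ʳf _)))
       off₂ : lookup S∪ x₀ ∧ lookup T∩ y₀ ≡ false
       off₂ = trans (cong (lookup S∪ x₀ ∧_) (trans (lookup-zipWith _∧_ y₀ T₁ T₂) (trans (cong (lookup T₁ y₀ ∧_) Ty) (∧ʳf _)))) (∧ʳf _)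

     deletable-or-usable : Feasible G′ a b ⊎ (1 ≤ a x₀ × 1 ≤ b y₀ × Feasible G′ (decr a x₀) (decr b y₀))
     deletable-or-usable with feasible? G′ a b
     ... | inj₁ f = inj₁ f
     ... | inj₂ (S₁ , T₁ , lt₁) with feasible? G′ (decr a x₀) (decr b y₀)
     ...   | inj₁ f = inj₂ (Tight.a-pos S₁ T₁ lt₁ , Tight.b-pos S₁ T₁ lt₁ , f)
     ...   | inj₂ (S₂ , T₂ , lt₂) = ⊥-elim (uncross S₁ T₁ S₂ T₂ lt₁ (Tight.a-pos S₁ T₁ lt₁) (Tight.b-pos S₁ T₁ lt₁) lt₂)

   private
     delete-⊆ : ∀ G x₀ y₀ x y → delete G x₀ y₀ x y ≡ true → G x y ≡ true
     delete-⊆ G x₀ y₀ x y p = proj₁ (∧-true {G x y} p)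

     size-delete : ∀ G x₀ y₀ → G x₀ y₀ ≡ true → size G ≡ size (delete G x₀ y₀) + 1
     size-delete G x₀ y₀ g = trans (sym (all-edges G)) (trans (edges-delete G x₀ y₀ (lookup (replicate M true)) (lookup (replicate N true)) g)
       (cong₂ _+_ (all-edges (delete G x₀ y₀)) (cong 𝟙 (cong₂ _∧_ (lookup-replicate x₀ true) (lookup-replicate y₀ true)))))

     factor′ : ∀ k G a b → size G ≤ k → Feasible G a b → ∑ M a ≡ ∑ N b → Factor G a b
     use-edge : ∀ G a b x₀ y₀ → G x₀ y₀ ≡ true → 1 ≤ a x₀ → 1 ≤ b y₀ →
       Factor (delete G x₀ y₀) (decr a x₀) (decr b y₀) → Factor G a b
     use-edge G a b x₀ y₀ g a-pos b-pos fac = record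
       { F = λ x y → F x y ∨ (eqF x x₀ ∧ eqF y y₀)
       ; F⊆G = sub
       ; rows = λ x → trans (trans (∑-cong N (λ y → pt x y)) (∑-+ N _ _))
           (trans (cong₂ _+_ (rows x) (trans (∑-cong N (λ y → cong 𝟙 (∧-comm (eqF x x₀) (eqF y y₀)))) (∑-δ∧ N y₀ (λ _ → eqF x x₀)))) (decr-+ a x₀ a-pos x))
       ; cols = λ y → trans (trans (∑-cong M (λ x → pt x y)) (∑-+ M _ _))
           (trans (cong₂ _+_ (cols y) (∑-δ∧ M x₀ (λ _ → eqF y y₀))) (decr-+ b y₀ b-pos y))
       }
       where
       open Factor fac
       open import Data.Bool.Properties using (∧-comm)
       sub : ∀ x y → F x y ∨ (eqF x x₀ ∧ eqF y y₀) ≡ true → G x y ≡ true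
       sub x y p with F x y in eq
       ... | true = delete-⊆ G x₀ y₀ x y (F⊆G x y eq)
       ... | false with eqF-≡ {i = x} (proj₁ (∧-true {eqF x x₀} p)) | eqF-≡ {i = y} (proj₂ (∧-true {eqF x x₀} p))
       ...   | refl | refl = g
       pt : ∀ x y → 𝟙 (F x y ∨ (eqF x x₀ ∧ eqF y y₀)) ≡ 𝟙 (F x y) + 𝟙 (eqF x x₀ ∧ eqF y y₀)
       pt x y with F x y in eq
       ... | false = refl
       ... | true with eqF x x₀ ∧ eqF y y₀ | ∧-true {G x y} (F⊆G x y eq)
       ...   | true | (_ , ())
       ...   | false | _ = refl
     factor′ k G a b sz feas ab with FP.any? (λ x → FP.any? (λ y → G x y Data.Bool.≟ true))
     ... | no none = record
         { F = λ _ _ → false ; F⊆G = λ _ _ () ; rows = λ x → trans (∑-zero N) (sym (a0 x)) ; cols = λ y → trans (∑-zero M) (sym (b0 y)) }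
       where
       G-false : ∀ x y → G x y ≡ false
       G-false x y = ¬-not (λ p → none (x , y , p))
       size0 : size G ≡ 0
       size0 = trans (∑-cong M (λ x → trans (∑-cong N (λ y → cong 𝟙 (G-false x y))) (∑-zero N))) (∑-zero M)
       ∑a0 : ∑ M a ≤ 0
       ∑a0 = subst₂ _≤_ (∑-cong M (λ x → cong (λ s → if s then a x else 0) (lookup-replicate x true)))
         (trans (cong₂ _+_ (trans (all-edges G) size0) (∑-cong N (λ y → cong (λ s → if s then 0 else b y) (lookup-replicate y true)))) (∑-zero N))
         (feas (replicate M true) (replicate N true))
       a0 : ∀ x → a x ≡ 0
       a0 x = n≤0⇒n≡0 (≤-trans (≤∑ a x) ∑a0)
       b0 : ∀ y → b y ≡ 0
       b0 y = n≤0⇒n≡0 (≤-trans (≤∑ b y) (subst (_≤ 0) ab ∑a0))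
     factor′ zero G a b sz feas ab | yes (x₀ , y₀ , g) =
       ⊥-elim (<-irrefl refl (≤-trans (≤-trans (m≤n+m 1 _) (≤-reflexive (sym (size-delete G x₀ y₀ g)))) sz))
     factor′ (suc k) G a b sz feas ab | yes (x₀ , y₀ , g) with deletable-or-usable G a b feas x₀ y₀ g
     ... | inj₁ f = record { F = F ; F⊆G = λ x y p → delete-⊆ G x₀ y₀ x y (F⊆G x y p) ; rows = rows ; cols = cols }
       where
       open Factor (factor′ k (delete G x₀ y₀) a b (+-cancelʳ-≤ 1 _ k (subst₂ _≤_ (size-delete G x₀ y₀ g) (+-comm 1 k) sz)) f ab)
     ... | inj₂ (ap , bp , f) = use-edge G a b x₀ y₀ g ap bp
         (factor′ k (delete G x₀ y₀) (decr a x₀) (decr b y₀) (+-cancelʳ-≤ 1 _ k (subst₂ _≤_ (size-delete G x₀ y₀ g) (+-comm 1 k) sz)) f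
           (+-cancelʳ-≡ 1 _ _ (trans (∑-decr a x₀ ap) (trans ab (sym (∑-decr b y₀ bp))))))

   abstract
     -- The edges are treated one at a time: each can be discarded or put into the factor without
     -- destroying feasibility. With no edges left, feasibility forces `a` to vanish, and the
     -- equality of the sums forces `b` to vanish.
     factor : ∀ G a b → Feasible G a b → ∑ M a ≡ ∑ N b → Factor G a b
     factor G a b = factor′ (size G) G a b ≤-refl

 -- Perfect matchings in regular bipartite graphs.

 record Bij (m : ℕ) : Set where
   field
     to from : Fin m → Fin m
     from-to : ∀ x → from (to x) ≡ x
     to-from : ∀ y → to (from y) ≡ y

 open Bij public

 idBij : ∀ {m} → Bij m
 idBij = record { to = id ; from = id ; from-to = λ _ → refl ; to-from = λ _ → refl }

 _∘Bij_ : ∀ {m} → Bij m → Bij m → Bij m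
 f ∘Bij g = record
   { to = to f ∘ to g ; from = from g ∘ from f
   ; from-to = λ x → trans (cong (from g) (from-to f _)) (from-to g x)
   ; to-from = λ x → trans (cong (to f) (to-from g _)) (to-from f x) }

 cnt-unique : ∀ n (P : Fin n → Bool) → cnt n P ≤ 1 → ∀ i j → P i ≡ true → P j ≡ true → i ≡ j
 cnt-unique n P le i j pi pj with i FP.≟ j
 ... | yes eq = eq
 ... | no ne = ⊥-elim (<-irrefl refl (≤-trans two le))
   where
   two : 2 ≤ cnt n P
   two = subst (_≤ cnt n P) (trans (∑-+ n _ _) (cong₂ _+_ (∑-δ n i) (∑-δ n j))) (∑-mono n pt)
     where
     pt : ∀ k → 𝟙 (eqF k i) + 𝟙 (eqF k j) ≤ 𝟙 (P k)
     pt k with k FP.≟ i | k FP.≟ j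
     ... | yes refl | yes refl = ⊥-elim (ne refl)
     ... | yes refl | no _ rewrite pi = ≤-refl
     ... | no _ | yes refl rewrite pj = ≤-refl
     ... | no _ | no _ = z≤n

 factor⇒bij : ∀ {m G} → Factor {m} {m} G (λ _ → 1) (λ _ → 1) → ∃ λ (μ : Bij m) → ∀ x → G x (to μ x) ≡ true
 factor⇒bij {m} {G} fac = μ , λ x → F⊆G x _ (proj₂ (row x))
   where
   open Factor fac
   row : ∀ x → ∃ λ y → F x y ≡ true
   row x = cnt-witness m (F x) (≤-reflexive (sym (rows x)))
   col : ∀ y → ∃ λ x → F x y ≡ true
   col y = cnt-witness m (λ x → F x y) (≤-reflexive (sym (cols y)))
   μ : Bij m
   μ = record
     { to = λ x → proj₁ (row x) ; from = λ y → proj₁ (col y)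
     ; from-to = λ x → cnt-unique m (λ z → F z _) (≤-reflexive (cols _)) _ x (proj₂ (col _)) (proj₂ (row x))
     ; to-from = λ y → cnt-unique m (F _) (≤-reflexive (rows _)) _ y (proj₂ (row _)) (proj₂ (col y)) }

 module _ {m : ℕ} (F : Fin m → Fin m → Bool) (r : ℕ)
          (rows : ∀ x → cnt m (F x) ≡ suc r) (cols : ∀ y → cnt m (λ x → F x y) ≡ suc r) where

   -- Double counting of the edges at S: those not ending in T end in columns outside T, each of
   -- which receives at most r + 1. Everything is multiplied by r + 1 to stay within integers.
   regular⇒feasible : Feasible {m} {m} F (λ _ → 1) (λ _ → 1)
   regular⇒feasible Sv Tv = *-cancelˡ-≤ (suc r) (begin
     suc r * rowSum {m} {m} (λ _ → 1) S
       ≡⟨ ∑-*ˡ m (suc r) (λ x → if S x then 1 else 0) ⟨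
     ∑ m (λ x → suc r * (if S x then 1 else 0))
       ≡⟨ ∑-cong m row ⟩
     ∑ m (λ x → cnt m (λ y → F x y ∧ (S x ∧ T y)) + cnt m (λ y → F x y ∧ (S x ∧ not (T y))))
       ≡⟨ ∑-+ m _ _ ⟩
     edges F S T + ∑ m (λ x → cnt m (λ y → F x y ∧ (S x ∧ not (T y))))
       ≡⟨ cong (edges F S T +_) (∑-comm m m _) ⟩
     edges F S T + ∑ m (λ y → cnt m (λ x → F x y ∧ (S x ∧ not (T y))))
       ≤⟨ +-mono-≤ (m≤m+n _ (r * edges F S T)) (∑-mono m col) ⟩
     suc r * edges F S T + ∑ m (λ y → suc r * (if T y then 0 else 1))
       ≡⟨ cong (suc r * edges F S T +_) (∑-*ˡ m (suc r) (λ y → if T y then 0 else 1)) ⟩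
     suc r * edges F S T + suc r * coSum {m} {m} (λ _ → 1) T
       ≡⟨ *-distribˡ-+ (suc r) (edges F S T) _ ⟨
     suc r * (edges F S T + coSum {m} {m} (λ _ → 1) T) ∎)
     where
     open ≤-Reasoning
     S = lookup Sv
     T = lookup Tv
     row : ∀ x → suc r * (if S x then 1 else 0) ≡ cnt m (λ y → F x y ∧ (S x ∧ T y)) + cnt m (λ y → F x y ∧ (S x ∧ not (T y)))
     row x with S x
     ... | true  = trans (*-identityʳ _) (trans (sym (rows x)) (trans (∑-cong m (λ y → pt (F x y) (T y))) (∑-+ m _ _)))
       where
       pt : ∀ f t → 𝟙 f ≡ 𝟙 (f ∧ t) + 𝟙 (f ∧ not t)
       pt true true = refl
       pt true false = refl
       pt false _ = refl
     ... | false = trans (*-zeroʳ r) (sym (cong₂ _+_ z z))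
       where
       pt : ∀ f → 𝟙 (f ∧ false) ≡ 0
       pt true = refl
       pt false = refl
       z : cnt m (λ y → F x y ∧ false) ≡ 0
       z = trans (∑-cong m (λ y → pt (F x y))) (∑-zero m)
     col : ∀ y → cnt m (λ x → F x y ∧ (S x ∧ not (T y))) ≤ suc r * (if T y then 0 else 1)
     col y with T y
     ... | true  = ≤-trans (≤-reflexive (trans (∑-cong m (λ x → pt (F x y) (S x))) (∑-zero m))) z≤n
       where
       pt : ∀ f s → 𝟙 (f ∧ (s ∧ false)) ≡ 0
       pt true true = refl
       pt true false = refl
       pt false _ = refl
     ... | false = ≤-trans (cnt-mono m (λ x p → proj₁ (∧-true {F x y} p))) (≤-reflexive (trans (cols y) (sym (*-identityʳ _))))

   matching : ∃ λ (μ : Bij m) → ∀ x → F x (to μ x) ≡ true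
   matching = factor⇒bij (factor F _ _ regular⇒feasible refl)

 regular⇒matchings : ∀ {m} r (F : Fin m → Fin m → Bool) →
   (∀ x → cnt m (F x) ≡ r) → (∀ y → cnt m (λ x → F x y) ≡ r) →
   ∃ λ (μ : Fin r → Bij m) → (∀ i x → F x (to (μ i) x) ≡ true) ×
     (∀ i j x → to (μ i) x ≡ to (μ j) x → i ≡ j)
 regular⇒matchings zero F rows cols = (λ ()) , (λ ()) , (λ ())
 regular⇒matchings {m} (suc r) F rows cols with matching F r rows cols
 ... | ν , ν∈ with regular⇒matchings r F′ rows′ cols′
   where
   F′ : Fin m → Fin m → Bool
   F′ x y = F x y ∧ not (eqF y (to ν x))
   drop : ∀ f e → (e ≡ true → f ≡ true) → 𝟙 (f ∧ not e) + 𝟙 e ≡ 𝟙 f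
   drop true  true  _ = refl
   drop true  false _ = refl
   drop false false _ = refl
   drop false true  h with h refl
   ... | ()
   on-ν : ∀ x y → eqF y (to ν x) ≡ true → F x y ≡ true
   on-ν x y e with eqF-≡ {i = y} e
   ... | refl = ν∈ x
   rows′ : ∀ x → cnt m (F′ x) ≡ r
   rows′ x = suc-injective (trans (+-comm 1 _) (trans (cong (cnt m (F′ x) +_) (sym (∑-δ m (to ν x))))
     (trans (sym (∑-+ m _ _)) (trans (∑-cong m (λ y → drop (F x y) _ (on-ν x y))) (rows x)))))
   swap : ∀ x y → eqF y (to ν x) ≡ eqF x (from ν y)
   swap x y with y FP.≟ to ν x | x FP.≟ from ν y
   ... | yes _ | yes _ = refl
   ... | no _ | no _ = refl
   ... | yes refl | no ne = ⊥-elim (ne (sym (from-to ν x)))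
   ... | no ne | yes refl = ⊥-elim (ne (sym (to-from ν y)))
   cols′ : ∀ y → cnt m (λ x → F′ x y) ≡ r
   cols′ y = suc-injective (trans (+-comm 1 _) (trans (cong (cnt m (λ x → F′ x y) +_) (sym (trans (∑-cong m (λ x → cong 𝟙 (swap x y))) (∑-δ m (from ν y)))))
     (trans (sym (∑-+ m _ _)) (trans (∑-cong m (λ x → drop (F x y) _ (on-ν x y))) (cols y)))))
 ... | μ , μ∈ , dis = μ⁺ , μ⁺∈ , dis⁺
   where
   μ⁺ : Fin (suc r) → Bij m
   μ⁺ zero    = ν
   μ⁺ (suc i) = μ i
   μ⁺∈ : ∀ i x → F x (to (μ⁺ i) x) ≡ true
   μ⁺∈ zero    x = ν∈ x
   μ⁺∈ (suc i) x = proj₁ (∧-true {F x _} (μ∈ i x))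
   off : ∀ i x → to (μ i) x ≢ to ν x
   off i x eq with trans (sym (not-true (proj₂ (∧-true {F x _} (μ∈ i x))))) (trans (cong (λ z → eqF z (to ν x)) eq) (eqF-refl _))
   ... | ()
   dis⁺ : ∀ i j x → to (μ⁺ i) x ≡ to (μ⁺ j) x → i ≡ j
   dis⁺ zero zero x eq = refl
   dis⁺ zero (suc j) x eq = ⊥-elim (off j x (sym eq))
   dis⁺ (suc i) zero x eq = ⊥-elim (off i x eq)
   dis⁺ (suc i) (suc j) x eq = cong suc (dis i j x eq)

 -- The cut condition for pseudorandom bipartite graphs.

 ≤-witness : ∀ {a b} → a ≤ b → ∃ λ d → b ≡ a + d
 ≤-witness {a} {b} le = b ∸ a , sym (m+[n∸m]≡n le)

 square-mono-< : ∀ {a b} → a < b → a * a < b * b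
 square-mono-< lt = *-mono-< lt lt

 2ab≤a²+b² : ∀ a b → 2 * (a * b) ≤ a * a + b * b
 2ab≤a²+b² a b with ≤-total a b
 ... | inj₁ le with ≤-witness le
 ...   | d , refl = ≤-trans (m≤m+n _ (d * d)) (≤-reflexive (id₁ a d))
   where
   id₁ : ∀ a d → 2 * (a * (a + d)) + d * d ≡ a * a + (a + d) * (a + d)
   id₁ = solve 2 (λ a d → con 2 :* (a :* (a :+ d)) :+ d :* d := a :* a :+ (a :+ d) :* (a :+ d)) refl
 2ab≤a²+b² a b | inj₂ le with ≤-witness le
 ...   | d , refl = ≤-trans (m≤m+n _ (d * d)) (≤-reflexive (id₂ b d))
   where
   id₂ : ∀ b d → 2 * ((b + d) * b) + d * d ≡ (b + d) * (b + d) + b * b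
   id₂ = solve 2 (λ b d → con 2 :* ((b :+ d) :* b) :+ d :* d := (b :+ d) :* (b :+ d) :+ b :* b) refl

 4ab≤[a+b]² : ∀ a b → 4 * (a * b) ≤ (a + b) * (a + b)
 4ab≤[a+b]² a b = ≤-trans (≤-reflexive (id₁ (a * b))) (≤-trans (+-monoˡ-≤ (2 * (a * b)) (2ab≤a²+b² a b)) (≤-reflexive (id₂ a b)))
   where
   id₁ : ∀ x → 4 * x ≡ 2 * x + 2 * x
   id₁ = solve 1 (λ x → con 4 :* x := con 2 :* x :+ con 2 :* x) refl
   id₂ : ∀ a b → a * a + b * b + 2 * (a * b) ≡ (a + b) * (a + b)
   id₂ = solve 2 (λ a b → a :* a :+ b :* b :+ con 2 :* (a :* b) := (a :+ b) :* (a :+ b)) refl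

 ∑∑-product : ∀ m n (f : Fin m → ℕ) (g : Fin n → ℕ) → ∑ m f * ∑ n g ≡ ∑ m (λ i → ∑ n (λ j → f i * g j))
 ∑∑-product m n f g = sym (trans (∑-cong m (λ i → ∑-*ˡ n (f i) g)) (∑-*ʳ m (∑ n g) f))

 cauchy-schwarz : ∀ n (w d : Fin n → ℕ) →
   ∑ n (λ i → w i * d i) * ∑ n (λ i → w i * d i) ≤ ∑ n w * ∑ n (λ i → w i * (d i * d i))
 cauchy-schwarz n w d = *-cancelˡ-≤ 2 (begin
   2 * (∑ n (λ i → w i * d i) * ∑ n (λ i → w i * d i))
     ≡⟨ cong (2 *_) (∑∑-product n n _ _) ⟩
   2 * ∑ n (λ i → ∑ n (λ j → w i * d i * (w j * d j)))
     ≡⟨ trans (∑-cong n (λ i → ∑-*ˡ n 2 _)) (∑-*ˡ n 2 _) ⟨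
   ∑ n (λ i → ∑ n (λ j → 2 * (w i * d i * (w j * d j))))
     ≤⟨ ∑-mono n (λ i → ∑-mono n (λ j → pt (w i) (w j) (d i) (d j))) ⟩
   ∑ n (λ i → ∑ n (λ j → w i * (w j * (d j * d j)) + w j * (w i * (d i * d i))))
     ≡⟨ trans (∑-cong n (λ i → ∑-+ n _ _)) (∑-+ n _ _) ⟩
   ∑ n (λ i → ∑ n (λ j → w i * (w j * (d j * d j)))) + ∑ n (λ i → ∑ n (λ j → w j * (w i * (d i * d i))))
     ≡⟨ cong₂ _+_ (sym (∑∑-product n n _ _)) (trans (∑-comm n n _) (sym (∑∑-product n n _ _))) ⟩
   W + W ≡⟨ cong (W +_) (+-identityʳ W) ⟨
   2 * W ∎)
   where
   open ≤-Reasoning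
   W = ∑ n w * ∑ n (λ i → w i * (d i * d i))
   pt : ∀ w v d e → 2 * (w * d * (v * e)) ≤ w * (v * (e * e)) + v * (w * (d * d))
   pt w v d e = ≤-trans (≤-reflexive (id₁ w v d e)) (≤-trans (*-monoʳ-≤ (w * v) (2ab≤a²+b² d e)) (≤-reflexive (id₂ w v d e)))
     where
     id₁ : ∀ w v d e → 2 * (w * d * (v * e)) ≡ w * v * (2 * (d * e))
     id₁ = solve 4 (λ w v d e → con 2 :* (w :* d :* (v :* e)) := w :* v :* (con 2 :* (d :* e))) refl
     id₂ : ∀ w v d e → w * v * (d * d + e * e) ≡ w * (v * (e * e)) + v * (w * (d * d))
     id₂ = solve 4 (λ w v d e → w :* v :* (d :* d :+ e :* e) := w :* (v :* (e :* e)) :+ v :* (w :* (d :* d))) refl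

 -- The numerical conditions under which a bipartite graph with parts of size at most M, degrees
 -- between δ and Δ and codegrees at most C has an r-factor; A and B split the error by AM-GM.
 record Parameters (M δ Δ C r : ℕ) : Set where
   field
     A B E      : ℕ
     budget     : 2 * r + A + 2 * B ≤ 2 * δ
     A≤2r       : A ≤ 2 * r
     codegree-ok : M * C + E ≤ 4 * (A * B) + δ * δ
     degree-ok  : M * Δ ≤ E * δ

 module CutBound {M δ Δ C r : ℕ} (par : Parameters M δ Δ C r) where
   open Parameters par
   open ≤-Reasoning

   r≤δ : r ≤ δ
   r≤δ = *-cancelˡ-≤ 2 (≤-trans (≤-trans (m≤m+n (2 * r) A) (m≤m+n _ (2 * B))) budget)

   -- Here X counts the edges from S to T, and u the columns outside T. At most s u of the edges at
   -- S end outside T, and (δ - r) s ≥ (s - r) u follows from r ≤ δ and u ≤ s ≤ δ.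
   small-cut : ∀ X s u → u ≤ s → s ≤ δ → δ * s ≤ X + s * u → r * s ≤ X + r * u
   small-cut X s u u≤s s≤δ deg with ≤-total s r
   ... | inj₁ s≤r = +-cancelʳ-≤ (s * u) _ _ (begin
       r * s + s * u ≤⟨ +-mono-≤ (*-monoˡ-≤ s r≤δ) (*-monoˡ-≤ u s≤r) ⟩
       δ * s + r * u ≤⟨ +-monoˡ-≤ (r * u) deg ⟩
       X + s * u + r * u ≡⟨ id₁ X (s * u) (r * u) ⟩
       X + r * u + s * u ∎)
     where
     id₁ : ∀ X a b → X + a + b ≡ X + b + a
     id₁ = solve 3 (λ X a b → X :+ a :+ b := X :+ b :+ a) refl
   ... | inj₂ r≤s with ≤-witness r≤s | ≤-witness s≤δ
   ...   | p , refl | q , refl = +-cancelʳ-≤ (s * u) _ _ (begin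
       r * s + s * u ≤⟨ m≤m+n _ (q * s) ⟩
       r * s + s * u + q * s ≤⟨ ineq ⟩
       δ * s + r * u ≤⟨ +-monoˡ-≤ (r * u) deg ⟩
       X + s * u + r * u ≡⟨ id₁ X (s * u) (r * u) ⟩
       X + r * u + s * u ∎)
     where
     id₁ : ∀ X a b → X + a + b ≡ X + b + a
     id₁ = solve 3 (λ X a b → X :+ a :+ b := X :+ b :+ a) refl
     ineq : r * s + s * u + q * s ≤ δ * s + r * u
     ineq = begin
       r * (r + p) + (r + p) * u + q * (r + p) ≡⟨ id₂ r p u q ⟩
       r * (r + p) + r * u + q * (r + p) + p * u ≤⟨ +-monoʳ-≤ _ (*-monoʳ-≤ p u≤s) ⟩
       r * (r + p) + r * u + q * (r + p) + p * (r + p) ≡⟨ id₃ r p u q ⟩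
       (r + p + q) * (r + p) + r * u ∎
       where
       id₂ : ∀ r p u q → r * (r + p) + (r + p) * u + q * (r + p) ≡ r * (r + p) + r * u + q * (r + p) + p * u
       id₂ = solve 4 (λ r p u q → r :* (r :+ p) :+ (r :+ p) :* u :+ q :* (r :+ p) := r :* (r :+ p) :+ r :* u :+ q :* (r :+ p) :+ p :* u) refl
       id₃ : ∀ r p u q → r * (r + p) + r * u + q * (r + p) + p * (r + p) ≡ (r + p + q) * (r + p) + r * u
       id₃ = solve 4 (λ r p u q → r :* (r :+ p) :+ r :* u :+ q :* (r :+ p) :+ p :* (r :+ p) := (r :+ p :+ q) :* (r :+ p) :+ r :* u) refl

   -- What the slack between r and δ buys: in `large-cut`, a failing cut makes t Y exceed u X by
   -- more than s (A u + B t). With 2 r = A + w, s = u + q and t = s + p, twice the difference of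
   -- the two sides is at least A q² + p s A + p (A + w) u + w u².
   gap : ∀ s t u → u ≤ s → s ≤ t →
     (t + u) * (r * s) + s * (A * u + B * t) ≤ t * (δ * s) + (t + u) * (r * u)
   gap s t u u≤s s≤t with ≤-witness u≤s
   ... | q , refl with ≤-witness s≤t
   ...   | p , refl with ≤-witness A≤2r
   ...     | w , 2r≡ = *-cancelˡ-≤ 2 (begin
       2 * ((t + u) * (r * s) + s * (A * u + B * t)) ≡⟨ id₁ r A B s t u ⟩
       (t + u) * ((2 * r) * s) + s * (2 * A * u + 2 * B * t) ≡⟨ cong (λ z → (t + u) * (z * s) + s * (2 * A * u + 2 * B * t)) 2r≡ ⟩
       (t + u) * ((A + w) * s) + s * (2 * A * u + 2 * B * t) ≤⟨ m≤m+n _ (A * (q * q) + p * (s * A) + p * (A + w) * u + w * (u * u)) ⟩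
       _ ≡⟨ id₂ A w B u q p ⟩
       t * (((A + w) + A + 2 * B) * s) + (t + u) * ((A + w) * u) ≡⟨ cong (λ z → t * ((z + A + 2 * B) * s) + (t + u) * (z * u)) 2r≡ ⟨
       t * ((2 * r + A + 2 * B) * s) + (t + u) * ((2 * r) * u) ≤⟨ +-monoˡ-≤ _ (*-monoʳ-≤ t (*-monoˡ-≤ s budget)) ⟩
       t * ((2 * δ) * s) + (t + u) * ((2 * r) * u) ≡⟨ id₃ r δ s t u ⟩
       2 * (t * (δ * s) + (t + u) * (r * u)) ∎)
     where
     id₁ : ∀ r A B s t u → 2 * ((t + u) * (r * s) + s * (A * u + B * t)) ≡ (t + u) * ((2 * r) * s) + s * (2 * A * u + 2 * B * t)
     id₁ = solve 6 (λ r A B s t u → con 2 :* ((t :+ u) :* (r :* s) :+ s :* (A :* u :+ B :* t)) := (t :+ u) :* ((con 2 :* r) :* s) :+ s :* (con 2 :* A :* u :+ con 2 :* B :* t)) refl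
     id₂ : ∀ A w B u q p → (u + q + p + u) * ((A + w) * (u + q)) + (u + q) * (2 * A * u + 2 * B * (u + q + p))
         + (A * (q * q) + p * ((u + q) * A) + p * (A + w) * u + w * (u * u))
       ≡ (u + q + p) * (((A + w) + A + 2 * B) * (u + q)) + (u + q + p + u) * ((A + w) * u)
     id₂ = solve 6 (λ A w B u q p → (u :+ q :+ p :+ u) :* ((A :+ w) :* (u :+ q)) :+ (u :+ q) :* (con 2 :* A :* u :+ con 2 :* B :* (u :+ q :+ p)) :+ (A :* (q :* q) :+ p :* ((u :+ q) :* A) :+ p :* (A :+ w) :* u :+ w :* (u :* u)) := (u :+ q :+ p) :* (((A :+ w) :+ A :+ con 2 :* B) :* (u :+ q)) :+ (u :+ q :+ p :+ u) :* ((A :+ w) :* u)) refl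
     id₃ : ∀ r δ s t u → t * ((2 * δ) * s) + (t + u) * ((2 * r) * u) ≡ 2 * (t * (δ * s) + (t + u) * (r * u))
     id₃ = solve 5 (λ r δ s t u → t :* ((con 2 :* δ) :* s) :+ (t :+ u) :* ((con 2 :* r) :* u) := con 2 :* (t :* (δ :* s) :+ (t :+ u) :* (r :* u))) refl

   variance : ∀ X Y t u V → X * X ≤ t * V → ∀ V′ → Y * Y ≤ u * V′ → 
     u * (X * X) + t * (Y * Y) ≤ u * t * (V + V′)
   variance X Y t u V hx V′ hy = ≤-trans (+-mono-≤ (*-monoʳ-≤ u hx) (*-monoʳ-≤ t hy)) (≤-reflexive (id₁ u t V V′))
     where
     id₁ : ∀ u t V V′ → u * (t * V) + t * (u * V′) ≡ u * t * (V + V′)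
     id₁ = solve 4 (λ u t V V′ → u :* (t :* V) :+ t :* (u :* V′) := u :* t :* (V :+ V′)) refl

   -- Second-moment argument. If the cut fails, too many edges of S end in the columns outside T, so
   -- the mean degrees X / t and Y / u into S lie far apart and force a large sum of squares; AM-GM
   -- turns the excess from `gap` into the term 4 A B. Codegrees bound the same sum by s (Δ + s C),
   -- which `codegree-ok` shows to be too small.
   large-cut : ∀ X Y s t u V V′ → u ≤ s → s ≤ t → 1 ≤ s → δ ≤ s → t + u ≤ M → δ * s ≤ X + Y →
     X * X ≤ t * V → Y * Y ≤ u * V′ → V + V′ ≤ s * (Δ + s * C) → r * s ≤ X + r * u
   large-cut X Y s t u V V′ u≤s s≤t 1≤s δ≤s m≤M deg hx hy hv = ≮⇒≥ λ lt → <-irrefl refl (begin-strict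
       s * s * (u * t * (4 * (A * B) + δ * δ)) ≡⟨ id₂ s u t A B δ ⟩
       s * s * (4 * ((A * u) * (B * t))) + u * t * ((δ * s) * (δ * s)) ≤⟨ +-mono-≤ (*-monoʳ-≤ (s * s) (4ab≤[a+b]² (A * u) (B * t))) (*-monoʳ-≤ (u * t) (*-mono-≤ deg deg)) ⟩
       s * s * ((A * u + B * t) * (A * u + B * t)) + u * t * ((X + Y) * (X + Y)) ≡⟨ cong (_+ u * t * ((X + Y) * (X + Y))) (id₃ s (A * u + B * t)) ⟩
       G * G + u * t * ((X + Y) * (X + Y)) <⟨ +-monoˡ-< _ (square-mono-< (big lt)) ⟩
       Z lt * Z lt + u * t * ((X + Y) * (X + Y)) ≡⟨ id₄ X Y t u (Z lt) (proj₂ (big′ lt)) ⟩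
       (t + u) * (u * (X * X) + t * (Y * Y)) ≤⟨ *-monoʳ-≤ (t + u) (variance X Y t u V hx V′ hy) ⟩
       (t + u) * (u * t * (V + V′)) ≤⟨ *-monoʳ-≤ (t + u) (*-monoʳ-≤ (u * t) hv) ⟩
       (t + u) * (u * t * (s * (Δ + s * C))) ≡⟨ id₅ (t + u) (u * t) s Δ C ⟩
       (u * t * s) * ((t + u) * Δ + s * ((t + u) * C)) ≤⟨ *-monoʳ-≤ (u * t * s) (+-mono-≤ (≤-trans (*-monoˡ-≤ Δ m≤M) (≤-trans degree-ok (*-monoʳ-≤ E δ≤s))) (*-monoʳ-≤ s (*-monoˡ-≤ C m≤M))) ⟩
       (u * t * s) * (E * s + s * (M * C)) ≡⟨ id₆ (u * t) s E (M * C) ⟩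
       s * s * (u * t * (M * C + E)) ≤⟨ *-monoʳ-≤ (s * s) (*-monoʳ-≤ (u * t) codegree-ok) ⟩
       s * s * (u * t * (4 * (A * B) + δ * δ)) ∎)
     where
     G = s * (A * u + B * t)
     shortfall : X + r * u < r * s → u * X + G < t * Y
     shortfall lt = +-cancelʳ-< (t * X + (t + u) * (r * u)) _ _ (begin-strict
       u * X + G + (t * X + (t + u) * (r * u)) ≡⟨ i₁ u t X G r ⟩
       (t + u) * (X + r * u) + G <⟨ +-monoˡ-< G (*-monoʳ-< (t + u) {{>-nonZero (≤-trans 1≤s (≤-trans s≤t (m≤m+n t u)))}} lt) ⟩
       (t + u) * (r * s) + G ≤⟨ gap s t u u≤s s≤t ⟩
       t * (δ * s) + (t + u) * (r * u) ≤⟨ +-monoˡ-≤ _ (*-monoʳ-≤ t deg) ⟩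
       t * (X + Y) + (t + u) * (r * u) ≡⟨ i₂ t X Y ((t + u) * (r * u)) ⟩
       t * Y + (t * X + (t + u) * (r * u)) ∎)
       where
       i₁ : ∀ u t X G r → u * X + G + (t * X + (t + u) * (r * u)) ≡ (t + u) * (X + r * u) + G
       i₁ = solve 5 (λ u t X G r → u :* X :+ G :+ (t :* X :+ (t :+ u) :* (r :* u)) := (t :+ u) :* (X :+ r :* u) :+ G) refl
       i₂ : ∀ t X Y R → t * (X + Y) + R ≡ t * Y + (t * X + R)
       i₂ = solve 4 (λ t X Y R → t :* (X :+ Y) :+ R := t :* Y :+ (t :* X :+ R)) refl
     big′ : X + r * u < r * s → ∃ λ z → t * Y ≡ u * X + z
     big′ lt = ≤-witness (≤-trans (m≤m+n (u * X) G) (<⇒≤ (shortfall lt)))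
     Z : X + r * u < r * s → ℕ
     Z lt = proj₁ (big′ lt)
     big : (lt : X + r * u < r * s) → G < Z lt
     big lt = +-cancelˡ-≤ (u * X) _ _ (≤-trans (≤-reflexive (+-suc (u * X) G)) (≤-trans (shortfall lt) (≤-reflexive (proj₂ (big′ lt)))))
     id₂ : ∀ s u t A B δ → s * s * (u * t * (4 * (A * B) + δ * δ)) ≡ s * s * (4 * ((A * u) * (B * t))) + u * t * ((δ * s) * (δ * s))
     id₂ = solve 6 (λ s u t A B δ → s :* s :* (u :* t :* (con 4 :* (A :* B) :+ δ :* δ)) := s :* s :* (con 4 :* ((A :* u) :* (B :* t))) :+ u :* t :* ((δ :* s) :* (δ :* s))) refl
     id₃ : ∀ s g → s * s * (g * g) ≡ (s * g) * (s * g)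
     id₃ = solve 2 (λ s g → s :* s :* (g :* g) := (s :* g) :* (s :* g)) refl
     -- Lagrange's identity for two groups: z = t Y - u X measures the distance between their means.
     id₄ : ∀ X Y t u z → t * Y ≡ u * X + z → z * z + u * t * ((X + Y) * (X + Y)) ≡ (t + u) * (u * (X * X) + t * (Y * Y))
     id₄ X Y t u z eq = +-cancelʳ-≡ (2 * (u * X * (t * Y))) _ _ (trans (cong (λ w → z * z + u * t * ((X + Y) * (X + Y)) + 2 * (u * X * w)) eq)
       (trans (a₁ X Y t u z) (trans (cong (λ w → w * w + (u * X) * (u * X) + u * t * ((X + Y) * (X + Y))) (sym eq)) (a₂ X Y t u))))
       where
       a₁ : ∀ X Y t u z → z * z + u * t * ((X + Y) * (X + Y)) + 2 * (u * X * (u * X + z)) ≡ (u * X + z) * (u * X + z) + (u * X) * (u * X) + u * t * ((X + Y) * (X + Y))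
       a₁ = solve 5 (λ X Y t u z → z :* z :+ u :* t :* ((X :+ Y) :* (X :+ Y)) :+ con 2 :* (u :* X :* (u :* X :+ z)) := (u :* X :+ z) :* (u :* X :+ z) :+ (u :* X) :* (u :* X) :+ u :* t :* ((X :+ Y) :* (X :+ Y))) refl
       a₂ : ∀ X Y t u → (t * Y) * (t * Y) + (u * X) * (u * X) + u * t * ((X + Y) * (X + Y)) ≡ (t + u) * (u * (X * X) + t * (Y * Y)) + 2 * (u * X * (t * Y))
       a₂ = solve 4 (λ X Y t u → (t :* Y) :* (t :* Y) :+ (u :* X) :* (u :* X) :+ u :* t :* ((X :+ Y) :* (X :+ Y)) := (t :+ u) :* (u :* (X :* X) :+ t :* (Y :* Y)) :+ con 2 :* (u :* X :* (t :* Y))) refl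
     id₅ : ∀ m v s Δ C → m * (v * (s * (Δ + s * C))) ≡ (v * s) * (m * Δ + s * (m * C))
     id₅ = solve 5 (λ m v s Δ C → m :* (v :* (s :* (Δ :+ s :* C))) := (v :* s) :* (m :* Δ :+ s :* (m :* C))) refl
     id₆ : ∀ v s E K → (v * s) * (E * s + s * K) ≡ s * s * (v * (K + E))
     id₆ = solve 4 (λ v s E K → (v :* s) :* (E :* s :+ s :* K) := s :* s :* (v :* (K :+ E))) refl

 -- The rows `PX` and columns `PY` are those still to be matched. This partial form is needed
 -- because forced pairs take vertices out; upper bounds hold everywhere, lower bounds only for the
 -- remaining vertices.
 record Pseudo {m : ℕ} (H : Fin m → Fin m → Bool) (PX PY : Fin m → Bool) (M δ Δ C : ℕ) : Set where
   field
     supp  : ∀ x y → H x y ≡ true → PX x ≡ true × PY y ≡ true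
     rowδ  : ∀ x → PX x ≡ true → δ ≤ cnt m (H x)
     colδ  : ∀ y → PY y ≡ true → δ ≤ cnt m (λ x → H x y)
     rowΔ  : ∀ x → cnt m (H x) ≤ Δ
     colΔ  : ∀ y → cnt m (λ x → H x y) ≤ Δ
     rowC  : ∀ x x′ → x ≢ x′ → cnt m (λ y → H x y ∧ H x′ y) ≤ C
     colC  : ∀ y y′ → y ≢ y′ → cnt m (λ x → H x y ∧ H x y′) ≤ C
     same  : cnt m PX ≡ cnt m PY
     bound : cnt m PX ≤ M

 transposed : ∀ {m H PX PY M δ Δ C} → Pseudo {m} H PX PY M δ Δ C → Pseudo (λ y x → H x y) PY PX M δ Δ C
 transposed {M = M} p = record
   { supp = λ y x h → proj₂ (supp x y h) , proj₁ (supp x y h)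
   ; rowδ = colδ ; colδ = rowδ ; rowΔ = colΔ ; colΔ = rowΔ ; rowC = colC ; colC = rowC
   ; same = sym same ; bound = subst (_≤ M) same bound }
   where open Pseudo p

 cnt-split : ∀ n (P S : Fin n → Bool) → cnt n (λ x → S x ∧ P x) + cnt n (λ x → not (S x) ∧ P x) ≡ cnt n P
 cnt-split n P S = trans (sym (∑-+ n _ _)) (∑-cong n (λ x → pt (S x) (P x)))
   where
   pt : ∀ s p → 𝟙 (s ∧ p) + 𝟙 (not s ∧ p) ≡ 𝟙 p
   pt true  p = +-identityʳ _
   pt false p = refl

 module _ {m : ℕ} {H : Fin m → Fin m → Bool} {PX PY : Fin m → Bool} {M δ Δ C r : ℕ}
          (ps : Pseudo H PX PY M δ Δ C) (par : Parameters M δ Δ C r) (S T : Fin m → Bool) where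
   open Pseudo ps

   private
     σ τ κ : Fin m → Bool
     σ x = S x ∧ PX x
     τ y = T y ∧ PY y
     κ y = not (T y) ∧ PY y
     s = cnt m σ
     t = cnt m τ
     u = cnt m κ

     d : Fin m → ℕ
     d y = cnt m (λ x → H x y ∧ σ x)

     X Y : ℕ
     X = ∑ m (λ y → 𝟙 (τ y) * d y)
     Y = ∑ m (λ y → 𝟙 (κ y) * d y)

     X≤edges : X ≤ edges H S T
     X≤edges = subst (X ≤_) (∑-comm m m _) (∑-mono m (λ y → subst (_≤ ∑ m (λ x → 𝟙 (H x y ∧ (S x ∧ T y))))
       (∑-*ˡ m (𝟙 (τ y)) _) (∑-mono m (λ x → pt (H x y) (S x) (PX x) (T y) (PY y)))))
       where
       pt : ∀ h s p t q → 𝟙 (t ∧ q) * 𝟙 (h ∧ (s ∧ p)) ≤ 𝟙 (h ∧ (s ∧ t))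
       pt h s p false q = z≤n
       pt h s p true false = z≤n
       pt false s p true true = z≤n
       pt true false p true true = z≤n
       pt true true false true true = z≤n
       pt true true true true true = ≤-refl

     degree-sum : δ * s ≤ X + Y
     degree-sum = begin
       δ * s ≡⟨ ∑-*ˡ m δ (𝟙 ∘ σ) ⟨
       ∑ m (λ x → δ * 𝟙 (σ x)) ≤⟨ ∑-mono m row ⟩
       ∑ m (λ x → ∑ m (λ y → (𝟙 (τ y) + 𝟙 (κ y)) * 𝟙 (H x y ∧ σ x))) ≡⟨ ∑-comm m m _ ⟩
       ∑ m (λ y → ∑ m (λ x → (𝟙 (τ y) + 𝟙 (κ y)) * 𝟙 (H x y ∧ σ x))) ≡⟨ ∑-cong m (λ y → trans (∑-*ˡ m (𝟙 (τ y) + 𝟙 (κ y)) _) (*-distribʳ-+ (d y) (𝟙 (τ y)) (𝟙 (κ y)))) ⟩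
       ∑ m (λ y → 𝟙 (τ y) * d y + 𝟙 (κ y) * d y) ≡⟨ ∑-+ m _ _ ⟩
       X + Y ∎
       where
       open ≤-Reasoning
       pt : ∀ h t q → (h ≡ true → q ≡ true) → 𝟙 h ≤ (𝟙 (t ∧ q) + 𝟙 (not t ∧ q)) * 𝟙 (h ∧ true)
       pt false t q _ = z≤n
       pt true  t q f rewrite f refl with t
       ... | true  = ≤-refl
       ... | false = ≤-refl
       row : ∀ x → δ * 𝟙 (σ x) ≤ ∑ m (λ y → (𝟙 (τ y) + 𝟙 (κ y)) * 𝟙 (H x y ∧ σ x))
       row x with σ x in eq
       ... | false = ≤-trans (≤-reflexive (*-zeroʳ δ)) z≤n
       ... | true  = ≤-trans (≤-reflexive (*-identityʳ δ)) (≤-trans (rowδ x (proj₂ (∧-true {S x} eq)))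
               (∑-mono m (λ y → pt (H x y) (T y) (PY y) (proj₂ ∘ supp x y))))

     d≤s : ∀ y → d y ≤ s
     d≤s y = cnt-mono m (λ x p → proj₂ (∧-true {H x y} p))

     Y≤su : Y ≤ s * u
     Y≤su = ≤-trans (∑-mono m (λ y → ≤-trans (*-monoʳ-≤ (𝟙 (κ y)) (d≤s y)) (≤-reflexive (*-comm (𝟙 (κ y)) s)))) (≤-reflexive (∑-*ˡ m s (𝟙 ∘ κ)))

     V V′ : ℕ
     V = ∑ m (λ y → 𝟙 (τ y) * (d y * d y))
     V′ = ∑ m (λ y → 𝟙 (κ y) * (d y * d y))

     -- Expanding the squares counts pairs of rows of S with a common neighbour: at most Δ for equal
     -- rows, at most C for distinct ones.
     second-moment : V + V′ ≤ s * (Δ + s * C)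
     second-moment = begin
       V + V′ ≡⟨ ∑-+ m _ _ ⟨
       ∑ m (λ y → 𝟙 (τ y) * (d y * d y) + 𝟙 (κ y) * (d y * d y)) ≤⟨ ∑-mono m (λ y → one (T y) (PY y) (d y * d y)) ⟩
       ∑ m (λ y → d y * d y) ≡⟨ ∑-cong m (λ y → ∑∑-product m m _ _) ⟩
       ∑ m (λ y → ∑ m (λ x → ∑ m (λ x′ → 𝟙 (H x y ∧ σ x) * 𝟙 (H x′ y ∧ σ x′)))) ≡⟨ ∑-comm m m _ ⟩
       ∑ m (λ x → ∑ m (λ y → ∑ m (λ x′ → 𝟙 (H x y ∧ σ x) * 𝟙 (H x′ y ∧ σ x′)))) ≡⟨ ∑-cong m (λ x → ∑-comm m m _) ⟩
       ∑ m (λ x → ∑ m (λ x′ → ∑ m (λ y → 𝟙 (H x y ∧ σ x) * 𝟙 (H x′ y ∧ σ x′)))) ≤⟨ ∑-mono m (λ x → ∑-mono m (λ x′ → pair x x′)) ⟩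
       ∑ m (λ x → ∑ m (λ x′ → 𝟙 (σ x) * (Δ * 𝟙 (eqF x′ x) + C * 𝟙 (σ x′)))) ≡⟨ ∑-cong m (λ x → trans (∑-*ˡ m (𝟙 (σ x)) _) (cong (𝟙 (σ x) *_) (inner x))) ⟩
       ∑ m (λ x → 𝟙 (σ x) * (Δ + s * C)) ≡⟨ ∑-*ʳ m (Δ + s * C) (𝟙 ∘ σ) ⟩
       s * (Δ + s * C) ∎
       where
       open ≤-Reasoning
       one : ∀ t q w → 𝟙 (t ∧ q) * w + 𝟙 (not t ∧ q) * w ≤ w
       one true true w = ≤-reflexive (trans (+-identityʳ _) (+-identityʳ _))
       one true false w = z≤n
       one false true w = ≤-reflexive (+-identityʳ _)
       one false false w = z≤n
       inner : ∀ x → ∑ m (λ x′ → Δ * 𝟙 (eqF x′ x) + C * 𝟙 (σ x′)) ≡ Δ + s * C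
       inner x = trans (∑-+ m _ _) (cong₂ _+_ (trans (∑-*ˡ m Δ _) (trans (cong (Δ *_) (∑-δ m x)) (*-identityʳ Δ)))
         (trans (∑-*ˡ m C _) (*-comm C s)))
       both : ∀ h h′ a b → 𝟙 (h ∧ a) * 𝟙 (h′ ∧ b) ≤ 𝟙 (h ∧ h′)
       both true true true true = ≤-refl
       both true true true false = z≤n
       both true true false b = z≤n
       both true false a b = ≤-reflexive (*-zeroʳ (𝟙 a))
       both false h′ a b = z≤n
       pair : ∀ x x′ → ∑ m (λ y → 𝟙 (H x y ∧ σ x) * 𝟙 (H x′ y ∧ σ x′)) ≤ 𝟙 (σ x) * (Δ * 𝟙 (eqF x′ x) + C * 𝟙 (σ x′))
       pair x x′ with σ x
       ... | false = ≤-reflexive (trans (∑-cong m (λ y → cong (λ z → 𝟙 z * 𝟙 (H x′ y ∧ σ x′)) (f (H x y)))) (∑-zero m))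
         where
         f : ∀ h → h ∧ false ≡ false
         f true = refl
         f false = refl
       ... | true with σ x′
       ...   | false = ≤-trans (≤-reflexive (trans (∑-cong m (λ y → f (𝟙 (H x y ∧ true)) (H x′ y))) (∑-zero m))) z≤n
         where
         f : ∀ w h → w * 𝟙 (h ∧ false) ≡ 0
         f w true = *-zeroʳ w
         f w false = *-zeroʳ w
       ...   | true with x′ FP.≟ x
       ...     | yes refl = ≤-trans (∑-mono m (λ y → ≤-trans (both (H x y) (H x y) true true) (g (H x y)))) (≤-trans (rowΔ x)
                   (≤-trans (≤-reflexive (sym (*-identityʳ Δ))) (≤-trans (m≤m+n _ (C * 1)) (≤-reflexive (sym (+-identityʳ _))))))
         where
         g : ∀ h → 𝟙 (h ∧ h) ≤ 𝟙 h
         g true = ≤-refl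
         g false = z≤n
       ...     | no ne = ≤-trans (∑-mono m (λ y → both (H x y) (H x′ y) true true)) (≤-trans (rowC x x′ (ne ∘ sym))
                   (≤-trans (≤-reflexive (sym (*-identityʳ C))) (≤-trans (m≤n+m _ (Δ * 0)) (≤-reflexive (sym (+-identityʳ _))))))

     cs : ∀ (w : Fin m → Bool) → ∑ m (λ y → 𝟙 (w y) * d y) * ∑ m (λ y → 𝟙 (w y) * d y) ≤ cnt m w * ∑ m (λ y → 𝟙 (w y) * (d y * d y))
     cs w = cauchy-schwarz m (𝟙 ∘ w) d

   -- Three regimes: u ≥ s is trivial, s ≤ δ needs degrees only, and s > δ is where codegrees enter.
   -- The assumption s ≤ t is the one that `gap` requires.
   one-sided-cut : s ≤ t → r * s ≤ edges H S T + r * u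
   one-sided-cut s≤t with ≤-total s u
   ... | inj₁ s≤u = ≤-trans (*-monoʳ-≤ r s≤u) (m≤n+m _ _)
   ... | inj₂ u≤s with s ≤? δ
   ...   | yes s≤δ = ≤-trans (CutBound.small-cut par X s u u≤s s≤δ (≤-trans degree-sum (+-monoʳ-≤ X Y≤su))) (+-monoˡ-≤ _ X≤edges)
   ...   | no s≰δ = ≤-trans (CutBound.large-cut par X Y s t u V V′ u≤s s≤t (≤-trans (s≤s z≤n) (≰⇒> s≰δ)) (<⇒≤ (≰⇒> s≰δ))
             (≤-trans (≤-reflexive (trans (cnt-split m PY T) (sym same))) bound) degree-sum (cs τ) (cs κ) second-moment) (+-monoˡ-≤ _ X≤edges)

 indicator : ∀ {m} → (Fin m → Bool) → ℕ → Fin m → ℕ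
 indicator P r x = if P x then r else 0

 module _ {m : ℕ} {H : Fin m → Fin m → Bool} {PX PY : Fin m → Bool} {M δ Δ C r : ℕ}
          (ps : Pseudo H PX PY M δ Δ C) (par : Parameters M δ Δ C r) where
   open Pseudo ps

   cut : ∀ S T → r * cnt m (λ x → S x ∧ PX x) ≤ edges H S T + r * cnt m (λ y → not (T y) ∧ PY y)
   cut S T with ≤-total (cnt m (λ x → S x ∧ PX x)) (cnt m (λ y → T y ∧ PY y))
   ... | inj₁ s≤t = one-sided-cut ps par S T s≤t
   -- As s + u* = t + u, the claim is equivalent to r t ≤ e + r u*, the same cut seen in the
   -- transposed graph, where the smaller side comes first.
   ... | inj₂ t≤s = +-cancelʳ-≤ (r * u*) _ _ (begin
       r * s + r * u* ≡⟨ *-distribˡ-+ r s u* ⟨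
       r * (s + u*) ≡⟨ cong (r *_) (trans (cnt-split m PX S) (trans same (sym (cnt-split m PY T)))) ⟩
       r * (t + u) ≡⟨ *-distribˡ-+ r t u ⟩
       r * t + r * u ≤⟨ +-monoˡ-≤ (r * u) (one-sided-cut (transposed ps) par T S t≤s) ⟩
       edges (λ y x → H x y) T S + r * u* + r * u ≡⟨ cong (λ z → z + r * u* + r * u) (trans (∑-comm m m _) (∑-cong m (λ x → ∑-cong m (λ y → cong (λ z → 𝟙 (H x y ∧ z)) (∧-comm (T y) (S x)))))) ⟩
       edges H S T + r * u* + r * u ≡⟨ id₁ (edges H S T) (r * u*) (r * u) ⟩
       edges H S T + r * u + r * u* ∎)
       where
       open ≤-Reasoning
       open import Data.Bool.Properties using (∧-comm)
       s = cnt m (λ x → S x ∧ PX x)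
       t = cnt m (λ y → T y ∧ PY y)
       u = cnt m (λ y → not (T y) ∧ PY y)
       u* = cnt m (λ x → not (S x) ∧ PX x)
       id₁ : ∀ a b c → a + b + c ≡ a + c + b
       id₁ = solve 3 (λ a b c → a :+ b :+ c := a :+ c :+ b) refl

   private
     row-indicator : ∀ k S → rowSum {m} {m} (indicator PX k) S ≡ k * cnt m (λ x → S x ∧ PX x)
     row-indicator k S = trans (∑-cong m (λ x → pt (S x) (PX x))) (∑-*ˡ m k _)
       where
       pt : ∀ s p → (if s then (if p then k else 0) else 0) ≡ k * 𝟙 (s ∧ p)
       pt true true = sym (*-identityʳ k)
       pt true false = sym (*-zeroʳ k)
       pt false p = sym (*-zeroʳ k)

     co-indicator : ∀ k T → coSum {m} {m} (indicator PY k) T ≡ k * cnt m (λ x → not (T x) ∧ PY x)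
     co-indicator k T = trans (∑-cong m (λ x → pt (T x) (PY x))) (∑-*ˡ m k _)
       where
       pt : ∀ s p → (if s then 0 else (if p then k else 0)) ≡ k * 𝟙 (not s ∧ p)
       pt false true = sym (*-identityʳ k)
       pt false false = sym (*-zeroʳ k)
       pt true p = sym (*-zeroʳ k)

     indicator-sum : ∀ k (P : Fin m → Bool) → ∑ m (indicator P k) ≡ k * cnt m P
     indicator-sum k P = trans (∑-cong m (λ x → pt (P x))) (∑-*ˡ m k _)
       where
       pt : ∀ p → (if p then k else 0) ≡ k * 𝟙 p
       pt true = sym (*-identityʳ k)
       pt false = sym (*-zeroʳ k)

   pseudo-factor : Factor {m} {m} H (indicator PX r) (indicator PY r)
   pseudo-factor = factor H _ _ (λ S T → subst₂ (λ a b → a ≤ edges H (lookup S) (lookup T) + b)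
       (sym (row-indicator r (lookup S))) (sym (co-indicator r (lookup T))) (cut (lookup S) (lookup T)))
     (trans (indicator-sum r PX) (trans (cong (r *_) same) (sym (indicator-sum r PY))))

   -- If s exceeds u, then s - u ≤ r (s - u), so the cut inequalities with factor r imply those with
   -- factor 1. A cycle with forced pairs needs just one matching of the remaining vertices.
   pseudo-1-factor : 1 ≤ r → Factor {m} {m} H (indicator PX 1) (indicator PY 1)
   pseudo-1-factor 1≤r = factor H _ _ (λ S T → subst₂ (λ a b → a ≤ edges H (lookup S) (lookup T) + b)
       (sym (row-indicator 1 (lookup S))) (sym (co-indicator 1 (lookup T))) (cut₁ (lookup S) (lookup T)))
     (trans (indicator-sum 1 PX) (trans (cong (1 *_) same) (sym (indicator-sum 1 PY))))
     where
     scale : ∀ r s e u → 1 ≤ r → r * s ≤ e + r * u → s ≤ e + u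
     scale (suc r) s e u _ le with ≤-total s u
     ... | inj₁ s≤u = ≤-trans s≤u (m≤n+m u e)
     ... | inj₂ u≤s with ≤-witness u≤s
     ...   | p , refl = ≤-trans (≤-reflexive (+-comm u p)) (+-monoˡ-≤ u (≤-trans (m≤m+n p (r * p)) (+-cancelʳ-≤ (suc r * u) _ _
             (≤-trans (≤-reflexive (trans (+-comm (suc r * p) _) (sym (*-distribˡ-+ (suc r) u p)))) le))))
     cut₁ : ∀ S T → 1 * cnt m (λ x → S x ∧ PX x) ≤ edges H S T + 1 * cnt m (λ y → not (T y) ∧ PY y)
     cut₁ S T = subst₂ (λ a b → a ≤ edges H S T + b) (sym (+-identityʳ _)) (sym (+-identityʳ _))
       (scale r _ (edges H S T) _ 1≤r (cut S T))

 pseudo-matchings : ∀ {m H M δ Δ C r} → Pseudo {m} H (λ _ → true) (λ _ → true) M δ Δ C → Parameters M δ Δ C r →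
   ∃ λ (μ : Fin r → Bij m) → (∀ i x → H x (to (μ i) x) ≡ true) × (∀ i j x → to (μ i) x ≡ to (μ j) x → i ≡ j)
 pseudo-matchings {r = r} ps par with regular⇒matchings r F rows cols
   where open Factor (pseudo-factor ps par)
 ... | μ , μ∈ , dis = μ , (λ i x → Factor.F⊆G (pseudo-factor ps par) x _ (μ∈ i x)) , dis

 -- Matchings through prescribed pairs, and pruned graphs.

 abstract
   injective⇒Bij : ∀ {m} (f : Fin m → Fin m) → (∀ x y → f x ≡ f y → x ≡ y) → ∃ λ (φ : Bij m) → ∀ x → to φ x ≡ f x
   injective⇒Bij {zero} f inj = idBij , λ ()
   injective⇒Bij {suc m} f inj = record { to = f ; from = λ y → proj₁ (hit y) ; from-to = λ x → inj _ _ (proj₂ (hit (f x))) ; to-from = λ y → proj₂ (hit y) } , λ _ → refl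
     where
     hit : ∀ y → ∃ λ x → f x ≡ y
     hit y with FP.any? (λ x → f x FP.≟ y)
     ... | yes p = p
     ... | no none = ⊥-elim (<-irrefl refl (FP.injective⇒≤ {f = λ x → Fin.punchOut {i = y} {j = f x} (λ eq → none (x , sym eq))}
             (λ {x} {x′} eq → inj x x′ (FP.punchOut-injective (λ eq → none (x , sym eq)) (λ eq → none (x′ , sym eq)) eq))))
       where import Data.Fin as Fin

 occ-∉ : ∀ {n} (x : Fin n) l → x ∉ l → occ x l ≡ 0
 occ-∉ x [] _ = refl
 occ-∉ x (y ∷ l) x∉ with x FP.≟ y
 ... | yes eq = ⊥-elim (x∉ (here eq))
 ... | no _   = occ-∉ x l (x∉ ∘ there)

 unique-occ≤1 : ∀ {n} (x : Fin n) l → Unique l → occ x l ≤ 1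
 unique-occ≤1 x [] _ = z≤n
 unique-occ≤1 x (y ∷ l) (y∉ AP.∷ u) with x FP.≟ y
 ... | yes refl = s≤s (≤-reflexive (occ-∉ x l (λ q → All.lookup y∉ q refl)))
 ... | no _     = unique-occ≤1 x l u

 unique-occ : ∀ {n} (x : Fin n) l → Unique l → occ x l ≤ 𝟙 (mem x l)
 unique-occ x l u with mem x l in eq
 ... | true  = unique-occ≤1 x l u
 ... | false = ≤-reflexive (occ-∉ x l (mem-false eq))

 cnt-unlisted : ∀ {n} (l : List (Fin n)) → Unique l → cnt n (λ x → not (mem x l)) + length l ≡ n
 cnt-unlisted {n} l u = trans (cong (cnt n (λ x → not (mem x l)) +_) (sym (∑-occ n l)))
   (trans (sym (∑-+ n _ _)) (trans (∑-cong n pt) (trans (∑-const n 1) (*-identityʳ n))))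
   where
   pt : ∀ x → 𝟙 (not (mem x l)) + occ x l ≡ 1
   pt x with mem x l | mem≤occ x l | unique-occ x l u
   ... | true  | a | b = ≤-antisym b a
   ... | false | a | b = cong suc (n≤0⇒n≡0 b)

 Unlisted : ∀ {m} → List (Fin m) → Fin m → Bool
 Unlisted l x = not (mem x l)

 -- A perfect matching of the unlisted vertices is glued to the forced pairs; injectivity holds
 -- because the matching never enters a listed column. The forced pairs themselves need not be edges
 -- of H.
 extend-forced : ∀ {m} {H : Fin m → Fin m → Bool} {M δ Δ C r} (ps : List (Fin m × Fin m)) →
   Unique (map proj₁ ps) → Unique (map proj₂ ps) →
   Pseudo H (Unlisted (map proj₁ ps)) (Unlisted (map proj₂ ps)) M δ Δ C → Parameters M δ Δ C r → 1 ≤ r →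
   ∃ λ (φ : Bij m) → (∀ {p} → p ∈ ps → to φ (proj₁ p) ≡ proj₂ p) ×
     (∀ x → x ∉ map proj₁ ps → H x (to φ x) ≡ true)
 extend-forced {m} {H} ps u₁ u₂ pseudo par 1≤r = φ , forced , unforced
   where
   open Factor (pseudo-1-factor pseudo par 1≤r)
   PX = Unlisted (map proj₁ ps)
   PY = Unlisted (map proj₂ ps)
   private-val : ∀ x → (x ∈ map proj₁ ps) ⊎ (PX x ≡ true)
   private-val x with mem x (map proj₁ ps) in eq
   ... | true  = inj₁ (mem-∈ eq)
   ... | false = inj₂ refl
   row : ∀ x → PX x ≡ true → ∃ λ y → F x y ≡ true
   row x p = cnt-witness m (F x) (≤-reflexive (sym (trans (rows x) (cong (λ b → if b then 1 else 0) p))))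
   f : Fin m → Fin m
   f x with private-val x
   ... | inj₁ l = proj₂ (proj₁ (∈-map⁻ proj₁ l))
   ... | inj₂ p = proj₁ (row x p)
   functional : ∀ {A B : Set} (ps : List (A × B)) → Unique (map proj₁ ps) → ∀ {a b b′} → (a , b) ∈ ps → (a , b′) ∈ ps → b ≡ b′
   functional (p ∷ ps) (n AP.∷ u) (here refl) (here refl) = refl
   functional (p ∷ ps) (n AP.∷ u) (here refl) (there q) = ⊥-elim (All.lookup n (∈-map⁺ proj₁ q) refl)
   functional (p ∷ ps) (n AP.∷ u) (there q) (here refl) = ⊥-elim (All.lookup n (∈-map⁺ proj₁ q) refl)
   functional (p ∷ ps) (n AP.∷ u) (there q) (there q′) = functional ps u q q′
   cofunctional : ∀ {A B : Set} (ps : List (A × B)) → Unique (map proj₂ ps) → ∀ {a a′ b} → (a , b) ∈ ps → (a′ , b) ∈ ps → a ≡ a′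
   cofunctional (p ∷ ps) (n AP.∷ u) (here refl) (here refl) = refl
   cofunctional (p ∷ ps) (n AP.∷ u) (here refl) (there q) = ⊥-elim (All.lookup n (∈-map⁺ proj₂ q) refl)
   cofunctional (p ∷ ps) (n AP.∷ u) (there q) (here refl) = ⊥-elim (All.lookup n (∈-map⁺ proj₂ q) refl)
   cofunctional (p ∷ ps) (n AP.∷ u) (there q) (there q′) = cofunctional ps u q q′
   f-spec : ∀ x → ((x , f x) ∈ ps) ⊎ (PX x ≡ true × F x (f x) ≡ true)
   f-spec x with private-val x
   ... | inj₁ l with ∈-map⁻ proj₁ l
   ...   | (_ , b) , q , refl = inj₁ q
   f-spec x | inj₂ p = inj₂ (p , proj₂ (row x p))
   in-PY : ∀ {x y} → F x y ≡ true → PY y ≡ true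
   in-PY {x} {y} p = proj₂ (Pseudo.supp pseudo x y (F⊆G x y p))
   listed : ∀ {x} {l : List (Fin m)} → x ∈ l → Unlisted l x ≡ true → ⊥
   listed q p with trans (sym (not-true p)) (mem-true q)
   ... | ()
   inj : ∀ x x′ → f x ≡ f x′ → x ≡ x′
   inj x x′ eq with f-spec x | f-spec x′
   ... | inj₁ q | inj₁ q′ = cofunctional ps u₂ q (subst (λ z → (x′ , z) ∈ ps) (sym eq) q′)
   ... | inj₁ q | inj₂ (p′ , e′) = ⊥-elim (listed (∈-map⁺ proj₂ (subst (λ z → (x , z) ∈ ps) eq q)) (in-PY e′))
   ... | inj₂ (p , e) | inj₁ q′ = ⊥-elim (listed (∈-map⁺ proj₂ (subst (λ z → (x′ , z) ∈ ps) (sym eq) q′)) (in-PY e))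
   ... | inj₂ (p , e) | inj₂ (p′ , e′) = cnt-unique m (λ z → F z (f x′)) (≤-trans (≤-reflexive (cols (f x′))) (at-most (PY (f x′)))) x x′
           (subst (λ z → F x z ≡ true) eq e) e′
     where
     at-most : ∀ b → (if b then 1 else 0) ≤ 1
     at-most true = ≤-refl
     at-most false = z≤n
   φ = proj₁ (injective⇒Bij f inj)
   φ≡ = proj₂ (injective⇒Bij f inj)
   forced : ∀ {p} → p ∈ ps → to φ (proj₁ p) ≡ proj₂ p
   forced {a , b} q with f-spec a
   ... | inj₁ q′ = trans (φ≡ a) (functional ps u₁ q′ q)
   ... | inj₂ (p , _) = ⊥-elim (listed (∈-map⁺ proj₁ q) p)
   unforced : ∀ x → x ∉ map proj₁ ps → H x (to φ x) ≡ true
   unforced x ∉l with f-spec x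
   ... | inj₁ q = ⊥-elim (∉l (∈-map⁺ proj₁ q))
   ... | inj₂ (_ , e) = trans (cong (H x) (φ≡ x)) (F⊆G x _ e)

 ++-∉ : ∀ {A : Set} {x : A} (l l′ : List A) → x ∉ l ++ l′ → x ∉ l × x ∉ l′
 ++-∉ l l′ x∉ = (λ p → x∉ (∈-++⁺ˡ p)) , (λ p → x∉ (∈-++⁺ʳ l p))

 ∉-mem : ∀ {n} {x : Fin n} {l} → x ∉ l → mem x l ≡ false
 ∉-mem x∉ = ¬-not (λ p → x∉ (mem-∈ p))

 cnt-remove-∉ : ∀ n (P R : Fin n → Bool) (l : List (Fin n)) → (∀ i → P i ≡ true → i ∉ l → R i ≡ true) →
   cnt n P ≤ cnt n R + length l
 cnt-remove-∉ n P R l imp = ≤-trans (cnt-remove n P l) (+-monoˡ-≤ (length l) (cnt-mono n (λ i p →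
   imp i (proj₁ (∧-true {P i} p)) (mem-false (not-true (proj₂ (∧-true {P i} p)))))))

 module Prune {m : ℕ} (G : Fin m → Fin m → Bool) {δ₀ Δ C : ℕ}
   (rowδ₀ : ∀ x → δ₀ ≤ cnt m (G x)) (colδ₀ : ∀ y → δ₀ ≤ cnt m (λ x → G x y))
   (rowΔ₀ : ∀ x → cnt m (G x) ≤ Δ) (colΔ₀ : ∀ y → cnt m (λ x → G x y) ≤ Δ)
   (rowC₀ : ∀ x x′ → x ≢ x′ → cnt m (λ y → G x y ∧ G x′ y) ≤ C)
   (colC₀ : ∀ y y′ → y ≢ y′ → cnt m (λ x → G x y ∧ G x y′) ≤ C)
   where

   pruned : (rl : Fin m → List (Fin m)) (l₁ l₂ : List (Fin m)) → Fin m → Fin m → Bool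
   pruned rl l₁ l₂ x y = (Unlisted l₁ x ∧ Unlisted l₂ y) ∧ (G x y ∧ not (mem y (rl x)))

   pruned⇒ : ∀ rl l₁ l₂ x y → pruned rl l₁ l₂ x y ≡ true →
     (Unlisted l₁ x ≡ true × Unlisted l₂ y ≡ true) × G x y ≡ true × y ∉ rl x
   pruned⇒ rl l₁ l₂ x y p = ∧-true (proj₁ q) , proj₁ q′ , mem-false (not-true (proj₂ q′))
     where
     q = ∧-true {Unlisted l₁ x ∧ Unlisted l₂ y} p
     q′ = ∧-true {G x y} (proj₂ q)

   ⇒pruned : ∀ rl l₁ l₂ x y → x ∉ l₁ → y ∉ l₂ → G x y ≡ true → y ∉ rl x → pruned rl l₁ l₂ x y ≡ true
   ⇒pruned rl l₁ l₂ x y a b c d rewrite ∉-mem a | ∉-mem b | c | ∉-mem d = refl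

   -- Deletions cannot raise degrees or codegrees, so Δ and C survive. A remaining vertex loses at
   -- most b forbidden partners and g₀ listed vertices of the other side, which is what `room` pays
   -- for.
   prune : (rl cl : Fin m → List (Fin m)) (l₁ l₂ : List (Fin m)) (b g₀ δ : ℕ) →
     (∀ x y → y ∈ rl x → x ∈ cl y) → (∀ x → length (rl x) ≤ b) → (∀ y → length (cl y) ≤ b) →
     length l₁ ≡ length l₂ → length l₁ ≤ g₀ → Unique l₁ → Unique l₂ → δ + (b + g₀) ≤ δ₀ →
     Pseudo (pruned rl l₁ l₂) (Unlisted l₁) (Unlisted l₂) m δ Δ C
   prune rl cl l₁ l₂ b g₀ δ rc rb cb len l≤ u₁ u₂ room = record
     { supp = λ x y p → proj₁ (pruned⇒ rl l₁ l₂ x y p)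
     ; rowδ = λ x p → low (rowδ₀ x) (cnt-remove-∉ m (G x) _ (rl x ++ l₂) (λ y gy y∉ →
         ⇒pruned rl l₁ l₂ x y (mem-false (not-true p)) (proj₂ (++-∉ (rl x) l₂ y∉)) gy (proj₁ (++-∉ (rl x) l₂ y∉))))
         (≤-trans (≤-reflexive (length-++ (rl x))) (+-mono-≤ (rb x) (subst (_≤ g₀) len l≤)))
     ; colδ = λ y p → low (colδ₀ y) (cnt-remove-∉ m (λ x → G x y) _ (cl y ++ l₁) (λ x gx x∉ →
         ⇒pruned rl l₁ l₂ x y (proj₂ (++-∉ (cl y) l₁ x∉)) (mem-false (not-true p)) gx (λ q → proj₁ (++-∉ (cl y) l₁ x∉) (rc x y q))))
         (≤-trans (≤-reflexive (length-++ (cl y))) (+-mono-≤ (cb y) l≤))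
     ; rowΔ = λ x → ≤-trans (cnt-mono m (λ y p → proj₁ (proj₂ (pruned⇒ rl l₁ l₂ x y p)))) (rowΔ₀ x)
     ; colΔ = λ y → ≤-trans (cnt-mono m (λ x p → proj₁ (proj₂ (pruned⇒ rl l₁ l₂ x y p)))) (colΔ₀ y)
     ; rowC = λ x x′ ne → ≤-trans (cnt-mono m (λ y p → both (g x y (proj₁ (∧-true {pruned rl l₁ l₂ x y} p))) (g x′ y (proj₂ (∧-true {pruned rl l₁ l₂ x y} p))))) (rowC₀ x x′ ne)
     ; colC = λ y y′ ne → ≤-trans (cnt-mono m (λ x p → both (g x y (proj₁ (∧-true {pruned rl l₁ l₂ x y} p))) (g x y′ (proj₂ (∧-true {pruned rl l₁ l₂ x y} p))))) (colC₀ y y′ ne)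
     ; same = +-cancelʳ-≡ (length l₁) _ _ (trans (cnt-unlisted l₁ u₁) (sym (trans (cong (cnt m (Unlisted l₂) +_) len) (cnt-unlisted l₂ u₂))))
     ; bound = ≤-trans (m≤m+n _ (length l₁)) (≤-reflexive (cnt-unlisted l₁ u₁)) }
     where
     g : ∀ x y → pruned rl l₁ l₂ x y ≡ true → G x y ≡ true
     g x y p = proj₁ (proj₂ (pruned⇒ rl l₁ l₂ x y p))
     both : ∀ {a b} → a ≡ true → b ≡ true → a ∧ b ≡ true
     both refl refl = refl
     low : ∀ {c d l} → δ₀ ≤ c → c ≤ d + l → l ≤ b + g₀ → δ ≤ d
     low {c} {d} {l} h₁ h₂ h₃ = +-cancelʳ-≤ (b + g₀) _ _ (≤-trans room (≤-trans h₁ (≤-trans h₂ (+-monoʳ-≤ d h₃))))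

 partners : ∀ {m} → Fin m → List (Fin m × Fin m) → List (Fin m)
 partners x []             = []
 partners x ((a , b) ∷ ps) = if eqF x a then b ∷ [] else partners x ps

 copartners : ∀ {m} → Fin m → List (Fin m × Fin m) → List (Fin m)
 copartners y []             = []
 copartners y ((a , b) ∷ ps) = if eqF y b then a ∷ [] else copartners y ps

 length-partners : ∀ {m} (x : Fin m) ps → length (partners x ps) ≤ 1
 length-partners x [] = z≤n
 length-partners x ((a , b) ∷ ps) with eqF x a
 ... | true = ≤-refl
 ... | false = length-partners x ps

 length-copartners : ∀ {m} (x : Fin m) ps → length (copartners x ps) ≤ 1
 length-copartners x [] = z≤n
 length-copartners x ((a , b) ∷ ps) with eqF x b
 ... | true = ≤-refl
 ... | false = length-copartners x ps

 partners⇒∈ : ∀ {m} (x y : Fin m) ps → y ∈ partners x ps → (x , y) ∈ ps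
 partners⇒∈ x y ((a , b) ∷ ps) p with eqF x a in eq | p
 ... | true  | here refl = here (cong (_, y) (eqF-≡ eq))
 ... | false | q = there (partners⇒∈ x y ps q)

 ∈⇒partners : ∀ {m} (x y : Fin m) ps → Unique (map proj₁ ps) → (x , y) ∈ ps → y ∈ partners x ps
 ∈⇒partners x y (_ ∷ ps) (n AP.∷ u) (here refl) rewrite eqF-refl x = here refl
 ∈⇒partners x y ((a , b) ∷ ps) (n AP.∷ u) (there q) with eqF x a in eq
 ... | true  = ⊥-elim (All.lookup n (∈-map⁺ proj₁ q) (sym (eqF-≡ eq)))
 ... | false = ∈⇒partners x y ps u q

 ∈⇒copartners : ∀ {m} (x y : Fin m) ps → Unique (map proj₂ ps) → (x , y) ∈ ps → x ∈ copartners y ps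
 ∈⇒copartners x y (_ ∷ ps) (n AP.∷ u) (here refl) rewrite eqF-refl y = here refl
 ∈⇒copartners x y ((a , b) ∷ ps) (n AP.∷ u) (there q) with eqF y b in eq
 ... | true  = ⊥-elim (All.lookup n (∈-map⁺ proj₂ q) (sym (eqF-≡ eq)))
 ... | false = ∈⇒copartners x y ps u q

 concatMap-∈ : ∀ {A B : Set} (f : A → List B) {y x} xs → x ∈ xs → y ∈ f x → y ∈ concatMap f xs
 concatMap-∈ f (x ∷ xs) (here refl) q = ∈-++⁺ˡ q
 concatMap-∈ f (x ∷ xs) (there p) q = ∈-++⁺ʳ (f x) (concatMap-∈ f xs p q)

 ∈-concatMap : ∀ {A B : Set} (f : A → List B) {y} xs → y ∈ concatMap f xs → ∃ λ x → x ∈ xs × y ∈ f x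
 ∈-concatMap f (x ∷ xs) p with ∈-++⁻ (f x) p
 ... | inj₁ q = x , here refl , q
 ... | inj₂ q with ∈-concatMap f xs q
 ...   | x′ , a , b = x′ , there a , b

 length-concatMap : ∀ {A B : Set} (f : A → List B) xs c → (∀ x → length (f x) ≤ c) → length (concatMap f xs) ≤ length xs * c
 length-concatMap f [] c le = z≤n
 length-concatMap f (x ∷ xs) c le = ≤-trans (≤-reflexive (length-++ (f x))) (+-mono-≤ (le x) (length-concatMap f xs c le))

 -- One pair of consecutive classes: the hosting cycles receive perfect matchings through their
 -- forced pairs one at a time, and all other cycles share a regular factor of what remains.
 module PairMatchings {m : ℕ} (G : Fin m → Fin m → Bool) {δ₀ δ Δ C r : ℕ}
   (rowδ₀ : ∀ x → δ₀ ≤ cnt m (G x)) (colδ₀ : ∀ y → δ₀ ≤ cnt m (λ x → G x y))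
   (rowΔ₀ : ∀ x → cnt m (G x) ≤ Δ) (colΔ₀ : ∀ y → cnt m (λ x → G x y) ≤ Δ)
   (rowC₀ : ∀ x x′ → x ≢ x′ → cnt m (λ y → G x y ∧ G x′ y) ≤ C)
   (colC₀ : ∀ y y′ → y ≢ y′ → cnt m (λ x → G x y ∧ G x y′) ≤ C)
   (par : Parameters m δ Δ C r) (1≤r : 1 ≤ r)
   {J : Set} (_≟J_ : DecidableEquality J) (idx : J → Fin r) (idx-inj : ∀ {i j} → idx i ≡ idx j → i ≡ j)
   (hosts : List J) (forced : J → List (Fin m × Fin m)) {Th g₀ : ℕ}
   (hosts≤ : length hosts ≤ Th)
   (u₁ : ∀ j → Unique (map proj₁ (forced j))) (u₂ : ∀ j → Unique (map proj₂ (forced j)))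
   (forced≤ : ∀ j → length (forced j) ≤ g₀)
   (non-host : ∀ j → j ∉ hosts → forced j ≡ [])
   (room : δ + (Th + Th + g₀) ≤ δ₀)
   where

   open Prune G rowδ₀ colδ₀ rowΔ₀ colΔ₀ rowC₀ colC₀

   Free : J → Fin m → Set
   Free j x = x ∉ map proj₁ (forced j)

   private
     rowForb colForb : Fin m → List (Fin m)
     rowForb x = concatMap (λ j → partners x (forced j)) hosts
     colForb y = concatMap (λ j → copartners y (forced j)) hosts

     -- Forbidden at x are its partners in the forced pairs of any host and its images under the
     -- matchings that f gives to the hosts. Each host contributes at most one of either sort,
     -- whence the bound Th + Th.
     rl cl : (J → Bij m) → Fin m → List (Fin m)
     rl f x = rowForb x ++ map (λ j → to (f j) x) hosts
     cl f y = colForb y ++ map (λ j → from (f j) y) hosts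

     rl⇒cl : ∀ f x y → y ∈ rl f x → x ∈ cl f y
     rl⇒cl f x y p with ∈-++⁻ (rowForb x) p
     ... | inj₁ q with ∈-concatMap _ hosts q
     ...   | j , j∈ , q′ = ∈-++⁺ˡ (concatMap-∈ _ hosts j∈ (∈⇒copartners x y (forced j) (u₂ j) (partners⇒∈ x y (forced j) q′)))
     rl⇒cl f x y p | inj₂ q with ∈-map⁻ (λ j → to (f j) x) q
     ...   | j , j∈ , refl = ∈-++⁺ʳ (colForb y) (subst (_∈ map (λ j → from (f j) (to (f _) x)) hosts) (from-to (f j) x) (∈-map⁺ (λ j → from (f j) _) j∈))

     h·1 : length hosts * 1 ≤ Th
     h·1 = ≤-trans (≤-reflexive (*-identityʳ _)) hosts≤

     rl≤ : ∀ f x → length (rl f x) ≤ Th + Th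
     rl≤ f x = ≤-trans (≤-reflexive (length-++ (rowForb x))) (+-mono-≤ (≤-trans (length-concatMap _ hosts 1 (λ j → length-partners x (forced j))) h·1)
       (≤-trans (≤-reflexive (length-map _ hosts)) hosts≤))

     cl≤ : ∀ f x → length (cl f x) ≤ Th + Th
     cl≤ f x = ≤-trans (≤-reflexive (length-++ (colForb x))) (+-mono-≤ (≤-trans (length-concatMap _ hosts 1 (λ j → length-copartners x (forced j))) h·1)
       (≤-trans (≤-reflexive (length-map _ hosts)) hosts≤))

     Avoids : J → Bij m → Set
     Avoids j φ = ∀ x → Free j x → G x (to φ x) ≡ true × to φ x ∉ rowForb x

     Ok : J → Bij m → Set
     Ok j φ = (∀ {p} → p ∈ forced j → to φ (proj₁ p) ≡ proj₂ p) × Avoids j φ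

     -- Only rows free for both cycles are compared; a row that is forced for one of them is taken
     -- care of by `rowForb`.
     Conf : J → J → Bij m → Bij m → Set
     Conf i j φ ψ = ∃ λ x → (j ∈ hosts × i ∈ hosts) × (Free i x × Free j x) × to φ x ≡ to ψ x

     step : ∀ j (f : J → Bij m) → ∃ λ φ → Ok j φ × (∀ i → i ≢ j → ¬ Conf j i φ (f i))
     step j f with extend-forced (forced j) (u₁ j) (u₂ j)
         (prune (rl f) (cl f) (map proj₁ (forced j)) (map proj₂ (forced j)) (Th + Th) g₀ δ
           (rl⇒cl f) (rl≤ f) (cl≤ f) (trans (length-map proj₁ (forced j)) (sym (length-map proj₂ (forced j))))
           (≤-trans (≤-reflexive (length-map proj₁ (forced j))) (forced≤ j)) (u₁ j) (u₂ j) room) par 1≤r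
     ... | φ , fo , un = φ , (fo , (λ x fr → proj₁ (good x fr) , proj₁ (++-∉ (rowForb x) _ (proj₂ (good x fr)))))
           , λ { i ne (x , (i∈ , _) , (fr , _) , eq) → proj₂ (++-∉ (rowForb x) _ (proj₂ (good x fr)))
                  (subst (_∈ map (λ j → to (f j) x) hosts) (sym eq) (∈-map⁺ (λ j → to (f j) x) i∈)) }
       where
       good : ∀ x → Free j x → G x (to φ x) ≡ true × to φ x ∉ rl f x
       good x fr = proj₂ (pruned⇒ (rl f) (map proj₁ (forced j)) (map proj₂ (forced j)) x (to φ x) (un x fr))

     abstract
       hosted : ∃ λ (f : J → Bij m) → (∀ i → i ∈ hosts → Ok i (f i)) ×
         (∀ i i′ → i ∈ hosts → i′ ∈ hosts → i′ ≢ i → ¬ Conf i i′ (f i) (f i′))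
       hosted = greedy _≟J_ Ok Conf (λ { (x , (a , b) , (c , d) , e) → x , (b , a) , (d , c) , sym e }) step (λ _ → idBij) hosts

     φ : J → Bij m
     φ = proj₁ hosted

     abstract
       rest : ∃ λ (μ : Fin r → Bij m) → (∀ i x → pruned (rl φ) [] [] x (to (μ i) x) ≡ true) ×
         (∀ i j x → to (μ i) x ≡ to (μ j) x → i ≡ j)
       rest = pseudo-matchings (prune (rl φ) (cl φ) [] [] (Th + Th) g₀ δ (rl⇒cl φ) (rl≤ φ) (cl≤ φ) refl z≤n AP.[] AP.[] room) par

     μ : Fin r → Bij m
     μ = proj₁ rest

     host? : ∀ j → Dec (j ∈ hosts)
     host? j = Any.any? (j ≟J_) hosts

   nx : J → Bij m
   nx j with host? j
   ... | yes _ = φ j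
   ... | no  _ = μ (idx j)

   private
     μ-good : ∀ i x → G x (to (μ i) x) ≡ true × to (μ i) x ∉ rl φ x
     μ-good i x = proj₂ (pruned⇒ (rl φ) [] [] x (to (μ i) x) (proj₁ (proj₂ rest) i x))

   nx-forced : ∀ j {p} → p ∈ forced j → to (nx j) (proj₁ p) ≡ proj₂ p
   nx-forced j p∈ with host? j
   ... | yes j∈ = proj₁ (proj₁ (proj₂ hosted) j j∈) p∈
   ... | no j∉ with subst (_ ∈_) (non-host j j∉) p∈
   ...   | ()

   nx-edge : ∀ j x → Free j x → G x (to (nx j) x) ≡ true
   nx-edge j x fr with host? j
   ... | yes j∈ = proj₁ (proj₂ (proj₁ (proj₂ hosted) j j∈) x fr)
   ... | no _   = proj₁ (μ-good (idx j) x)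

   -- A forced pair may later be travelled as a shortcut past a gadget, so no cycle may use it as an
   -- ordinary matching edge.
   nx-avoids-forced : ∀ j x → Free j x → ∀ i → (x , to (nx j) x) ∉ forced i
   nx-avoids-forced j x fr i q with host? i
   ... | no i∉ with subst ((x , to (nx j) x) ∈_) (non-host i i∉) q
   ...   | ()
   nx-avoids-forced j x fr i q | yes i∈ = not-forb (concatMap-∈ _ hosts i∈ (∈⇒partners x _ (forced i) (u₁ i) q))
     where
     not-forb : to (nx j) x ∉ rowForb x
     not-forb with host? j
     ... | yes j∈ = proj₂ (proj₂ (proj₁ (proj₂ hosted) j j∈) x fr)
     ... | no _   = proj₁ (++-∉ (rowForb x) _ (proj₂ (μ-good (idx j) x)))

   nx-disjoint : ∀ i j x → Free i x → Free j x → to (nx i) x ≡ to (nx j) x → i ≡ j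
   nx-disjoint i j x fi fj eq with i ≟J j
   ... | yes e = e
   ... | no ne = ⊥-elim (clash eq)
     where
     clash : to (nx i) x ≡ to (nx j) x → ⊥
     clash eq with host? i | host? j
     ... | yes i∈ | yes j∈ = proj₂ (proj₂ hosted) i j i∈ j∈ (ne ∘ sym) (x , (j∈ , i∈) , (fi , fj) , eq)
     ... | yes i∈ | no _ = proj₂ (++-∉ (rowForb x) _ (proj₂ (μ-good (idx j) x))) (subst (_∈ map (λ k → to (φ k) x) hosts) eq (∈-map⁺ (λ k → to (φ k) x) i∈))
     ... | no _ | yes j∈ = proj₂ (++-∉ (rowForb x) _ (proj₂ (μ-good (idx i) x))) (subst (_∈ map (λ k → to (φ k) x) hosts) (sym eq) (∈-map⁺ (λ k → to (φ k) x) j∈))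
     ... | no _ | no _ = ne (idx-inj (proj₂ (proj₂ rest) (idx i) (idx j) x eq))

 -- Load balancing.

 length-cartesianProduct : ∀ {A B : Set} (xs : List A) (ys : List B) → length (cartesianProduct xs ys) ≡ length xs * length ys
 length-cartesianProduct [] ys = refl
 length-cartesianProduct (x ∷ xs) ys = trans (length-++ (map (x ,_) ys)) (cong₂ _+_ (length-map _ ys) (length-cartesianProduct xs ys))

 remove-∈ : ∀ {A : Set} {x : A} {l} → x ∈ l → ∃ λ l′ → length l ≡ suc (length l′) × (∀ {y} → y ≢ x → y ∈ l → y ∈ l′)
 remove-∈ {l = x ∷ l} (here refl) = l , refl , λ { ne (here eq) → ⊥-elim (ne eq) ; ne (there p) → p }
 remove-∈ {l = z ∷ l} (there p) with remove-∈ p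
 ... | l′ , len , keep = z ∷ l′ , cong suc len , λ { ne (here eq) → here eq ; ne (there q) → there (keep ne q) }

 unique-⊆-length : ∀ {A : Set} (l l′ : List A) → Unique l → (∀ x → x ∈ l → x ∈ l′) → length l ≤ length l′
 unique-⊆-length [] l′ _ _ = z≤n
 unique-⊆-length (x ∷ l) l′ (x∉ AP.∷ u) sub with remove-∈ (sub x (here refl))
 ... | l″ , len , keep = ≤-trans (s≤s (unique-⊆-length l l″ u (λ y p → keep (λ { refl → All.lookup x∉ p refl }) (sub y (there p))))) (≤-reflexive (sym len))

 tally : ∀ {A : Set} {P : A → Set} → (∀ a → Dec (P a)) → List A → ℕ
 tally P? l = length (filter P? l)

 tally-∷ : ∀ {A : Set} {P : A → Set} (P? : ∀ a → Dec (P a)) x l → tally P? (x ∷ l) ≡ 𝟙 ⌊ P? x ⌋ + tally P? l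
 tally-∷ P? x l with P? x
 ... | yes _ = refl
 ... | no  _ = refl

 tally-cong : ∀ {A : Set} {P R : A → Set} (P? : ∀ a → Dec (P a)) (R? : ∀ a → Dec (R a)) l →
   (∀ a → a ∈ l → ⌊ P? a ⌋ ≡ ⌊ R? a ⌋) → tally P? l ≡ tally R? l
 tally-cong P? R? [] eq = refl
 tally-cong P? R? (x ∷ l) eq = trans (tally-∷ P? x l) (trans (cong₂ _+_ (cong 𝟙 (eq x (here refl))) (tally-cong P? R? l (λ a p → eq a (there p)))) (sym (tally-∷ R? x l)))

 -- Load balancing: each new item takes an option on which all of its keys are lightly loaded.
 module Balance {I Key : Set} (_≟I_ : DecidableEquality I) (_≟K_ : DecidableEquality Key) {h : ℕ} (a : ℕ)
   (key : Fin a → I → Fin h → Key) (key-inj : ∀ k i o o′ → key k i o ≡ key k i o′ → o ≡ o′)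
   (Rel : Fin a → I → I → Set) (rel? : ∀ k i i′ → Dec (Rel k i i′)) (related : ∀ k i i′ o o′ → key k i o ≡ key k i′ o′ → Rel k i i′)
   (all : List I) (bound : Fin a → ℕ) (rel≤ : ∀ k i → tally (rel? k i) all ≤ bound k) (cap : ℕ) (room : ∑ a bound < h * suc cap) where

   load : (I → Fin h) → List I → Fin a → Key → ℕ
   load f xs k κ = tally (λ i → key k i (f i) ≟K κ) xs

   -- Distinct options give the item i distinct keys, so each listed item loads at most one of these
   -- keys, and only if it is related to i.
   load-sum : ∀ f k i xs → ∑ h (λ o → load f xs k (key k i o)) ≤ tally (rel? k i) xs
   load-sum f k i [] = ≤-reflexive (∑-zero h)
   load-sum f k i (x ∷ xs) = begin
     ∑ h (λ o → load f (x ∷ xs) k (key k i o)) ≡⟨ ∑-cong h (λ o → tally-∷ (λ i′ → key k i′ (f i′) ≟K key k i o) x xs) ⟩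
     ∑ h (λ o → 𝟙 ⌊ key k x (f x) ≟K key k i o ⌋ + load f xs k (key k i o)) ≡⟨ ∑-+ h _ _ ⟩
     cnt h (λ o → ⌊ key k x (f x) ≟K key k i o ⌋) + ∑ h (λ o → load f xs k (key k i o)) ≤⟨ +-mono-≤ hits (load-sum f k i xs) ⟩
     𝟙 ⌊ rel? k i x ⌋ + tally (rel? k i) xs ≡⟨ tally-∷ (rel? k i) x xs ⟨
     tally (rel? k i) (x ∷ xs) ∎
     where
     open ≤-Reasoning
     hits : cnt h (λ o → ⌊ key k x (f x) ≟K key k i o ⌋) ≤ 𝟙 ⌊ rel? k i x ⌋
     hits with FP.any? (λ o → key k x (f x) ≟K key k i o)
     ... | no none = ≤-trans (≤-reflexive (trans (∑-cong h pt) (∑-zero h))) z≤n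
       where
       pt : ∀ o → 𝟙 ⌊ key k x (f x) ≟K key k i o ⌋ ≡ 0
       pt o with key k x (f x) ≟K key k i o
       ... | yes eq = ⊥-elim (none (o , eq))
       ... | no _ = refl
     ... | yes (o₀ , eq₀) with rel? k i x
     ...   | no ¬r = ⊥-elim (¬r (related k i x o₀ (f x) (sym eq₀)))
     ...   | yes _ = ≤-trans (∑-mono h pt) (≤-reflexive (∑-δ h o₀))
       where
       pt : ∀ o → 𝟙 ⌊ key k x (f x) ≟K key k i o ⌋ ≤ 𝟙 (eqF o o₀)
       pt o with key k x (f x) ≟K key k i o
       ... | no _ = z≤n
       ... | yes eq rewrite key-inj k i o o₀ (trans (sym eq) eq₀) | eqF-refl o₀ = ≤-refl

   private
     pigeonhole : ∀ n (g : Fin n → ℕ) → ∑ n g < n * suc cap → ∃ λ o → g o ≤ cap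
     pigeonhole zero g ()
     pigeonhole (suc n) g lt with g zero ≤? cap
     ... | yes le = zero , le
     ... | no ¬le with pigeonhole n (g ∘ suc) (+-cancelˡ-< (suc cap) _ _ (≤-<-trans (+-monoˡ-≤ _ (≰⇒> ¬le)) lt))
     ...   | o , le = suc o , le

     tally-prefix : ∀ k i xs → (∃ λ ys → ys ++ xs ≡ all) → tally (rel? k i) xs ≤ bound k
     tally-prefix k i xs (ys , eq) = ≤-trans (le ys) (≤-trans (≤-reflexive (cong (tally (rel? k i)) eq)) (rel≤ k i))
       where
       le : ∀ ys → tally (rel? k i) xs ≤ tally (rel? k i) (ys ++ xs)
       le [] = ≤-refl
       le (y ∷ ys) = ≤-trans (le ys) (≤-trans (m≤n+m _ (𝟙 ⌊ rel? k i y ⌋)) (≤-reflexive (sym (tally-∷ (rel? k i) y (ys ++ xs)))))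

   assign : Fin h → ∀ xs → Unique xs → (∃ λ ys → ys ++ xs ≡ all) → ∃ λ (f : I → Fin h) → ∀ k κ → load f xs k κ ≤ suc cap
   assign o⁰ [] _ _ = (λ _ → o⁰) , λ _ _ → z≤n
   assign o⁰ (x ∷ xs) (x∉ AP.∷ u) (ys , eq) with assign o⁰ xs u (ys ++ (x ∷ []) , trans (++-assoc ys (x ∷ []) xs) eq)
     where open import Data.List.Properties using (++-assoc)
   -- Summed over all options and all kinds of keys, the loads that x meets stay below h (cap + 1).
   -- Hence some option has total load at most cap, and adding x keeps each of its keys within cap +
   -- 1.
   ... | f , ok with pigeonhole h (λ o → ∑ a (λ k → load f xs k (key k x o)))
       (≤-<-trans (≤-trans (≤-reflexive (∑-comm h a _)) (∑-mono a (λ k → ≤-trans (load-sum f k x xs) (tally-prefix k x xs (ys ++ (x ∷ []) , trans (++-assoc ys (x ∷ []) xs) eq))))) room)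
     where open import Data.List.Properties using (++-assoc)
   ...   | o , light = g , okg
     where
     g : I → Fin h
     g i with i ≟I x
     ... | yes _ = o
     ... | no  _ = f i
     g-x : g x ≡ o
     g-x with x ≟I x
     ... | yes _ = refl
     ... | no ne = ⊥-elim (ne refl)
     g-other : ∀ i → i ∈ xs → g i ≡ f i
     g-other i i∈ with i ≟I x
     ... | yes refl = ⊥-elim (All.lookup x∉ i∈ refl)
     ... | no _ = refl
     same : ∀ k κ → load g xs k κ ≡ load f xs k κ
     same k κ = tally-cong (λ i → key k i (g i) ≟K κ) (λ i → key k i (f i) ≟K κ) xs (λ i i∈ → cong (λ z → ⌊ key k i z ≟K κ ⌋) (g-other i i∈))
     okg : ∀ k κ → load g (x ∷ xs) k κ ≤ suc cap
     okg k κ = ≤-trans (≤-reflexive (trans (tally-∷ (λ i → key k i (g i) ≟K κ) x xs) (cong₂ (λ z w → 𝟙 ⌊ key k x z ≟K κ ⌋ + w) g-x (same k κ)))) new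
       where
       new : 𝟙 ⌊ key k x o ≟K κ ⌋ + load f xs k κ ≤ suc cap
       new with key k x o ≟K κ
       ... | yes refl = s≤s (≤-trans (≤∑ (λ k → load f xs k (key k x o)) k) light)
       ... | no _ = ok k κ

   balanced-assignment : Fin h → Unique all → ∃ λ (f : I → Fin h) → ∀ k κ → load f all k κ ≤ suc cap
   balanced-assignment o⁰ u = assign o⁰ all u ([] , refl)

 -- Type t traverses the classes in the order cls t 0, cls t 1, …; every ordered pair of classes
 -- is consecutive for at most one type and position.
 record Scheme (K : ℕ) : Set where
   field
     cls     : Fin K → ℕ → Fin K
     pos     : Fin K → Fin K → ℕ
     typ     : ℕ → Fin K → Fin K
     pos<    : ∀ t c → pos t c < K
     cls-pos : ∀ t c → cls t (pos t c) ≡ c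
     pos-cls : ∀ t k → k < K → pos t (cls t k) ≡ k
     typ-cls : ∀ t k → typ k (cls t k) ≡ t
     step-unique : ∀ t t′ k k′ → k < K → k′ < K → cls t k ≡ cls t′ k′ → cls t (suc k) ≡ cls t′ (suc k′) → k ≡ k′

 -- Gadgets of a cycle in batch b may sit at the chain positions hp b o; a chain position k hosts
 -- gadgets only for the cycles in batch bof k.
 record Hosting (B h e : ℕ) : Set where
   field
     hp     : Fin B → Fin h → ℕ
     bof    : ℕ → Fin B
     hp<    : ∀ b o → hp b o < e
     bof-hp : ∀ b o → bof (hp b o) ≡ b
     hp-inj : ∀ b o o′ → hp b o ≡ hp b o′ → o ≡ o′

 -- Edge roles and the data of the construction.

 data Tag : Set where
   main free c₁ c₂ gA gB : Tag

 -- Matchings are taken among `main` edges only; a shortcut past a gadget may also be `free`.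
 isMain isHost : Tag → Bool
 isMain main = true
 isMain _    = false
 isHost main = true
 isHost free = true
 isHost _    = false

 -- The tag of an edge x → y depends on the label β of x and the label α of y.
 record Tagging (Q : ℕ) : Set where
   field
     tag : Fin Q → Fin Q → Tag
     a₁ b₂ : Fin Q → Fin Q
     tag-a₁ : ∀ b → tag b (a₁ b) ≡ c₁
     tag-b₂ : ∀ a → tag (b₂ a) a ≡ c₂
     gβ gα : Fin Q → Fin Q → Fin Q
     tag-gA : ∀ a b → tag (gβ a b) a ≡ gA
     tag-gB : ∀ a b → tag b (gα a b) ≡ gB
     tag-host : ∀ a b → isHost (tag (gβ a b) (gα a b)) ≡ true

 -- There are K classes of m vertices and ℓ leftover vertices. Positions 0, ..., e of a type carry
 -- the paths, and the last ω positions supply connectors and gadgets. Each type has r cycles in B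
 -- batches of at most `Th`, and each batch has h slots for hosting. One slot of a cycle holds at
 -- most `g₀` gadgets: `suc cap` from classes and `ZL` leftover ones. The other fields bound from
 -- below the candidates of each greedy choice and make the main graphs pseudorandom.
 record Setup : Set where
   field
     K m ℓ B h r Th ω e Q cap ZL : ℕ
     scheme  : Scheme K
     hosting : Hosting B h e
     tagging : Tagging Q
     K≡ : K ≡ suc e + ω

   V : Set
   V = (Fin K × Fin m) ⊎ Fin ℓ

   field
     adj : V → V → Bool
     α β : Fin m → Fin Q
     hashL : Fin ℓ → Fin h
     bucketL : Fin h → List (Fin ℓ)
     ∈bucketL : ∀ x → x ∈ bucketL (hashL x)
     bucketL≤ : ∀ s → length (bucketL s) ≤ ZL
     bj : Fin r → Fin B
     batch : Fin B → List (Fin r)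
     ∈batch : ∀ j → j ∈ batch (bj j)
     batch≤ : ∀ b → length (batch b) ≤ Th
     balance-room : ω * m + (ω * r + ω * r) < h * suc cap

   g₀ : ℕ
   g₀ = suc cap + ZL

   field
     x₀ : Fin m
     0<e : 0 < e
     gadget-in : ∀ c i x b → suc cap + g₀ < cnt m (λ u → adj (inj₁ (c , u)) (inj₁ (i , x)) ∧ eqF (β u) b)
     -- Common out-neighbours of u and of the gadget, so that u → v is available as a shortcut. The
     -- summand `Th` serves to keep the shortcuts of one batch apart.
     gadget-out : ∀ c i u x c′ a → c ≢ i → Th + (suc cap + g₀) <
       cnt m (λ v → (adj (inj₁ (c , u)) (inj₁ (c′ , v)) ∧ adj (inj₁ (i , x)) (inj₁ (c′ , v))) ∧ eqF (α v) a)
     left-in  : ∀ c l → r + g₀ < cnt m (λ u → adj (inj₁ (c , u)) (inj₂ l))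
     left-out : ∀ c l → r + g₀ < cnt m (λ v → adj (inj₂ l) (inj₁ (c , v)))
     c₄ : ℕ
     connect : ∀ c x c′ y i a b → c ≢ c′ → c₄ ≤
       cnt m (λ w → (adj (inj₁ (c , x)) (inj₁ (i , w)) ∧ adj (inj₁ (i , w)) (inj₁ (c′ , y))) ∧ (eqF (α w) a ∧ eqF (β w) b))
     connect-room : m + (r + r) < ω * c₄
     δ₀ δ Δ C : ℕ

   G : Fin K → Fin K → Fin m → Fin m → Bool
   G c c′ x y = adj (inj₁ (c , x)) (inj₁ (c′ , y)) ∧ isMain (Tagging.tag tagging (β x) (α y))

   field
     rowδ₀ : ∀ c c′ x → δ₀ ≤ cnt m (G c c′ x)
     colδ₀ : ∀ c c′ y → δ₀ ≤ cnt m (λ x → G c c′ x y)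
     rowΔ₀ : ∀ c c′ x → cnt m (G c c′ x) ≤ Δ
     colΔ₀ : ∀ c c′ y → cnt m (λ x → G c c′ x y) ≤ Δ
     rowC₀ : ∀ c c′ x x′ → x ≢ x′ → cnt m (λ y → G c c′ x y ∧ G c c′ x′ y) ≤ C
     colC₀ : ∀ c c′ y y′ → y ≢ y′ → cnt m (λ x → G c c′ x y ∧ G c c′ x y′) ≤ C
     par   : Parameters m δ Δ C r
     1≤r   : 1 ≤ r
     room  : δ + (Th + Th + g₀) ≤ δ₀

 module Derived (setup : Setup) where
   open Setup setup public
   open Scheme scheme public
   open Hosting hosting public
   open Tagging tagging public

   J : Set
   J = Fin r

   _≟V_ : DecidableEquality V
   _≟V_ = ⊎P.≡-dec (×P.≡-dec FP._≟_ FP._≟_) FP._≟_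

   Gadget : Fin K → V → Set
   Gadget t (inj₁ (i , x)) = e < pos t i
   Gadget t (inj₂ l)       = ⊤

   gadget? : ∀ t g → Dec (Gadget t g)
   gadget? t (inj₁ (i , x)) = e <? pos t i
   gadget? t (inj₂ l)       = yes tt

   e<K : e < K
   e<K = subst (e <_) (sym K≡) (m≤m+n (suc e) ω)

   allJ : List J
   allJ = allFin r

   ∈allJ : ∀ j → j ∈ allJ
   ∈allJ = ∈-allFin

   length-allFin : ∀ n → length (allFin n) ≡ n
   length-allFin n = length-tabulate id

   length-allJ : length allJ ≡ r
   length-allJ = length-allFin r

   allV : List V
   allV = map inj₁ (cartesianProduct (allFin K) (allFin m)) ++ map inj₂ (allFin ℓ)

   ∈allV : ∀ v → v ∈ allV
   ∈allV (inj₁ (c , x)) = ∈-++⁺ˡ (∈-map⁺ inj₁ (∈-cartesianProduct⁺ (∈-allFin c) (∈-allFin x)))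
   ∈allV (inj₂ l) = ∈-++⁺ʳ (map inj₁ (cartesianProduct (allFin K) (allFin m))) (∈-map⁺ inj₂ (∈-allFin l))

   Item : Set
   Item = Fin K × (J × V)

   allItems : List Item
   allItems = cartesianProduct (allFin K) (cartesianProduct allJ allV)

   ∈allItems : ∀ i → i ∈ allItems
   ∈allItems (t , j , g) = ∈-cartesianProduct⁺ (∈-allFin t) (∈-cartesianProduct⁺ (∈allJ j) (∈allV g))

   _≟I_ : DecidableEquality Item
   _≟I_ = ×P.≡-dec FP._≟_ (×P.≡-dec FP._≟_ _≟V_)

 -- Host positions and ends of the gadgets.

 module Choice (setup : Setup) where
   open Derived setup

   W-classes : Fin K → List (Fin K)
   W-classes t = map (λ (i : Fin ω) → cls t (suc e + toℕ i)) (allFin ω)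

   W-index : ∀ t i → e < pos t i → ∃ λ (k : Fin ω) → pos t i ≡ suc e + toℕ k
   W-index t i e< with ≤-witness e<
   ... | d , eq = fromℕ< {d} d< , trans eq (cong (suc e +_) (sym (FP.toℕ-fromℕ< d<)))
     where
     d< : d < ω
     d< = +-cancelˡ-< (suc e) d ω (subst₂ _<_ eq K≡ (pos< t i))

   W-class∈ : ∀ t i → e < pos t i → i ∈ W-classes t
   W-class∈ t i gd with W-index t i gd
   ... | k , eq = subst (_∈ W-classes t) (trans (cong (cls t) (sym eq)) (cls-pos t i)) (∈-map⁺ _ (∈-allFin k))

   ItemW : Set
   ItemW = Fin K × (J × (Fin K × Fin m))

   gadgetW? : ∀ (i : ItemW) → Dec (e < pos (proj₁ i) (proj₁ (proj₂ (proj₂ i))))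
   gadgetW? (t , j , (i , x)) = e <? pos t i

   allW : List ItemW
   allW = filter gadgetW? (cartesianProduct (allFin K) (cartesianProduct allJ (cartesianProduct (allFin K) (allFin m))))

   ∈allW : ∀ t j i x → e < pos t i → (t , j , (i , x)) ∈ allW
   ∈allW t j i x gd = ∈-filter⁺ gadgetW? (∈-cartesianProduct⁺ (∈-allFin t) (∈-cartesianProduct⁺ (∈-allFin j) (∈-cartesianProduct⁺ (∈-allFin i) (∈-allFin x)))) gd

   private
     Key : Set
     Key = (Fin K × (J × Fin h)) ⊎ ((Fin K × Fin m) × Fin K)

     _≟K_ : DecidableEquality Key
     _≟K_ = ⊎P.≡-dec (×P.≡-dec FP._≟_ (×P.≡-dec FP._≟_ FP._≟_)) (×P.≡-dec (×P.≡-dec FP._≟_ FP._≟_) FP._≟_)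

     -- Three loads are balanced at once: the gadgets of one cycle at one slot and, for a gadget
     -- vertex, the cycles of all types that enter it from a given class or leave it to a given
     -- class. They bound the competitors in the two greedy choices of ends.
     key : Fin 3 → ItemW → Fin h → Key
     key zero             (t , j , w) o = inj₁ (t , j , o)
     key (suc zero)       (t , j , w) o = inj₂ (w , cls t (hp (bj j) o))
     key (suc (suc zero)) (t , j , w) o = inj₂ (w , cls t (suc (hp (bj j) o)))

     hp<K : ∀ b o → hp b o < K
     hp<K b o = <-trans (hp< b o) e<K

     cls-inj : ∀ t k k′ → k < K → k′ < K → cls t k ≡ cls t k′ → k ≡ k′
     cls-inj t k k′ lt lt′ eq = trans (sym (pos-cls t k lt)) (trans (cong (pos t) eq) (pos-cls t k′ lt′))

     key-inj : ∀ k i o o′ → key k i o ≡ key k i o′ → o ≡ o′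
     key-inj zero i o o′ refl = refl
     key-inj (suc zero) (t , j , w) o o′ eq = hp-inj (bj j) o o′ (cls-inj t _ _ (hp<K (bj j) o) (hp<K (bj j) o′) (×P.,-injectiveʳ (⊎P.inj₂-injective eq)))
     key-inj (suc (suc zero)) (t , j , w) o o′ eq = hp-inj (bj j) o o′ (suc-injective (cls-inj t _ _ (≤-<-trans (hp< (bj j) o) e<K) (≤-<-trans (hp< (bj j) o′) e<K) (×P.,-injectiveʳ (⊎P.inj₂-injective eq))))

     Rel : Fin 3 → ItemW → ItemW → Set
     Rel zero    (t , j , w) (t′ , j′ , w′) = (t , j) ≡ (t′ , j′)
     Rel (suc _) (t , j , w) (t′ , j′ , w′) = w ≡ w′

     rel? : ∀ k i i′ → Dec (Rel k i i′)
     rel? zero    (t , j , w) (t′ , j′ , w′) = ×P.≡-dec FP._≟_ FP._≟_ (t , j) (t′ , j′)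
     rel? (suc _) (t , j , w) (t′ , j′ , w′) = ×P.≡-dec FP._≟_ FP._≟_ w w′

     related : ∀ k i i′ o o′ → key k i o ≡ key k i′ o′ → Rel k i i′
     related zero i i′ o o′ refl = refl
     related (suc zero) (t , j , w) (t′ , j′ , w′) o o′ eq = ,-injectiveˡ (⊎P.inj₂-injective eq)
     related (suc (suc zero)) (t , j , w) (t′ , j′ , w′) o o′ eq = ,-injectiveˡ (⊎P.inj₂-injective eq)

     unique-allW : Unique allW
     unique-allW = UP.filter⁺ gadgetW? (UP.cartesianProduct⁺ (UP.allFin⁺ K) (UP.cartesianProduct⁺ (UP.allFin⁺ r) (UP.cartesianProduct⁺ (UP.allFin⁺ K) (UP.allFin⁺ m))))

     relevant : ∀ k i (l : List ItemW) → (∀ i′ → i′ ∈ allW → Rel k i i′ → i′ ∈ l) → tally (rel? k i) allW ≤ length l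
     relevant k i l sub = unique-⊆-length (filter (rel? k i) allW) l (UP.filter⁺ (rel? k i) unique-allW)
       (λ x p → sub x (proj₁ (∈-filter⁻ (rel? k i) {xs = allW} p)) (proj₂ (∈-filter⁻ (rel? k i) {xs = allW} p)))

     is-gadget : ∀ t j i x → (t , j , (i , x)) ∈ allW → e < pos t i
     is-gadget t j i x p = proj₂ (∈-filter⁻ gadgetW? {xs = cartesianProduct (allFin K) (cartesianProduct allJ (cartesianProduct (allFin K) (allFin m)))} p)

     length-W : ∀ t → length (W-classes t) ≡ ω
     length-W t = trans (length-map _ (allFin ω)) (length-allFin ω)

     bound : Fin 3 → ℕ
     bound zero    = ω * m
     bound (suc _) = ω * r

     -- Each final position has exactly one type for which the class of the vertex stands there, so
     -- at most ω r cycles have it as a gadget.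
     by-vertex : Fin K × Fin m → List ItemW
     by-vertex (i , x) = map (λ { (k , j) → typ (suc e + toℕ k) i , j , (i , x) }) (cartesianProduct (allFin ω) allJ)

     by-vertex∈ : ∀ t j i x → (t , j , (i , x)) ∈ allW → (t , j , (i , x)) ∈ by-vertex (i , x)
     by-vertex∈ t j i x p with W-index t i (is-gadget t j i x p)
     ... | k , eq = subst (λ t′ → (t′ , j , (i , x)) ∈ by-vertex (i , x)) (trans (cong₂ typ (sym eq) (sym (cls-pos t i))) (typ-cls t (pos t i)))
           (∈-map⁺ (λ { (k , j) → typ (suc e + toℕ k) i , j , (i , x) }) (∈-cartesianProduct⁺ (∈-allFin k) (∈-allFin j)))

     length-by-vertex : ∀ w → length (by-vertex w) ≡ ω * r
     length-by-vertex (i , x) = trans (length-map _ (cartesianProduct (allFin ω) allJ)) (trans (length-cartesianProduct (allFin ω) allJ) (cong₂ _*_ (length-allFin ω) length-allJ))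

     by-cycle : Fin K → J → List ItemW
     by-cycle t j = map (λ w → t , j , w) (cartesianProduct (W-classes t) (allFin m))

     length-by-cycle : ∀ t j → length (by-cycle t j) ≡ ω * m
     length-by-cycle t j = trans (length-map _ (cartesianProduct (W-classes t) (allFin m))) (trans (length-cartesianProduct (W-classes t) (allFin m)) (cong₂ _*_ (length-W t) (length-allFin m)))

     rel≤ : ∀ k i → tally (rel? k i) allW ≤ bound k
     rel≤ zero (t , j , w) = ≤-trans (relevant zero (t , j , w) (by-cycle t j)
       (λ { (t′ , j′ , (i , x)) p refl → ∈-map⁺ (λ w → t , j , w) (∈-cartesianProduct⁺ (W-class∈ t i (is-gadget t j i x p)) (∈-allFin x)) })) (≤-reflexive (length-by-cycle t j))
     rel≤ (suc zero) (t , j , w) = ≤-trans (relevant (suc zero) (t , j , w) (by-vertex w) (λ { (t′ , j′ , (i , x)) p refl → by-vertex∈ t′ j′ i x p })) (≤-reflexive (length-by-vertex w))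
     rel≤ (suc (suc zero)) (t , j , w) = ≤-trans (relevant (suc (suc zero)) (t , j , w) (by-vertex w) (λ { (t′ , j′ , (i , x)) p refl → by-vertex∈ t′ j′ i x p })) (≤-reflexive (length-by-vertex w))

     h-nonzero : Fin h
     h-nonzero = go h balance-room
       where
       go : ∀ h → ω * m + (ω * r + ω * r) < h * suc cap → Fin h
       go (suc h) _ = zero

     open Balance (×P.≡-dec FP._≟_ (×P.≡-dec FP._≟_ (×P.≡-dec FP._≟_ FP._≟_))) _≟K_ 3 key key-inj Rel rel? related allW bound rel≤ cap
       (subst (_< h * suc cap) (cong (λ z → ω * m + (ω * r + z)) (sym (+-identityʳ (ω * r)))) balance-room)

     abstract
       assignment : ∃ λ (f : ItemW → Fin h) → ∀ k κ → load f allW k κ ≤ suc cap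
       assignment = balanced-assignment h-nonzero unique-allW

   slot : Fin K → J → V → Fin h
   slot t j (inj₁ w) = proj₁ assignment (t , j , w)
   slot t j (inj₂ l) = hashL l

   host : Fin K → J → V → ℕ
   host t j g = hp (bj j) (slot t j g)

   host<e : ∀ t j g → host t j g < e
   host<e t j g = hp< (bj j) (slot t j g)

   private
     vertex : ItemW → V
     vertex (t , j , w) = inj₁ w

     item : ItemW → Item
     item (t , j , w) = t , j , inj₁ w

     slotW : ItemW → Fin h
     slotW = proj₁ assignment

   gadgetsAt : Fin K → J → Fin h → List V
   gadgetsAt t j o = map vertex (filter (λ i → key zero i (slotW i) ≟K inj₁ (t , j , o)) allW) ++ map inj₂ (bucketL o)

   ∈gadgetsAt : ∀ t j g → Gadget t g → g ∈ gadgetsAt t j (slot t j g)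
   ∈gadgetsAt t j (inj₁ (i , x)) gd = ∈-++⁺ˡ (∈-map⁺ vertex (∈-filter⁺ (λ i′ → key zero i′ (slotW i′) ≟K inj₁ (t , j , slot t j (inj₁ (i , x)))) (∈allW t j i x gd) refl))
   ∈gadgetsAt t j (inj₂ l) gd = ∈-++⁺ʳ (map vertex (filter (λ i → key zero i (slotW i) ≟K inj₁ (t , j , hashL l)) allW)) (∈-map⁺ inj₂ (∈bucketL l))

   length-gadgetsAt : ∀ t j o → length (gadgetsAt t j o) ≤ g₀
   length-gadgetsAt t j o = ≤-trans (≤-reflexive (length-++ (map vertex (filter (λ i → key zero i (slotW i) ≟K inj₁ (t , j , o)) allW))))
     (+-mono-≤ (≤-trans (≤-reflexive (length-map vertex (filter (λ i → key zero i (slotW i) ≟K inj₁ (t , j , o)) allW))) (proj₂ assignment zero (inj₁ (t , j , o)))) (≤-trans (≤-reflexive (length-map inj₂ (bucketL o))) (bucketL≤ o)))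

   targetSlots : V → ℕ
   targetSlots (inj₁ _) = suc cap
   targetSlots (inj₂ _) = r

   module Targets (κ : Fin 3) (sh : ℕ → ℕ) (sh-key : ∀ t j w o → key κ (t , j , w) o ≡ inj₂ (w , cls t (sh (hp (bj j) o)))) where

     target : Item → Fin K
     target (t , j , g) = cls t (sh (host t j g))

     sameTarget : Fin K → V → List Item
     sameTarget c (inj₁ w) = map item (filter (λ i → key κ i (slotW i) ≟K inj₂ (w , c)) allW)
     sameTarget c (inj₂ l) = map (λ j → typ (sh (hp (bj j) (hashL l))) c , j , inj₂ l) allJ

     length-sameTarget : ∀ c g → length (sameTarget c g) ≤ targetSlots g
     length-sameTarget c (inj₁ w) = ≤-trans (≤-reflexive (length-map item (filter (λ i → key κ i (slotW i) ≟K inj₂ (w , c)) allW))) (proj₂ assignment κ (inj₂ (w , c)))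
     length-sameTarget c (inj₂ l) = ≤-reflexive (trans (length-map _ allJ) length-allJ)

     ∈sameTarget : ∀ t j g → Gadget t g → (t , j , g) ∈ sameTarget (target (t , j , g)) g
     ∈sameTarget t j (inj₁ (i , x)) gd = ∈-map⁺ item (∈-filter⁺ (λ i′ → key κ i′ (slotW i′) ≟K inj₂ ((i , x) , target (t , j , inj₁ (i , x)))) (∈allW t j i x gd) (sh-key t j (i , x) (slotW (t , j , (i , x)))))
     ∈sameTarget t j (inj₂ l) gd = subst (_∈ sameTarget c (inj₂ l)) (cong (λ t′ → t′ , j , inj₂ l) (typ-cls t _)) (∈-map⁺ (λ j → typ (sh (hp (bj j) (hashL l))) c , j , inj₂ l) (∈allJ j))
       where c = target (t , j , inj₂ l)

     module _ (Good : Item → Fin m → Bool) (XC : Item → Item → Set) (XC-sym : ∀ {i i′} → XC i i′ → XC i′ i)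
       (extra : Item → List Item) (∈extra : ∀ i i′ → i′ ≢ i → XC i i′ → Gadget (proj₁ i′) (proj₂ (proj₂ i′)) → i′ ∈ extra i)
       (enough : ∀ t j g → Gadget t g → length (extra (t , j , g)) + (targetSlots g + g₀) < cnt m (Good (t , j , g))) where

       GI : Item → Set
       GI (t , j , g) = Gadget t g

       -- Gadgets of one cycle at one host position need distinct ends, or the forced pairs would
       -- not be a partial matching. Cycles with the same gadget vertex and ends in the same class
       -- need distinct ends, or they would share an edge at the gadget. `XC` is a further
       -- constraint, nontrivial for the heads.
       SameHost SameTarget Clash : Item → Item → Set
       SameHost (t , j , g) (t′ , j′ , g′) = (t ≡ t′ × j ≡ j′) × host t j g ≡ host t′ j′ g′
       SameTarget i i′ = proj₂ (proj₂ i) ≡ proj₂ (proj₂ i′) × target i ≡ target i′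
       Clash i i′ = SameHost i i′ ⊎ SameTarget i i′ ⊎ XC i i′

       private
         Conf : Item → Item → Fin m → Fin m → Set
         Conf i i′ u u′ = (GI i × GI i′) × u ≡ u′ × Clash i i′

         Conf-sym : ∀ {i i′ u u′} → Conf i i′ u u′ → Conf i′ i u′ u
         Conf-sym ((a , b) , eq , inj₁ ((p , q) , s)) = (b , a) , sym eq , inj₁ ((sym p , sym q) , sym s)
         Conf-sym ((a , b) , eq , inj₂ (inj₁ (p , q))) = (b , a) , sym eq , inj₂ (inj₁ (sym p , sym q))
         Conf-sym ((a , b) , eq , inj₂ (inj₂ x)) = (b , a) , sym eq , inj₂ (inj₂ (XC-sym x))

         Ok : Item → Fin m → Set
         Ok i u = GI i → Good i u ≡ true

         forbidden : Item → List Item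
         forbidden (t , j , g) = extra (t , j , g) ++ (sameTarget (target (t , j , g)) g ++ map (λ g′ → t , j , g′) (gadgetsAt t j (slot t j g)))

         forbidden≤ : ∀ i → length (forbidden i) ≤ length (extra i) + (targetSlots (proj₂ (proj₂ i)) + g₀)
         forbidden≤ (t , j , g) = ≤-trans (≤-reflexive (trans (length-++ (extra (t , j , g))) (cong (length (extra (t , j , g)) +_) (length-++ (sameTarget (target (t , j , g)) g)))))
           (+-monoʳ-≤ (length (extra (t , j , g))) (+-mono-≤ (length-sameTarget (target (t , j , g)) g) (≤-trans (≤-reflexive (length-map _ (gadgetsAt t j (slot t j g)))) (length-gadgetsAt t j (slot t j g)))))

         clash⇒∈ : ∀ i i′ → i′ ≢ i → GI i′ → Clash i i′ → i′ ∈ forbidden i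
         clash⇒∈ (t , j , g) (t′ , j′ , g′) ne gd′ (inj₁ ((refl , refl) , hs)) = ∈-++⁺ʳ (extra (t , j , g)) (∈-++⁺ʳ (sameTarget _ g)
           (∈-map⁺ (λ g′ → t , j , g′) (subst (λ o → g′ ∈ gadgetsAt t j o) (hp-inj (bj j) _ _ (sym hs)) (∈gadgetsAt t j g′ gd′))))
         clash⇒∈ i@(t , j , g) (t′ , j′ , g′) ne gd′ (inj₂ (inj₁ (refl , tg))) = ∈-++⁺ʳ (extra i) (∈-++⁺ˡ
           (subst (λ c → (t′ , j′ , g) ∈ sameTarget c g) (sym tg) (∈sameTarget t′ j′ g gd′)))
         clash⇒∈ i i′ ne gd′ (inj₂ (inj₂ x)) = ∈-++⁺ˡ (∈extra i i′ ne x gd′)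

         step : ∀ i (f : Item → Fin m) → ∃ λ u → Ok i u × (∀ i′ → i′ ≢ i → ¬ Conf i i′ u (f i′))
         step i@(t , j , g) f with gadget? t g
         -- A vertex that is no gadget for this type gets a dummy end; conflicts are declared
         -- between gadgets only.
         ... | no ¬g = x₀ , (λ gd → ⊥-elim (¬g gd)) , λ { i′ ne ((gd , _) , _) → ¬g gd }
         ... | yes gd with avoid (Good i) (map f (forbidden i)) (≤-<-trans (≤-trans (≤-reflexive (length-map f (forbidden i))) (forbidden≤ i)) (enough t j g gd))
         ...   | u , good , u∉ = u , (λ _ → good) , λ { i′ ne ((_ , gd′) , eq , cl) → u∉ (subst (_∈ map f (forbidden i)) (sym eq) (∈-map⁺ f (clash⇒∈ i i′ ne gd′ cl))) }

       abstract
         choice : ∃ λ (f : Item → Fin m) → (∀ i → GI i → Good i (f i) ≡ true) ×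
           (∀ i i′ → i′ ≢ i → GI i → GI i′ → f i ≡ f i′ → ¬ Clash i i′)
         choice with greedy _≟I_ Ok Conf Conf-sym step (λ _ → x₀) allItems
         ... | f , ok , nc = f , (λ i → ok i (∈allItems i)) , λ i i′ ne gd gd′ eq cl → nc i i′ (∈allItems i) (∈allItems i′) ne ((gd , gd′) , eq , cl)

   module Tails = Targets (suc zero) id (λ _ _ _ _ → refl)
   module Heads = Targets (suc (suc zero)) suc (λ _ _ _ _ → refl)

 unique-map : ∀ {A B : Set} (f : A → B) (l : List A) → Unique l → (∀ a b → a ∈ l → b ∈ l → f a ≡ f b → a ≡ b) → Unique (map f l)
 unique-map f [] u inj = AP.[]
 unique-map f (a ∷ l) (n AP.∷ u) inj = all l n (λ b b∈ → inj a b (here refl) (there b∈)) AP.∷ unique-map f l u (λ a b p q → inj a b (there p) (there q))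
   where
   all : ∀ l → All (a ≢_) l → (∀ b → b ∈ l → f a ≡ f b → a ≡ b) → All (f a ≢_) (map f l)
   all [] [] h = []
   all (b ∷ l) (ne ∷ ns) h = (λ eq → ne (h b (here refl) eq)) ∷ all l ns (λ b b∈ → h b (there b∈))

 unique-length≤ : ∀ {n} (l l′ : List (Fin n)) → Unique l → (∀ x → x ∈ l → x ∈ l′) → length l ≤ length l′
 unique-length≤ {n} l l′ u sub = subst₂ _≤_ (∑-occ n l) (∑-occ n l′) (∑-mono n (λ x → ≤-trans (unique-occ x l u) (le x)))
   where
   le : ∀ x → 𝟙 (mem x l) ≤ occ x l′
   le x with mem x l in eq
   ... | true  = ∈⇒occ (sub x (mem-∈ eq))
   ... | false = z≤n

 empty-list : ∀ {A : Set} (l : List A) → (∀ x → x ∉ l) → l ≡ []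
 empty-list [] _ = refl
 empty-list (x ∷ l) none = ⊥-elim (none x (here refl))

 first : ∀ {A : Set} {P : A → Set} → (∀ a → Dec (P a)) → List A → List A
 first P? [] = []
 first P? (x ∷ l) with P? x
 ... | yes _ = x ∷ []
 ... | no _  = first P? l

 length-first : ∀ {A : Set} {P : A → Set} (P? : ∀ a → Dec (P a)) l → length (first P? l) ≤ 1
 length-first P? [] = z≤n
 length-first P? (x ∷ l) with P? x
 ... | yes _ = ≤-refl
 ... | no _  = length-first P? l

 ∈first : ∀ {A : Set} {P : A → Set} (P? : ∀ a → Dec (P a)) → (∀ a b → P a → P b → a ≡ b) → ∀ l a → a ∈ l → P a → a ∈ first P? l
 ∈first P? un (x ∷ l) a p pa with P? x
 ∈first P? un (x ∷ l) a p pa | yes px = here (un a x pa px)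
 ∈first P? un (x ∷ l) a (here refl) pa | no ¬p = ⊥-elim (¬p pa)
 ∈first P? un (x ∷ l) a (there p) pa | no ¬p = ∈first P? un l a p pa

 module Gadgets (setup : Setup) where
   open Choice setup public
   open Derived setup public

   private
     Good₁ : Item → Fin m → Bool
     Good₁ (t , j , inj₁ (i , x)) u = adj (inj₁ (cls t (host t j (inj₁ (i , x))) , u)) (inj₁ (i , x)) ∧ eqF (β u) (gβ (α x) (β x))
     Good₁ (t , j , inj₂ l) u = adj (inj₁ (cls t (host t j (inj₂ l)) , u)) (inj₂ l)

     enough₁ : ∀ t j g → Gadget t g → 0 + (targetSlots g + g₀) < cnt m (Good₁ (t , j , g))
     enough₁ t j (inj₁ (i , x)) _ = gadget-in (cls t (host t j (inj₁ (i , x)))) i x (gβ (α x) (β x))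
     enough₁ t j (inj₂ l) _ = left-in (cls t (host t j (inj₂ l))) l

     choice₁ = Tails.choice Good₁ (λ _ _ → ⊥) (λ ()) (λ _ → []) (λ _ _ _ ()) enough₁

   fu : Item → Fin m
   fu = proj₁ choice₁

   fu-good : ∀ t j g → Gadget t g → Good₁ (t , j , g) (fu (t , j , g)) ≡ true
   fu-good t j g = proj₁ (proj₂ choice₁) (t , j , g)

   fu-host : ∀ t j g g′ → Gadget t g → Gadget t g′ → host t j g ≡ host t j g′ → fu (t , j , g) ≡ fu (t , j , g′) → g ≡ g′
   fu-host t j g g′ gd gd′ hs eq with g ≟V g′
   ... | yes p = p
   ... | no ne = ⊥-elim (proj₂ (proj₂ choice₁) (t , j , g) (t , j , g′) (λ p → ne (sym (cong (proj₂ ∘ proj₂) p))) gd gd′ eq (inj₁ ((refl , refl) , hs)))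

   fu-target : ∀ t j t′ j′ g → Gadget t g → Gadget t′ g → cls t (host t j g) ≡ cls t′ (host t′ j′ g) →
     fu (t , j , g) ≡ fu (t′ , j′ , g) → (t , j) ≡ (t′ , j′)
   fu-target t j t′ j′ g gd gd′ c≡ eq with ×P.≡-dec FP._≟_ FP._≟_ (t , j) (t′ , j′)
   ... | yes p = p
   ... | no ne = ⊥-elim (proj₂ (proj₂ choice₁) (t , j , g) (t′ , j′ , g) (λ { refl → ne refl }) gd gd′ eq (inj₂ (inj₁ (refl , c≡))))

   isW : V → Set
   isW (inj₁ _) = ⊤
   isW (inj₂ _) = ⊥

   private
     u⟨_⟩ : Item → V
     u⟨ i@(t , j , g) ⟩ = inj₁ (cls t (host t j g) , fu i)

     -- A gadget from a class asks for v adjacent from u and from itself, with the label that tags g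
     -- → v as `gB` and, by `tag-host`, makes u → v a host edge. Edges at a leftover vertex are
     -- recognised by that vertex, so no label is prescribed there.
     Good₂ : Item → Fin m → Bool
     Good₂ (t , j , inj₁ (i , x)) v = (adj u⟨ t , j , inj₁ (i , x) ⟩ (inj₁ (cls t (suc (host t j (inj₁ (i , x)))) , v))
       ∧ adj (inj₁ (i , x)) (inj₁ (cls t (suc (host t j (inj₁ (i , x)))) , v))) ∧ eqF (α v) (gα (α x) (β x))
     Good₂ (t , j , inj₂ l) v = adj (inj₂ l) (inj₁ (cls t (suc (host t j (inj₂ l))) , v))

     -- Two cycles of one type with the same u at the same host position must not receive the same
     -- v, since both might travel the shortcut u → v.
     XC : Item → Item → Set
     XC (t , j , g) (t′ , j′ , g′) = (isW g × isW g′) × (t ≡ t′ × host t j g ≡ host t′ j′ g′) × fu (t , j , g) ≡ fu (t′ , j′ , g′)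

     XC-sym : ∀ {i i′} → XC i i′ → XC i′ i
     XC-sym ((a , b) , (c , d) , e) = (b , a) , (sym c , sym d) , sym e

     hostsOf : ℕ → List J
     hostsOf k = batch (bof k)

     ∈hostsOf : ∀ t j g → j ∈ hostsOf (host t j g)
     ∈hostsOf t j g = subst (λ b → j ∈ batch b) (sym (bof-hp (bj j) (slot t j g))) (∈batch j)

     Owner : Fin K → ℕ → Fin m → J → V → Set
     Owner t k u j g = (Gadget t g × host t j g ≡ k) × fu (t , j , g) ≡ u

     owner? : ∀ t k u j g → Dec (Owner t k u j g)
     owner? t k u j g = (gadget? t g ×-dec (host t j g ≟ k)) ×-dec (fu (t , j , g) FP.≟ u)

     owner-unique : ∀ t k u j g g′ → Owner t k u j g → Owner t k u j g′ → g ≡ g′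
     owner-unique t k u j g g′ ((gd , a) , b) ((gd′ , a′) , b′) = fu-host t j g g′ gd gd′ (trans a (sym a′)) (trans b (sym b′))

     owners : Fin K → ℕ → Fin m → J → List Item
     owners t k u j = map (λ g → t , j , g) (first (owner? t k u j) allV)

     -- Only the batch of a position hosts there, and within a cycle the tail u determines the
     -- gadget. So each of the at most `Th` cycles contributes at most one competitor.
     extra : Item → List Item
     extra (t , j , inj₁ w) = concatMap (owners t (host t j (inj₁ w)) (fu (t , j , inj₁ w))) (hostsOf (host t j (inj₁ w)))
     extra (t , j , inj₂ l) = []

     extra≤ : ∀ t j w → length (extra (t , j , inj₁ w)) ≤ Th
     extra≤ t j w = ≤-trans (length-concatMap (owners t (host t j (inj₁ w)) (fu (t , j , inj₁ w))) (hostsOf (host t j (inj₁ w))) 1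
       (λ j′ → ≤-trans (≤-reflexive (length-map _ (first (owner? t (host t j (inj₁ w)) (fu (t , j , inj₁ w)) j′) allV))) (length-first (owner? t (host t j (inj₁ w)) (fu (t , j , inj₁ w)) j′) allV)))
       (≤-trans (≤-reflexive (*-identityʳ _)) (batch≤ (bof (host t j (inj₁ w)))))

     ∈extra : ∀ i i′ → i′ ≢ i → XC i i′ → Gadget (proj₁ i′) (proj₂ (proj₂ i′)) → i′ ∈ extra i
     ∈extra (t , j , inj₂ l) (t′ , j′ , g′) ne ((() , _) , _) gd′
     ∈extra (t , j , inj₁ w) (t′ , j′ , g′) ne (_ , (refl , hs) , eq) gd′ =
       concatMap-∈ (owners t (host t j (inj₁ w)) (fu (t , j , inj₁ w))) (hostsOf (host t j (inj₁ w))) (subst (λ k → j′ ∈ hostsOf k) (sym hs) (∈hostsOf t j′ g′))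
         (∈-map⁺ (λ g → t , j′ , g) (∈first (owner? t (host t j (inj₁ w)) (fu (t , j , inj₁ w)) j′) (owner-unique t (host t j (inj₁ w)) (fu (t , j , inj₁ w)) j′) allV g′ (∈allV g′) ((gd′ , sym hs) , sym eq)))

     -- Gadgets lie beyond position e and hosts before it; the count of common out-neighbours in
     -- `gadget-out` presupposes two different classes.
     host-class≢ : ∀ t j i x → Gadget t (inj₁ (i , x)) → cls t (host t j (inj₁ (i , x))) ≢ i
     host-class≢ t j i x gd eq = <-asym (subst (e <_) (trans (cong (pos t) (sym eq)) (pos-cls t _ (<-trans (host<e t j (inj₁ (i , x))) e<K))) gd) (host<e t j (inj₁ (i , x)))

     enough₂ : ∀ t j g → Gadget t g → length (extra (t , j , g)) + (targetSlots g + g₀) < cnt m (Good₂ (t , j , g))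
     enough₂ t j (inj₁ (i , x)) gd = ≤-<-trans (+-monoˡ-≤ (suc cap + g₀) (extra≤ t j (i , x)))
       (gadget-out (cls t (host t j (inj₁ (i , x)))) i (fu (t , j , inj₁ (i , x))) x (cls t (suc (host t j (inj₁ (i , x))))) (gα (α x) (β x)) (host-class≢ t j i x gd))
     enough₂ t j (inj₂ l) _ = left-out (cls t (suc (host t j (inj₂ l)))) l

     choice₂ = Heads.choice Good₂ XC (λ {i} {i′} → XC-sym {i} {i′}) extra ∈extra enough₂

   fv : Item → Fin m
   fv = proj₁ choice₂

   fv-good : ∀ t j g → Gadget t g → Good₂ (t , j , g) (fv (t , j , g)) ≡ true
   fv-good t j g = proj₁ (proj₂ choice₂) (t , j , g)

   fv-host : ∀ t j g g′ → Gadget t g → Gadget t g′ → host t j g ≡ host t j g′ → fv (t , j , g) ≡ fv (t , j , g′) → g ≡ g′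
   fv-host t j g g′ gd gd′ hs eq with g ≟V g′
   ... | yes p = p
   ... | no ne = ⊥-elim (proj₂ (proj₂ choice₂) (t , j , g) (t , j , g′) (λ p → ne (sym (cong (proj₂ ∘ proj₂) p))) gd gd′ eq (inj₁ ((refl , refl) , hs)))

   fv-target : ∀ t j t′ j′ g → Gadget t g → Gadget t′ g → cls t (suc (host t j g)) ≡ cls t′ (suc (host t′ j′ g)) →
     fv (t , j , g) ≡ fv (t′ , j′ , g) → (t , j) ≡ (t′ , j′)
   fv-target t j t′ j′ g gd gd′ c≡ eq with ×P.≡-dec FP._≟_ FP._≟_ (t , j) (t′ , j′)
   ... | yes p = p
   ... | no ne = ⊥-elim (proj₂ (proj₂ choice₂) (t , j , g) (t′ , j′ , g) (λ { refl → ne refl }) gd gd′ eq (inj₂ (inj₁ (refl , c≡))))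

   fu-fv-pair : ∀ t j j′ g g′ → Gadget t g → Gadget t g′ → isW g → isW g′ → host t j g ≡ host t j′ g′ →
     fu (t , j , g) ≡ fu (t , j′ , g′) → fv (t , j , g) ≡ fv (t , j′ , g′) → j ≡ j′
   fu-fv-pair t j j′ g g′ gd gd′ w w′ hs ueq veq with j FP.≟ j′
   ... | yes p = p
   ... | no ne = ⊥-elim (proj₂ (proj₂ choice₂) (t , j , g) (t , j′ , g′) (λ { refl → ne refl }) gd gd′ veq (inj₂ (inj₂ ((w , w′) , (refl , hs) , ueq))))

   fu-edge : ∀ t j g → Gadget t g → adj (inj₁ (cls t (host t j g) , fu (t , j , g))) g ≡ true
   fu-edge t j (inj₁ (i , x)) gd = proj₁ (∧-true (fu-good t j (inj₁ (i , x)) gd))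
   fu-edge t j (inj₂ l) gd = fu-good t j (inj₂ l) gd

   fv-edge : ∀ t j g → Gadget t g → adj g (inj₁ (cls t (suc (host t j g)) , fv (t , j , g))) ≡ true
   fv-edge t j (inj₁ (i , x)) gd = proj₂ (∧-true {adj u⟨ t , j , inj₁ (i , x) ⟩ _} (proj₁ (∧-true (fv-good t j (inj₁ (i , x)) gd))))
   fv-edge t j (inj₂ l) gd = fv-good t j (inj₂ l) gd

   shortcut-edge : ∀ t j g → Gadget t g → isW g →
     adj (inj₁ (cls t (host t j g) , fu (t , j , g))) (inj₁ (cls t (suc (host t j g)) , fv (t , j , g))) ≡ true
   shortcut-edge t j (inj₁ (i , x)) gd _ = proj₁ (∧-true (proj₁ (∧-true (fv-good t j (inj₁ (i , x)) gd))))

   fu-β : ∀ t j i x → Gadget t (inj₁ (i , x)) → β (fu (t , j , inj₁ (i , x))) ≡ gβ (α x) (β x)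
   fu-β t j i x gd = eqF-≡ (proj₂ (∧-true {adj (inj₁ (cls t (host t j (inj₁ (i , x))) , fu (t , j , inj₁ (i , x)))) (inj₁ (i , x))} (fu-good t j (inj₁ (i , x)) gd)))

   fv-α : ∀ t j i x → Gadget t (inj₁ (i , x)) → α (fv (t , j , inj₁ (i , x))) ≡ gα (α x) (β x)
   fv-α t j i x gd = eqF-≡ (proj₂ (∧-true {adj u⟨ t , j , inj₁ (i , x) ⟩ (inj₁ (cls t (suc (host t j (inj₁ (i , x)))) , fv (t , j , inj₁ (i , x)))) ∧ _} (fv-good t j (inj₁ (i , x)) gd)))

   Here : Fin K → ℕ → J → V → Set
   Here t k j g = Gadget t g × host t j g ≡ k

   here? : ∀ t k j g → Dec (Here t k j g)
   here? t k j g = gadget? t g ×-dec (host t j g ≟ k)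

   gadgetsHere : Fin K → ℕ → J → List V
   gadgetsHere t k j = filter (here? t k j) allV

   ∈gadgetsHere⁺ : ∀ t k j g → Here t k j g → g ∈ gadgetsHere t k j
   ∈gadgetsHere⁺ t k j g hr = ∈-filter⁺ (here? t k j) (∈allV g) hr

   ∈gadgetsHere⁻ : ∀ t k j g → g ∈ gadgetsHere t k j → Here t k j g
   ∈gadgetsHere⁻ t k j g p = proj₂ (∈-filter⁻ (here? t k j) {xs = allV} p)

   private
     unique-allV : Unique allV
     unique-allV = UP.++⁺ (UP.map⁺ ⊎P.inj₁-injective (UP.cartesianProduct⁺ (UP.allFin⁺ K) (UP.allFin⁺ m))) (UP.map⁺ ⊎P.inj₂-injective (UP.allFin⁺ ℓ)) disj
       where
       disj : ∀ {v} → v ∈ map inj₁ (cartesianProduct (allFin K) (allFin m)) × v ∈ map inj₂ (allFin ℓ) → ⊥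
       disj (p , q) with ∈-map⁻ inj₁ p | ∈-map⁻ inj₂ q
       ... | _ , _ , refl | _ , _ , ()

     unique-here : ∀ t k j → Unique (gadgetsHere t k j)
     unique-here t k j = UP.filter⁺ (here? t k j) unique-allV

     forced : Fin K → ℕ → J → List (Fin m × Fin m)
     forced t k j = map (λ g → fu (t , j , g) , fv (t , j , g)) (gadgetsHere t k j)

     map-map : ∀ {A B C : Set} (f : B → C) (g : A → B) l → map f (map g l) ≡ map (λ a → f (g a)) l
     map-map f g [] = refl
     map-map f g (x ∷ l) = cong (f (g x) ∷_) (map-map f g l)

     u₁ : ∀ t k j → Unique (map (λ g → fu (t , j , g)) (gadgetsHere t k j))
     u₁ t k j = unique-map (λ g → fu (t , j , g)) (gadgetsHere t k j) (unique-here t k j) (λ g g′ p q eq →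
       let hr = ∈gadgetsHere⁻ t k j g p ; hr′ = ∈gadgetsHere⁻ t k j g′ q in fu-host t j g g′ (proj₁ hr) (proj₁ hr′) (trans (proj₂ hr) (sym (proj₂ hr′))) eq)

     u₂ : ∀ t k j → Unique (map (λ g → fv (t , j , g)) (gadgetsHere t k j))
     u₂ t k j = unique-map (λ g → fv (t , j , g)) (gadgetsHere t k j) (unique-here t k j) (λ g g′ p q eq →
       let hr = ∈gadgetsHere⁻ t k j g p ; hr′ = ∈gadgetsHere⁻ t k j g′ q in fv-host t j g g′ (proj₁ hr) (proj₁ hr′) (trans (proj₂ hr) (sym (proj₂ hr′))) eq)

     -- All gadgets of one cycle at position k occupy the same slot, because `hp` is injective on a
     -- batch. Their tails are compared in place of the gadgets, which moves the count into `Fin m`.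
     here≤ : ∀ t k j → length (gadgetsHere t k j) ≤ g₀
     here≤ t k j with gadgetsHere t k j in eq
     ... | [] = z≤n
     ... | g ∷ gs = subst (λ l → length l ≤ g₀) eq (begin
         length (gadgetsHere t k j) ≡⟨ length-map _ (gadgetsHere t k j) ⟨
         length (map (λ g → fu (t , j , g)) (gadgetsHere t k j)) ≤⟨ unique-length≤ _ (map (λ g → fu (t , j , g)) (gadgetsAt t j (slot t j g))) (u₁ t k j) sub ⟩
         length (map (λ g → fu (t , j , g)) (gadgetsAt t j (slot t j g))) ≡⟨ length-map _ (gadgetsAt t j (slot t j g)) ⟩
         length (gadgetsAt t j (slot t j g)) ≤⟨ length-gadgetsAt t j (slot t j g) ⟩
         g₀ ∎)
       where
       open ≤-Reasoning
       hr = ∈gadgetsHere⁻ t k j g (subst (g ∈_) (sym eq) (here refl))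
       sub : ∀ x → x ∈ map (λ g → fu (t , j , g)) (gadgetsHere t k j) → x ∈ map (λ g → fu (t , j , g)) (gadgetsAt t j (slot t j g))
       sub x p with ∈-map⁻ (λ g → fu (t , j , g)) p
       ... | g′ , q , refl = ∈-map⁺ (λ g → fu (t , j , g)) (subst (λ s → g′ ∈ gadgetsAt t j s)
               (hp-inj (bj j) _ _ (trans (proj₂ (∈gadgetsHere⁻ t k j g′ q)) (sym (proj₂ hr)))) (∈gadgetsAt t j g′ (proj₁ (∈gadgetsHere⁻ t k j g′ q))))

     non-host : ∀ t k j → j ∉ hostsOf k → forced t k j ≡ []
     non-host t k j j∉ = cong (map _) (empty-list (gadgetsHere t k j) (λ g p →
       j∉ (subst (λ k → j ∈ hostsOf k) (proj₂ (∈gadgetsHere⁻ t k j g p)) (∈hostsOf t j g))))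

     module PM (t : Fin K) (k : ℕ) = PairMatchings (G (cls t k) (cls t (suc k)))
       (rowδ₀ (cls t k) (cls t (suc k))) (colδ₀ (cls t k) (cls t (suc k)))
       (rowΔ₀ (cls t k) (cls t (suc k))) (colΔ₀ (cls t k) (cls t (suc k)))
       (rowC₀ (cls t k) (cls t (suc k))) (colC₀ (cls t k) (cls t (suc k)))
       par 1≤r FP._≟_ id id (hostsOf k) (forced t k) {Th} {g₀} (batch≤ (bof k))
       (λ j → subst Unique (sym (map-map proj₁ _ (gadgetsHere t k j))) (u₁ t k j))
       (λ j → subst Unique (sym (map-map proj₂ _ (gadgetsHere t k j))) (u₂ t k j))
       (λ j → ≤-trans (≤-reflexive (length-map _ (gadgetsHere t k j))) (here≤ t k j))
       (non-host t k) room

   FreeAt : Fin K → ℕ → J → Fin m → Set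
   FreeAt t k j x = ∀ g → Here t k j g → fu (t , j , g) ≢ x

   private
     unlist : ∀ t k j x → FreeAt t k j x → x ∉ map proj₁ (forced t k j)
     unlist t k j x fr p with ∈-map⁻ proj₁ p
     ... | q , q∈ , refl with ∈-map⁻ (λ g → fu (t , j , g) , fv (t , j , g)) q∈
     ...   | g , g∈ , refl = fr g (∈gadgetsHere⁻ t k j g g∈) refl

   abstract
     nx : Fin K → ℕ → J → Bij m
     nx t k = PM.nx t k

     nx-forced : ∀ t j g → Gadget t g → to (nx t (host t j g) j) (fu (t , j , g)) ≡ fv (t , j , g)
     nx-forced t j g gd = PM.nx-forced t (host t j g) j (∈-map⁺ (λ g → fu (t , j , g) , fv (t , j , g)) (∈gadgetsHere⁺ t (host t j g) j g (gd , refl)))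

     nx-edge : ∀ t k j x → FreeAt t k j x → G (cls t k) (cls t (suc k)) x (to (nx t k j) x) ≡ true
     nx-edge t k j x fr = PM.nx-edge t k j x (unlist t k j x fr)

     nx-avoids : ∀ t k j x → FreeAt t k j x → ∀ i g → Here t k i g → fu (t , i , g) ≡ x → to (nx t k j) x ≢ fv (t , i , g)
     nx-avoids t k j x fr i g hr refl eq = PM.nx-avoids-forced t k j x (unlist t k j x fr) i
       (subst (λ z → (x , z) ∈ forced t k i) (sym eq) (∈-map⁺ (λ g → fu (t , i , g) , fv (t , i , g)) (∈gadgetsHere⁺ t k i g hr)))

     nx-disjoint : ∀ t k i j x → FreeAt t k i x → FreeAt t k j x → to (nx t k i) x ≡ to (nx t k j) x → i ≡ j
     nx-disjoint t k i j x fi fj = PM.nx-disjoint t k i j x (unlist t k i x fi) (unlist t k j x fj)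

 -- Joining the paths of a cycle by connectors.

 module Shift {m : ℕ} (x₀ : Fin m) where

   0<m : 0 < m
   0<m = ≤-trans (s≤s z≤n) (FP.toℕ<n x₀)

   least : Fin m
   least = fromℕ< 0<m

   next : Fin m → Fin m
   next i with suc (toℕ i) <? m
   ... | yes p = fromℕ< p
   ... | no  _ = least

   next-toℕ : ∀ i → suc (toℕ i) < m → toℕ (next i) ≡ suc (toℕ i)
   next-toℕ i p with suc (toℕ i) <? m
   ... | yes q = FP.toℕ-fromℕ< q
   ... | no ¬q = ⊥-elim (¬q p)

   next-injective : ∀ i j → next i ≡ next j → i ≡ j
   next-injective i j eq with suc (toℕ i) <? m | suc (toℕ j) <? m
   ... | yes p | yes q = FP.toℕ-injective (suc-injective (trans (sym (FP.toℕ-fromℕ< p)) (trans (cong toℕ eq) (FP.toℕ-fromℕ< q))))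
   ... | yes p | no _ with trans (sym (FP.toℕ-fromℕ< p)) (trans (cong toℕ eq) (FP.toℕ-fromℕ< 0<m))
   ...   | ()
   next-injective i j eq | no _ | yes q with trans (sym (FP.toℕ-fromℕ< q)) (trans (cong toℕ (sym eq)) (FP.toℕ-fromℕ< 0<m))
   ...   | ()
   next-injective i j eq | no ¬p | no ¬q = FP.toℕ-injective (suc-injective (trans (≤-antisym (FP.toℕ<n i) (≮⇒≥ ¬p)) (sym (≤-antisym (FP.toℕ<n j) (≮⇒≥ ¬q)))))

   abstract
     shift : ∃ λ (φ : Bij m) → ∀ x → to φ x ≡ next x
     shift = injective⇒Bij next next-injective

   next-induction : (P : Fin m → Set) → P least → (∀ i → P i → P (next i)) → ∀ i → P i
   next-induction P base step i = go (toℕ i) i refl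
     where
     go : ∀ k i → toℕ i ≡ k → P i
     go zero i eq = subst P (FP.toℕ-injective (trans (FP.toℕ-fromℕ< 0<m) (sym eq))) base
     go (suc k) i eq = subst P (FP.toℕ-injective (trans (next-toℕ i′ (subst (λ z → suc z < m) (sym (FP.toℕ-fromℕ< k<m)) (subst (_< m) eq (FP.toℕ<n i))))
         (trans (cong suc (FP.toℕ-fromℕ< k<m)) (sym eq)))) (step i′ (go k i′ (FP.toℕ-fromℕ< k<m)))
       where
       k<m : k < m
       k<m = <-trans (n<1+n k) (subst (_< m) eq (FP.toℕ<n i))
       i′ = fromℕ< k<m

 module Connect (setup : Setup) where
   open Gadgets setup public
   open Shift x₀

   up : Fin K → J → ℕ → Bij m
   up t j zero    = idBij
   up t j (suc k) = nx t k j ∘Bij up t j k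

   abstract
     startOf : Fin K → J → Fin m → Fin m
     startOf t j x = from (up t j e) x

     endOf : Fin K → J → Fin m → Fin m
     endOf t j s = to (up t j e) s

     endOf-def : ∀ t j s → endOf t j s ≡ to (up t j e) s
     endOf-def t j s = refl

     start-end : ∀ t j s → startOf t j (endOf t j s) ≡ s
     start-end t j s = from-to (up t j e) s

     end-start : ∀ t j x → endOf t j (startOf t j x) ≡ x
     end-start t j x = to-from (up t j e) x

   private
     Item₃ : Set
     Item₃ = Fin K × (J × Fin m)

     _≟₃_ : DecidableEquality Item₃
     _≟₃_ = ×P.≡-dec FP._≟_ (×P.≡-dec FP._≟_ FP._≟_)

     all₃ : List Item₃
     all₃ = cartesianProduct (allFin K) (cartesianProduct allJ (allFin m))

     ∈all₃ : ∀ i → i ∈ all₃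
     ∈all₃ (t , j , x) = ∈-cartesianProduct⁺ (∈-allFin t) (∈-cartesianProduct⁺ (∈allJ j) (∈-allFin x))

     -- The connector behind the path that ends in x leads to the cyclic successor of the start of
     -- that same path. This closes all paths into a single cycle, whatever permutation the
     -- matchings compose to.
     good₃ : Item₃ → Fin ω → Fin m → Bool
     good₃ (t , j , x) i w = (adj (inj₁ (cls t e , x)) (inj₁ (cls t (suc e + toℕ i) , w)) ∧
       adj (inj₁ (cls t (suc e + toℕ i) , w)) (inj₁ (cls t 0 , next (startOf t j x))))
       ∧ (eqF (α w) (a₁ (β x)) ∧ eqF (β w) (b₂ (α (next (startOf t j x)))))

     Good₃ : Item₃ → Fin (ω * m) → Bool
     Good₃ i v = good₃ i (proj₁ (remQuot {ω} m v)) (proj₂ (remQuot {ω} m v))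

     ends≢ : ∀ t → cls t e ≢ cls t 0
     ends≢ t eq = <-irrefl (trans (sym (pos-cls t 0 (<-trans 0<e e<K))) (trans (cong (pos t) (sym eq)) (pos-cls t e e<K))) 0<e

     many₃ : ∀ i → ω * c₄ ≤ cnt (ω * m) (Good₃ i)
     many₃ i@(t , j , x) = begin
       ω * c₄ ≡⟨ ∑-const ω c₄ ⟨
       ∑ ω (λ _ → c₄) ≤⟨ ∑-mono ω (λ i′ → connect (cls t e) x (cls t 0) _ (cls t (suc e + toℕ i′)) _ _ (ends≢ t)) ⟩
       ∑ ω (λ i′ → cnt m (good₃ i i′)) ≡⟨ ∑-cong ω (λ i′ → ∑-cong m (λ w → cong (λ p → 𝟙 (good₃ i (proj₁ p) (proj₂ p))) (FP.remQuot-combine i′ w))) ⟨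
       ∑ ω (λ i′ → ∑ m (λ w → 𝟙 (Good₃ i (combine i′ w)))) ≡⟨ ∑-combine ω m (𝟙 ∘ Good₃ i) ⟨
       cnt (ω * m) (Good₃ i) ∎
       where open ≤-Reasoning

     -- Connectors of one cycle must differ, and two cycles of a type must share neither the edge
     -- into a connector (same end) nor the edge out of it (same start). This excludes at most m + r
     -- + r other choices.
     Clash₃ : Item₃ → Item₃ → Set
     Clash₃ (t , j , x) (t′ , j′ , x′) = t ≡ t′ × (j ≡ j′ ⊎ x ≡ x′ ⊎ startOf t j x ≡ startOf t′ j′ x′)

     Conf₃ : Item₃ → Item₃ → Fin (ω * m) → Fin (ω * m) → Set
     Conf₃ i i′ v v′ = v ≡ v′ × Clash₃ i i′

     Conf₃-sym : ∀ {i i′ v v′} → Conf₃ i i′ v v′ → Conf₃ i′ i v′ v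
     Conf₃-sym (eq , t≡ , inj₁ p) = sym eq , sym t≡ , inj₁ (sym p)
     Conf₃-sym (eq , t≡ , inj₂ (inj₁ p)) = sym eq , sym t≡ , inj₂ (inj₁ (sym p))
     Conf₃-sym (eq , t≡ , inj₂ (inj₂ p)) = sym eq , sym t≡ , inj₂ (inj₂ (sym p))

     forbidden₃ : Item₃ → List Item₃
     forbidden₃ (t , j , x) = map (λ x′ → t , j , x′) (allFin m) ++ (map (λ j′ → t , j′ , x) allJ ++ map (λ j′ → t , j′ , endOf t j′ (startOf t j x)) allJ)

     forbidden₃≤ : ∀ i → length (forbidden₃ i) ≡ m + (r + r)
     forbidden₃≤ (t , j , x) = trans (length-++ (map (λ x′ → t , j , x′) (allFin m))) (cong₂ _+_ (trans (length-map _ (allFin m)) (length-allFin m))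
       (trans (length-++ (map (λ j′ → t , j′ , x) allJ)) (cong₂ _+_ (trans (length-map _ allJ) length-allJ) (trans (length-map _ allJ) length-allJ))))

     clash₃⇒∈ : ∀ i i′ → Clash₃ i i′ → i′ ∈ forbidden₃ i
     clash₃⇒∈ (t , j , x) (t , j′ , x′) (refl , inj₁ refl) = ∈-++⁺ˡ (∈-map⁺ (λ x′ → t , j , x′) (∈-allFin x′))
     clash₃⇒∈ (t , j , x) (t , j′ , x′) (refl , inj₂ (inj₁ refl)) = ∈-++⁺ʳ (map (λ x′ → t , j , x′) (allFin m)) (∈-++⁺ˡ (∈-map⁺ (λ j′ → t , j′ , x) (∈allJ j′)))
     clash₃⇒∈ (t , j , x) (t , j′ , x′) (refl , inj₂ (inj₂ eq)) = ∈-++⁺ʳ (map (λ x′ → t , j , x′) (allFin m)) (∈-++⁺ʳ (map (λ j′ → t , j′ , x) allJ)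
       (subst (λ z → (t , j′ , z) ∈ map (λ j′ → t , j′ , endOf t j′ (startOf t j x)) allJ) (trans (cong (endOf t j′) eq) (end-start t j′ x′)) (∈-map⁺ (λ j′ → t , j′ , endOf t j′ (startOf t j x)) (∈allJ j′))))

     step₃ : ∀ i (f : Item₃ → Fin (ω * m)) → ∃ λ v → Good₃ i v ≡ true × (∀ i′ → i′ ≢ i → ¬ Conf₃ i i′ v (f i′))
     step₃ i f with avoid (Good₃ i) (map f (forbidden₃ i)) (<-≤-trans (≤-<-trans (≤-reflexive (trans (length-map f (forbidden₃ i)) (forbidden₃≤ i))) connect-room) (many₃ i))
     ... | v , good , v∉ = v , good , λ { i′ ne (eq , cl) → v∉ (subst (_∈ map f (forbidden₃ i)) (sym eq) (∈-map⁺ f (clash₃⇒∈ i i′ cl))) }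

     abstract
       choice₃ : ∃ λ (f : Item₃ → Fin (ω * m)) → (∀ i → Good₃ i (f i) ≡ true) × (∀ i i′ → i′ ≢ i → f i ≡ f i′ → ¬ Clash₃ i i′)
       choice₃ with greedy _≟₃_ (λ i v → Good₃ i v ≡ true) Conf₃ (λ {i} {i′} → Conf₃-sym {i} {i′}) step₃
         -- Any initial assignment will do; this one exists because the candidate sets are nonempty.
         (λ i → proj₁ (step₃ i (λ i′ → proj₁ (avoid (Good₃ i′) [] (≤-<-trans z≤n (<-≤-trans connect-room (many₃ i′))))))) all₃
       ... | f , ok , nc = f , (λ i → ok i (∈all₃ i)) , λ i i′ ne eq cl → nc i i′ (∈all₃ i) (∈all₃ i′) ne (eq , cl)

     cn : Fin K → J → Fin m → Fin ω × Fin m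
     cn t j x = remQuot {ω} m (proj₁ choice₃ (t , j , x))

     cn-good : ∀ t j x → good₃ (t , j , x) (proj₁ (cn t j x)) (proj₂ (cn t j x)) ≡ true
     cn-good t j x = proj₁ (proj₂ choice₃) (t , j , x)

     remQuot-injective : ∀ (u v : Fin (ω * m)) → remQuot {ω} m u ≡ remQuot {ω} m v → u ≡ v
     remQuot-injective u v eq = trans (sym (FP.combine-remQuot {ω} m u)) (trans (cong (λ p → combine (proj₁ p) (proj₂ p)) eq) (FP.combine-remQuot {ω} m v))

     cn-clash : ∀ i i′ → cn (proj₁ i) (proj₁ (proj₂ i)) (proj₂ (proj₂ i)) ≡ cn (proj₁ i′) (proj₁ (proj₂ i′)) (proj₂ (proj₂ i′)) → Clash₃ i i′ → i ≡ i′
     cn-clash i i′ eq cl with i′ ≟₃ i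
     ... | yes p = sym p
     ... | no ne = ⊥-elim (proj₂ (proj₂ choice₃) i i′ ne (remQuot-injective _ _ eq) cl)

   conn-class : Fin K → J → Fin m → Fin K
   conn-class t j x = cls t (suc e + toℕ (proj₁ (cn t j x)))

   conn-idx : Fin K → J → Fin m → Fin m
   conn-idx t j x = proj₂ (cn t j x)

   conn : Fin K → J → Fin m → V
   conn t j x = inj₁ (conn-class t j x , conn-idx t j x)

   start : Fin K → J → Fin m → V
   start t j x = inj₁ (cls t 0 , next (startOf t j x))

   conn-edges : ∀ t j x → adj (inj₁ (cls t e , x)) (conn t j x) ≡ true × adj (conn t j x) (start t j x) ≡ true
   conn-edges t j x = ∧-true {adj (inj₁ (cls t e , x)) (conn t j x)} (proj₁ (∧-true (cn-good t j x)))

   conn-α : ∀ t j x → α (conn-idx t j x) ≡ a₁ (β x)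
   conn-α t j x = eqF-≡ (proj₁ (∧-true {eqF (α (conn-idx t j x)) (a₁ (β x))} (proj₂ (∧-true {adj (inj₁ (cls t e , x)) (conn t j x) ∧ adj (conn t j x) (start t j x)} (cn-good t j x)))))

   conn-β : ∀ t j x → β (conn-idx t j x) ≡ b₂ (α (next (startOf t j x)))
   conn-β t j x = eqF-≡ (proj₂ (∧-true {eqF (α (conn-idx t j x)) (a₁ (β x))} (proj₂ (∧-true {adj (inj₁ (cls t e , x)) (conn t j x) ∧ adj (conn t j x) (start t j x)} (cn-good t j x)))))

   conn-position : ∀ t j x → pos t (conn-class t j x) ≡ suc e + toℕ (proj₁ (cn t j x))
   conn-position t j x = pos-cls t _ (subst (suc e + toℕ (proj₁ (cn t j x)) <_) (sym K≡) (+-monoʳ-< (suc e) (FP.toℕ<n (proj₁ (cn t j x)))))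

   conn-pos : ∀ t j x → e < pos t (conn-class t j x)
   conn-pos t j x = subst (e <_) (sym (conn-position t j x)) (m≤m+n (suc e) _)

   private
     conn⇒cn : ∀ t j x j′ x′ → conn t j x ≡ conn t j′ x′ → cn t j x ≡ cn t j′ x′
     conn⇒cn t j x j′ x′ eq with ⊎P.inj₁-injective eq
     ... | eq′ = ×P.×-≡,≡→≡ (FP.toℕ-injective (+-cancelˡ-≡ (suc e) _ _ (trans (sym (conn-position t j x)) (trans (cong (pos t) (,-injectiveˡ eq′)) (conn-position t j′ x′)))) , ×P.,-injectiveʳ eq′)

   conn-injective : ∀ t j x x′ → conn t j x ≡ conn t j x′ → x ≡ x′
   conn-injective t j x x′ eq = cong (proj₂ ∘ proj₂) (cn-clash (t , j , x) (t , j , x′) (conn⇒cn t j x j x′ eq) (refl , inj₁ refl))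

   conn-end : ∀ t j j′ x → conn t j x ≡ conn t j′ x → j ≡ j′
   conn-end t j j′ x eq = cong (proj₁ ∘ proj₂) (cn-clash (t , j , x) (t , j′ , x) (conn⇒cn t j x j′ x eq) (refl , inj₂ (inj₁ refl)))

   conn-start : ∀ t j j′ x x′ → conn t j x ≡ conn t j′ x′ → start t j x ≡ start t j′ x′ → j ≡ j′
   conn-start t j j′ x x′ eq seq = cong (proj₁ ∘ proj₂) (cn-clash (t , j , x) (t , j′ , x′) (conn⇒cn t j x j′ x′ eq)
     (refl , inj₂ (inj₂ (next-injective _ _ (×P.,-injectiveʳ (⊎P.inj₁-injective seq))))))

 -- The successor functions of the cycles, their disjointness and their single orbits.

 data Kind : Set where
   host-kind end-kind start-kind in-kind out-kind left-in-kind left-out-kind : Kind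

 -- `main` and `free` share a kind because a shortcut may carry either tag; matching edges and
 -- shortcuts are then told apart by `thru-unique`.
 tagKind : Tag → Kind
 tagKind main = host-kind
 tagKind free = host-kind
 tagKind c₁   = end-kind
 tagKind c₂   = start-kind
 tagKind gA   = in-kind
 tagKind gB   = out-kind

 isHost-kind : ∀ {g} → isHost g ≡ true → tagKind g ≡ host-kind
 isHost-kind {main} _ = refl
 isHost-kind {free} _ = refl

 isMain-kind : ∀ {g} → isMain g ≡ true → tagKind g ≡ host-kind
 isMain-kind {main} _ = refl

 module Cycles (setup : Setup) where
   open Connect setup public
   open Shift x₀

   kind : V → V → Kind
   kind (inj₂ _)       _              = left-out-kind
   kind (inj₁ _)       (inj₂ _)       = left-in-kind
   kind (inj₁ (_ , x)) (inj₁ (_ , y)) = tagKind (tag (β x) (α y))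

   Used : Fin K → J → V → Set
   Used t j g = ∃ λ x → conn t j x ≡ g

   used? : ∀ t j g → Dec (Used t j g)
   used? t j g = FP.any? (λ x → conn t j x ≟V g)

   Used-W : ∀ t j g → Used t j g → isW g
   Used-W t j g (x , refl) = tt

   Occupied : Fin K → ℕ → J → Fin m → V → Set
   Occupied t k j x g = Here t k j g × fu (t , j , g) ≡ x

   search : ∀ {P : V → Set} → (∀ g → Dec (P g)) → Dec (∃ P)
   search P? with Any.any? P? allV
   ... | yes p = yes (Any.lookup p , AnyP.lookup-result p)
     where import Data.List.Relation.Unary.Any.Properties as AnyP
   ... | no ¬p = no λ { (g , pg) → ¬p (Any.map (λ { refl → pg }) (∈allV g)) }

   occupied? : ∀ t k j x → Dec (∃ (Occupied t k j x))
   occupied? t k j x = search (λ g → here? t k j g ×-dec (fu (t , j , g) FP.≟ x))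

   -- One constructor per role, with the role as an index, so that edges of different roles never
   -- have to be compared. `thru` asks that every gadget waiting at x be in use as a connector;
   -- otherwise the cycle passes through the gadget instead.
   data Edge (t : Fin K) (j : J) : Kind → V → V → Set where
     thru : ∀ k x → k < e → (∀ g → Occupied t k j x g → Used t j g) →
       Edge t j host-kind (inj₁ (cls t k , x)) (inj₁ (cls t (suc k) , to (nx t k j) x))
     end-conn : ∀ x → Edge t j end-kind (inj₁ (cls t e , x)) (conn t j x)
     conn-start-edge : ∀ x → Edge t j start-kind (conn t j x) (start t j x)
     in-W : ∀ w → Gadget t (inj₁ w) → Edge t j in-kind (inj₁ (cls t (host t j (inj₁ w)) , fu (t , j , inj₁ w))) (inj₁ w)
     out-W : ∀ w → Gadget t (inj₁ w) → Edge t j out-kind (inj₁ w) (inj₁ (cls t (suc (host t j (inj₁ w))) , fv (t , j , inj₁ w)))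
     in-L : ∀ l → Edge t j left-in-kind (inj₁ (cls t (host t j (inj₂ l)) , fu (t , j , inj₂ l))) (inj₂ l)
     out-L : ∀ l → Edge t j left-out-kind (inj₂ l) (inj₁ (cls t (suc (host t j (inj₂ l))) , fv (t , j , inj₂ l)))

   nx-occupied : ∀ t k j x g → Occupied t k j x g → to (nx t k j) x ≡ fv (t , j , g)
   nx-occupied t k j x g ((gd , refl) , refl) = nx-forced t j g gd

   nx-free : ∀ t k j x → ¬ ∃ (Occupied t k j x) → FreeAt t k j x
   nx-free t k j x none g hr eq = none (g , hr , eq)

   -- The labels were prescribed when the ends were chosen, so the two ends of an edge reveal its
   -- role. An edge shared by two cycles would therefore play the same role in both.
   edge-kind : ∀ {t j κ v b} → Edge t j κ v b → kind v b ≡ κ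
   edge-kind {t} {j} (thru k x k<e all-used) with occupied? t k j x
   ... | no none = isMain-kind (proj₂ (∧-true {adj (inj₁ (cls t k , x)) (inj₁ (cls t (suc k) , to (nx t k j) x))} (nx-edge t k j x (nx-free t k j x none))))
   ... | yes (inj₂ l , occ) = ⊥-elim (Used-W t j (inj₂ l) (all-used (inj₂ l) occ))
   ... | yes (inj₁ (i , w) , occ@((gd , hs) , fu≡)) = isHost-kind (trans (cong₂ (λ b a → isHost (tag b a))
           (trans (cong β (sym fu≡)) (fu-β t j i w gd)) (trans (cong α (nx-occupied t k j x (inj₁ (i , w)) occ)) (fv-α t j i w gd))) (tag-host (α w) (β w)))
   edge-kind {t} {j} (end-conn x) = cong tagKind (trans (cong (tag (β x)) (conn-α t j x)) (tag-a₁ (β x)))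
   edge-kind {t} {j} (conn-start-edge x) = cong tagKind (trans (cong (λ b → tag b (α (next (startOf t j x)))) (conn-β t j x)) (tag-b₂ _))
   edge-kind {t} {j} (in-W (i , x) gd) = cong tagKind (trans (cong (λ b → tag b (α x)) (fu-β t j i x gd)) (tag-gA (α x) (β x)))
   edge-kind {t} {j} (out-W (i , x) gd) = cong tagKind (trans (cong (tag (β x)) (fv-α t j i x gd)) (tag-gB (α x) (β x)))
   edge-kind (in-L l) = refl
   edge-kind (out-L l) = refl

   edge-adj : ∀ {t j κ v b} → Edge t j κ v b → adj v b ≡ true
   edge-adj {t} {j} (thru k x k<e all-used) with occupied? t k j x
   ... | no none = proj₁ (∧-true (nx-edge t k j x (nx-free t k j x none)))
   ... | yes (inj₂ l , occ) = ⊥-elim (Used-W t j (inj₂ l) (all-used (inj₂ l) occ))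
   ... | yes (inj₁ w , occ@((gd , refl) , refl)) = trans (cong (λ y → adj (inj₁ (cls t (host t j (inj₁ w)) , fu (t , j , inj₁ w))) (inj₁ (cls t (suc (host t j (inj₁ w))) , y)))
           (nx-forced t j (inj₁ w) gd)) (shortcut-edge t j (inj₁ w) gd tt)
   edge-adj {t} {j} (end-conn x) = proj₁ (conn-edges t j x)
   edge-adj {t} {j} (conn-start-edge x) = proj₂ (conn-edges t j x)
   edge-adj {t} {j} (in-W w gd) = fu-edge t j (inj₁ w) gd
   edge-adj {t} {j} (out-W w gd) = fv-edge t j (inj₁ w) gd
   edge-adj {t} {j} (in-L l) = fu-edge t j (inj₂ l) tt
   edge-adj {t} {j} (out-L l) = fv-edge t j (inj₂ l) tt

   private
     cls₀-injective : ∀ k t t′ → cls t k ≡ cls t′ k → t ≡ t′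
     cls₀-injective k t t′ eq = trans (sym (typ-cls t k)) (trans (cong (typ k) eq) (typ-cls t′ k))

     v₁ : ∀ {i i′ : Fin K} {x x′ : Fin m} → _≡_ {A = V} (inj₁ (i , x)) (inj₁ (i′ , x′)) → i ≡ i′ × x ≡ x′
     v₁ refl = refl , refl

     -- Free against free is the disjointness of the matchings, free against forced is excluded by
     -- `nx-avoids`, and forced against forced by the constraint `XC` on heads, which applies
     -- because a gadget in use as a connector comes from a class.
     thru-unique : ∀ t k j j′ x → (∀ g → Occupied t k j x g → Used t j g) → (∀ g → Occupied t k j′ x g → Used t j′ g) →
       to (nx t k j) x ≡ to (nx t k j′) x → j ≡ j′
     thru-unique t k j j′ x au au′ eq with occupied? t k j x | occupied? t k j′ x
     ... | no n | no n′ = nx-disjoint t k j j′ x (nx-free t k j x n) (nx-free t k j′ x n′) eq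
     ... | no n | yes (g , occ@(hr , fu≡)) = ⊥-elim (nx-avoids t k j x (nx-free t k j x n) j′ g hr fu≡ (trans eq (nx-occupied t k j′ x g occ)))
     ... | yes (g , occ@(hr , fu≡)) | no n = ⊥-elim (nx-avoids t k j′ x (nx-free t k j′ x n) j g hr fu≡ (trans (sym eq) (nx-occupied t k j x g occ)))
     ... | yes (g , occ@((gd , hs) , fu≡)) | yes (g′ , occ′@((gd′ , hs′) , fu≡′)) =
           fu-fv-pair t j j′ g g′ gd gd′ (Used-W t j g (au g occ)) (Used-W t j′ g′ (au′ g′ occ′)) (trans hs (sym hs′)) (trans fu≡ (sym fu≡′))
             (trans (sym (nx-occupied t k j x g occ)) (trans eq (nx-occupied t k j′ x g′ occ′)))

     -- Each role has its own reason: the order of the classes and the matchings for chain edges,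
     -- `Clash₃` for edges at a connector, `SameTarget` for edges at a gadget.
     same-kind : ∀ {t j t′ j′ κ v b v′ b′} → Edge t j κ v b → Edge t′ j′ κ v′ b′ → v ≡ v′ → b ≡ b′ → (t , j) ≡ (t′ , j′)
     same-kind {t} {j} {t′} {j′} (thru k x k<e au) (thru k′ x′ k<e′ au′) veq beq with v₁ veq | v₁ beq
     ... | c≡ , refl | c≡′ , y≡ with step-unique t t′ k k′ (<-trans k<e e<K) (<-trans k<e′ e<K) c≡ c≡′
     ...   | refl with cls₀-injective k t t′ c≡
     ...     | refl = cong (t ,_) (thru-unique t k j j′ x au au′ y≡)
     same-kind {t} {j} {t′} {j′} (end-conn x) (end-conn x′) veq beq with v₁ veq
     ... | c≡ , refl with cls₀-injective e t t′ c≡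
     ...   | refl = cong (t ,_) (conn-end t j j′ x beq)
     same-kind {t} {j} {t′} {j′} (conn-start-edge x) (conn-start-edge x′) veq beq with v₁ beq
     ... | c≡ , y≡ with cls₀-injective 0 t t′ c≡
     ...   | refl = cong (t ,_) (conn-start t j j′ x x′ veq beq)
     same-kind {t} {j} {t′} {j′} (in-W w gd) (in-W .w gd′) veq refl with v₁ veq
     ... | c≡ , x≡ = fu-target t j t′ j′ (inj₁ w) gd gd′ c≡ x≡
     same-kind {t} {j} {t′} {j′} (out-W w gd) (out-W .w gd′) refl beq with v₁ beq
     ... | c≡ , x≡ = fv-target t j t′ j′ (inj₁ w) gd gd′ c≡ x≡
     same-kind {t} {j} {t′} {j′} (in-L l) (in-L .l) veq refl with v₁ veq
     ... | c≡ , x≡ = fu-target t j t′ j′ (inj₂ l) tt tt c≡ x≡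
     same-kind {t} {j} {t′} {j′} (out-L l) (out-L .l) refl beq with v₁ beq
     ... | c≡ , x≡ = fv-target t j t′ j′ (inj₂ l) tt tt c≡ x≡

   edge-unique : ∀ {t j t′ j′ κ κ′ v b} → Edge t j κ v b → Edge t′ j′ κ′ v b → (t , j) ≡ (t′ , j′)
   edge-unique E E′ with trans (sym (edge-kind E)) (edge-kind E′)
   ... | refl = same-kind E E′ refl refl

   module Successor (t : Fin K) (j : J) where

     Active : V → Set
     Active g = Gadget t g × ¬ Used t j g

     ins? : ∀ k x → Dec (∃ λ g → Occupied t k j x g × ¬ Used t j g)
     ins? k x = search (λ g → (here? t k j g ×-dec (fu (t , j , g) FP.≟ x)) ×-dec ¬? (used? t j g))

     exit : V → V
     exit g = inj₁ (cls t (suc (host t j g)) , fv (t , j , g))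

     chain-succ : ∀ k x → Dec (∃ λ g → Occupied t k j x g × ¬ Used t j g) → V
     chain-succ k x (yes (g , _)) = g
     chain-succ k x (no _)        = inj₁ (cls t (suc k) , to (nx t k j) x)

     W-succ : ∀ g → Dec (Used t j g) → V
     W-succ g (yes (x , _)) = start t j x
     W-succ g (no _)        = exit g

     class-succ : ∀ i x → Tri (pos t i < e) (pos t i ≡ e) (e < pos t i) → V
     class-succ i x (tri< _ _ _) = chain-succ (pos t i) x (ins? (pos t i) x)
     class-succ i x (tri≈ _ _ _) = conn t j x
     class-succ i x (tri> _ _ _) = W-succ (inj₁ (i , x)) (used? t j (inj₁ (i , x)))

     succ : V → V
     succ (inj₁ (i , x)) = class-succ i x (<-cmp (pos t i) e)
     succ (inj₂ l)       = exit (inj₂ l)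

     private
       enter-edge : ∀ g → Gadget t g → ∃ λ κ → Edge t j κ (inj₁ (cls t (host t j g) , fu (t , j , g))) g
       enter-edge (inj₁ w) gd = _ , in-W w gd
       enter-edge (inj₂ l) gd = _ , in-L l

       exit-edge : ∀ g → Gadget t g → ∃ λ κ → Edge t j κ g (exit g)
       exit-edge (inj₁ w) gd = _ , out-W w gd
       exit-edge (inj₂ l) gd = _ , out-L l

       chain-edge : ∀ k x → k < e → ∀ d → ∃ λ κ → Edge t j κ (inj₁ (cls t k , x)) (chain-succ k x d)
       chain-edge k x k<e (yes (g , ((gd , refl) , refl) , _)) = enter-edge g gd
       chain-edge k x k<e (no none) = _ , thru k x k<e all-used
         where
         all-used : ∀ g → Occupied t k j x g → Used t j g
         all-used g occ with used? t j g
         ... | yes u = u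
         ... | no ¬u = ⊥-elim (none (g , occ , ¬u))

       class-edge : ∀ i x d → ∃ λ κ → Edge t j κ (inj₁ (i , x)) (class-succ i x d)
       class-edge i x (tri< lt _ _) = subst (λ c → ∃ λ κ → Edge t j κ (inj₁ (c , x)) (chain-succ (pos t i) x (ins? (pos t i) x))) (cls-pos t i) (chain-edge (pos t i) x lt (ins? (pos t i) x))
       class-edge i x (tri≈ _ eq _) = _ , subst (λ c → Edge t j end-kind (inj₁ (c , x)) (conn t j x)) (trans (cong (cls t) (sym eq)) (cls-pos t i)) (end-conn x)
       class-edge i x (tri> _ _ gt) with used? t j (inj₁ (i , x))
       ... | yes (z , eq) = _ , subst (λ v → Edge t j start-kind v (start t j z)) eq (conn-start-edge z)
       ... | no _ = exit-edge (inj₁ (i , x)) gt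

     succ-edge : ∀ v → ∃ λ κ → Edge t j κ v (succ v)
     succ-edge (inj₁ (i , x)) = class-edge i x (<-cmp (pos t i) e)
     succ-edge (inj₂ l) = _ , out-L l

     succ-exit : ∀ g → Active g → succ g ≡ exit g
     succ-exit (inj₂ l) _ = refl
     succ-exit (inj₁ (i , x)) (gd , ¬u) with <-cmp (pos t i) e
     ... | tri< lt _ _ = ⊥-elim (<-asym lt gd)
     ... | tri≈ _ eq _ = ⊥-elim (<-irrefl (sym eq) gd)
     ... | tri> _ _ _ with used? t j (inj₁ (i , x))
     ...   | yes u = ⊥-elim (¬u u)
     ...   | no _ = refl

     succ-conn : ∀ x → succ (conn t j x) ≡ start t j x
     succ-conn x with <-cmp (pos t (conn-class t j x)) e
     ... | tri< lt _ _ = ⊥-elim (<-asym lt (conn-pos t j x))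
     ... | tri≈ _ eq _ = ⊥-elim (<-irrefl (sym eq) (conn-pos t j x))
     ... | tri> _ _ _ with used? t j (conn t j x)
     ...   | yes (z , eq) = cong (start t j) (conn-injective t j z x eq)
     ...   | no ¬u = ⊥-elim (¬u (x , refl))

     succ-end : ∀ x → succ (inj₁ (cls t e , x)) ≡ conn t j x
     succ-end x with <-cmp (pos t (cls t e)) e
     ... | tri< _ ne _ = ⊥-elim (ne (pos-cls t e e<K))
     ... | tri≈ _ _ _ = refl
     ... | tri> _ ne _ = ⊥-elim (ne (pos-cls t e e<K))

     chain-succ-cong : ∀ i x → pos t i < e → succ (inj₁ (i , x)) ≡ chain-succ (pos t i) x (ins? (pos t i) x)
     chain-succ-cong i x lt with <-cmp (pos t i) e
     ... | tri< _ _ _ = refl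
     ... | tri≈ ¬lt _ _ = ⊥-elim (¬lt lt)
     ... | tri> ¬lt _ _ = ⊥-elim (¬lt lt)

     succ-chain : ∀ k x → k < e → succ (inj₁ (cls t k , x)) ≡ chain-succ k x (ins? k x)
     succ-chain k x k<e = trans (chain-succ-cong (cls t k) x (subst (_< e) (sym p≡) k<e)) (cong (λ k → chain-succ k x (ins? k x)) p≡)
       where
       p≡ : pos t (cls t k) ≡ k
       p≡ = pos-cls t k (<-trans k<e e<K)

     iter : ℕ → V
     iter zero    = inj₁ (cls t 0 , least)
     iter (suc k) = succ (iter k)

     Reach : V → Set
     Reach v = ∃ λ k → iter k ≡ v

     reach-succ : ∀ {v w} → Reach v → succ v ≡ w → Reach w
     reach-succ (k , refl) refl = suc k , refl

     -- The detour through a gadget also ends at the image of x, as the matching is forced to send u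
     -- to v. Insertions therefore do not disturb the order in which the paths are traversed.
     reach-next : ∀ k x → k < e → Reach (inj₁ (cls t k , x)) → Reach (inj₁ (cls t (suc k) , to (nx t k j) x))
     reach-next k x k<e R with ins? k x | succ-chain k x k<e
     ... | no _ | eq = reach-succ R eq
     ... | yes (g , occ@((gd , refl) , fu≡) , ¬u) | eq = reach-succ (reach-succ R eq)
           (trans (succ-exit g (gd , ¬u)) (cong (λ y → inj₁ (cls t (suc (host t j g)) , y)) (sym (nx-occupied t k j x g occ))))

     reach-chain : ∀ k s → k ≤ e → Reach (inj₁ (cls t 0 , s)) → Reach (inj₁ (cls t k , to (up t j k) s))
     reach-chain zero s _ R = R
     reach-chain (suc k) s k<e R = reach-next k _ k<e (reach-chain k s (<⇒≤ k<e) R)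

     reach-end : ∀ s → Reach (inj₁ (cls t 0 , s)) → Reach (conn t j (endOf t j s))
     reach-end s R = reach-succ (reach-chain e s ≤-refl R) (trans (succ-end _) (cong (conn t j) (sym (endOf-def t j s))))

     -- One round through the chain and a connector advances the start by one place, so induction
     -- along the cyclic order reaches every start.
     reach-start : ∀ s → Reach (inj₁ (cls t 0 , s))
     reach-start = next-induction (λ s → Reach (inj₁ (cls t 0 , s))) (0 , refl)
       (λ s R → reach-succ (reach-end s R) (trans (succ-conn _) (cong (λ z → inj₁ (cls t 0 , next z)) (start-end t j s))))

     reach-position : ∀ k x → k ≤ e → Reach (inj₁ (cls t k , x))
     reach-position k x k≤e = subst (λ z → Reach (inj₁ (cls t k , z))) (to-from (up t j k) x) (reach-chain k (from (up t j k) x) k≤e (reach-start _))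

     -- No other gadget of the cycle shares both host position and tail with g, so the gadget that
     -- follows its tail is g itself.
     reach-active : ∀ g → Active g → Reach g
     reach-active g (gd , ¬u) with ins? (host t j g) (fu (t , j , g)) | succ-chain (host t j g) (fu (t , j , g)) (host<e t j g)
     ... | no none | _ = ⊥-elim (none (g , ((gd , refl) , refl) , ¬u))
     ... | yes (g′ , ((gd′ , hs) , fu≡) , _) | eq = reach-succ (reach-position (host t j g) (fu (t , j , g)) (<⇒≤ (host<e t j g)))
           (trans eq (fu-host t j g′ g gd′ gd hs fu≡))

     reach : ∀ v → Reach v
     reach (inj₂ l) = reach-active (inj₂ l) (tt , Used-W t j (inj₂ l))
     reach (inj₁ (i , x)) with <-cmp (pos t i) e
     ... | tri< lt _ _ = subst (λ c → Reach (inj₁ (c , x))) (cls-pos t i) (reach-position (pos t i) x (<⇒≤ lt))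
     ... | tri≈ _ eq _ = subst (λ c → Reach (inj₁ (c , x))) (cls-pos t i) (reach-position (pos t i) x (≤-reflexive eq))
     ... | tri> _ _ gt with used? t j (inj₁ (i , x))
     ...   | yes (z , eq) = subst Reach (trans (cong (conn t j) (end-start t j z)) eq) (reach-end (startOf t j z) (reach-start _))
     ...   | no ¬u = reach-active (inj₁ (i , x)) (gt , ¬u)

     returns : ∃ λ k → iter (suc k) ≡ iter 0
     returns with proj₁ shift | proj₂ shift
     -- The path whose start is the cyclic predecessor of `least` is the one that closes the cycle.
     ... | c | c≡ with reach-end (from c least) (reach-start _)
     ...   | k , eq = k , trans (cong succ eq) (trans (succ-conn _) (cong (λ z → inj₁ (cls t 0 , z))
               (trans (cong next (start-end t j (from c least))) (trans (sym (c≡ _)) (to-from c least)))))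

   record Packing : Set where
     field
       σ        : Fin K × J → V → V
       origin   : Fin K × J → V
       σ-adj    : ∀ i v → adj v (σ i v) ≡ true
       σ-unique : ∀ i i′ v → σ i v ≡ σ i′ v → i ≡ i′
       orbit    : Fin K × J → ℕ → V
       orbit-0  : ∀ i → orbit i 0 ≡ origin i
       orbit-s  : ∀ i k → orbit i (suc k) ≡ σ i (orbit i k)
       covers   : ∀ i v → ∃ λ k → orbit i k ≡ v
       returns  : ∀ i → ∃ λ k → orbit i (suc k) ≡ origin i

   packing : Packing
   packing = record
     { σ = λ { (t , j) → Successor.succ t j }
     ; origin = λ { (t , j) → Successor.iter t j 0 }
     ; σ-adj = λ { (t , j) v → edge-adj (proj₂ (Successor.succ-edge t j v)) }
     ; σ-unique = λ { (t , j) (t′ , j′) v eq → edge-unique (proj₂ (Successor.succ-edge t j v))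
         (subst (Edge t′ j′ _ v) (sym eq) (proj₂ (Successor.succ-edge t′ j′ v))) }
     ; orbit = λ { (t , j) → Successor.iter t j }
     ; orbit-0 = λ _ → refl ; orbit-s = λ _ _ → refl
     ; covers = λ { (t , j) → Successor.reach t j }
     ; returns = λ { (t , j) → Successor.returns t j } }

 -- The triangular class order, hosting positions and labels.

 module Residues (K : ℕ) .{{_ : NonZero K}} where

   mod-cancel : ∀ a b → (a + b + (K ∸ a % K)) % K ≡ b % K
   mod-cancel a b = trans (cong (_% K) (begin
     a + b + (K ∸ a % K) ≡⟨ cong (λ z → z + b + (K ∸ a % K)) (m≡m%n+[m/n]*n a K) ⟩
     a % K + a / K * K + b + (K ∸ a % K) ≡⟨ id₁ (a % K) (a / K * K) b (K ∸ a % K) ⟩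
     b + (a % K + (K ∸ a % K)) + a / K * K ≡⟨ cong (λ z → b + z + a / K * K) (m+[n∸m]≡n (<⇒≤ (m%n<n a K))) ⟩
     b + K + a / K * K ∎)) (trans ([m+kn]%n≡m%n (b + K) (a / K) K) ([m+n]%n≡m%n b K))
     where
     open ≡-Reasoning
     id₁ : ∀ r q b c → r + q + b + c ≡ b + (r + c) + q
     id₁ = solve 4 (λ r q b c → r :+ q :+ b :+ c := b :+ (r :+ c) :+ q) refl

   mod-+-congˡ : ∀ a a′ c → a % K ≡ a′ % K → (a + c) % K ≡ (a′ + c) % K
   mod-+-congˡ a a′ c eq = trans (%-distribˡ-+ a c K) (trans (cong (λ z → (z + c % K) % K) eq) (sym (%-distribˡ-+ a′ c K)))

   mod-cancelˡ : ∀ a a′ b b′ → a % K ≡ a′ % K → (a + b) % K ≡ (a′ + b′) % K → b % K ≡ b′ % K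
   mod-cancelˡ a a′ b b′ eq eq′ = trans (sym (mod-cancel a b)) (trans (cong (λ z → (a + b + (K ∸ z)) % K) eq)
     (trans (mod-+-congˡ (a + b) (a′ + b′) (K ∸ a′ % K) eq′) (mod-cancel a′ b′)))

 triangle : ℕ → ℕ
 triangle zero    = 0
 triangle (suc k) = triangle k + suc k

 triangle-+ : ∀ k d → triangle (k + d) ≡ triangle k + (d * k + triangle d)
 triangle-+ k zero = trans (cong triangle (+-identityʳ k)) (sym (+-identityʳ _))
 triangle-+ k (suc d) = trans (cong triangle (+-suc k d)) (trans (cong (_+ suc (k + d)) (triangle-+ k d)) (id₁ (triangle k) d k (triangle d)))
   where
   id₁ : ∀ x d k y → x + (d * k + y) + suc (k + d) ≡ x + (suc d * k + (y + suc d))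
   id₁ = solve 4 (λ x d k y → x :+ (d :* k :+ y) :+ (con 1 :+ (k :+ d)) := x :+ ((con 1 :+ d) :* k :+ (y :+ (con 1 :+ d)))) refl

 2triangle : ∀ d → 2 * triangle d ≡ d * suc d
 2triangle zero = refl
 2triangle (suc d) = trans (*-distribˡ-+ 2 (triangle d) (suc d)) (trans (cong (_+ 2 * suc d) (2triangle d)) (id₁ d))
   where
   id₁ : ∀ d → d * suc d + 2 * suc d ≡ suc d * suc (suc d)
   id₁ = solve 1 (λ d → d :* (con 1 :+ d) :+ con 2 :* (con 1 :+ d) := (con 1 :+ d) :* (con 1 :+ ((con 1 :+ d)))) refl

 odd-cancel : ∀ n c b → 2 ^ n ∣ suc (2 * c) * b → 2 ^ n ∣ b
 odd-cancel zero c b _ = divides b (sym (*-identityʳ b))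
 odd-cancel (suc n) c b dv with ∣m+n∣m⇒∣n {2} {2 * (c * b)} {b} (subst (2 ∣_) (id₁ c b) (∣-trans (m∣m*n (2 ^ n)) dv)) (m∣m*n (c * b))
   where
   id₁ : ∀ c b → suc (2 * c) * b ≡ 2 * (c * b) + b
   id₁ = solve 2 (λ c b → (con 1 :+ (con 2 :* c)) :* b := con 2 :* (c :* b) :+ b) refl
 ... | divides b′ refl = subst (2 * 2 ^ n ∣_) (*-comm 2 b′) (*-monoʳ-∣ 2 (odd-cancel n c b′ (*-cancelˡ-∣ 2 (subst (2 * 2 ^ n ∣_) (id₂ c b′) dv))))
   where
   id₂ : ∀ c b → suc (2 * c) * (b * 2) ≡ 2 * (suc (2 * c) * b)
   id₂ = solve 2 (λ c b → (con 1 :+ (con 2 :* c)) :* (b :* con 2) := con 2 :* ((con 1 :+ (con 2 :* c)) :* b)) refl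

 even-or-odd : ∀ n → (∃ λ c → n ≡ 2 * c) ⊎ (∃ λ c → n ≡ suc (2 * c))
 even-or-odd zero = inj₁ (0 , refl)
 even-or-odd (suc n) with even-or-odd n
 ... | inj₁ (c , refl) = inj₂ (c , refl)
 ... | inj₂ (c , refl) = inj₁ (suc c , id₁ c)
   where
   id₁ : ∀ c → suc (suc (2 * c)) ≡ 2 * suc c
   id₁ = solve 1 (λ c → (con 1 :+ ((con 1 :+ (con 2 :* c)))) := con 2 :* (con 1 :+ c)) refl

 mod-≡⇒∣ : ∀ K .{{_ : NonZero K}} a b → (a + b) % K ≡ a % K → K ∣ b
 mod-≡⇒∣ K a b eq = divides (b / K) (trans (m≡m%n+[m/n]*n b K) (cong (_+ b / K * K)
   (trans (sym (mod-cancel a b)) (trans (mod-+-congˡ (a + b) (a + 0) (K ∸ a % K) (trans eq (cong (_% K) (sym (+-identityʳ a)))))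
     (trans (mod-cancel a 0) (m<n⇒m%n≡m (m<n K)))))))
   where
   open Residues K
   m<n : ∀ K .{{_ : NonZero K}} → 0 < K
   m<n (suc K) = s≤s z≤n

 no-multiple : ∀ {K d} → K ∣ d → d < K → d ≡ 0
 no-multiple {K} {zero} _ _ = refl
 no-multiple {K} {suc d} dv lt = ⊥-elim (<⇒≱ lt (∣⇒≤ dv))

 -- Triangular numbers are a permutation modulo 2^κ: a coincidence of triangle k and
 -- triangle (k + d) gives 2^(κ+1) ∣ d (2k + d + 1), where exactly one factor is odd.
 triangle-injective : ∀ κ .{{_ : NonZero (2 ^ κ)}} k d → k + d < 2 ^ κ → triangle (k + d) % 2 ^ κ ≡ triangle k % 2 ^ κ → d ≡ 0
 triangle-injective κ k d lt eq = by-parity (even-or-odd d)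
   where
   K = 2 ^ κ
   K∣ : K ∣ d * k + triangle d
   K∣ = mod-≡⇒∣ K (triangle k) (d * k + triangle d) (trans (cong (_% K) (sym (triangle-+ k d))) eq)
   2K∣ : 2 ^ suc κ ∣ d * suc (2 * k + d)
   2K∣ = subst (2 * K ∣_) (trans (*-distribˡ-+ 2 (d * k) (triangle d)) (trans (cong (2 * (d * k) +_) (2triangle d)) (id₁ d k))) (*-monoʳ-∣ 2 K∣)
     where
     id₁ : ∀ d k → 2 * (d * k) + d * suc d ≡ d * suc (2 * k + d)
     id₁ = solve 2 (λ d k → con 2 :* (d :* k) :+ d :* (con 1 :+ d) := d :* (con 1 :+ (con 2 :* k :+ d))) refl
   small : suc (2 * k + d) < 2 ^ suc κ
   small = ≤-trans (≤-trans (m≤m+n _ d) (≤-reflexive (id₂ k d))) (*-monoʳ-≤ 2 lt)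
     where
     id₂ : ∀ k d → suc (suc (2 * k + d)) + d ≡ 2 * suc (k + d)
     id₂ = solve 2 (λ k d → (con 1 :+ ((con 1 :+ (con 2 :* k :+ d)))) :+ d := con 2 :* (con 1 :+ (k :+ d))) refl
   by-parity : (∃ λ c → d ≡ 2 * c) ⊎ (∃ λ c → d ≡ suc (2 * c)) → d ≡ 0
   by-parity (inj₁ (c , d≡)) = no-multiple (odd-cancel (suc κ) (k + c) d (subst (2 ^ suc κ ∣_) (trans (*-comm d _) (cong (_* d) (trans (cong (λ z → suc (2 * k + z)) d≡) (cong suc (sym (*-distribˡ-+ 2 k c)))))) 2K∣))
     (≤-trans (≤-<-trans (m≤n+m d k) lt) (m≤m+n K (K + 0)))
   by-parity (inj₂ (c , d≡)) with no-multiple (odd-cancel (suc κ) c (suc (2 * k + d)) (subst (λ z → 2 ^ suc κ ∣ z * suc (2 * k + d)) d≡ 2K∣)) small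
   ... | ()

 module TriangularScheme (κ : ℕ) where

   K : ℕ
   K = 2 ^ κ

   instance
     K≢0 : NonZero K
     K≢0 = m^n≢0 2 κ

   open Residues K

   res : ℕ → Fin K
   res n = fromℕ< (m%n<n n K)

   res-≡ : ∀ {m n} → res m ≡ res n → m % K ≡ n % K
   res-≡ eq = trans (sym (FP.toℕ-fromℕ< _)) (trans (cong toℕ eq) (FP.toℕ-fromℕ< _))

   clsT : Fin K → ℕ → Fin K
   clsT t k = res (toℕ t + triangle k)

   cls-inj : ∀ t (k l : Fin K) → clsT t (toℕ k) ≡ clsT t (toℕ l) → k ≡ l
   cls-inj t k l eq = FP.toℕ-injective (go (≤-total (toℕ k) (toℕ l)) (FP.toℕ<n k) (FP.toℕ<n l) (mod-cancelˡ (toℕ t) (toℕ t) _ _ refl (res-≡ eq)))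
     where
     go : ∀ {a b} → a ≤ b ⊎ b ≤ a → a < K → b < K → triangle a % K ≡ triangle b % K → a ≡ b
     go {a} (inj₁ le) a< b< eq with ≤-witness le
     ... | d , refl with triangle-injective κ a d b< (sym eq)
     ...   | refl = sym (+-identityʳ a)
     go {a} {b} (inj₂ le) a< b< eq with ≤-witness le
     ... | d , refl with triangle-injective κ b d a< eq
     ...   | refl = +-identityʳ b

   typ-inj : ∀ k (t t′ : Fin K) → clsT t k ≡ clsT t′ k → t ≡ t′
   typ-inj k t t′ eq = FP.toℕ-injective (trans (sym (m<n⇒m%n≡m (FP.toℕ<n t))) (trans
     (mod-cancelˡ (triangle k) (triangle k) (toℕ t) (toℕ t′) refl (trans (cong (_% K) (+-comm (triangle k) (toℕ t))) (trans (res-≡ eq) (cong (_% K) (+-comm (toℕ t′) (triangle k))))))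
     (m<n⇒m%n≡m (FP.toℕ<n t′))))

   posB : ∀ t → ∃ λ (φ : Bij K) → ∀ k → to φ k ≡ clsT t (toℕ k)
   posB t = injective⇒Bij (λ k → clsT t (toℕ k)) (cls-inj t)

   typB : ∀ k → ∃ λ (φ : Bij K) → ∀ t → to φ t ≡ clsT t k
   typB k = injective⇒Bij (λ t → clsT t k) (typ-inj k)

   triangular : Scheme K
   triangular = record
     { cls = clsT
     ; pos = λ t c → toℕ (from (proj₁ (posB t)) c)
     ; typ = λ k c → from (proj₁ (typB k)) c
     ; pos< = λ t c → FP.toℕ<n _
     ; cls-pos = λ t c → trans (sym (proj₂ (posB t) _)) (to-from (proj₁ (posB t)) c)
     ; pos-cls = λ t k k< → trans (cong toℕ (trans (cong (from (proj₁ (posB t))) (trans (cong (clsT t) (sym (FP.toℕ-fromℕ< k<))) (sym (proj₂ (posB t) _)))) (from-to (proj₁ (posB t)) _))) (FP.toℕ-fromℕ< k<)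
     ; typ-cls = λ t k → trans (cong (from (proj₁ (typB k))) (sym (proj₂ (typB k) t))) (from-to (proj₁ (typB k)) t)
     -- Step k changes the class by k + 1 modulo K, so two consecutive classes determine k.
     ; step-unique = λ t t′ k k′ k< k<′ eq eq′ → trans (sym (m<n⇒m%n≡m k<)) (trans
         (mod-cancelˡ 1 1 k k′ refl (mod-cancelˡ (toℕ t + triangle k) (toℕ t′ + triangle k′) (suc k) (suc k′) (res-≡ eq)
           (trans (cong (_% K) (+-assoc (toℕ t) (triangle k) (suc k))) (trans (res-≡ eq′) (cong (_% K) (sym (+-assoc (toℕ t′) (triangle k′) (suc k′)))))))) (m<n⇒m%n≡m k<′))
     }

 module SpacedHosting (B h e : ℕ) .{{_ : NonZero B}} (room : B * h ≤ e) where

   place : Fin B → Fin h → ℕ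
   place b o = toℕ b + toℕ o * B

   place% : ∀ b o → place b o % B ≡ toℕ b
   place% b o = trans ([m+kn]%n≡m%n (toℕ b) (toℕ o) B) (m<n⇒m%n≡m (FP.toℕ<n b))

   spaced : Hosting B h e
   spaced = record
     { hp = place
     ; bof = λ k → fromℕ< (m%n<n k B)
     ; hp< = λ b o → ≤-trans (≤-trans (+-monoˡ-≤ (toℕ o * B) (FP.toℕ<n b)) (≤-trans (*-monoˡ-≤ B (FP.toℕ<n o)) (≤-reflexive (*-comm h B)))) room
     ; bof-hp = λ b o → FP.toℕ-injective (trans (FP.toℕ-fromℕ< _) (place% b o))
     ; hp-inj = λ b o o′ eq → FP.toℕ-injective (*-cancelʳ-≡ _ _ B (+-cancelˡ-≡ (toℕ b) _ _ eq))
     }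

 _≟T_ : DecidableEquality Tag
 s ≟T t = map′ code-injective (cong code) (code s ≟ code t)
   where
   code : Tag → ℕ
   code main = 0
   code free = 1
   code c₁ = 2
   code c₂ = 3
   code gA = 4
   code gB = 5
   code-injective : ∀ {s t} → code s ≡ code t → s ≡ t
   code-injective {main} {main} _ = refl
   code-injective {free} {free} _ = refl
   code-injective {c₁} {c₁} _ = refl
   code-injective {c₂} {c₂} _ = refl
   code-injective {gA} {gA} _ = refl
   code-injective {gB} {gB} _ = refl

 -- Differences modulo 16; {2,3} + {4,6} is an interval of length four, which no translate
 -- keeps inside {2,3,4,6}, so a gadget can always be shortcut by an untagged edge.
 byDifference : ℕ → Tag
 byDifference 2  = gA
 byDifference 3  = gA
 byDifference 4  = gB
 byDifference 6  = gB
 byDifference 8  = c₁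
 byDifference 10 = c₂
 byDifference _  = free

 table : Fin 16 → Fin 16 → Tag
 table b a = byDifference ((toℕ a + (16 ∸ toℕ b)) % 16)

 abstract
   table-c₁ : ∀ b → ∃ λ a → table b a ≡ c₁
   table-c₁ = toWitness {a? = FP.all? (λ b → FP.any? (λ a → table b a ≟T c₁))} tt

   table-c₂ : ∀ a → ∃ λ b → table b a ≡ c₂
   table-c₂ = toWitness {a? = FP.all? (λ a → FP.any? (λ b → table b a ≟T c₂))} tt

   table-gadget : ∀ a b → ∃ λ b′ → ∃ λ a′ → (table b′ a ≡ gA × table b a′ ≡ gB) × isHost (table b′ a′) ≡ true
   table-gadget a b = case search a b of λ { (b′ , in-tag , a′ , out-tag , host) → b′ , a′ , (in-tag , out-tag) , host }
     where
     search : ∀ a b → ∃ λ b′ → table b′ a ≡ gA × ∃ λ a′ → table b a′ ≡ gB × isHost (table b′ a′) ≡ true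
     search = toWitness {a? = FP.all? (λ a → FP.all? (λ b → FP.any? (λ b′ → (table b′ a ≟T gA) ×-dec FP.any? (λ a′ →
       (table b a′ ≟T gB) ×-dec (isHost (table b′ a′) ≟B true)))))} tt

 module TableTagging (q : ℕ) where

   quotL : Fin (q * 16) → Fin q
   quotL x = proj₁ (remQuot {q} 16 x)

   remL : Fin (q * 16) → Fin 16
   remL x = proj₂ (remQuot {q} 16 x)

   -- Labels are pairs in `Fin q` × `Fin 16`, and only pairs with equal first components can receive
   -- a special tag. Special edges thus involve just 16 of the Q labels opposite a given one, few
   -- enough to spare, while the table in the second component still realises every role for every
   -- label.
   tagQ : Fin (q * 16) → Fin (q * 16) → Tag
   tagQ b a with quotL b FP.≟ quotL a
   ... | yes _ = table (remL b) (remL a)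
   ... | no  _ = main

   tagQ-main : ∀ b a → quotL b ≢ quotL a → tagQ b a ≡ main
   tagQ-main b a ne with quotL b FP.≟ quotL a
   ... | yes eq = ⊥-elim (ne eq)
   ... | no _   = refl

   private
     rqc : ∀ (x : Fin q) (y : Fin 16) → remQuot {q} 16 (combine x y) ≡ (x , y)
     rqc x y = FP.remQuot-combine x y

     tag-same : ∀ b a → quotL b ≡ quotL a → tagQ b a ≡ table (remL b) (remL a)
     tag-same b a eq with quotL b FP.≟ quotL a
     ... | yes _ = refl
     ... | no ne = ⊥-elim (ne eq)

     tag-combineʳ : ∀ b y → tagQ b (combine (quotL b) y) ≡ table (remL b) y
     tag-combineʳ b y = trans (tag-same b _ (sym (cong proj₁ (rqc (quotL b) y)))) (cong (table (remL b)) (cong proj₂ (rqc (quotL b) y)))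

     tag-combineˡ : ∀ a y → tagQ (combine (quotL a) y) a ≡ table y (remL a)
     tag-combineˡ a y = trans (tag-same _ a (cong proj₁ (rqc (quotL a) y))) (cong (λ z → table z (remL a)) (cong proj₂ (rqc (quotL a) y)))

     tag-hosts : ∀ b a → isHost (table (remL b) (remL a)) ≡ true → isHost (tagQ b a) ≡ true
     tag-hosts b a ok with quotL b FP.≟ quotL a
     ... | yes _ = ok
     ... | no _  = refl

   tagging : Tagging (q * 16)
   tagging = record
     { tag = tagQ
     ; a₁ = λ b → combine (quotL b) (proj₁ (table-c₁ (remL b)))
     ; b₂ = λ a → combine (quotL a) (proj₁ (table-c₂ (remL a)))
     ; tag-a₁ = λ b → trans (tag-combineʳ b _) (proj₂ (table-c₁ (remL b)))
     ; tag-b₂ = λ a → trans (tag-combineˡ a _) (proj₂ (table-c₂ (remL a)))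
     ; gβ = λ a b → combine (quotL a) (proj₁ (table-gadget (remL a) (remL b)))
     ; gα = λ a b → combine (quotL b) (proj₁ (proj₂ (table-gadget (remL a) (remL b))))
     ; tag-gA = λ a b → trans (tag-combineˡ a _) (proj₁ (proj₁ (proj₂ (proj₂ (table-gadget (remL a) (remL b))))))
     ; tag-gB = λ a b → trans (tag-combineʳ b _) (proj₂ (proj₁ (proj₂ (proj₂ (table-gadget (remL a) (remL b))))))
     ; tag-host = λ a b → tag-hosts _ _ (trans (cong₂ (λ x y → isHost (table x y)) (cong proj₂ (rqc (quotL a) _)) (cong proj₂ (rqc (quotL b) _)))
         (proj₂ (proj₂ (proj₂ (table-gadget (remL a) (remL b))))))
     }

 -- Balanced halving by conditional expectations.

 bernoulli-upper : ∀ x k → (suc x) ^ k * suc x ≤ x ^ k * suc x + k * (suc x) ^ k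
 bernoulli-upper x zero = ≤-reflexive (sym (+-identityʳ _))
 bernoulli-upper x (suc k) = begin
   y * y ^ k * y ≡⟨ id₁ y (y ^ k) ⟩
   y * (y ^ k * y) ≤⟨ *-monoʳ-≤ y (bernoulli-upper x k) ⟩
   y * (x ^ k * y + k * y ^ k) ≡⟨ id₂ x (x ^ k) k (y ^ k) ⟩
   x * x ^ k * y + k * (y * y ^ k) + y * x ^ k ≤⟨ +-monoʳ-≤ (x * x ^ k * y + k * (y * y ^ k)) (*-monoʳ-≤ y (^-monoˡ-≤ k (n≤1+n x))) ⟩
   x * x ^ k * y + k * (y * y ^ k) + y * y ^ k ≡⟨ id₃ (x * x ^ k * y) k (y * y ^ k) ⟩
   x * x ^ k * y + (y * y ^ k + k * (y * y ^ k)) ∎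
   where
   open ≤-Reasoning
   y = suc x
   id₁ : ∀ y z → y * z * y ≡ y * (z * y)
   id₁ = solve 2 (λ y z → y :* z :* y := y :* (z :* y)) refl
   id₂ : ∀ x w k z → suc x * (w * suc x + k * z) ≡ x * w * suc x + k * (suc x * z) + suc x * w
   id₂ = solve 4 (λ x w k z → (con 1 :+ x) :* (w :* (con 1 :+ x) :+ k :* z) := x :* w :* (con 1 :+ x) :+ k :* ((con 1 :+ x) :* z) :+ (con 1 :+ x) :* w) refl
   id₃ : ∀ a k z → a + k * z + z ≡ a + (z + k * z)
   id₃ = solve 3 (λ a k z → a :+ k :* z :+ z := a :+ (z :+ k :* z)) refl

 -- Bernoulli's inequality (1 + 1/q)^k ≥ 1 + k/q with denominators cleared; its companion
 -- `bernoulli-upper` is (1 - 1/(x+1))^k ≥ 1 - k/(x+1).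
 bernoulli-lower : ∀ q k → q ^ k * q + k * q ^ k ≤ q * suc q ^ k
 bernoulli-lower q zero = ≤-reflexive (id₁ q)
   where
   id₁ : ∀ q → 1 * q + 0 ≡ q * 1
   id₁ = solve 1 (λ q → con 1 :* q :+ con 0 := q :* con 1) refl
 bernoulli-lower q (suc k) = begin
   q * q ^ k * q + (q * q ^ k + k * (q * q ^ k)) ≤⟨ m≤m+n _ (k * q ^ k) ⟩
   q * q ^ k * q + (q * q ^ k + k * (q * q ^ k)) + k * q ^ k ≡⟨ id₁ q (q ^ k) k ⟩
   suc q * (q ^ k * q + k * q ^ k) ≤⟨ *-monoʳ-≤ (suc q) (bernoulli-lower q k) ⟩
   suc q * (q * suc q ^ k) ≡⟨ id₂ q (suc q ^ k) ⟩
   q * (suc q * suc q ^ k) ∎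
   where
   open ≤-Reasoning
   id₁ : ∀ q z k → q * z * q + (q * z + k * (q * z)) + k * z ≡ suc q * (z * q + k * z)
   id₁ = solve 3 (λ q z k → q :* z :* q :+ (q :* z :+ k :* (q :* z)) :+ k :* z := (con 1 :+ q) :* (z :* q :+ k :* z)) refl
   id₂ : ∀ q z → suc q * (q * z) ≡ q * (suc q * z)
   id₂ = solve 2 (λ q z → (con 1 :+ q) :* (q :* z) := q :* ((con 1 :+ q) :* z)) refl

 ^-+ : ∀ a b c → a ^ (b + c) ≡ a ^ b * a ^ c
 ^-+ a b c = ^-distribˡ-+-* a b c

 *-^ : ∀ a b c → (a * b) ^ c ≡ a ^ c * b ^ c
 *-^ a b zero = refl
 *-^ a b (suc c) = trans (cong (a * b *_) (*-^ a b c)) (id₁ a b (a ^ c) (b ^ c))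
   where
   id₁ : ∀ a b x y → a * b * (x * y) ≡ a * x * (b * y)
   id₁ = solve 4 (λ a b x y → a :* b :* (x :* y) := a :* x :* (b :* y)) refl

 module Tail (p : ℕ) (1≤p : 1 ≤ p) where

   q = suc p

   double-step : 2 * q ^ q ≤ suc q ^ q
   double-step = *-cancelˡ-≤ q (≤-trans (≤-reflexive (id₁ q (q ^ q))) (bernoulli-lower q q))
     where
     id₁ : ∀ q z → q * (2 * z) ≡ z * q + q * z
     id₁ = solve 2 (λ q z → q :* (con 2 :* z) := z :* q :+ q :* z) refl

   -- ξ / q² = 1 - 1/q² is the joint factor of one up-step and one down-step.
   ξ = p * suc q

   q²≡ : suc ξ ≡ q * q
   q²≡ = id₁ p
     where
     id₁ : ∀ p → suc (p * suc (suc p)) ≡ suc p * suc p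
     id₁ = solve 1 (λ p → (con 1 :+ (p :* (con 1 :+ ((con 1 :+ p))))) := (con 1 :+ p) :* (con 1 :+ p)) refl

   -- Bernoulli in the form (1 - 1/q²)^q ≥ 1 - 1/q.
   loss-step : (q * q) ^ q * p ≤ ξ ^ q * q
   loss-step = *-cancelˡ-≤ q (+-cancelʳ-≤ (q * (q * q) ^ q) _ _ (begin
     q * ((q * q) ^ q * p) + q * (q * q) ^ q ≡⟨ id₁ p ((q * q) ^ q) ⟩
     (q * q) ^ q * (q * q) ≡⟨ cong (λ z → z ^ q * z) q²≡ ⟨
     suc ξ ^ q * suc ξ ≤⟨ bernoulli-upper ξ q ⟩
     ξ ^ q * suc ξ + q * suc ξ ^ q ≡⟨ cong (λ z → ξ ^ q * z + q * z ^ q) q²≡ ⟩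
     ξ ^ q * (q * q) + q * (q * q) ^ q ≡⟨ cong (_+ q * (q * q) ^ q) (id₂ q (ξ ^ q)) ⟩
     q * (ξ ^ q * q) + q * (q * q) ^ q ∎))
     where
     open ≤-Reasoning
     id₁ : ∀ p z → suc p * (z * p) + suc p * z ≡ z * (suc p * suc p)
     id₁ = solve 2 (λ p z → (con 1 :+ p) :* (z :* p) :+ (con 1 :+ p) :* z := z :* ((con 1 :+ p) :* (con 1 :+ p))) refl
     id₂ : ∀ q z → z * (q * q) ≡ q * (z * q)
     id₂ = solve 2 (λ q z → z :* (q :* q) := q :* (z :* q)) refl

   cube-step : q * (q * q) ≤ p * (suc q * suc q)
   cube-step with ≤-witness 1≤p
   ... | d , refl = ≤-trans (m≤m+n _ (1 + (3 * d + d * d))) (≤-reflexive (id₁ d))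
     where
     id₁ : ∀ d → suc (1 + d) * (suc (1 + d) * suc (1 + d)) + (1 + (3 * d + d * d)) ≡ (1 + d) * (suc (suc (1 + d)) * suc (suc (1 + d)))
     id₁ = solve 1 (λ d → (con 1 :+ (con 1 :+ d)) :* ((con 1 :+ (con 1 :+ d)) :* (con 1 :+ (con 1 :+ d))) :+ (con 1 :+ (con 3 :* d :+ d :* d)) := (con 1 :+ d) :* ((con 1 :+ ((con 1 :+ (con 1 :+ d)))) :* (con 1 :+ ((con 1 :+ (con 1 :+ d)))))) refl

   -- q steps down cost at most two steps up.
   block : q ^ (2 * q) * (q * q) ≤ ξ ^ q * (suc q * suc q)
   block = *-cancelˡ-≤ q (begin
     q * (q ^ (2 * q) * (q * q)) ≡⟨ id₁ q (q ^ (2 * q)) ⟩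
     q ^ (2 * q) * (q * (q * q)) ≤⟨ *-monoʳ-≤ (q ^ (2 * q)) cube-step ⟩
     q ^ (2 * q) * (p * (suc q * suc q)) ≡⟨ id₂ (q ^ (2 * q)) p (suc q * suc q) ⟩
     q ^ (2 * q) * p * (suc q * suc q) ≡⟨ cong (λ z → z * p * (suc q * suc q)) sq ⟩
     (q * q) ^ q * p * (suc q * suc q) ≤⟨ *-monoˡ-≤ (suc q * suc q) loss-step ⟩
     ξ ^ q * q * (suc q * suc q) ≡⟨ id₃ (ξ ^ q) q (suc q * suc q) ⟩
     q * (ξ ^ q * (suc q * suc q)) ∎)
     where
     open ≤-Reasoning
     sq : q ^ (2 * q) ≡ (q * q) ^ q
     sq = trans (cong (q ^_) (cong (q +_) (+-identityʳ q))) (trans (^-+ q q q) (sym (*-^ q q q)))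
     id₁ : ∀ q z → q * (z * (q * q)) ≡ z * (q * (q * q))
     id₁ = solve 2 (λ q z → q :* (z :* (q :* q)) := z :* (q :* (q :* q))) refl
     id₂ : ∀ z p w → z * (p * w) ≡ z * p * w
     id₂ = solve 3 (λ z p w → z :* (p :* w) := z :* p :* w) refl
     id₃ : ∀ z q w → z * q * w ≡ q * (z * w)
     id₃ = solve 3 (λ z q w → z :* q :* w := q :* (z :* w)) refl

   -- A walk with P up-steps and N ≤ q E down-steps and weight at most 2^b has small drift.
   drift : ∀ P N E b M → N ≤ q * E → M ≤ 2 ^ b → suc q ^ P * p ^ N ≤ M * q ^ (P + N) → P ≤ N + (2 * E + q * b)
   drift P N E b M N≤ M≤ h = ≮⇒≥ λ lt → <-irrefl refl (contra (proj₁ (≤-witness lt)) (proj₂ (≤-witness lt)))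
     where
     open ≤-Reasoning
     -- The down-steps are padded to a full multiple q E so that `block` applies E times; padding is
     -- harmless since ξ ≤ q².
     n = q * E ∸ N
     N+n : N + n ≡ q * E
     N+n = m+[n∸m]≡n N≤
     contra : ∀ d → P ≡ suc (N + (2 * E + q * b)) + d → 2 ^ b * q ^ (suc (2 * E + q * b) + d + 2 * (q * E)) < 2 ^ b * q ^ (suc (2 * E + q * b) + d + 2 * (q * E))
     contra d refl = begin-strict
       2 ^ b * q ^ (suc (2 * E + q * b) + d + 2 * (q * E)) ≡⟨ lhs ⟩
       (q ^ (2 * q) * (q * q)) ^ E * (2 * q ^ q) ^ b * q ^ suc d ≤⟨ *-monoˡ-≤ (q ^ suc d) (*-mono-≤ (^-monoˡ-≤ E block) (^-monoˡ-≤ b double-step)) ⟩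
       (ξ ^ q * (suc q * suc q)) ^ E * (suc q ^ q) ^ b * q ^ suc d <⟨ *-monoʳ-< _ {{pos}} (^-monoˡ-< (suc d) (n<1+n q)) ⟩
       (ξ ^ q * (suc q * suc q)) ^ E * (suc q ^ q) ^ b * suc q ^ suc d ≡⟨ mid ⟩
       suc q ^ (suc (2 * E + q * b) + d) * (ξ ^ N * ξ ^ n) ≤⟨ *-monoʳ-≤ (suc q ^ (suc (2 * E + q * b) + d)) (*-monoʳ-≤ (ξ ^ N) (^-monoˡ-≤ n (≤-trans (n≤1+n ξ) (≤-reflexive q²≡)))) ⟩
       suc q ^ (suc (2 * E + q * b) + d) * (ξ ^ N * (q * q) ^ n) ≡⟨ back ⟩
       suc q ^ P * p ^ N * (q * q) ^ n ≤⟨ *-monoˡ-≤ ((q * q) ^ n) h ⟩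
       M * q ^ (P + N) * (q * q) ^ n ≤⟨ *-monoˡ-≤ ((q * q) ^ n) (*-monoˡ-≤ (q ^ (P + N)) M≤) ⟩
       2 ^ b * q ^ (P + N) * (q * q) ^ n ≡⟨ fin ⟩
       2 ^ b * q ^ (suc (2 * E + q * b) + d + 2 * (q * E)) ∎
       where
       pos : NonZero ((ξ ^ q * (suc q * suc q)) ^ E * (suc q ^ q) ^ b)
       pos = m*n≢0 _ _ {{m^n≢0 _ E {{m*n≢0 (ξ ^ q) (suc q * suc q) {{m^n≢0 ξ q {{m*n≢0 p (suc q) {{>-nonZero 1≤p}}}}}}}}}} {{m^n≢0 (suc q ^ q) b {{m^n≢0 (suc q) q}}}}
       lhs : 2 ^ b * q ^ (suc (2 * E + q * b) + d + 2 * (q * E)) ≡ (q ^ (2 * q) * (q * q)) ^ E * (2 * q ^ q) ^ b * q ^ suc d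
       lhs = begin-equality
         2 ^ b * q ^ (suc (2 * E + q * b) + d + 2 * (q * E)) ≡⟨ cong (λ z → 2 ^ b * q ^ z) (ex E q b d) ⟩
         2 ^ b * q ^ (2 * q * E + (2 * E + (q * b + suc d))) ≡⟨ cong (2 ^ b *_) (trans (^-+ q (2 * q * E) _) (cong (q ^ (2 * q * E) *_) (trans (^-+ q (2 * E) _) (cong (q ^ (2 * E) *_) (^-+ q (q * b) (suc d)))))) ⟩
         2 ^ b * (q ^ (2 * q * E) * (q ^ (2 * E) * (q ^ (q * b) * q ^ suc d))) ≡⟨ cong₂ (λ u v → 2 ^ b * (u * (v * (q ^ (q * b) * q ^ suc d)))) (sym (^-*-assoc q (2 * q) E)) (trans (sym (^-*-assoc q 2 E)) (cong (_^ E) (cong (q *_) (*-identityʳ q)))) ⟩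
         2 ^ b * ((q ^ (2 * q)) ^ E * ((q * q) ^ E * (q ^ (q * b) * q ^ suc d))) ≡⟨ cong (λ u → 2 ^ b * ((q ^ (2 * q)) ^ E * ((q * q) ^ E * (u * q ^ suc d)))) (sym (^-*-assoc q q b)) ⟩
         2 ^ b * ((q ^ (2 * q)) ^ E * ((q * q) ^ E * ((q ^ q) ^ b * q ^ suc d))) ≡⟨ re (2 ^ b) ((q ^ (2 * q)) ^ E) ((q * q) ^ E) ((q ^ q) ^ b) (q ^ suc d) ⟩
         (q ^ (2 * q)) ^ E * (q * q) ^ E * (2 ^ b * (q ^ q) ^ b) * q ^ suc d ≡⟨ cong₂ (λ u v → u * v * q ^ suc d) (sym (*-^ (q ^ (2 * q)) (q * q) E)) (sym (*-^ 2 (q ^ q) b)) ⟩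
         (q ^ (2 * q) * (q * q)) ^ E * (2 * q ^ q) ^ b * q ^ suc d ∎
         where
         ex : ∀ E q b d → suc (2 * E + q * b) + d + 2 * (q * E) ≡ 2 * q * E + (2 * E + (q * b + suc d))
         ex = solve 4 (λ E q b d → (con 1 :+ (con 2 :* E :+ q :* b)) :+ d :+ con 2 :* (q :* E) := con 2 :* q :* E :+ (con 2 :* E :+ (q :* b :+ (con 1 :+ d)))) refl
         re : ∀ a b c d e → a * (b * (c * (d * e))) ≡ b * c * (a * d) * e
         re = solve 5 (λ a b c d e → a :* (b :* (c :* (d :* e))) := b :* c :* (a :* d) :* e) refl
       mid : (ξ ^ q * (suc q * suc q)) ^ E * (suc q ^ q) ^ b * suc q ^ suc d ≡ suc q ^ (suc (2 * E + q * b) + d) * (ξ ^ N * ξ ^ n)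
       mid = begin-equality
         (ξ ^ q * (suc q * suc q)) ^ E * (suc q ^ q) ^ b * suc q ^ suc d ≡⟨ cong₂ (λ u v → u * v * suc q ^ suc d) (trans (*-^ (ξ ^ q) _ E) (cong₂ _*_ (^-*-assoc ξ q E) (trans (cong (_^ E) (cong (suc q *_) (sym (*-identityʳ (suc q))))) (^-*-assoc (suc q) 2 E)))) (^-*-assoc (suc q) q b) ⟩
         ξ ^ (q * E) * suc q ^ (2 * E) * suc q ^ (q * b) * suc q ^ suc d ≡⟨ re (ξ ^ (q * E)) (suc q ^ (2 * E)) (suc q ^ (q * b)) (suc q ^ suc d) ⟩
         suc q ^ (2 * E) * (suc q ^ (q * b) * suc q ^ suc d) * ξ ^ (q * E) ≡⟨ cong₂ _*_ (trans (cong (suc q ^ (2 * E) *_) (sym (^-+ (suc q) (q * b) (suc d)))) (trans (sym (^-+ (suc q) (2 * E) _)) (cong (suc q ^_) (ex E q b d)))) (trans (cong (ξ ^_) (sym N+n)) (^-+ ξ N n)) ⟩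
         suc q ^ (suc (2 * E + q * b) + d) * (ξ ^ N * ξ ^ n) ∎
         where
         re : ∀ a b c d → a * b * c * d ≡ b * (c * d) * a
         re = solve 4 (λ a b c d → a :* b :* c :* d := b :* (c :* d) :* a) refl
         ex : ∀ E q b d → 2 * E + (q * b + suc d) ≡ suc (2 * E + q * b) + d
         ex = solve 4 (λ E q b d → con 2 :* E :+ (q :* b :+ (con 1 :+ d)) := (con 1 :+ (con 2 :* E :+ q :* b)) :+ d) refl
       back : suc q ^ (suc (2 * E + q * b) + d) * (ξ ^ N * (q * q) ^ n) ≡ suc q ^ P * p ^ N * (q * q) ^ n
       back = begin-equality
         suc q ^ (suc (2 * E + q * b) + d) * (ξ ^ N * (q * q) ^ n) ≡⟨ cong (λ z → suc q ^ (suc (2 * E + q * b) + d) * (z * (q * q) ^ n)) (*-^ p (suc q) N) ⟩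
         suc q ^ (suc (2 * E + q * b) + d) * (p ^ N * suc q ^ N * (q * q) ^ n) ≡⟨ re (suc q ^ (suc (2 * E + q * b) + d)) (p ^ N) (suc q ^ N) ((q * q) ^ n) ⟩
         suc q ^ N * suc q ^ (suc (2 * E + q * b) + d) * p ^ N * (q * q) ^ n ≡⟨ cong (λ z → z * p ^ N * (q * q) ^ n) (trans (sym (^-+ (suc q) N _)) (cong (suc q ^_) (ex N (2 * E + q * b) d))) ⟩
         suc q ^ P * p ^ N * (q * q) ^ n ∎
         where
         re : ∀ a b c d → a * (b * c * d) ≡ c * a * b * d
         re = solve 4 (λ a b c d → a :* (b :* c :* d) := c :* a :* b :* d) refl
         ex : ∀ N z d → N + (suc z + d) ≡ suc (N + z) + d
         ex = solve 3 (λ N z d → N :+ ((con 1 :+ z) :+ d) := (con 1 :+ (N :+ z)) :+ d) refl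
       fin : 2 ^ b * q ^ (P + N) * (q * q) ^ n ≡ 2 ^ b * q ^ (suc (2 * E + q * b) + d + 2 * (q * E))
       fin = begin-equality
         2 ^ b * q ^ (P + N) * (q * q) ^ n ≡⟨ cong (2 ^ b * q ^ (P + N) *_) (trans (cong (_^ n) (cong (q *_) (sym (*-identityʳ q)))) (^-*-assoc q 2 n)) ⟩
         2 ^ b * q ^ (P + N) * q ^ (2 * n) ≡⟨ *-assoc (2 ^ b) _ _ ⟩
         2 ^ b * (q ^ (P + N) * q ^ (2 * n)) ≡⟨ cong (2 ^ b *_) (trans (sym (^-+ q (P + N) (2 * n))) (cong (q ^_) (trans (ex N n (2 * E + q * b) d) (cong (λ z → suc (2 * E + q * b) + d + 2 * z) N+n)))) ⟩
         2 ^ b * q ^ (suc (2 * E + q * b) + d + 2 * (q * E)) ∎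
         where
         ex : ∀ N n z d → suc (N + z) + d + N + 2 * n ≡ suc z + d + 2 * (N + n)
         ex = solve 4 (λ N n z d → (con 1 :+ (N :+ z)) :+ d :+ N :+ con 2 :* n := (con 1 :+ z) :+ d :+ con 2 :* (N :+ n)) refl

 Π : ∀ n → (Fin n → ℕ) → ℕ
 Π zero    f = 1
 Π (suc n) f = f zero * Π n (f ∘ suc)

 module Halving (p : ℕ) (1≤p : 1 ≤ p) {M : ℕ} {V : Set} (φ : Fin M → V → Bool) (b : ℕ) (2M≤ : 2 * M ≤ 2 ^ b) where

   open Tail p 1≤p

   -- A test gains the factor 1 + 1/q or 1 - 1/q according to the half in which its element lands,
   -- and 1 if it contains both or neither of two paired vertices. The common factor q clears
   -- denominators.
   wt : Bool → Bool → ℕ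
   wt true  false = suc q
   wt false true  = p
   wt _     _     = q

   wt-sym : ∀ x y → wt x y + wt y x ≡ 2 * q
   wt-sym true true = cong (q +_) (sym (+-identityʳ q))
   wt-sym false false = cong (q +_) (sym (+-identityʳ q))
   wt-sym true false = trans (sym (+-suc q p)) (cong (q +_) (sym (+-identityʳ q)))
   wt-sym false true = trans (+-suc p q) (cong (q +_) (sym (+-identityʳ q)))

   pick : Bool → V → V → V
   pick true  x y = x
   pick false x y = y

   -- Method of conditional expectations for the sum of the two tilted weights of every test.
   walk : ∀ s (l r : Fin s → V) (A B : Fin M → ℕ) → ∃ λ (χ : Fin s → Bool) →
     ∑ M (λ i → A i * Π s (λ a → wt (φ i (pick (χ a) (l a) (r a))) (φ i (pick (χ a) (r a) (l a))))
              + B i * Π s (λ a → wt (φ i (pick (χ a) (r a) (l a))) (φ i (pick (χ a) (l a) (r a)))))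
       ≤ ∑ M (λ i → A i + B i) * q ^ s
   walk zero l r A B = (λ ()) , ≤-reflexive (trans (∑-cong M (λ i → cong₂ _+_ (*-identityʳ (A i)) (*-identityʳ (B i)))) (sym (*-identityʳ _)))
   walk (suc s) l r A B = choose (≤-total X Y)
     where
     x y : Fin M → Bool
     x i = φ i (l zero)
     y i = φ i (r zero)
     X = ∑ M (λ i → A i * wt (x i) (y i) + B i * wt (y i) (x i))
     Y = ∑ M (λ i → A i * wt (y i) (x i) + B i * wt (x i) (y i))
     X+Y : X + Y ≡ 2 * (∑ M (λ i → A i + B i) * q)
     X+Y = trans (sym (∑-+ M _ _)) (trans (∑-cong M (λ i → trans (id₁ (A i) (B i) (wt (x i) (y i)) (wt (y i) (x i)))
         (cong ((A i + B i) *_) (wt-sym (x i) (y i))))) (trans (∑-*ʳ M (2 * q) _) (id₂ (∑ M (λ i → A i + B i)) q)))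
       where
       id₁ : ∀ a b u v → a * u + b * v + (a * v + b * u) ≡ (a + b) * (u + v)
       id₁ = solve 4 (λ a b u v → a :* u :+ b :* v :+ (a :* v :+ b :* u) := (a :+ b) :* (u :+ v)) refl
       id₂ : ∀ s q → s * (2 * q) ≡ 2 * (s * q)
       id₂ = solve 2 (λ s q → s :* (con 2 :* q) := con 2 :* (s :* q)) refl
     half : ∀ {X Y Z} → X + Y ≡ 2 * Z → X ≤ Y → X ≤ Z
     half {X} {Y} {Z} eq le = *-cancelˡ-≤ 2 (≤-trans (≤-reflexive (cong (X +_) (+-identityʳ X))) (≤-trans (+-monoʳ-≤ X le) (≤-reflexive eq)))
     finish : ∀ bit → ∑ M (λ i → A i * wt (φ i (pick bit (l zero) (r zero))) (φ i (pick bit (r zero) (l zero))) + B i * wt (φ i (pick bit (r zero) (l zero))) (φ i (pick bit (l zero) (r zero)))) ≤ ∑ M (λ i → A i + B i) * q →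
       ∃ λ (χ : Fin (suc s) → Bool) →
       ∑ M (λ i → A i * Π (suc s) (λ a → wt (φ i (pick (χ a) (l a) (r a))) (φ i (pick (χ a) (r a) (l a))))
              + B i * Π (suc s) (λ a → wt (φ i (pick (χ a) (r a) (l a))) (φ i (pick (χ a) (l a) (r a)))))
       ≤ ∑ M (λ i → A i + B i) * q ^ suc s
     finish bit le with walk s (l ∘ suc) (r ∘ suc)
       (λ i → A i * wt (φ i (pick bit (l zero) (r zero))) (φ i (pick bit (r zero) (l zero))))
       (λ i → B i * wt (φ i (pick bit (r zero) (l zero))) (φ i (pick bit (l zero) (r zero))))
     ... | χ , h = (λ { zero → bit ; (suc a) → χ a }) , ≤-trans (≤-reflexive (∑-cong M (λ i → cong₂ _+_ (sym (*-assoc (A i) _ _)) (sym (*-assoc (B i) _ _)))))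
           (≤-trans h (≤-trans (*-monoˡ-≤ (q ^ s) le) (≤-reflexive (*-assoc (∑ M (λ i → A i + B i)) q (q ^ s)))))
     choose : X ≤ Y ⊎ Y ≤ X → _
     choose (inj₁ le) = finish true (half X+Y le)
     choose (inj₂ le) = finish false (half (trans (+-comm Y X) X+Y) le)

   up-steps down-steps : ∀ s (x y : Fin s → Bool) → ℕ
   up-steps s x y = cnt s (λ a → x a ∧ not (y a))
   down-steps s x y = cnt s (λ a → not (x a) ∧ y a)

   Π-wt : ∀ s (x y : Fin s → Bool) → Π s (λ a → wt (x a) (y a)) * q ^ (up-steps s x y + down-steps s x y)
     ≡ suc q ^ up-steps s x y * p ^ down-steps s x y * q ^ s
   Π-wt zero x y = refl
   Π-wt (suc s) x y with x zero | y zero | Π-wt s (x ∘ suc) (y ∘ suc)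
   ... | true | true | ih = trans (*-assoc q (Π s (λ a → wt (x (suc a)) (y (suc a)))) (q ^ (up-steps s (x ∘ suc) (y ∘ suc) + down-steps s (x ∘ suc) (y ∘ suc)))) (trans (cong (q *_) ih) (id₁ q (suc q ^ up-steps s (x ∘ suc) (y ∘ suc) * p ^ down-steps s (x ∘ suc) (y ∘ suc)) (q ^ s)))
     where
     id₁ : ∀ q a c → q * (a * c) ≡ a * (q * c)
     id₁ = solve 3 (λ q a c → q :* (a :* c) := a :* (q :* c)) refl
   ... | false | false | ih = trans (*-assoc q (Π s (λ a → wt (x (suc a)) (y (suc a)))) (q ^ (up-steps s (x ∘ suc) (y ∘ suc) + down-steps s (x ∘ suc) (y ∘ suc)))) (trans (cong (q *_) ih) (id₁ q (suc q ^ up-steps s (x ∘ suc) (y ∘ suc) * p ^ down-steps s (x ∘ suc) (y ∘ suc)) (q ^ s)))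
     where
     id₁ : ∀ q a c → q * (a * c) ≡ a * (q * c)
     id₁ = solve 3 (λ q a c → q :* (a :* c) := a :* (q :* c)) refl
   ... | true | false | ih = trans (id₁ q W (q ^ (P + N))) (trans (cong (suc q * q *_) ih) (id₂ q (suc q ^ P) (p ^ N) (q ^ s)))
     where
     W = Π s (λ a → wt (x (suc a)) (y (suc a)))
     P = up-steps s (x ∘ suc) (y ∘ suc)
     N = down-steps s (x ∘ suc) (y ∘ suc)
     id₁ : ∀ q a c → suc q * a * (q * c) ≡ suc q * q * (a * c)
     id₁ = solve 3 (λ q a c → (con 1 :+ q) :* a :* (q :* c) := (con 1 :+ q) :* q :* (a :* c)) refl
     id₂ : ∀ q a b c → suc q * q * (a * b * c) ≡ suc q * a * b * (q * c)
     id₂ = solve 4 (λ q a b c → (con 1 :+ q) :* q :* (a :* b :* c) := (con 1 :+ q) :* a :* b :* (q :* c)) refl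
   ... | false | true | ih = trans (cong (λ z → p * W * q ^ z) (+-suc P N)) (trans (id₁ p q W (q ^ (P + N))) (trans (cong (p * q *_) ih) (id₂ p q (suc q ^ P) (p ^ N) (q ^ s))))
     where
     W = Π s (λ a → wt (x (suc a)) (y (suc a)))
     P = up-steps s (x ∘ suc) (y ∘ suc)
     N = down-steps s (x ∘ suc) (y ∘ suc)
     id₁ : ∀ p q a c → p * a * (q * c) ≡ p * q * (a * c)
     id₁ = solve 4 (λ p q a c → p :* a :* (q :* c) := p :* q :* (a :* c)) refl
     id₂ : ∀ p q a b c → p * q * (a * b * c) ≡ a * (p * b) * (q * c)
     id₂ = solve 5 (λ p q a b c → p :* q :* (a :* b :* c) := a :* (p :* b) :* (q :* c)) refl

   E₀ = 2 + q * b

   cnt-both : ∀ s (x y : Fin s → Bool) → cnt s x ≡ cnt s (λ a → x a ∧ y a) + up-steps s x y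
   cnt-both s x y = trans (∑-cong s (λ a → pt (x a) (y a))) (∑-+ s _ _)
     where
     pt : ∀ x y → 𝟙 x ≡ 𝟙 (x ∧ y) + 𝟙 (x ∧ not y)
     pt true true = refl
     pt true false = refl
     pt false y = refl

   cnt-both′ : ∀ s (x y : Fin s → Bool) → cnt s y ≡ cnt s (λ a → x a ∧ y a) + down-steps s x y
   cnt-both′ s x y = trans (∑-cong s (λ a → pt (x a) (y a))) (∑-+ s _ _)
     where
     pt : ∀ x y → 𝟙 y ≡ 𝟙 (x ∧ y) + 𝟙 (not x ∧ y)
     pt true true = refl
     pt true false = refl
     pt false true = refl
     pt false false = refl

   -- `drift` applied with E just above Y / q, made relative: it reads X ≤ (1 + 2/q)(X + Y)/2 +
   -- E₀/2.
   balance : ∀ s (x y : Fin s → Bool) → Π s (λ a → wt (x a) (y a)) ≤ 2 * M * q ^ s →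
     2 * (q * cnt s x) ≤ (q + 2) * (cnt s x + cnt s y) + q * E₀
   balance s x y h = begin
     2 * (q * X) ≡⟨ id₀ q X ⟩
     q * X + q * X ≤⟨ +-monoʳ-≤ (q * X) (*-monoʳ-≤ q X≤) ⟩
     q * X + q * (Y + (2 * E + q * b)) ≡⟨ id₁ q X Y E b ⟩
     q * (X + Y) + 2 * (q * E) + q * (q * b) ≤⟨ +-monoˡ-≤ (q * (q * b)) (+-monoʳ-≤ (q * (X + Y)) (*-monoʳ-≤ 2 qE≤)) ⟩
     q * (X + Y) + 2 * (Y + q) + q * (q * b) ≤⟨ m≤m+n _ (2 * X) ⟩
     q * (X + Y) + 2 * (Y + q) + q * (q * b) + 2 * X ≡⟨ id₂ q X Y b ⟩
     (q + 2) * (X + Y) + q * E₀ ∎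
     where
     open ≤-Reasoning
     X = cnt s x
     Y = cnt s y
     P = up-steps s x y
     N = down-steps s x y
     both = cnt s (λ a → x a ∧ y a)
     E = Y / q + 1
     qE≤ : q * E ≤ Y + q
     qE≤ = ≤-trans (≤-reflexive (trans (*-distribˡ-+ q (Y / q) 1) (cong₂ _+_ (*-comm q (Y / q)) (*-identityʳ q)))) (+-monoˡ-≤ q (m/n*n≤m Y q))
     N≤ : N ≤ q * E
     N≤ = ≤-trans (≤-trans (m≤n+m N both) (≤-reflexive (sym (cnt-both′ s x y)))) (≤-trans (≤-reflexive (m≡m%n+[m/n]*n Y q))
       (≤-trans (+-monoˡ-≤ (Y / q * q) (<⇒≤ (m%n<n Y q))) (≤-reflexive (id₃ q (Y / q)))))
       where
       id₃ : ∀ q d → q + d * q ≡ q * (d + 1)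
       id₃ = solve 2 (λ q d → q :+ d :* q := q :* (d :+ con 1)) refl
     key : suc q ^ P * p ^ N ≤ 2 * M * q ^ (P + N)
     key = *-cancelʳ-≤ _ _ (q ^ s) {{m^n≢0 q s}} (≤-trans (≤-reflexive (sym (Π-wt s x y))) (≤-trans (*-monoˡ-≤ (q ^ (P + N)) h) (≤-reflexive (id₄ (2 * M) (q ^ s) (q ^ (P + N))))))
       where
       id₄ : ∀ a b c → a * b * c ≡ a * c * b
       id₄ = solve 3 (λ a b c → a :* b :* c := a :* c :* b) refl
     X≤ : X ≤ Y + (2 * E + q * b)
     X≤ = ≤-trans (≤-reflexive (cnt-both s x y)) (≤-trans (+-monoʳ-≤ both (drift P N E b (2 * M) N≤ 2M≤ key))
       (≤-reflexive (trans (sym (+-assoc both N _)) (cong (_+ (2 * E + q * b)) (sym (cnt-both′ s x y))))))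
     id₀ : ∀ q X → 2 * (q * X) ≡ q * X + q * X
     id₀ = solve 2 (λ q X → con 2 :* (q :* X) := q :* X :+ q :* X) refl
     id₁ : ∀ q X Y E b → q * X + q * (Y + (2 * E + q * b)) ≡ q * (X + Y) + 2 * (q * E) + q * (q * b)
     id₁ = solve 5 (λ q X Y E b → q :* X :+ q :* (Y :+ (con 2 :* E :+ q :* b)) := q :* (X :+ Y) :+ con 2 :* (q :* E) :+ q :* (q :* b)) refl
     id₂ : ∀ q X Y b → q * (X + Y) + 2 * (Y + q) + q * (q * b) + 2 * X ≡ (q + 2) * (X + Y) + q * (2 + q * b)
     id₂ = solve 4 (λ q X Y b → q :* (X :+ Y) :+ con 2 :* (Y :+ q) :+ q :* (q :* b) :+ con 2 :* X := (q :+ con 2) :* (X :+ Y) :+ q :* (con 2 :+ q :* b)) refl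

   -- A union bound without probability: the total weight of all tests, tilted either way, ends at
   -- most at 2 M q^s, so no single test exceeds this value. Both tilts together give both
   -- directions.
   split : ∀ s (l r : Fin s → V) → ∃ λ (χ : Fin s → Bool) → ∀ i →
     let L = cnt s (λ a → φ i (pick (χ a) (l a) (r a))) ; R = cnt s (λ a → φ i (pick (χ a) (r a) (l a))) in
     2 * (q * L) ≤ (q + 2) * (L + R) + q * E₀ × 2 * (q * R) ≤ (q + 2) * (L + R) + q * E₀
   split s l r with walk s l r (λ _ → 1) (λ _ → 1)
   ... | χ , h = χ , λ i → balance s (x i) (y i) (≤-trans (le₁ (Π s (λ a → wt (x i a) (y i a))) (Π s (λ a → wt (y i a) (x i a)))) (bound i)) ,
       subst (λ z → 2 * (q * cnt s (y i)) ≤ (q + 2) * z + q * E₀) (+-comm (cnt s (y i)) _)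
         (balance s (y i) (x i) (≤-trans (le₂ (Π s (λ a → wt (x i a) (y i a))) (Π s (λ a → wt (y i a) (x i a)))) (bound i)))
     where
     x y : Fin M → Fin s → Bool
     x i a = φ i (pick (χ a) (l a) (r a))
     y i a = φ i (pick (χ a) (r a) (l a))
     bound : ∀ i → 1 * Π s (λ a → wt (x i a) (y i a)) + 1 * Π s (λ a → wt (y i a) (x i a)) ≤ 2 * M * q ^ s
     bound i = ≤-trans (≤∑ (λ i → 1 * Π s (λ a → wt (x i a) (y i a)) + 1 * Π s (λ a → wt (y i a) (x i a))) i)
       (≤-trans h (≤-reflexive (cong (_* q ^ s) (trans (∑-const M 2) (*-comm M 2)))))
     le₁ : ∀ u v → u ≤ 1 * u + 1 * v
     le₁ u v = ≤-trans (≤-reflexive (sym (*-identityˡ u))) (m≤m+n (1 * u) (1 * v))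
     le₂ : ∀ u v → v ≤ 1 * u + 1 * v
     le₂ u v = ≤-trans (≤-reflexive (sym (*-identityˡ v))) (m≤n+m (1 * v) (1 * u))

 -- Powers of two by doubling, so that an array with `pw (suc A)` rows falls into two halves under
 -- `splitAt`.
 pw : ℕ → ℕ
 pw zero    = 1
 pw (suc A) = pw A + pw A

 pw≡2^ : ∀ A → pw A ≡ 2 ^ A
 pw≡2^ zero = refl
 pw≡2^ (suc A) = trans (cong₂ _+_ (pw≡2^ A) (pw≡2^ A)) (cong (2 ^ A +_) (sym (+-identityʳ (2 ^ A))))

 module Partition (p : ℕ) (1≤p : 1 ≤ p) {M : ℕ} {V : Set} (φ : Fin M → V → Bool) (b : ℕ) (2M≤ : 2 * M ≤ 2 ^ b) (m₀ : ℕ) where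

   open Halving p 1≤p φ b 2M≤ public using (E₀; split; pick)

   q o g : ℕ
   q = suc p
   o = p ∸ 1
   g = q + 2

   o+2 : o + 2 ≡ q
   o+2 with ≤-witness 1≤p
   ... | d , refl = +-comm d 2

   o≤q : o ≤ q
   o≤q = ≤-trans (m≤m+n o 2) (≤-reflexive o+2)

   Array : ℕ → Set
   Array A = Fin (pw A) → Fin m₀ → V

   total : ∀ A → Array A → Fin M → ℕ
   total A v i = ∑ (pw A) (λ f → cnt m₀ (φ i ∘ v f))

   Injective₂ : ∀ A → Array A → Set
   Injective₂ A v = ∀ f s f′ s′ → v f s ≡ v f′ s′ → (f , s) ≡ (f′ , s′)

   -- After A halvings a total c leaves a share n with n ≤ (g / 2q)^A (c + (2^A - 1) E₀) and n + E₀
   -- ≥ (o / 2q)^A c + E₀ / 2^A. The two terms in E₀ sum the additive errors of all levels and let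
   -- the induction close.
   High Low : ℕ → ℕ → ℕ → Set
   High A c n = (2 * q) ^ A * n + g ^ A * E₀ ≤ g ^ A * (c + 2 ^ A * E₀)
   Low A c n = o ^ A * c + q ^ A * E₀ ≤ (2 * q) ^ A * (n + E₀)

   high-step : ∀ A c c′ n → 2 * (q * c′) ≤ g * c + q * E₀ → High A c′ n → High (suc A) c n
   high-step A c c′ n h ih = +-cancelʳ-≤ (2 * q * (g ^ A * E₀)) _ _ (begin
     2 * q * (2 * q) ^ A * n + g * g ^ A * E₀ + 2 * q * (g ^ A * E₀) ≡⟨ id₁ q ((2 * q) ^ A) n g (g ^ A) E₀ ⟩
     2 * q * ((2 * q) ^ A * n + g ^ A * E₀) + g * g ^ A * E₀ ≤⟨ +-monoˡ-≤ (g * g ^ A * E₀) (*-monoʳ-≤ (2 * q) ih) ⟩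
     2 * q * (g ^ A * (c′ + 2 ^ A * E₀)) + g * g ^ A * E₀ ≡⟨ id₂ q (g ^ A) c′ (2 ^ A) E₀ g ⟩
     g ^ A * (2 * (q * c′) + 2 * q * 2 ^ A * E₀ + g * E₀) ≤⟨ *-monoʳ-≤ (g ^ A) (+-monoˡ-≤ (g * E₀) (+-monoˡ-≤ (2 * q * 2 ^ A * E₀) h)) ⟩
     g ^ A * (g * c + q * E₀ + 2 * q * 2 ^ A * E₀ + g * E₀) ≤⟨ *-monoʳ-≤ (g ^ A) (≤-trans (m≤m+n _ (4 * (2 ^ A ∸ 1) * E₀ + 2 * E₀)) (≤-reflexive (trans (cong (λ z → g * c + q * E₀ + 2 * q * z * E₀ + g * E₀ + (4 * (2 ^ A ∸ 1) * E₀ + 2 * E₀)) (sym two)) (trans (id₃ q c E₀ (2 ^ A ∸ 1)) (cong (λ z → g * c + g * (2 * z) * E₀ + 2 * q * E₀) two))))) ⟩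
     g ^ A * (g * c + g * (2 * 2 ^ A) * E₀ + 2 * q * E₀) ≡⟨ id₄ g (g ^ A) c (2 * 2 ^ A) E₀ q ⟩
     g * g ^ A * (c + 2 * 2 ^ A * E₀) + 2 * q * (g ^ A * E₀) ∎)
     where
     open ≤-Reasoning
     two : suc (2 ^ A ∸ 1) ≡ 2 ^ A
     two = trans (+-comm 1 _) (m∸n+n≡m (>-nonZero⁻¹ (2 ^ A) {{m^n≢0 2 A}}))
     id₁ : ∀ q t n g h e → 2 * q * t * n + g * h * e + 2 * q * (h * e) ≡ 2 * q * (t * n + h * e) + g * h * e
     id₁ = solve 6 (λ q t n g h e → con 2 :* q :* t :* n :+ g :* h :* e :+ con 2 :* q :* (h :* e) := con 2 :* q :* (t :* n :+ h :* e) :+ g :* h :* e) refl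
     id₂ : ∀ q h c t e g → 2 * q * (h * (c + t * e)) + g * h * e ≡ h * (2 * (q * c) + 2 * q * t * e + g * e)
     id₂ = solve 6 (λ q h c t e g → con 2 :* q :* (h :* (c :+ t :* e)) :+ g :* h :* e := h :* (con 2 :* (q :* c) :+ con 2 :* q :* t :* e :+ g :* e)) refl
     id₃ : ∀ q c e t → (q + 2) * c + q * e + 2 * q * suc t * e + (q + 2) * e + (4 * t * e + 2 * e) ≡ (q + 2) * c + (q + 2) * (2 * suc t) * e + 2 * q * e
     id₃ = solve 4 (λ q c e t → (q :+ con 2) :* c :+ q :* e :+ con 2 :* q :* (con 1 :+ t) :* e :+ (q :+ con 2) :* e :+ (con 4 :* t :* e :+ con 2 :* e) := (q :+ con 2) :* c :+ (q :+ con 2) :* (con 2 :* (con 1 :+ t)) :* e :+ con 2 :* q :* e) refl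
     id₄ : ∀ g h c t e q → h * (g * c + g * t * e + 2 * q * e) ≡ g * h * (c + t * e) + 2 * q * (h * e)
     id₄ = solve 6 (λ g h c t e q → h :* (g :* c :+ g :* t :* e :+ con 2 :* q :* e) := g :* h :* (c :+ t :* e) :+ con 2 :* q :* (h :* e)) refl

   low-step : ∀ A c l r n → l + r ≡ c → 2 * (q * r) ≤ g * c + q * E₀ → Low A l n → Low (suc A) c n
   low-step A c l r n refl h ih = begin
     o * o ^ A * (l + r) + q * q ^ A * E₀ ≡⟨ id₁ o (o ^ A) (l + r) (q * q ^ A * E₀) ⟩
     o ^ A * (o * (l + r)) + q * q ^ A * E₀ ≤⟨ +-monoˡ-≤ (q * q ^ A * E₀) (*-monoʳ-≤ (o ^ A) child) ⟩
     o ^ A * (2 * q * l + q * E₀) + q * q ^ A * E₀ ≡⟨ id₂ (o ^ A) q l E₀ (q ^ A) ⟩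
     2 * q * (o ^ A * l) + q * (o ^ A * E₀) + q * (q ^ A * E₀) ≤⟨ +-monoˡ-≤ (q * (q ^ A * E₀)) (+-monoʳ-≤ (2 * q * (o ^ A * l)) (*-monoʳ-≤ q (*-monoˡ-≤ E₀ (^-monoˡ-≤ A o≤q)))) ⟩
     2 * q * (o ^ A * l) + q * (q ^ A * E₀) + q * (q ^ A * E₀) ≡⟨ id₃ q (o ^ A * l) (q ^ A * E₀) ⟩
     2 * q * (o ^ A * l + q ^ A * E₀) ≤⟨ *-monoʳ-≤ (2 * q) ih ⟩
     2 * q * ((2 * q) ^ A * (n + E₀)) ≡⟨ *-assoc (2 * q) ((2 * q) ^ A) (n + E₀) ⟨
     2 * q * (2 * q) ^ A * (n + E₀) ∎
     where
     open ≤-Reasoning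
     child : o * (l + r) ≤ 2 * q * l + q * E₀
     child = +-cancelʳ-≤ (g * (l + r)) _ _ (begin
       o * (l + r) + g * (l + r) ≡⟨ trans (id₄ o q (l + r)) (trans (cong (λ z → (z + q) * (l + r)) o+2) (id₅ q l r)) ⟩
       2 * q * l + 2 * (q * r) ≤⟨ +-monoʳ-≤ (2 * q * l) h ⟩
       2 * q * l + (g * (l + r) + q * E₀) ≡⟨ id₆ (2 * q * l) (g * (l + r)) (q * E₀) ⟩
       2 * q * l + q * E₀ + g * (l + r) ∎)
       where
       id₄ : ∀ o q c → o * c + (q + 2) * c ≡ (o + 2 + q) * c
       id₄ = solve 3 (λ o q c → o :* c :+ (q :+ con 2) :* c := (o :+ con 2 :+ q) :* c) refl
       id₅ : ∀ q l r → (q + q) * (l + r) ≡ 2 * q * l + 2 * (q * r)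
       id₅ = solve 3 (λ q l r → (q :+ q) :* (l :+ r) := con 2 :* q :* l :+ con 2 :* (q :* r)) refl
       id₆ : ∀ a b c → a + (b + c) ≡ a + c + b
       id₆ = solve 3 (λ a b c → a :+ (b :+ c) := a :+ c :+ b) refl
     id₁ : ∀ o h c x → o * h * c + x ≡ h * (o * c) + x
     id₁ = solve 4 (λ o h c x → o :* h :* c :+ x := h :* (o :* c) :+ x) refl
     id₂ : ∀ h q l e k → h * (2 * q * l + q * e) + q * k * e ≡ 2 * q * (h * l) + q * (h * e) + q * (k * e)
     id₂ = solve 5 (λ h q l e k → h :* (con 2 :* q :* l :+ q :* e) :+ q :* k :* e := con 2 :* q :* (h :* l) :+ q :* (h :* e) :+ q :* (k :* e)) refl
     id₃ : ∀ q x y → 2 * q * x + q * y + q * y ≡ 2 * q * (x + y)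
     id₃ = solve 3 (λ q x y → con 2 :* q :* x :+ q :* y :+ q :* y := con 2 :* q :* (x :+ y)) refl

   Balanced : ∀ A → Array A → Array A → Set
   Balanced A v w = (∀ f s → ∃₂ λ f′ s′ → w f s ≡ v f′ s′) × (Injective₂ A v → Injective₂ A w) ×
     (∀ i f → High A (total A v i) (cnt m₀ (φ i ∘ w f)) × Low A (total A v i) (cnt m₀ (φ i ∘ w f)))

   module Step (A : ℕ) (v : Array (suc A)) where

     n = pw A

     -- The two halves are paired entry by entry, and one bit per pair decides which vertex goes
     -- left. So the parts have exactly equal size and no vertex is lost or repeated.
     lo hi : Fin (n * m₀) → V
     lo z = v (proj₁ (remQuot {n} m₀ z) ↑ˡ n) (proj₂ (remQuot {n} m₀ z))
     hi z = v (n ↑ʳ proj₁ (remQuot {n} m₀ z)) (proj₂ (remQuot {n} m₀ z))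

     χ : Fin n → Fin m₀ → Bool
     χ f s = proj₁ (split (n * m₀) lo hi) (combine f s)

     left right : Array A
     left  f s = pick (χ f s) (v (f ↑ˡ n) s) (v (n ↑ʳ f) s)
     right f s = pick (χ f s) (v (n ↑ʳ f) s) (v (f ↑ˡ n) s)

     total-sum : ∀ i → total A left i + total A right i ≡ total (suc A) v i
     total-sum i = trans (sym (∑-+ n _ _)) (trans (∑-cong n (λ f → trans (sym (∑-+ m₀ _ _)) (trans (∑-cong m₀ (λ s → pt (χ f s) (v (f ↑ˡ n) s) (v (n ↑ʳ f) s))) (∑-+ m₀ _ _)))) (trans (∑-+ n _ _) (sym (∑-++ n n _))))
       where
       pt : ∀ c x y → 𝟙 (φ i (pick c x y)) + 𝟙 (φ i (pick c y x)) ≡ 𝟙 (φ i x) + 𝟙 (φ i y)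
       pt true x y = refl
       pt false x y = +-comm (𝟙 (φ i y)) (𝟙 (φ i x))

     flat : ∀ (u : Fin (n * m₀) → ℕ) → ∑ (n * m₀) u ≡ ∑ n (λ f → ∑ m₀ (λ s → u (combine f s)))
     flat u = ∑-combine n m₀ u

     flat-left : ∀ i → cnt (n * m₀) (λ a → φ i (pick (proj₁ (split (n * m₀) lo hi) a) (lo a) (hi a))) ≡ total A left i
     flat-left i = trans (flat _) (∑-cong n (λ f → ∑-cong m₀ (λ s → cong (λ z → 𝟙 (φ i (pick (χ f s) (v (proj₁ z ↑ˡ n) (proj₂ z)) (v (n ↑ʳ proj₁ z) (proj₂ z))))) (FP.remQuot-combine f s))))

     flat-right : ∀ i → cnt (n * m₀) (λ a → φ i (pick (proj₁ (split (n * m₀) lo hi) a) (hi a) (lo a))) ≡ total A right i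
     flat-right i = trans (flat _) (∑-cong n (λ f → ∑-cong m₀ (λ s → cong (λ z → 𝟙 (φ i (pick (χ f s) (v (n ↑ʳ proj₁ z) (proj₂ z)) (v (proj₁ z ↑ˡ n) (proj₂ z))))) (FP.remQuot-combine f s))))

     halves : ∀ i → 2 * (q * total A left i) ≤ g * total (suc A) v i + q * E₀ × 2 * (q * total A right i) ≤ g * total (suc A) v i + q * E₀
     halves i = subst₂ (λ L R → 2 * (q * L) ≤ g * total (suc A) v i + q * E₀ × 2 * (q * R) ≤ g * total (suc A) v i + q * E₀) (flat-left i) (flat-right i)
       (subst (λ c → 2 * (q * flatL) ≤ g * c + q * E₀ × 2 * (q * flatR) ≤ g * c + q * E₀) (trans (cong₂ _+_ (flat-left i) (flat-right i)) (total-sum i))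
         (proj₂ (split (n * m₀) lo hi) i))
       where
       flatL = cnt (n * m₀) (λ a → φ i (pick (proj₁ (split (n * m₀) lo hi) a) (lo a) (hi a)))
       flatR = cnt (n * m₀) (λ a → φ i (pick (proj₁ (split (n * m₀) lo hi) a) (hi a) (lo a)))

     from-v : ∀ c f s → ∃₂ λ f′ s′ → pick c (v (f ↑ˡ n) s) (v (n ↑ʳ f) s) ≡ v f′ s′
     from-v true  f s = _ , _ , refl
     from-v false f s = _ , _ , refl

     from-v′ : ∀ c f s → ∃₂ λ f′ s′ → pick c (v (n ↑ʳ f) s) (v (f ↑ˡ n) s) ≡ v f′ s′
     from-v′ true  f s = _ , _ , refl
     from-v′ false f s = _ , _ , refl

     ↑≢ : ∀ (f f′ : Fin n) → f ↑ˡ n ≢ n ↑ʳ f′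
     ↑≢ f f′ eq with trans (sym (FP.splitAt-↑ˡ n f n)) (trans (cong (splitAt n) eq) (FP.splitAt-↑ʳ n n f′))
     ... | ()

     module _ (inj : Injective₂ (suc A) v) where

       ↑ˡ-inj : ∀ f s f′ s′ → v (f ↑ˡ n) s ≡ v (f′ ↑ˡ n) s′ → (f , s) ≡ (f′ , s′)
       ↑ˡ-inj f s f′ s′ eq with inj _ _ _ _ eq
       ... | eq′ = cong₂ _,_ (FP.↑ˡ-injective n f f′ (,-injectiveˡ eq′)) (×P.,-injectiveʳ eq′)

       ↑ʳ-inj : ∀ f s f′ s′ → v (n ↑ʳ f) s ≡ v (n ↑ʳ f′) s′ → (f , s) ≡ (f′ , s′)
       ↑ʳ-inj f s f′ s′ eq with inj _ _ _ _ eq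
       ... | eq′ = cong₂ _,_ (FP.↑ʳ-injective n f f′ (,-injectiveˡ eq′)) (×P.,-injectiveʳ eq′)

       mixed : ∀ f s f′ s′ → v (f ↑ˡ n) s ≢ v (n ↑ʳ f′) s′
       mixed f s f′ s′ eq = ↑≢ f f′ (,-injectiveˡ (inj _ _ _ _ eq))

       left-inj : Injective₂ A left
       left-inj f s f′ s′ eq with χ f s | χ f′ s′
       ... | true  | true  = ↑ˡ-inj f s f′ s′ eq
       ... | false | false = ↑ʳ-inj f s f′ s′ eq
       ... | true  | false = ⊥-elim (mixed f s f′ s′ eq)
       ... | false | true  = ⊥-elim (mixed f′ s′ f s (sym eq))

       right-inj : Injective₂ A right
       right-inj f s f′ s′ eq with χ f s | χ f′ s′
       ... | true  | true  = ↑ʳ-inj f s f′ s′ eq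
       ... | false | false = ↑ˡ-inj f s f′ s′ eq
       ... | true  | false = ⊥-elim (mixed f′ s′ f s (sym eq))
       ... | false | true  = ⊥-elim (mixed f s f′ s′ eq)

       left≢right : ∀ f s f′ s′ → left f s ≢ right f′ s′
       left≢right f s f′ s′ eq with χ f s in c | χ f′ s′ in c′
       ... | true  | true  = mixed f s f′ s′ eq
       ... | false | false = mixed f′ s′ f s (sym eq)
       ... | true  | false with ↑ˡ-inj f s f′ s′ eq
       ...   | refl with trans (sym c) c′
       ...     | ()
       left≢right f s f′ s′ eq | false | true with ↑ʳ-inj f s f′ s′ eq
       ...   | refl with trans (sym c) c′
       ...     | ()

   abstract
     balanced : ∀ A (v : Array A) → ∃ λ w → Balanced A v w
     balanced zero v = v , (λ f s → f , s , refl) , id , λ { i zero → high i , low i }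
       where
       high : ∀ i → High 0 (total 0 v i) (cnt m₀ (φ i ∘ v zero))
       high i = ≤-reflexive (id₁ (cnt m₀ (φ i ∘ v zero)) E₀)
         where
         id₁ : ∀ n e → 1 * n + 1 * e ≡ 1 * (n + 0 + 1 * e)
         id₁ = solve 2 (λ n e → con 1 :* n :+ con 1 :* e := con 1 :* (n :+ con 0 :+ con 1 :* e)) refl
       low : ∀ i → Low 0 (total 0 v i) (cnt m₀ (φ i ∘ v zero))
       low i = ≤-reflexive (id₁ (cnt m₀ (φ i ∘ v zero)) E₀)
         where
         id₁ : ∀ n e → 1 * (n + 0) + 1 * e ≡ 1 * (n + e)
         id₁ = solve 2 (λ n e → con 1 :* (n :+ con 0) :+ con 1 :* e := con 1 :* (n :+ e)) refl
     balanced (suc A) v with balanced A (Step.left A v) | balanced A (Step.right A v)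
     ... | wl , srcl , injl , bl | wr , srcr , injr , br = w , src , inj , bounds
       where
       open Step A v
       w : Array (suc A)
       w f s = [ (λ f → wl f s) , (λ f → wr f s) ]′ (splitAt n f)
       src : ∀ f s → ∃₂ λ f′ s′ → w f s ≡ v f′ s′
       src f s with splitAt n f
       ... | inj₁ f₁ with srcl f₁ s
       ...   | f₂ , s₂ , eq with from-v (χ f₂ s₂) f₂ s₂
       ...     | f₃ , s₃ , eq′ = f₃ , s₃ , trans eq eq′
       src f s | inj₂ f₁ with srcr f₁ s
       ...   | f₂ , s₂ , eq with from-v′ (χ f₂ s₂) f₂ s₂
       ...     | f₃ , s₃ , eq′ = f₃ , s₃ , trans eq eq′
       inj : Injective₂ (suc A) v → Injective₂ (suc A) w
       inj iv f s f′ s′ eq with splitAt n f in e | splitAt n f′ in e′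
       ... | inj₁ f₁ | inj₁ f₂ with injl (left-inj iv) f₁ s f₂ s′ eq
       ...   | refl = cong (_, s) (trans (sym (FP.splitAt⁻¹-↑ˡ e)) (FP.splitAt⁻¹-↑ˡ e′))
       inj iv f s f′ s′ eq | inj₂ f₁ | inj₂ f₂ with injr (right-inj iv) f₁ s f₂ s′ eq
       ...   | refl = cong (_, s) (trans (sym (FP.splitAt⁻¹-↑ʳ {i = f} e)) (FP.splitAt⁻¹-↑ʳ {i = f′} e′))
       inj iv f s f′ s′ eq | inj₁ f₁ | inj₂ f₂ with srcl f₁ s | srcr f₂ s′
       ...   | a , b , p | a′ , b′ , p′ = ⊥-elim (left≢right iv a b a′ b′ (trans (sym p) (trans eq p′)))
       inj iv f s f′ s′ eq | inj₂ f₁ | inj₁ f₂ with srcr f₁ s | srcl f₂ s′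
       ...   | a , b , p | a′ , b′ , p′ = ⊥-elim (left≢right iv a′ b′ a b (trans (sym p′) (trans (sym eq) p)))
       bounds : ∀ i f → High (suc A) (total (suc A) v i) (cnt m₀ (φ i ∘ w f)) × Low (suc A) (total (suc A) v i) (cnt m₀ (φ i ∘ w f))
       bounds i f with splitAt n f
       ... | inj₁ f₁ = high-step A _ (total A left i) _ (proj₁ (halves i)) (proj₁ (bl i f₁)) ,
             low-step A _ (total A left i) (total A right i) _ (total-sum i) (proj₂ (halves i)) (proj₂ (bl i f₁))
       ... | inj₂ f₁ = high-step A _ (total A right i) _ (proj₂ (halves i)) (proj₁ (br i f₁)) ,
             low-step A _ (total A right i) (total A left i) _ (trans (+-comm (total A right i) _) (total-sum i)) (proj₁ (halves i)) (proj₂ (br i f₁))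

 -- From fine classes to the data of the construction.

 module Buckets (h : ℕ) .{{_ : NonZero h}} where

   hashN : ∀ {N} → Fin N → Fin h
   hashN x = fromℕ< (m%n<n (toℕ x) h)

   bucketN : ∀ {N} → Fin h → List (Fin N)
   bucketN {N} s = filter (λ x → hashN x FP.≟ s) (allFin N)

   ∈bucketN : ∀ {N} (x : Fin N) → x ∈ bucketN (hashN x)
   ∈bucketN {N} x = ∈-filter⁺ (λ y → hashN y FP.≟ hashN x) (∈-allFin x) refl

   bucketN≤ : ∀ {N} (s : Fin h) → length (bucketN {N} s) ≤ suc (N / h)
   bucketN≤ {N} s = begin
     length (bucketN {N} s) ≡⟨ length-map level (bucketN {N} s) ⟨
     length (map level (bucketN {N} s)) ≤⟨ unique-length≤ (map level (bucketN {N} s)) (allFin (suc (N / h)))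
         (unique-map level (bucketN s) (UP.filter⁺ (λ x → hashN x FP.≟ s) (UP.allFin⁺ N)) inj) (λ x _ → ∈-allFin x) ⟩
     length (allFin (suc (N / h))) ≡⟨ length-tabulate id ⟩
     suc (N / h) ∎
     where
     open ≤-Reasoning
     level : Fin N → Fin (suc (N / h))
     level x = fromℕ< (s≤s (/-mono-≤ {o = h} (<⇒≤ (FP.toℕ<n x)) ≤-refl))
     hash≡ : ∀ x → x ∈ bucketN s → toℕ x % h ≡ toℕ s
     hash≡ x p = trans (sym (FP.toℕ-fromℕ< _)) (cong toℕ (proj₂ (∈-filter⁻ (λ x → hashN x FP.≟ s) {xs = allFin N} p)))
     inj : ∀ x y → x ∈ bucketN s → y ∈ bucketN s → level x ≡ level y → x ≡ y
     inj x y p q eq = FP.toℕ-injective (trans (m≡m%n+[m/n]*n (toℕ x) h) (trans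
       (cong₂ (λ a b → a + b * h) (trans (hash≡ x p) (sym (hash≡ y q))) (trans (sym (FP.toℕ-fromℕ< _)) (trans (cong toℕ eq) (FP.toℕ-fromℕ< _))))
       (sym (m≡m%n+[m/n]*n (toℕ y) h))))

 ∧-intro : ∀ {a b} → a ≡ true → b ≡ true → a ∧ b ≡ true
 ∧-intro refl refl = refl

 -- In fine c a b, the class is c and a, b are the α- and β-labels.
 record Fine (U : Set) (E : U → U → Bool) (K Q m₀ ℓ : ℕ) : Set where
   field
     fine : Fin K → Fin Q → Fin Q → Fin m₀ → U
     left : Fin ℓ → U
     fine-injective : ∀ {c a b s c′ a′ b′ s′} → fine c a b s ≡ fine c′ a′ b′ s′ → (c ≡ c′ × a ≡ a′) × (b ≡ b′ × s ≡ s′)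
     dlo dhi clo chi : ℕ
     outlo : ∀ u c a b → dlo ≤ cnt m₀ (λ s → E u (fine c a b s))
     inlo  : ∀ u c a b → dlo ≤ cnt m₀ (λ s → E (fine c a b s) u)
     outhi : ∀ u c a b → cnt m₀ (λ s → E u (fine c a b s)) ≤ dhi
     inhi  : ∀ u c a b → cnt m₀ (λ s → E (fine c a b s) u) ≤ dhi
     outoutlo : ∀ u v c a b → u ≢ v → clo ≤ cnt m₀ (λ s → E u (fine c a b s) ∧ E v (fine c a b s))
     outinlo  : ∀ u v c a b → u ≢ v → clo ≤ cnt m₀ (λ s → E u (fine c a b s) ∧ E (fine c a b s) v)
     outouthi : ∀ u v c a b → u ≢ v → cnt m₀ (λ s → E u (fine c a b s) ∧ E v (fine c a b s)) ≤ chi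
     ininhi   : ∀ u v c a b → u ≢ v → cnt m₀ (λ s → E (fine c a b s) u ∧ E (fine c a b s) v) ≤ chi

 module Labelled (Q m₀ : ℕ) where

   m : ℕ
   m = Q * Q * m₀

   αL βL : Fin m → Fin Q
   αL x = proj₁ (remQuot {Q} Q (proj₁ (remQuot {Q * Q} m₀ x)))
   βL x = proj₂ (remQuot {Q} Q (proj₁ (remQuot {Q * Q} m₀ x)))

   sL : Fin m → Fin m₀
   sL x = proj₂ (remQuot {Q * Q} m₀ x)

   mk : Fin Q → Fin Q → Fin m₀ → Fin m
   mk a b s = combine (combine a b) s

   α-mk : ∀ a b s → αL (mk a b s) ≡ a
   α-mk a b s = trans (cong (λ p → proj₁ (remQuot {Q} Q (proj₁ p))) (FP.remQuot-combine (combine a b) s)) (cong proj₁ (FP.remQuot-combine a b))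

   β-mk : ∀ a b s → βL (mk a b s) ≡ b
   β-mk a b s = trans (cong (λ p → proj₂ (remQuot {Q} Q (proj₁ p))) (FP.remQuot-combine (combine a b) s)) (cong proj₂ (FP.remQuot-combine a b))

   s-mk : ∀ a b s → sL (mk a b s) ≡ s
   s-mk a b s = cong proj₂ (FP.remQuot-combine (combine a b) s)

   mk-surjective : ∀ x → mk (αL x) (βL x) (sL x) ≡ x
   mk-surjective x = trans (cong (λ z → combine z (sL x)) (FP.combine-remQuot {Q} Q (proj₁ (remQuot {Q * Q} m₀ x)))) (FP.combine-remQuot {Q * Q} m₀ x)

   cnt-mk : ∀ P → cnt m P ≡ ∑ Q (λ a → ∑ Q (λ b → cnt m₀ (λ s → P (mk a b s))))
   cnt-mk P = trans (∑-combine (Q * Q) m₀ (𝟙 ∘ P)) (∑-combine Q Q _)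

   cnt-lower : ∀ (P : Fin m → Bool) (w : Fin Q → Fin Q → Bool) (R : Fin Q → Fin Q → Fin m₀ → Bool) l →
     (∀ a b s → R a b s ≡ true → w a b ≡ true → P (mk a b s) ≡ true) → (∀ a b → w a b ≡ true → l ≤ cnt m₀ (R a b)) →
     l * ∑ Q (λ a → cnt Q (w a)) ≤ cnt m P
   cnt-lower P w R l imp low = begin
     l * ∑ Q (λ a → cnt Q (w a)) ≡⟨ trans (∑-cong Q (λ a → ∑-*ˡ Q l (𝟙 ∘ w a))) (∑-*ˡ Q l (λ a → cnt Q (w a))) ⟨
     ∑ Q (λ a → ∑ Q (λ b → l * 𝟙 (w a b))) ≤⟨ ∑-mono Q (λ a → ∑-mono Q (λ b → cell a b)) ⟩
     ∑ Q (λ a → ∑ Q (λ b → cnt m₀ (λ s → P (mk a b s)))) ≡⟨ cnt-mk P ⟨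
     cnt m P ∎
     where
     open ≤-Reasoning
     cell : ∀ a b → l * 𝟙 (w a b) ≤ cnt m₀ (λ s → P (mk a b s))
     cell a b with w a b in eq
     ... | false = ≤-trans (≤-reflexive (*-zeroʳ l)) z≤n
     ... | true  = ≤-trans (≤-reflexive (*-identityʳ l)) (≤-trans (low a b eq) (cnt-mono m₀ (λ s r → imp a b s r eq)))

   cnt-upper : ∀ (P : Fin m → Bool) (R : Fin Q → Fin Q → Fin m₀ → Bool) u →
     (∀ a b s → P (mk a b s) ≡ true → R a b s ≡ true) → (∀ a b → cnt m₀ (R a b) ≤ u) → cnt m P ≤ Q * Q * u
   cnt-upper P R u imp up = begin
     cnt m P ≡⟨ cnt-mk P ⟩
     ∑ Q (λ a → ∑ Q (λ b → cnt m₀ (λ s → P (mk a b s)))) ≤⟨ ∑-mono Q (λ a → ∑-mono Q (λ b → ≤-trans (cnt-mono m₀ (imp a b)) (up a b))) ⟩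
     ∑ Q (λ a → ∑ Q (λ b → u)) ≡⟨ trans (∑-cong Q (λ _ → ∑-const Q u)) (∑-const Q (Q * u)) ⟩
     Q * (Q * u) ≡⟨ *-assoc Q Q u ⟨
     Q * Q * u ∎
     where open ≤-Reasoning

   row-weight : ∀ (w : Fin Q → Bool) → ∑ Q (λ a → cnt Q w) ≡ Q * cnt Q w
   row-weight w = ∑-const Q (cnt Q w)

 -- The purely numerical requirements, separated from the graph; they are verified for the concrete
 -- parameters in `Scaled`.
 record Room (K q m₀ ℓ B h r ω e cap dlo dhi clo chi δ : ℕ) .{{_ : NonZero B}} .{{_ : NonZero h}} : Set where
   Q : ℕ
   Q = q * 16

   m : ℕ
   m = Q * Q * m₀

   Th : ℕ
   Th = suc (r / B)

   g₀ : ℕ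
   g₀ = suc cap + suc (ℓ / h)

   field
     K≡       : K ≡ suc e + ω
     host-room : B * h ≤ e
     0<e      : 0 < e
     0<q      : 0 < q
     0<m₀     : 0 < m₀
     balance-room : ω * m + (ω * r + ω * r) < h * suc cap
     in-room  : suc cap + g₀ < Q * dlo
     out-room : Th + (suc cap + g₀) < Q * clo
     left-room : r + g₀ < Q * Q * dlo
     connect-room : m + (r + r) < ω * clo
     δ-room   : δ + (Th + Th + g₀) ≤ Q * ((Q ∸ 16) * dlo)
     par      : Parameters m δ (Q * Q * dhi) (Q * Q * chi) r
     1≤r      : 1 ≤ r

 module BuildSetup (κ q m₀ ℓ B h r ω e cap δ : ℕ) .{{_ : NonZero B}} .{{_ : NonZero h}}
   {U : Set} {E : U → U → Bool} (fn : Fine U E (2 ^ κ) (q * 16) m₀ ℓ)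
   (rm : Room (2 ^ κ) q m₀ ℓ B h r ω e cap (Fine.dlo fn) (Fine.dhi fn) (Fine.clo fn) (Fine.chi fn) δ) where

   open Fine fn
   open Room rm
   open Labelled Q m₀ hiding (m)
   open TableTagging q
   open Buckets

   VV : Set
   VV = (Fin (2 ^ κ) × Fin m) ⊎ Fin ℓ

   θ : VV → U
   θ (inj₁ (c , x)) = fine c (αL x) (βL x) (sL x)
   θ (inj₂ l)       = left l

   adjV : VV → VV → Bool
   adjV u v = E (θ u) (θ v)

   tagM : Fin Q → Fin Q → Bool
   tagM b a = isMain (tagQ b a)

   θ-mk : ∀ c a b s → θ (inj₁ (c , mk a b s)) ≡ fine c a b s
   θ-mk c a b s = trans (cong₂ (λ a′ b′ → fine c a′ b′ (sL (mk a b s))) (α-mk a b s) (β-mk a b s)) (cong (fine c a b) (s-mk a b s))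

   θ-injective : ∀ c c′ x x′ → θ (inj₁ (c , x)) ≡ θ (inj₁ (c′ , x′)) → c ≡ c′ × x ≡ x′
   θ-injective c c′ x x′ eq with fine-injective eq
   ... | (c≡ , a≡) , (b≡ , s≡) = c≡ , trans (sym (mk-surjective x)) (trans (cong₂ (λ a b → mk a b (sL x)) a≡ b≡) (trans (cong (mk (αL x′) (βL x′)) s≡) (mk-surjective x′)))

   private
     to-out : ∀ u c a b s → E u (fine c a b s) ≡ true → E u (θ (inj₁ (c , mk a b s))) ≡ true
     to-out u c a b s p = trans (cong (E u) (θ-mk c a b s)) p
     to-in : ∀ u c a b s → E (fine c a b s) u ≡ true → E (θ (inj₁ (c , mk a b s))) u ≡ true
     to-in u c a b s p = trans (cong (λ z → E z u) (θ-mk c a b s)) p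
     of-out : ∀ u c a b s → E u (θ (inj₁ (c , mk a b s))) ≡ true → E u (fine c a b s) ≡ true
     of-out u c a b s p = trans (sym (cong (E u) (θ-mk c a b s))) p
     of-in : ∀ u c a b s → E (θ (inj₁ (c , mk a b s))) u ≡ true → E (fine c a b s) u ≡ true
     of-in u c a b s p = trans (sym (cong (λ z → E z u) (θ-mk c a b s))) p

     eqF-of : ∀ {n} {i j : Fin n} → i ≡ j → eqF i j ≡ true
     eqF-of refl = eqF-refl _

     -- exactly one admissible label in one coordinate
     column-count : ∀ b → ∑ Q (λ (a : Fin Q) → cnt Q (λ b′ → eqF b′ b)) ≡ Q
     column-count b = trans (∑-cong Q (λ _ → ∑-δ Q b)) (trans (∑-const Q 1) (*-identityʳ Q))

     row-count : ∀ a → ∑ Q (λ a′ → cnt Q (λ (b′ : Fin Q) → eqF a′ a)) ≡ Q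
     row-count a = trans (∑-comm Q Q (λ a′ _ → 𝟙 (eqF a′ a))) (column-count a)

     cell-count : ∀ a b → ∑ Q (λ a′ → cnt Q (λ b′ → eqF b′ b ∧ eqF a′ a)) ≡ 1
     cell-count a b = trans (∑-cong Q (λ a′ → ∑-δ∧′ b (eqF a′ a))) (∑-δ Q a)
       where
       ∑-δ∧′ : ∀ b c → cnt Q (λ b′ → eqF b′ b ∧ c) ≡ 𝟙 c
       ∑-δ∧′ b c = ∑-δ∧ {0} {0} Q b (λ _ → c)

     all-count : ∑ Q (λ (a : Fin Q) → cnt Q (λ (b : Fin Q) → true)) ≡ Q * Q
     all-count = trans (∑-cong Q (λ _ → trans (∑-const Q 1) (*-identityʳ Q))) (∑-const Q Q)

     same-quotient : ∀ (z : Fin q) → cnt Q (λ a → eqF (quotL a) z) ≡ 16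
     same-quotient z = trans (∑-combine q 16 _) (trans (∑-cong q (λ i → trans (∑-cong 16 (λ j → cong (λ p → 𝟙 (eqF (proj₁ p) z)) (FP.remQuot-combine {q} {16} i j)))
       (∑-const 16 (𝟙 (eqF i z))))) (trans (∑-*ˡ q 16 (λ i → 𝟙 (eqF i z))) (trans (cong (16 *_) (∑-δ q z)) refl)))

     main-count : ∀ (f : Fin Q → Bool) (z : Fin q) → (∀ a → quotL a ≢ z → f a ≡ true) → Q ∸ 16 ≤ cnt Q f
     main-count f z ok = m≤n+o⇒m∸o≤n′ (begin
       Q ≡⟨ trans (∑-const Q 1) (*-identityʳ Q) ⟨
       ∑ Q (λ _ → 1) ≤⟨ ∑-mono Q pt ⟩
       ∑ Q (λ a → 𝟙 (f a) + 𝟙 (eqF (quotL a) z)) ≡⟨ ∑-+ Q _ _ ⟩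
       cnt Q f + cnt Q (λ a → eqF (quotL a) z) ≡⟨ cong (cnt Q f +_) (same-quotient z) ⟩
       cnt Q f + 16 ∎)
       where
       open ≤-Reasoning
       m≤n+o⇒m∸o≤n′ : ∀ {m n o} → m ≤ n + o → m ∸ o ≤ n
       m≤n+o⇒m∸o≤n′ {m} {n} {o} le = ≤-trans (∸-monoˡ-≤ o le) (≤-reflexive (m+n∸n≡m n o))
       pt : ∀ a → 1 ≤ 𝟙 (f a) + 𝟙 (eqF (quotL a) z)
       pt a with quotL a FP.≟ z
       ... | yes _ = m≤n+m 1 _
       ... | no ne rewrite ok a ne = ≤-refl

     row-main : ∀ b → Q ∸ 16 ≤ cnt Q (λ a → tagM b a)
     row-main b = main-count _ (quotL b) (λ a ne → cong isMain (tagQ-main b a (ne ∘ sym)))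

     col-main : ∀ a → Q ∸ 16 ≤ cnt Q (λ b → tagM b a)
     col-main a = main-count _ (quotL a) (λ b ne → cong isMain (tagQ-main b a ne))

   setup : Setup
   setup = record
     { K = 2 ^ κ ; m = m ; ℓ = ℓ ; B = B ; h = h ; r = r ; Th = Th ; ω = ω ; e = e ; Q = Q ; cap = cap ; ZL = suc (ℓ / h)
     ; scheme = TriangularScheme.triangular κ
     ; hosting = SpacedHosting.spaced B h e host-room
     ; tagging = tagging
     ; K≡ = K≡
     ; adj = adjV
     ; α = αL ; β = βL
     ; hashL = hashN h
     ; bucketL = bucketN h
     ; ∈bucketL = ∈bucketN h
     ; bucketL≤ = bucketN≤ h
     ; bj = hashN B
     ; batch = bucketN B
     ; ∈batch = ∈bucketN B
     ; batch≤ = bucketN≤ B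
     ; balance-room = balance-room
     ; x₀ = mk₀
     ; 0<e = 0<e
     ; gadget-in = λ c i x b → <-≤-trans in-room (≤-trans (≤-reflexive (trans (*-comm Q dlo) (cong (dlo *_) (sym (column-count b)))))
         (cnt-lower _ (λ a b′ → eqF b′ b) (λ a b′ s → E (fine c a b′ s) (θ (inj₁ (i , x)))) dlo
           (λ a b′ s p w → ∧-intro (to-in _ c a b′ s p) (eqF-of (trans (β-mk a b′ s) (eqF-≡ w)))) (λ a b′ _ → inlo _ c a b′)))
     ; gadget-out = λ c i u x c′ a c≢i → <-≤-trans out-room (≤-trans (≤-reflexive (trans (*-comm Q clo) (cong (clo *_) (sym (row-count a)))))
         (cnt-lower _ (λ a′ b → eqF a′ a) (λ a′ b s → E (θ (inj₁ (c , u))) (fine c′ a′ b s) ∧ E (θ (inj₁ (i , x))) (fine c′ a′ b s)) clo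
           (λ a′ b s p w → ∧-intro (∧-intro (to-out _ c′ a′ b s (proj₁ (∧-true p))) (to-out _ c′ a′ b s (proj₂ (∧-true {E (θ (inj₁ (c , u))) (fine c′ a′ b s)} p)))) (eqF-of (trans (α-mk a′ b s) (eqF-≡ w))))
           (λ a′ b _ → outoutlo _ _ c′ a′ b (λ eq → c≢i (proj₁ (θ-injective c i u x eq))))))
     ; left-in = λ c l → <-≤-trans left-room (≤-trans (≤-reflexive (trans (*-comm (Q * Q) dlo) (cong (dlo *_) (sym all-count))))
         (cnt-lower _ (λ _ _ → true) (λ a b s → E (fine c a b s) (left l)) dlo (λ a b s p _ → to-in _ c a b s p) (λ a b _ → inlo _ c a b)))
     ; left-out = λ c l → <-≤-trans left-room (≤-trans (≤-reflexive (trans (*-comm (Q * Q) dlo) (cong (dlo *_) (sym all-count))))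
         (cnt-lower _ (λ _ _ → true) (λ a b s → E (left l) (fine c a b s)) dlo (λ a b s p _ → to-out _ c a b s p) (λ a b _ → outlo _ c a b)))
     ; c₄ = clo
     ; connect = λ c x c′ y i a b c≢c′ → ≤-trans (≤-reflexive (trans (sym (*-identityʳ clo)) (cong (clo *_) (sym (cell-count a b)))))
         (cnt-lower _ (λ a′ b′ → eqF b′ b ∧ eqF a′ a) (λ a′ b′ s → E (θ (inj₁ (c , x))) (fine i a′ b′ s) ∧ E (fine i a′ b′ s) (θ (inj₁ (c′ , y)))) clo
           (λ a′ b′ s p w → ∧-intro (∧-intro (to-out _ i a′ b′ s (proj₁ (∧-true p))) (to-in _ i a′ b′ s (proj₂ (∧-true {E (θ (inj₁ (c , x))) (fine i a′ b′ s)} p))))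
             (∧-intro (eqF-of (trans (α-mk a′ b′ s) (eqF-≡ (proj₂ (∧-true {eqF b′ b} w))))) (eqF-of (trans (β-mk a′ b′ s) (eqF-≡ (proj₁ (∧-true {eqF b′ b} w)))))))
           (λ a′ b′ _ → outinlo _ _ i a′ b′ (λ eq → c≢c′ (proj₁ (θ-injective c c′ x y eq)))))
     ; connect-room = connect-room
     ; δ₀ = Q * ((Q ∸ 16) * dlo) ; δ = δ ; Δ = Q * Q * dhi ; C = Q * Q * chi
     ; rowδ₀ = λ c c′ x → ≤-trans (weigh (≤-trans (*-monoʳ-≤ Q (row-main (βL x))) (≤-reflexive (sym (row-total x)))))
         (cnt-lower _ (λ a b → tagM (βL x) a) (λ a b s → E (θ (inj₁ (c , x))) (fine c′ a b s)) dlo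
           (λ a b s p w → ∧-intro (to-out _ c′ a b s p) (trans (cong (tagM (βL x)) (α-mk a b s)) w)) (λ a b _ → outlo _ c′ a b))
     ; colδ₀ = λ c c′ y → ≤-trans (weigh (≤-trans (*-monoʳ-≤ Q (col-main (αL y))) (≤-reflexive (sym (row-weight _)))))
         (cnt-lower _ (λ a b → tagM b (αL y)) (λ a b s → E (fine c a b s) (θ (inj₁ (c′ , y)))) dlo
           (λ a b s p w → ∧-intro (to-in _ c a b s p) (trans (cong (λ z → tagM z (αL y)) (β-mk a b s)) w)) (λ a b _ → inlo _ c a b))
     ; rowΔ₀ = λ c c′ x → cnt-upper _ (λ a b s → E (θ (inj₁ (c , x))) (fine c′ a b s)) dhi
         (λ a b s p → of-out _ c′ a b s (proj₁ (∧-true p))) (λ a b → outhi _ c′ a b)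
     ; colΔ₀ = λ c c′ y → cnt-upper _ (λ a b s → E (fine c a b s) (θ (inj₁ (c′ , y)))) dhi
         (λ a b s p → of-in _ c a b s (proj₁ (∧-true p))) (λ a b → inhi _ c a b)
     ; rowC₀ = λ c c′ x x′ ne → cnt-upper _ (λ a b s → E (θ (inj₁ (c , x))) (fine c′ a b s) ∧ E (θ (inj₁ (c , x′))) (fine c′ a b s)) chi
         (λ a b s p → ∧-intro (of-out _ c′ a b s (proj₁ (∧-true (proj₁ (∧-true p)))))
           (of-out _ c′ a b s (proj₁ (∧-true (proj₂ (∧-true {adjV (inj₁ (c , x)) (inj₁ (c′ , mk a b s)) ∧ tagM (βL x) (αL (mk a b s))} p))))))
         (λ a b → outouthi _ _ c′ a b (λ eq → ne (proj₂ (θ-injective c c x x′ eq))))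
     ; colC₀ = λ c c′ y y′ ne → cnt-upper _ (λ a b s → E (fine c a b s) (θ (inj₁ (c′ , y))) ∧ E (fine c a b s) (θ (inj₁ (c′ , y′)))) chi
         (λ a b s p → ∧-intro (of-in _ c a b s (proj₁ (∧-true (proj₁ (∧-true p)))))
           (of-in _ c a b s (proj₁ (∧-true (proj₂ (∧-true {adjV (inj₁ (c , mk a b s)) (inj₁ (c′ , y)) ∧ tagM (βL (mk a b s)) (αL y)} p))))))
         (λ a b → ininhi _ _ c a b (λ eq → ne (proj₂ (θ-injective c′ c′ y y′ eq))))
     ; par = par
     ; 1≤r = 1≤r
     ; room = δ-room
     }
     where
     Q>0 : 0 < Q
     Q>0 = *-mono-≤ 0<q (s≤s {n = 15} z≤n)
     mk₀ : Fin m
     mk₀ = mk (fromℕ< Q>0) (fromℕ< Q>0) (fromℕ< 0<m₀)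
     row-total : ∀ x → ∑ Q (λ a → cnt Q (λ (b : Fin Q) → tagM (βL x) a)) ≡ Q * cnt Q (λ a → tagM (βL x) a)
     row-total x = trans (∑-comm Q Q (λ a _ → 𝟙 (tagM (βL x) a))) (row-weight _)
     weigh : ∀ {S} → Q * (Q ∸ 16) ≤ S → Q * ((Q ∸ 16) * dlo) ≤ dlo * S
     weigh {S} le = ≤-trans (≤-reflexive (trans (sym (*-assoc Q (Q ∸ 16) dlo)) (*-comm (Q * (Q ∸ 16)) dlo))) (*-monoʳ-≤ dlo le)

 -- Splitting the vertices of a digraph.

 module Tests {n : ℕ} (E : Fin n → Fin n → Bool) where

   test : Fin 5 → Fin n → Fin n → Fin n → Bool
   test zero                         a b x = E a x
   test (suc zero)                   a b x = E x a
   test (suc (suc zero))             a b x = E a x ∧ E b x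
   test (suc (suc (suc zero)))       a b x = E a x ∧ E x b
   test (suc (suc (suc (suc zero)))) a b x = E x a ∧ E x b

   -- The two degree tests ignore their second vertex; the uniform indexing by pairs costs only a
   -- constant factor in the number of tests.
   M : ℕ
   M = 5 * (n * n)

   φ : Fin M → Fin n → Bool
   φ i = test (proj₁ kp) (proj₁ ab) (proj₂ ab)
     where
     kp = remQuot {5} (n * n) i
     ab = remQuot {n} n (proj₂ kp)

   index : Fin 5 → Fin n → Fin n → Fin M
   index k a b = combine k (combine a b)

   φ-index : ∀ k a b x → φ (index k a b) x ≡ test k a b x
   φ-index k a b x = trans (cong (λ p → test (proj₁ p) (proj₁ (remQuot {n} n (proj₂ p))) (proj₂ (remQuot {n} n (proj₂ p))) x) (FP.remQuot-combine k (combine a b)))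
     (cong (λ p → test k (proj₁ p) (proj₂ p) x) (FP.remQuot-combine a b))

 split-injective : ∀ {N ℓ n} (f : Fin N → Fin n) (g : Fin ℓ → Fin n) → (∀ y z → f y ≡ f z → y ≡ z) → (∀ y z → g y ≡ g z → y ≡ z) → (∀ y z → f y ≢ g z) →
   ∀ y z → [ f , g ]′ (splitAt N y) ≡ [ f , g ]′ (splitAt N z) → y ≡ z
 split-injective {N} f g f-inj g-inj f≢g y z eq with splitAt N y in ey | splitAt N z in ez
 ... | inj₁ y′ | inj₁ z′ = trans (sym (FP.splitAt⁻¹-↑ˡ ey)) (trans (cong (_↑ˡ _) (f-inj y′ z′ eq)) (FP.splitAt⁻¹-↑ˡ ez))
 ... | inj₂ y′ | inj₂ z′ = trans (sym (FP.splitAt⁻¹-↑ʳ {i = y} ey)) (trans (cong (N ↑ʳ_) (g-inj y′ z′ eq)) (FP.splitAt⁻¹-↑ʳ {i = z} ez))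
 ... | inj₁ y′ | inj₂ z′ = ⊥-elim (f≢g y′ z′ eq)
 ... | inj₂ y′ | inj₁ z′ = ⊥-elim (f≢g z′ y′ (sym eq))

 module Arrange (A m₀ ℓ : ℕ) (p : ℕ) (1≤p : 1 ≤ p) (E : Fin (pw A * m₀ + ℓ) → Fin (pw A * m₀ + ℓ) → Bool) (b : ℕ)
   (2M≤ : 2 * Tests.M E ≤ 2 ^ b) where

   open Tests E
   open Partition p 1≤p φ b 2M≤ m₀ public

   n : ℕ
   n = pw A * m₀ + ℓ

   v₀ : Array A
   v₀ f s = combine f s ↑ˡ ℓ

   v₀-injective : Injective₂ A v₀
   v₀-injective f s f′ s′ eq with FP.combine-injective f s f′ s′ (FP.↑ˡ-injective ℓ (combine f s) (combine f′ s′) eq)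
   ... | refl , refl = refl

   w : Array A
   w = proj₁ (balanced A v₀)

   w-source : ∀ f s → ∃₂ λ f′ s′ → w f s ≡ v₀ f′ s′
   w-source = proj₁ (proj₂ (balanced A v₀))

   w-injective : Injective₂ A w
   w-injective = proj₁ (proj₂ (proj₂ (balanced A v₀))) v₀-injective

   rest : Fin ℓ → Fin n
   rest l = (pw A * m₀) ↑ʳ l

   total≤ : ∀ i → total A v₀ i ≤ cnt n (φ i)
   total≤ i = ≤-trans (≤-reflexive (sym (∑-combine (pw A) m₀ (λ z → 𝟙 (φ i (z ↑ˡ ℓ)))))) (≤-trans (m≤m+n _ _) (≤-reflexive (sym (∑-++ (pw A * m₀) ℓ _))))

   ≤total : ∀ i → cnt n (φ i) ≤ total A v₀ i + ℓ
   ≤total i = ≤-trans (≤-reflexive (∑-++ (pw A * m₀) ℓ _)) (+-mono-≤ (≤-reflexive (∑-combine (pw A) m₀ (λ z → 𝟙 (φ i (z ↑ˡ ℓ)))))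
     (≤-trans (∑-mono ℓ (λ l → 𝟙≤1 _)) (≤-reflexive (trans (∑-const ℓ 1) (*-identityʳ ℓ)))))

   bounds : ∀ k a b f → ∃ λ c → (c ≤ cnt n (test k a b) × cnt n (test k a b) ≤ c + ℓ) ×
     (High A c (cnt m₀ (λ s → test k a b (w f s))) × Low A c (cnt m₀ (λ s → test k a b (w f s))))
   bounds k a b f = total A v₀ i , (subst (total A v₀ i ≤_) c≡ (total≤ i) , subst (_≤ total A v₀ i + ℓ) c≡ (≤total i)) ,
     subst (λ c → High A (total A v₀ i) c × Low A (total A v₀ i) c) (∑-cong m₀ (λ s → cong 𝟙 (φ-index k a b (w f s)))) (proj₂ (proj₂ (proj₂ (balanced A v₀))) i f)
     where
     i = index k a b
     c≡ : cnt n (φ i) ≡ cnt n (test k a b)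
     c≡ = ∑-cong n (λ x → cong 𝟙 (φ-index k a b x))

   perm : Fin n → Fin n
   perm z = [ (λ y → w (proj₁ (remQuot {pw A} m₀ y)) (proj₂ (remQuot {pw A} m₀ y))) , rest ]′ (splitAt (pw A * m₀) z)

   rest≢ : ∀ f s l → w f s ≢ rest l
   rest≢ f s l eq with w-source f s
   ... | f′ , s′ , eq′ with trans (sym (FP.splitAt-↑ˡ (pw A * m₀) (combine f′ s′) ℓ)) (trans (cong (splitAt (pw A * m₀)) (trans (sym eq′) eq)) (FP.splitAt-↑ʳ (pw A * m₀) ℓ l))
   ...   | ()

   perm-injective : ∀ y z → perm y ≡ perm z → y ≡ z
   perm-injective = split-injective (λ y → w (proj₁ (remQuot {pw A} m₀ y)) (proj₂ (remQuot {pw A} m₀ y))) rest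
     (λ y z eq → trans (sym (FP.combine-remQuot {pw A} m₀ y)) (trans (cong (λ q → combine (proj₁ q) (proj₂ q))
       (w-injective (proj₁ (remQuot {pw A} m₀ y)) (proj₂ (remQuot {pw A} m₀ y)) (proj₁ (remQuot {pw A} m₀ z)) (proj₂ (remQuot {pw A} m₀ z)) eq)) (FP.combine-remQuot {pw A} m₀ z)))
     (λ l l′ → FP.↑ʳ-injective (pw A * m₀) l l′)
     (λ y l → rest≢ (proj₁ (remQuot {pw A} m₀ y)) (proj₂ (remQuot {pw A} m₀ y)) l)

   -- `perm` lists fine classes and leftover vertices injectively by n indices, and an injective
   -- self-map of a finite set is onto.
   locate : ∀ u → (∃₂ λ f s → w f s ≡ u) ⊎ (∃ λ l → rest l ≡ u)
   locate u with injective⇒Bij perm perm-injective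
   ... | π , π≡ with splitAt (pw A * m₀) (from π u) | trans (sym (π≡ (from π u))) (to-from π u)
   ...   | inj₁ y | eq = inj₁ (_ , _ , eq)
   ...   | inj₂ l | eq = inj₂ (l , eq)

   module FineClasses (K Q : ℕ) (F≡ : pw A ≡ K * (Q * Q)) (dlo dhi clo chi Dlo Dhi Clo Chi : ℕ)
     (deg-out : ∀ a → Dlo ≤ cnt n (E a) × cnt n (E a) ≤ Dhi)
     (deg-in : ∀ a → Dlo ≤ cnt n (λ x → E x a) × cnt n (λ x → E x a) ≤ Dhi)
     (codeg-out : ∀ a b → a ≢ b → Clo ≤ cnt n (λ x → E a x ∧ E b x) × cnt n (λ x → E a x ∧ E b x) ≤ Chi)
     (codeg-through : ∀ a b → a ≢ b → Clo ≤ cnt n (λ x → E a x ∧ E x b))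
     (codeg-in : ∀ a b → a ≢ b → cnt n (λ x → E x a ∧ E x b) ≤ Chi)
     (d-low : ∀ c k → Dlo ≤ c + ℓ → Low A c k → dlo ≤ k) (d-high : ∀ c k → c ≤ Dhi → High A c k → k ≤ dhi)
     (c-low : ∀ c k → Clo ≤ c + ℓ → Low A c k → clo ≤ k) (c-high : ∀ c k → c ≤ Chi → High A c k → k ≤ chi)
     where

     fineIdx : Fin K → Fin Q → Fin Q → Fin (pw A)
     fineIdx c a b = Fin.cast (sym F≡) (combine c (combine a b))
       where import Data.Fin as Fin

     lower : ∀ {D d} k a b f → (∀ c k → D ≤ c + ℓ → Low A c k → d ≤ k) → D ≤ cnt n (test k a b) → d ≤ cnt m₀ (λ s → test k a b (w f s))
     lower k a b f imp le = imp (proj₁ B) (cnt m₀ (λ s → test k a b (w f s))) (≤-trans le (proj₂ (proj₁ (proj₂ B)))) (proj₂ (proj₂ (proj₂ B)))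
       where B = bounds k a b f

     upper : ∀ {D d} k a b f → (∀ c k → c ≤ D → High A c k → k ≤ d) → cnt n (test k a b) ≤ D → cnt m₀ (λ s → test k a b (w f s)) ≤ d
     upper k a b f imp le = imp (proj₁ B) (cnt m₀ (λ s → test k a b (w f s))) (≤-trans (proj₁ (proj₁ (proj₂ B))) le) (proj₁ (proj₂ (proj₂ B)))
       where B = bounds k a b f

     fineIdx-injective : ∀ {c a b c′ a′ b′} → fineIdx c a b ≡ fineIdx c′ a′ b′ → c ≡ c′ × (a ≡ a′ × b ≡ b′)
     fineIdx-injective {c} {a} {b} {c′} {a′} {b′} eq with FP.combine-injective c (combine a b) c′ (combine a′ b′)
         (trans (sym (FP.cast-involutive F≡ (sym F≡) _)) (trans (cong (Fin.cast F≡) eq) (FP.cast-involutive F≡ (sym F≡) _)))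
       where import Data.Fin as Fin
     ... | refl , eq′ with FP.combine-injective a b a′ b′ eq′
     ...   | refl , refl = refl , refl , refl

     fineIdx-surjective : ∀ f → ∃ λ c → ∃ λ a → ∃ λ b → fineIdx c a b ≡ f
     fineIdx-surjective f with FP.combine-surjective {K} {Q * Q} (Fin.cast F≡ f)
       where import Data.Fin as Fin
     ... | c , ab , eq with FP.combine-surjective {Q} {Q} ab
     ...   | a , b , refl = c , a , b , trans (cong (Fin.cast (sym F≡)) eq) (FP.cast-involutive (sym F≡) F≡ f)
       where import Data.Fin as Fin

     fineClasses : Fine (Fin n) E K Q m₀ ℓ
     fineClasses = record
       { fine = λ c a b s → w (fineIdx c a b) s
       ; left = rest
       ; fine-injective = λ eq → let eq′ = w-injective _ _ _ _ eq ; eqs = fineIdx-injective (,-injectiveˡ eq′) in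
           (proj₁ eqs , proj₁ (proj₂ eqs)) , (proj₂ (proj₂ eqs) , ×P.,-injectiveʳ eq′)
       ; dlo = dlo ; dhi = dhi ; clo = clo ; chi = chi
       ; outlo = λ u c a b → lower zero u u (fineIdx c a b) d-low (proj₁ (deg-out u))
       ; inlo = λ u c a b → lower (suc zero) u u (fineIdx c a b) d-low (proj₁ (deg-in u))
       ; outhi = λ u c a b → upper zero u u (fineIdx c a b) d-high (proj₂ (deg-out u))
       ; inhi = λ u c a b → upper (suc zero) u u (fineIdx c a b) d-high (proj₂ (deg-in u))
       ; outoutlo = λ u v c a b ne → lower (suc (suc zero)) u v (fineIdx c a b) c-low (proj₁ (codeg-out u v ne))
       ; outinlo = λ u v c a b ne → lower (suc (suc (suc zero))) u v (fineIdx c a b) c-low (codeg-through u v ne)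
       ; outouthi = λ u v c a b ne → upper (suc (suc zero)) u v (fineIdx c a b) c-high (proj₂ (codeg-out u v ne))
       ; ininhi = λ u v c a b ne → upper (suc (suc (suc (suc zero)))) u v (fineIdx c a b) c-high (codeg-in u v ne)
       }


 -- From orbits to Hamilton cycles.

 module Orbit {n : ℕ} (s : Fin n → Fin n) (o : ℕ → Fin n) (o-step : ∀ k → o (suc k) ≡ s (o k))
   (covers : ∀ v → ∃ λ k → o k ≡ v) (returns : ∃ λ k → o (suc k) ≡ o 0) where

   -- After a repetition the orbit is periodic, so all of its values occur before index j.
   folds : ∀ i j → i < j → o j ≡ o i → ∀ k → ∃ λ k′ → k′ < j × o k ≡ o k′
   folds i j i<j eq zero = 0 , ≤-<-trans z≤n i<j , refl
   folds i j i<j eq (suc k) with folds i j i<j eq k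
   ... | k′ , k′<j , e with suc k′ <? j
   ...   | yes lt = suc k′ , lt , trans (o-step k) (trans (cong s e) (sym (o-step k′)))
   ...   | no ¬lt = i , i<j , trans (o-step k) (trans (cong s e) (trans (sym (o-step k′)) (trans (cong o (≤-antisym k′<j (≮⇒≥ ¬lt))) eq)))

   -- A repetition before index n would confine the orbit to fewer than n values, but it visits
   -- every vertex.
   distinct : ∀ i j → i < j → j < n → o j ≢ o i
   distinct i j i<j j<n eq = <-irrefl refl (<-≤-trans j<n (FP.injective⇒≤ {f = f} (λ {u} {v} e →
       trans (sym (back u)) (trans (cong o (trans (sym (FP.toℕ-fromℕ< _)) (trans (cong toℕ e) (FP.toℕ-fromℕ< _)))) (back v)))))
     where
     first-visit : ∀ v → ∃ λ k → k < j × o k ≡ v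
     first-visit v with covers v
     ... | k , e with folds i j i<j eq k
     ...   | k′ , lt , e′ = k′ , lt , trans (sym e′) e
     f : Fin n → Fin j
     f v = fromℕ< (proj₁ (proj₂ (first-visit v)))
     back : ∀ v → o (proj₁ (first-visit v)) ≡ v
     back v = proj₂ (proj₂ (first-visit v))

   tour : Fin n → Fin n
   tour i = o (toℕ i)

   tour-injective : ∀ i j → tour i ≡ tour j → i ≡ j
   tour-injective i j eq with <-cmp (toℕ i) (toℕ j)
   ... | tri< lt _ _ = ⊥-elim (distinct _ _ lt (FP.toℕ<n j) (sym eq))
   ... | tri≈ _ e _  = FP.toℕ-injective e
   ... | tri> _ _ gt = ⊥-elim (distinct _ _ gt (FP.toℕ<n i) eq)

   position : ∀ v → ∃ λ i → tour i ≡ v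
   position v with injective⇒Bij tour tour-injective
   ... | π , π≡ = from π v , trans (sym (π≡ _)) (to-from π v)

   -- Some vertex of the orbit has successor `o 0`; were it not the last one of the tour, `o 0`
   -- would recur before index n.
   closes : ∀ i → suc (toℕ i) ≡ n → s (tour i) ≡ o 0
   closes i last with position (o (proj₁ returns))
   ... | i′ , e with suc (toℕ i′) <? n
   ...   | yes lt = ⊥-elim (distinct 0 (suc (toℕ i′)) (s≤s z≤n) lt (trans (o-step _) (trans (cong s e) (trans (sym (o-step _)) (proj₂ returns)))))
   ...   | no ¬lt = trans (cong (s ∘ o) (suc-injective (trans last (≤-antisym (≮⇒≥ ¬lt) (FP.toℕ<n i′))))) (trans (cong s e) (trans (sym (o-step _)) (proj₂ returns)))

   cycle : D.HamCycle n
   cycle = tour , λ {i} {j} → tour-injective i j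

   edge⇒succ : ∀ a b → D.CycleEdge cycle a b → b ≡ s a
   edge⇒succ a b (i , j , inj₁ nxt , refl , refl) = trans (cong o nxt) (o-step (toℕ i))
   edge⇒succ a b (i , j , inj₂ (j0 , last) , refl , refl) = trans (cong o j0) (sym (closes i last))

   succ⇒edge : ∀ a → D.CycleEdge cycle a (s a)
   succ⇒edge a with position a
   ... | i , refl with suc (toℕ i) <? n
   ...   | yes lt = i , fromℕ< lt , inj₁ (FP.toℕ-fromℕ< lt) , refl , trans (cong o (FP.toℕ-fromℕ< lt)) (o-step (toℕ i))
   ...   | no ¬lt = i , fromℕ< 0<n , inj₂ (FP.toℕ-fromℕ< 0<n , last) , refl , trans (cong o (FP.toℕ-fromℕ< 0<n)) (sym (closes i last))
     where
     last : suc (toℕ i) ≡ n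
     last = ≤-antisym (FP.toℕ<n i) (≮⇒≥ ¬lt)
     0<n : 0 < n
     0<n = ≤-<-trans z≤n (FP.toℕ<n i)

 sum-tabulate : ∀ n (f : Fin n → ℕ) → LA.sum (tabulate f) ≡ ∑ n f
 sum-tabulate zero f = refl
 sum-tabulate (suc n) f = cong (f zero +_) (sum-tabulate n (f ∘ suc))

 sum-allFin : ∀ n (f : Fin n → ℕ) → LA.sum (map f (allFin n)) ≡ ∑ n f
 sum-allFin n f = trans (cong LA.sum (map-tabulate id f)) (sum-tabulate n f)

 count≡cnt : ∀ {n} (P : Fin n → Bool) → D.count P ≡ cnt n P
 count≡cnt {n} P = sum-allFin n (λ x → 𝟙 (P x))

 edgeCount≡ : ∀ {n} (G : D.Digraph n) → D.edgeCount G ≡ ∑ n (λ a → cnt n (D.adj G a))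
 edgeCount≡ {n} G = trans (sum-allFin n (λ a → D.count (D.adj G a))) (∑-cong n (λ a → count≡cnt (D.adj G a)))

 -- Edge-disjoint successor functions with a single orbit are the required Hamilton cycles; every
 -- vertex has exactly one covered out-edge per cycle.
 module Assemble {n : ℕ} (G : D.Digraph n) {I : Set} (is : List I) (uniq : Unique is)
   (s : I → Fin n → Fin n) (s-adj : ∀ i v → D.adj G v (s i v) ≡ true) (s-unique : ∀ i i′ v → s i v ≡ s i′ v → i ≡ i′)
   (o : I → ℕ → Fin n) (o-step : ∀ i k → o i (suc k) ≡ s i (o i k))
   (covers : ∀ i v → ∃ λ k → o i k ≡ v) (returns : ∀ i → ∃ λ k → o i (suc k) ≡ o i 0) where

   module O (i : I) = Orbit (s i) (o i) (o-step i) (covers i) (returns i)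

   Cs : List (D.HamCycle n)
   Cs = map O.cycle is

   in-G : ∀ C → C ∈ Cs → D.CycleIn G C
   in-G C C∈ a b ce with ∈-map⁻ O.cycle C∈
   ... | i , _ , refl = trans (cong (D.adj G a) (O.edge⇒succ i a b ce)) (s-adj i a)

   disjoint : ∀ is → Unique is → D.PairwiseEdgeDisjoint (map O.cycle is)
   disjoint [] _ = D.[]
   disjoint (i ∷ is) (i∉ AP.∷ u) = (λ C′ C′∈ a b ce ce′ → clash C′ C′∈ a b ce ce′) D.∷ disjoint is u
     where
     clash : ∀ C′ → C′ ∈ map O.cycle is → ∀ a b → D.CycleEdge (O.cycle i) a b → ¬ D.CycleEdge C′ a b
     clash C′ C′∈ a b ce ce′ with ∈-map⁻ O.cycle C′∈
     ... | i′ , i′∈ , refl = All.lookup i∉ i′∈ (s-unique i i′ a (trans (sym (O.edge⇒succ i a b ce)) (O.edge⇒succ i′ a b ce′)))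

   covered : Fin n → List (Fin n)
   covered a = map (λ i → s i a) is

   missed : Fin n → List (Fin n)
   missed a = filter (λ b → (D.adj G a b ∧ not (mem b (covered a))) ≟B true) (allFin n)

   U : List (Fin n × Fin n)
   U = concatMap (λ a → map (a ,_) (missed a)) (allFin n)

   covers-edges : ∀ a b → D.adj G a b ≡ true → (∃ λ C → C ∈ Cs × D.CycleEdge C a b) ⊎ ((a , b) ∈ U)
   covers-edges a b ab with mem b (covered a) in eq
   ... | true with ∈-map⁻ (λ i → s i a) (mem-∈ {l = covered a} eq)
   ...   | i , i∈ , refl = inj₁ (O.cycle i , ∈-map⁺ O.cycle i∈ , O.succ⇒edge i a)
   covers-edges a b ab | false = inj₂ (concatMap-∈ (λ a → map (a ,_) (missed a)) (allFin n) (∈-allFin a)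
     (∈-map⁺ (a ,_) (∈-filter⁺ (λ b → (D.adj G a b ∧ not (mem b (covered a))) ≟B true) (∈-allFin b) (cong₂ (λ x y → x ∧ not y) ab eq))))

   private
     length-filter : ∀ m (P : Fin m → Bool) (f : Fin m → Fin n) (R : Fin n → Bool) → (∀ x → R (f x) ≡ P x) →
       length (filter (λ b → R b ≟B true) (tabulate f)) ≡ cnt m P
     length-filter zero P f R eq = refl
     length-filter (suc m) P f R eq with R (f zero) ≟B true
     ... | yes p rewrite sym (eq zero) | p = cong suc (length-filter m (P ∘ suc) (f ∘ suc) R (eq ∘ suc))
     ... | no ¬p rewrite sym (eq zero) | ¬-not ¬p = length-filter m (P ∘ suc) (f ∘ suc) R (eq ∘ suc)

     unique-covered : ∀ a → Unique (covered a)
     unique-covered a = unique-map (λ i → s i a) is uniq (λ i i′ _ _ eq → s-unique i i′ a eq)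

     vertex-count : ∀ a → length (missed a) + length is ≡ cnt n (D.adj G a)
     vertex-count a = begin
       length (missed a) + length is ≡⟨ cong₂ _+_ (length-filter n (λ b → D.adj G a b ∧ not (mem b (covered a))) id _ (λ _ → refl)) (trans (sym (length-map _ is)) (sym (∑-occ n (covered a)))) ⟩
       cnt n (λ b → D.adj G a b ∧ not (mem b (covered a))) + ∑ n (λ b → occ b (covered a)) ≡⟨ ∑-+ n _ _ ⟨
       ∑ n (λ b → 𝟙 (D.adj G a b ∧ not (mem b (covered a))) + occ b (covered a)) ≡⟨ ∑-cong n pt ⟩
       cnt n (D.adj G a) ∎
       where
       open ≡-Reasoning
       pt : ∀ b → 𝟙 (D.adj G a b ∧ not (mem b (covered a))) + occ b (covered a) ≡ 𝟙 (D.adj G a b)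
       pt b with mem b (covered a) in eq
       ... | false rewrite occ-∉ b (covered a) (mem-false {l = covered a} eq) = trans (+-identityʳ _) (cong 𝟙 (∧-idʳ (D.adj G a b)))
         where
         ∧-idʳ : ∀ x → x ∧ true ≡ x
         ∧-idʳ true = refl
         ∧-idʳ false = refl
       ... | true with ∈-map⁻ (λ i → s i a) (mem-∈ {l = covered a} eq)
       ...   | i , _ , refl rewrite s-adj i a = ≤-antisym (unique-occ≤1 (s i a) (covered a) (unique-covered a)) (∈⇒occ (mem-∈ {l = covered a} eq))

   U-count : length U + length is * n ≡ D.edgeCount G
   U-count = trans (cong₂ _+_ (go n id) (*-comm (length is) n)) (trans (cong (∑ n (λ a → length (missed a)) +_) (sym (∑-const n (length is))))
     (trans (sym (∑-+ n _ _)) (trans (∑-cong n vertex-count) (sym (edgeCount≡ G)))))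
     where
     go : ∀ k (f : Fin k → Fin n) → length (concatMap (λ a → map (a ,_) (missed a)) (tabulate f)) ≡ ∑ k (λ x → length (missed (f x)))
     go zero f = refl
     go (suc k) f = trans (length-++ (map (f zero ,_) (missed (f zero)))) (cong₂ _+_ (length-map _ (missed (f zero))) (go k (f ∘ suc)))

 module PackingTheorem (A κ q m₀ ℓ B h r ω e cap δ : ℕ) .{{_ : NonZero B}} .{{_ : NonZero h}}
   (F≡ : pw A ≡ 2 ^ κ * (q * 16 * (q * 16)))
   (G : D.Digraph (pw A * m₀ + ℓ)) (fn : Fine (Fin (pw A * m₀ + ℓ)) (D.adj G) (2 ^ κ) (q * 16) m₀ ℓ)
   (rm : Room (2 ^ κ) q m₀ ℓ B h r ω e cap (Fine.dlo fn) (Fine.dhi fn) (Fine.clo fn) (Fine.chi fn) δ)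
   (left-injective : ∀ {l l′} → Fine.left fn l ≡ Fine.left fn l′ → l ≡ l′)
   (left≢fine : ∀ {c a b s l} → Fine.fine fn c a b s ≢ Fine.left fn l)
   (located : ∀ u → (∃ λ c → ∃ λ a → ∃ λ b → ∃ λ s → Fine.fine fn c a b s ≡ u) ⊎ (∃ λ l → Fine.left fn l ≡ u))
   where

   n : ℕ
   n = pw A * m₀ + ℓ

   open Fine fn
   open BuildSetup κ q m₀ ℓ B h r ω e cap δ fn rm
   open Labelled (q * 16) m₀ using (mk)

   θ-inj : ∀ x y → θ x ≡ θ y → x ≡ y
   θ-inj (inj₁ (c , x)) (inj₁ (c′ , x′)) eq with θ-injective c c′ x x′ eq
   ... | refl , refl = refl
   θ-inj (inj₁ _) (inj₂ _) eq = ⊥-elim (left≢fine eq)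
   θ-inj (inj₂ _) (inj₁ _) eq = ⊥-elim (left≢fine (sym eq))
   θ-inj (inj₂ l) (inj₂ l′) eq = cong inj₂ (left-injective eq)

   θ-onto : ∀ u → ∃ λ v → θ v ≡ u
   θ-onto u with located u
   ... | inj₁ (c , a , b , s , eq) = inj₁ (c , mk a b s) , trans (θ-mk c a b s) eq
   ... | inj₂ (l , eq) = inj₂ l , eq

   private
     θ′ : Fin n → VV
     θ′ u = proj₁ (θ-onto u)

     θ′-θ : ∀ v → θ′ (θ v) ≡ v
     θ′-θ v = θ-inj _ v (proj₂ (θ-onto (θ v)))

     open Derived setup using (J; allJ; length-allJ; K)
     open Cycles.Packing (Cycles.packing setup)

     indices : List (Fin K × J)
     indices = cartesianProduct (allFin K) allJ

     unique-indices : Unique indices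
     unique-indices = UP.cartesianProduct⁺ (UP.allFin⁺ K) (UP.allFin⁺ r)

     length-indices : length indices ≡ 2 ^ κ * r
     length-indices = trans (length-cartesianProduct (allFin K) allJ) (cong₂ _*_ (length-tabulate {n = K} id) length-allJ)

     succF : Fin K × J → Fin n → Fin n
     succF i u = θ (σ i (θ′ u))

     module As = Assemble G indices unique-indices succF
       (λ i u → trans (cong (λ w → D.adj G w (θ (σ i (θ′ u)))) (sym (proj₂ (θ-onto u)))) (σ-adj i (θ′ u)))
       (λ i i′ u eq → σ-unique i i′ (θ′ u) (θ-inj _ _ eq))
       (λ i k → θ (orbit i k))
       (λ i k → cong θ (trans (orbit-s i k) (cong (σ i) (sym (θ′-θ (orbit i k))))))
       (λ i u → proj₁ (covers i (θ′ u)) , trans (cong θ (proj₂ (covers i (θ′ u)))) (proj₂ (θ-onto u)))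
       (λ i → proj₁ (returns i) , cong θ (trans (proj₂ (returns i)) (sym (orbit-0 i))))

   abstract
     hamilton-packing : ∃ λ (Cs : List (D.HamCycle n)) → ∃ λ (U : List (Fin n × Fin n)) →
       (∀ C → C ∈ Cs → D.CycleIn G C) × D.PairwiseEdgeDisjoint Cs ×
       (∀ a b → D.adj G a b ≡ true → (∃ λ C → C ∈ Cs × D.CycleEdge C a b) ⊎ ((a , b) ∈ U)) ×
       length U + 2 ^ κ * r * n ≡ D.edgeCount G
     hamilton-packing = As.Cs , As.U , As.in-G , As.disjoint indices unique-indices , As.covers-edges ,
       trans (cong (λ z → length As.U + z * n) (sym length-indices)) As.U-count

 module PackUniform (A κ q m₀ ℓ B h r ω e cap δ p b : ℕ) .{{_ : NonZero B}} .{{_ : NonZero h}} (1≤p : 1 ≤ p)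
   (F≡ : pw A ≡ 2 ^ κ * (q * 16 * (q * 16)))
   (G : D.Digraph (pw A * m₀ + ℓ)) (2M≤ : 2 * (5 * ((pw A * m₀ + ℓ) * (pw A * m₀ + ℓ))) ≤ 2 ^ b)
   (dlo dhi clo chi Dlo Dhi Clo Chi : ℕ)
   (deg-out : ∀ a → Dlo ≤ cnt (pw A * m₀ + ℓ) (D.adj G a) × cnt (pw A * m₀ + ℓ) (D.adj G a) ≤ Dhi)
   (deg-in : ∀ a → Dlo ≤ cnt (pw A * m₀ + ℓ) (λ x → D.adj G x a) × cnt (pw A * m₀ + ℓ) (λ x → D.adj G x a) ≤ Dhi)
   (codeg-out : ∀ a b → a ≢ b → Clo ≤ cnt (pw A * m₀ + ℓ) (λ x → D.adj G a x ∧ D.adj G b x) × cnt (pw A * m₀ + ℓ) (λ x → D.adj G a x ∧ D.adj G b x) ≤ Chi)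
   (codeg-through : ∀ a b → a ≢ b → Clo ≤ cnt (pw A * m₀ + ℓ) (λ x → D.adj G a x ∧ D.adj G x b))
   (codeg-in : ∀ a b → a ≢ b → cnt (pw A * m₀ + ℓ) (λ x → D.adj G x a ∧ D.adj G x b) ≤ Chi)
   where

   open Arrange A m₀ ℓ p 1≤p (D.adj G) b 2M≤ public using (High; Low; E₀; w; rest; rest≢; locate)
   private module Ar = Arrange A m₀ ℓ p 1≤p (D.adj G) b 2M≤

   module _ (d-low : ∀ c k → Dlo ≤ c + ℓ → Low A c k → dlo ≤ k) (d-high : ∀ c k → c ≤ Dhi → High A c k → k ≤ dhi)
     (c-low : ∀ c k → Clo ≤ c + ℓ → Low A c k → clo ≤ k) (c-high : ∀ c k → c ≤ Chi → High A c k → k ≤ chi)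
     (rm : Room (2 ^ κ) q m₀ ℓ B h r ω e cap dlo dhi clo chi δ) where

     private
       module FC = Ar.FineClasses (2 ^ κ) (q * 16) F≡ dlo dhi clo chi Dlo Dhi Clo Chi deg-out deg-in codeg-out codeg-through codeg-in d-low d-high c-low c-high

       located : ∀ u → (∃ λ c → ∃ λ a → ∃ λ b → ∃ λ s → Fine.fine FC.fineClasses c a b s ≡ u) ⊎ (∃ λ l → Fine.left FC.fineClasses l ≡ u)
       located u = by-part (locate u)
         where
         by-index : ∀ f s → w f s ≡ u → (∃ λ c → ∃ λ a → ∃ λ b → FC.fineIdx c a b ≡ f) → ∃ λ c → ∃ λ a → ∃ λ b → ∃ λ s → Fine.fine FC.fineClasses c a b s ≡ u
         by-index f s eq (c , a , b , refl) = c , a , b , s , eq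
         by-part : (∃₂ λ f s → w f s ≡ u) ⊎ (∃ λ l → rest l ≡ u) → (∃ λ c → ∃ λ a → ∃ λ b → ∃ λ s → Fine.fine FC.fineClasses c a b s ≡ u) ⊎ (∃ λ l → Fine.left FC.fineClasses l ≡ u)
         by-part (inj₁ (f , s , eq)) = inj₁ (by-index f s eq (FC.fineIdx-surjective f))
         by-part (inj₂ l) = inj₂ l

     open PackingTheorem A κ q m₀ ℓ B h r ω e cap δ F≡ G FC.fineClasses rm
       (λ {l} {l′} eq → FP.↑ʳ-injective (pw A * m₀) l l′ eq) (λ eq → rest≢ _ _ _ eq) located public using (hamilton-packing)

 -- Accumulated error of repeated halving.

 power-loss : ∀ o A → (o + 2) ^ A * (o + 2) ≤ o ^ A * (o + 2) + 2 * A * (o + 2) ^ A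
 power-loss o zero = ≤-reflexive (sym (+-identityʳ _))
 power-loss o (suc A) = begin
   q * q ^ A * q ≡⟨ id₁ q (q ^ A) ⟩
   q * (q ^ A * q) ≤⟨ *-monoʳ-≤ q (power-loss o A) ⟩
   q * (o ^ A * q + 2 * A * q ^ A) ≡⟨ id₂ o (o ^ A) A (q ^ A) ⟩
   o * o ^ A * q + 2 * A * (q * q ^ A) + 2 * (o ^ A * q) ≤⟨ +-monoʳ-≤ (o * o ^ A * q + 2 * A * (q * q ^ A)) (*-monoʳ-≤ 2 (*-monoˡ-≤ q (^-monoˡ-≤ A (m≤m+n o 2)))) ⟩
   o * o ^ A * q + 2 * A * (q * q ^ A) + 2 * (q ^ A * q) ≡⟨ id₃ (o * o ^ A * q) A q (q ^ A) ⟩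
   o * o ^ A * q + 2 * suc A * (q * q ^ A) ∎
   where
   open ≤-Reasoning
   q = o + 2
   id₁ : ∀ q x → q * x * q ≡ q * (x * q)
   id₁ = solve 2 (λ q x → q :* x :* q := q :* (x :* q)) refl
   id₂ : ∀ o x A z → (o + 2) * (x * (o + 2) + 2 * A * z) ≡ o * x * (o + 2) + 2 * A * ((o + 2) * z) + 2 * (x * (o + 2))
   id₂ = solve 4 (λ o x A z → (o :+ con 2) :* (x :* (o :+ con 2) :+ con 2 :* A :* z) := o :* x :* (o :+ con 2) :+ con 2 :* A :* ((o :+ con 2) :* z) :+ con 2 :* (x :* (o :+ con 2))) refl
   id₃ : ∀ x A q z → x + 2 * A * (q * z) + 2 * (z * q) ≡ x + 2 * suc A * (q * z)
   id₃ = solve 4 (λ x A q z → x :+ con 2 :* A :* (q :* z) :+ con 2 :* (z :* q) := x :+ con 2 :* (con 1 :+ A) :* (q :* z)) refl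

 -- With q = o + 2, (1 - 2/q)^A ≥ 1 - 2A/q ≥ 1 - 1/(s₁ + 1): the relative errors of A halvings
 -- together stay within 1/(s₁ + 1).
 power-ratio : ∀ o A s₁ → 2 * A * suc s₁ ≤ o + 2 → s₁ * (o + 2) ^ A ≤ suc s₁ * o ^ A
 power-ratio o A s₁ h = *-cancelʳ-≤ _ _ q {{m+1≢0}} (+-cancelʳ-≤ (q * q ^ A) _ _ (begin
   s₁ * q ^ A * q + q * q ^ A ≡⟨ id₁ s₁ (q ^ A) q ⟩
   suc s₁ * (q ^ A * q) ≤⟨ *-monoʳ-≤ (suc s₁) (power-loss o A) ⟩
   suc s₁ * (o ^ A * q + 2 * A * q ^ A) ≡⟨ id₂ s₁ (o ^ A) q A (q ^ A) ⟩
   suc s₁ * o ^ A * q + 2 * A * suc s₁ * q ^ A ≤⟨ +-monoʳ-≤ (suc s₁ * o ^ A * q) (*-monoˡ-≤ (q ^ A) h) ⟩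
   suc s₁ * o ^ A * q + q * q ^ A ∎))
   where
   open ≤-Reasoning
   q = o + 2
   m+1≢0 : NonZero (o + 2)
   m+1≢0 = >-nonZero (≤-trans (s≤s z≤n) (m≤n+m 2 o))
   id₁ : ∀ s x q → s * x * q + q * x ≡ suc s * (x * q)
   id₁ = solve 3 (λ s x q → s :* x :* q :+ q :* x := (con 1 :+ s) :* (x :* q)) refl
   id₂ : ∀ s x q A z → suc s * (x * q + 2 * A * z) ≡ suc s * x * q + 2 * A * suc s * z
   id₂ = solve 5 (λ s x q A z → (con 1 :+ s) :* (x :* q :+ con 2 :* A :* z) := (con 1 :+ s) :* x :* q :+ con 2 :* A :* (con 1 :+ s) :* z) refl

 module Deviation {o A s₁ : ℕ} (0<o : 0 < o) (h : 2 * A * suc s₁ ≤ o + 2) (E₀ : ℕ) where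

   private
     q = o + 2
     instance
       q≢0 : NonZero (q ^ A)
       q≢0 = m^n≢0 q A {{>-nonZero (≤-trans 0<o (m≤m+n o 2))}}
       o≢0 : NonZero (o ^ A)
       o≢0 = m^n≢0 o A {{>-nonZero 0<o}}

   low-deviation : ∀ c k → o ^ A * c + q ^ A * E₀ ≤ (2 * q) ^ A * (k + E₀) → s₁ * c ≤ suc s₁ * (2 ^ A * (k + E₀))
   low-deviation c k low = *-cancelʳ-≤ _ _ (q ^ A) (begin
     s₁ * c * q ^ A ≡⟨ id₁ s₁ c (q ^ A) ⟩
     s₁ * q ^ A * c ≤⟨ *-monoˡ-≤ c (power-ratio o A s₁ h) ⟩
     suc s₁ * o ^ A * c ≡⟨ *-assoc (suc s₁) (o ^ A) c ⟩
     suc s₁ * (o ^ A * c) ≤⟨ *-monoʳ-≤ (suc s₁) (≤-trans (m≤m+n _ (q ^ A * E₀)) low) ⟩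
     suc s₁ * ((2 * q) ^ A * (k + E₀)) ≡⟨ cong (λ z → suc s₁ * (z * (k + E₀))) (*-^ 2 q A) ⟩
     suc s₁ * (2 ^ A * q ^ A * (k + E₀)) ≡⟨ id₂ (suc s₁) (2 ^ A) (q ^ A) (k + E₀) ⟩
     suc s₁ * (2 ^ A * (k + E₀)) * q ^ A ∎)
     where
     open ≤-Reasoning
     id₁ : ∀ s c x → s * c * x ≡ s * x * c
     id₁ = solve 3 (λ s c x → s :* c :* x := s :* x :* c) refl
     id₂ : ∀ s f x k → s * (f * x * k) ≡ s * (f * k) * x
     id₂ = solve 4 (λ s f x k → s :* (f :* x :* k) := s :* (f :* k) :* x) refl

   high-deviation : ∀ c k → (2 * q) ^ A * k + (q + 2) ^ A * E₀ ≤ (q + 2) ^ A * (c + 2 ^ A * E₀) → s₁ * (2 ^ A * k) ≤ suc s₁ * (c + 2 ^ A * E₀)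
   high-deviation c k high = *-cancelʳ-≤ _ _ (q ^ A) (begin
     s₁ * (2 ^ A * k) * q ^ A ≡⟨ id₁ s₁ (2 ^ A * k) (q ^ A) ⟩
     s₁ * q ^ A * (2 ^ A * k) ≤⟨ *-monoˡ-≤ (2 ^ A * k) (power-ratio o A s₁ h) ⟩
     suc s₁ * o ^ A * (2 ^ A * k) ≡⟨ id₂ (suc s₁) (o ^ A) (2 ^ A * k) ⟩
     suc s₁ * (2 ^ A * k * o ^ A) ≤⟨ *-monoʳ-≤ (suc s₁) up ⟩
     suc s₁ * ((c + 2 ^ A * E₀) * q ^ A) ≡⟨ *-assoc (suc s₁) (c + 2 ^ A * E₀) (q ^ A) ⟨
     suc s₁ * (c + 2 ^ A * E₀) * q ^ A ∎)
     where
     open ≤-Reasoning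
     id₁ : ∀ s c x → s * c * x ≡ s * x * c
     id₁ = solve 3 (λ s c x → s :* c :* x := s :* x :* c) refl
     id₂ : ∀ s x k → s * x * k ≡ s * (k * x)
     id₂ = solve 3 (λ s x k → s :* x :* k := s :* (k :* x)) refl
     -- (q + 2)(q - 2) ≤ q² bounds the upper factor (1 + 2/q)^A by the inverse of the lower one.
     go≤ : (q + 2) ^ A * o ^ A ≤ q ^ A * q ^ A
     go≤ = ≤-trans (≤-reflexive (sym (*-^ (q + 2) o A))) (≤-trans (^-monoˡ-≤ A (≤-trans (m≤m+n _ 4) (≤-reflexive (id₃ o)))) (≤-reflexive (*-^ q q A)))
       where
       id₃ : ∀ o → (o + 2 + 2) * o + 4 ≡ (o + 2) * (o + 2)
       id₃ = solve 1 (λ o → (o :+ con 2 :+ con 2) :* o :+ con 4 := (o :+ con 2) :* (o :+ con 2)) refl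
     up : 2 ^ A * k * o ^ A ≤ (c + 2 ^ A * E₀) * q ^ A
     up = *-cancelʳ-≤ _ _ (q ^ A) (begin
       2 ^ A * k * o ^ A * q ^ A ≡⟨ id₄ (2 ^ A) k (o ^ A) (q ^ A) ⟩
       2 ^ A * q ^ A * k * o ^ A ≡⟨ cong (λ z → z * k * o ^ A) (*-^ 2 q A) ⟨
       (2 * q) ^ A * k * o ^ A ≤⟨ *-monoˡ-≤ (o ^ A) (≤-trans (m≤m+n _ ((q + 2) ^ A * E₀)) high) ⟩
       (q + 2) ^ A * (c + 2 ^ A * E₀) * o ^ A ≡⟨ id₅ ((q + 2) ^ A) (c + 2 ^ A * E₀) (o ^ A) ⟩
       (q + 2) ^ A * o ^ A * (c + 2 ^ A * E₀) ≤⟨ *-monoˡ-≤ _ go≤ ⟩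
       q ^ A * q ^ A * (c + 2 ^ A * E₀) ≡⟨ id₆ (q ^ A) (c + 2 ^ A * E₀) ⟩
       (c + 2 ^ A * E₀) * q ^ A * q ^ A ∎)
       where
       id₄ : ∀ f k x z → f * k * x * z ≡ f * z * k * x
       id₄ = solve 4 (λ f k x z → f :* k :* x :* z := f :* z :* k :* x) refl
       id₅ : ∀ g c x → g * c * x ≡ g * x * c
       id₅ = solve 3 (λ g c x → g :* c :* x := g :* x :* c) refl
       id₆ : ∀ z c → z * z * c ≡ c * z * z
       id₆ = solve 2 (λ z c → z :* z :* c := c :* z :* z) refl

 -- The pattern of the inequalities below: a nonnegative combination of hypotheses gives L ≤ R, and
 -- a polynomial identity with explicit slack s turns it into the claim. Multipliers and slack form
 -- a certificate for the semiring solver.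
 linear : ∀ {l r L R s} → L ≤ R → l + R + s ≡ r + L → l ≤ r
 linear {l} {r} {L} {R} {s} L≤R eq = +-cancelʳ-≤ R l r (≤-trans (m≤m+n (l + R) s) (≤-trans (≤-reflexive eq) (+-monoʳ-≤ r L≤R)))

 -- Polynomial inequalities between the parameters.

 Pr≤2m : ∀ w v P Q m₀ y → P * ((w + 42) * ((v + 13) * y)) ≤ 2 * m₀ → P * ((w + 42) * (v + 5) * (Q * Q * y)) ≤ 2 * (Q * Q * m₀)
 Pr≤2m w v P Q m₀ y h = linear (*-monoʳ-≤ (Q * Q) h) (id₁ w v P Q m₀ y)
   where
   id₁ : ∀ w v P Q m₀ y → (P * ((w + 42) * (v + 5) * (Q * Q * y))) + (Q * Q) * (2 * m₀) + (8 * P * Q * Q * w * y + 336 * P * Q * Q * y) ≡ 2 * (Q * Q * m₀) + (Q * Q) * (P * ((w + 42) * ((v + 13) * y)))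
   id₁ = solve 6 (λ w v P Q m₀ y → (P :* ((w :+ con 42) :* (v :+ con 5) :* (Q :* Q :* y))) :+ (Q :* Q) :* (con 2 :* m₀) :+ (con 8 :* P :* Q :* Q :* w :* y :+ con 336 :* P :* Q :* Q :* y) := con 2 :* (Q :* Q :* m₀) :+ (Q :* Q) :* (P :* ((w :+ con 42) :* ((v :+ con 13) :* y)))) refl

 m+2r-small : ∀ m r P → 10 ≤ P → P * r ≤ 2 * m → 5 * (m + (r + r)) ≤ 7 * m
 m+2r-small m r P h h₂ = linear (+-mono-≤ (*-monoʳ-≤ r h) h₂) (id₁ m r P)
   where
   id₁ : ∀ m r P → (5 * (m + (r + r))) + (r * P + 2 * m) + 0 ≡ 7 * m + (r * 10 + P * r)
   id₁ = solve 3 (λ m r P → (con 5 :* (m :+ (r :+ r))) :+ (r :* P :+ con 2 :* m) :+ con 0 := con 7 :* m :+ (r :* con 10 :+ P :* r)) refl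

 -- Since μ is about m₀ / 2P², the factor 4 Q² P² makes the number of connector candidates about
 -- twice the class size Q² m₀, while m + 2 r is at most 7/5 of it.
 connect-small : ∀ m r Q P m₀ μ → 5 * (Q * Q * m₀ + (r + r)) ≤ 7 * (Q * Q * m₀) → m₀ + 1 ≤ 2 * (P * P) * (μ + 1) → 3 ≤ μ → 1 ≤ Q * Q → suc (Q * Q * m₀ + (r + r)) ≤ 4 * (Q * Q * (P * P)) * μ
 connect-small m r Q P m₀ μ h₁ h₂ h₃ h₄ = *-cancelˡ-≤ 5 (linear (+-mono-≤ (+-mono-≤ (+-mono-≤ h₁ (*-monoʳ-≤ (7 * (Q * Q)) h₂)) (*-monoʳ-≤ (5 * (Q * Q * (P * P))) h₃)) (*-monoʳ-≤ 7 h₄)) (id₁ m r Q P m₀ μ))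
   where
   id₁ : ∀ m r Q P m₀ μ → (5 * (suc (Q * Q * m₀ + (r + r)))) + (((7 * (Q * Q * m₀) + (7 * (Q * Q)) * (2 * (P * P) * (μ + 1))) + (5 * (Q * Q * (P * P))) * μ) + 7 * (Q * Q)) + (2 + P * P * Q * Q + P * P * Q * Q * μ) ≡ 5 * (4 * (Q * Q * (P * P)) * μ) + ((((5 * (Q * Q * m₀ + (r + r))) + (7 * (Q * Q)) * (m₀ + 1)) + (5 * (Q * Q * (P * P))) * 3) + 7 * 1)
   id₁ = solve 6 (λ m r Q P m₀ μ → (con 5 :* ((con 1 :+ (Q :* Q :* m₀ :+ (r :+ r))))) :+ (((con 7 :* (Q :* Q :* m₀) :+ (con 7 :* (Q :* Q)) :* (con 2 :* (P :* P) :* (μ :+ con 1))) :+ (con 5 :* (Q :* Q :* (P :* P))) :* μ) :+ con 7 :* (Q :* Q)) :+ (con 2 :+ P :* P :* Q :* Q :+ P :* P :* Q :* Q :* μ) := con 5 :* (con 4 :* (Q :* Q :* (P :* P)) :* μ) :+ ((((con 5 :* (Q :* Q :* m₀ :+ (r :+ r))) :+ (con 7 :* (Q :* Q)) :* (m₀ :+ con 1)) :+ (con 5 :* (Q :* Q :* (P :* P))) :* con 3) :+ con 7 :* con 1)) refl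

 -- Source of 240: with c about Q μ / 10 the slots hold about 24 Q⁴ P⁴ μ, against a demand of at
 -- most ω² μ = 16 Q⁴ P⁴ μ.
 balance-small : ∀ m r Q P μ c → m + (r + r) ≤ 4 * (Q * Q * (P * P)) * μ → suc (Q * μ) ≤ 10 * suc c → 1 ≤ Q * Q * Q * (P * P * (P * P)) → suc (4 * (Q * Q * (P * P)) * m + (4 * (Q * Q * (P * P)) * r + 4 * (Q * Q * (P * P)) * r)) ≤ 240 * (Q * Q * Q * (P * P * (P * P))) * suc c
 balance-small m r Q P μ c h₁ h₂ h₃ = linear (+-mono-≤ (+-mono-≤ (*-monoʳ-≤ (4 * (Q * Q * (P * P))) h₁) (*-monoʳ-≤ (24 * (Q * Q * Q * (P * P * (P * P)))) h₂)) h₃) (id₁ m r Q P μ c)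
   where
   id₁ : ∀ m r Q P μ c → (suc (4 * (Q * Q * (P * P)) * m + (4 * (Q * Q * (P * P)) * r + 4 * (Q * Q * (P * P)) * r))) + (((4 * (Q * Q * (P * P))) * (4 * (Q * Q * (P * P)) * μ) + (24 * (Q * Q * Q * (P * P * (P * P)))) * (10 * suc c)) + Q * Q * Q * (P * P * (P * P))) + (23 * P * P * P * P * Q * Q * Q + 8 * P * P * P * P * Q * Q * Q * Q * μ) ≡ 240 * (Q * Q * Q * (P * P * (P * P))) * suc c + (((4 * (Q * Q * (P * P))) * (m + (r + r)) + (24 * (Q * Q * Q * (P * P * (P * P)))) * (suc (Q * μ))) + 1)
   id₁ = solve 6 (λ m r Q P μ c → ((con 1 :+ (con 4 :* (Q :* Q :* (P :* P)) :* m :+ (con 4 :* (Q :* Q :* (P :* P)) :* r :+ con 4 :* (Q :* Q :* (P :* P)) :* r)))) :+ (((con 4 :* (Q :* Q :* (P :* P))) :* (con 4 :* (Q :* Q :* (P :* P)) :* μ) :+ (con 24 :* (Q :* Q :* Q :* (P :* P :* (P :* P)))) :* (con 10 :* (con 1 :+ c))) :+ Q :* Q :* Q :* (P :* P :* (P :* P))) :+ (con 23 :* P :* P :* P :* P :* Q :* Q :* Q :+ con 8 :* P :* P :* P :* P :* Q :* Q :* Q :* Q :* μ) := con 240 :* (Q :* Q :* Q :* (P :* P :* (P :* P))) :* (con 1 :+ c) :+ (((con 4 :* (Q :* Q :* (P :* P))) :* (m :+ (r :+ r)) :+ (con 24 :* (Q :* Q :* Q :* (P :* P :* (P :* P))))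 :* ((con 1 :+ (Q :* μ)))) :+ con 1)) refl

 -- Source of the divisor 10 in `cap`: four quantities of size at most cap + 1 must fit below Q μ
 -- when the heads are chosen.
 cap-small : ∀ x c → 10 * c ≤ x → 9 ≤ x → suc (4 * suc c) ≤ x
 cap-small x c h₁ h₂ = *-cancelˡ-≤ 10 (linear (+-mono-≤ (*-monoʳ-≤ 4 h₁) (*-monoʳ-≤ 6 h₂)) (id₁ x c))
   where
   id₁ : ∀ x c → 10 * (suc (4 * suc c)) + (4 * x + 6 * x) + 4 ≡ 10 * x + (4 * (10 * c) + 6 * 9)
   id₁ = solve 2 (λ x c → con 10 :* ((con 1 :+ (con 4 :* (con 1 :+ c)))) :+ (con 4 :* x :+ con 6 :* x) :+ con 4 := con 10 :* x :+ (con 4 :* (con 10 :* c) :+ con 6 :* con 9)) refl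

 r-bound : ∀ P Q m₀ r μ → P * r ≤ 2 * (Q * Q * m₀) → m₀ + 1 ≤ 2 * (P * P) * (μ + 1) → P * r ≤ P * (4 * (Q * Q * P) * (μ + 1))
 r-bound P Q m₀ r μ h₁ h₂ = linear (+-mono-≤ h₁ (*-monoʳ-≤ (2 * (Q * Q)) h₂)) (id₁ P Q m₀ r μ)
   where
   id₁ : ∀ P Q m₀ r μ → P * r + (2 * (Q * Q * m₀) + (2 * (Q * Q)) * (2 * (P * P) * (μ + 1))) + (2 * Q * Q) ≡ (P * (4 * (Q * Q * P) * (μ + 1))) + (P * r + (2 * (Q * Q)) * (m₀ + 1))
   id₁ = solve 5 (λ P Q m₀ r μ → P :* r :+ (con 2 :* (Q :* Q :* m₀) :+ (con 2 :* (Q :* Q)) :* (con 2 :* (P :* P) :* (μ :+ con 1))) :+ (con 2 :* Q :* Q) := (P :* (con 4 :* (Q :* Q :* P) :* (μ :+ con 1))) :+ (P :* r :+ (con 2 :* (Q :* Q)) :* (m₀ :+ con 1))) refl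

 -- Source of 80: r is at most about 4 Q² P μ, and 80 Q P c is about 8 Q² P μ. Hence a batch has at
 -- most cap + 1 cycles.
 r<B·cap : ∀ P Q r μ c → r ≤ 4 * (Q * Q * P) * (μ + 1) → 1 ≤ μ → suc (Q * μ) ≤ 10 * suc c → 1 ≤ Q * P → suc r ≤ 80 * (Q * P) * suc c
 r<B·cap P Q r μ c h₁ h₂ h₃ h₄ = *-cancelˡ-≤ 10 (linear (+-mono-≤ (+-mono-≤ (+-mono-≤ (*-monoʳ-≤ 10 h₁) (*-monoʳ-≤ (40 * (Q * Q * P)) h₂)) (*-monoʳ-≤ (80 * (Q * P)) h₃)) (*-monoʳ-≤ 80 h₄)) (id₁ P Q r μ c))
   where
   id₁ : ∀ P Q r μ c → 10 * (suc r) + (((10 * (4 * (Q * Q * P) * (μ + 1)) + (40 * (Q * Q * P)) * μ) + (80 * (Q * P)) * (10 * suc c)) + 80 * (Q * P)) + 70 ≡ 10 * (80 * (Q * P) * suc c) + (((10 * r + (40 * (Q * Q * P)) * 1) + (80 * (Q * P)) * (suc (Q * μ))) + 80 * 1)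
   id₁ = solve 5 (λ P Q r μ c → con 10 :* ((con 1 :+ r)) :+ (((con 10 :* (con 4 :* (Q :* Q :* P) :* (μ :+ con 1)) :+ (con 40 :* (Q :* Q :* P)) :* μ) :+ (con 80 :* (Q :* P)) :* (con 10 :* (con 1 :+ c))) :+ con 80 :* (Q :* P)) :+ con 70 := con 10 :* (con 80 :* (Q :* P) :* (con 1 :+ c)) :+ (((con 10 :* r :+ (con 40 :* (Q :* Q :* P)) :* con 1) :+ (con 80 :* (Q :* P)) :* ((con 1 :+ (Q :* μ)))) :+ con 80 :* con 1)) refl

 -- Source of 3200: there are fewer than 4 B h Q² = 320 Q³ P h leftover vertices, and a slot should
 -- receive at most cap + 1 of them.
 cube-small : ∀ P Q μ c → 3200 * (Q * Q * P) ≤ μ → suc (Q * μ) ≤ 10 * suc c → 320 * (Q * Q * Q * P) ≤ suc c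
 cube-small P Q μ c h₁ h₂ = *-cancelˡ-≤ 10 (linear (+-mono-≤ (*-monoʳ-≤ Q h₁) h₂) (id₁ P Q μ c))
   where
   id₁ : ∀ P Q μ c → 10 * (320 * (Q * Q * Q * P)) + (Q * μ + 10 * suc c) + 1 ≡ 10 * (suc c) + (Q * (3200 * (Q * Q * P)) + suc (Q * μ))
   id₁ = solve 4 (λ P Q μ c → con 10 :* (con 320 :* (Q :* Q :* Q :* P)) :+ (Q :* μ :+ con 10 :* (con 1 :+ c)) :+ con 1 := con 10 :* ((con 1 :+ c)) :+ (Q :* (con 3200 :* (Q :* Q :* P)) :+ (con 1 :+ (Q :* μ)))) refl

 Pμ≤d : ∀ P a m₀ μ y → 2 * (P * P) * μ ≤ m₀ → m₀ ≤ 2 * (P * (a * y)) → P * (P * μ) ≤ P * (a * y)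
 Pμ≤d P a m₀ μ y h₁ h₂ = *-cancelˡ-≤ 2 (linear (+-mono-≤ h₁ h₂) (id₁ P a m₀ μ y))
   where
   id₁ : ∀ P a m₀ μ y → 2 * (P * (P * μ)) + (m₀ + 2 * (P * (a * y))) + 0 ≡ 2 * (P * (a * y)) + (2 * (P * P) * μ + m₀)
   id₁ = solve 5 (λ P a m₀ μ y → con 2 :* (P :* (P :* μ)) :+ (m₀ :+ con 2 :* (P :* (a :* y))) :+ con 0 := con 2 :* (P :* (a :* y)) :+ (con 2 :* (P :* P) :* μ :+ m₀)) refl

 10μ≤d : ∀ P μ d → 10 ≤ P → P * μ ≤ d → 10 * μ ≤ d
 10μ≤d P μ d h₁ h₂ = linear (+-mono-≤ (*-monoʳ-≤ μ h₁) h₂) (id₁ P μ d)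
   where
   id₁ : ∀ P μ d → 10 * μ + (μ * P + d) + 0 ≡ d + (μ * 10 + P * μ)
   id₁ = solve 3 (λ P μ d → con 10 :* μ :+ (μ :* P :+ d) :+ con 0 := d :+ (μ :* con 10 :+ P :* μ)) refl

 μ≤dlo : ∀ w μ x → 10 * μ ≤ (w + 42) * x → 42 ≤ w → μ ≤ (w + 1) * x
 μ≤dlo w μ x h₁ h₂ = *-cancelˡ-≤ 10 (linear (+-mono-≤ h₁ (*-monoʳ-≤ x h₂)) (id₁ w μ x))
   where
   id₁ : ∀ w μ x → 10 * μ + (((w + 42) * x) + x * w) + (8 * w * x + 10 * x) ≡ (10 * ((w + 1) * x)) + (10 * μ + x * 42)
   id₁ = solve 3 (λ w μ x → con 10 :* μ :+ (((w :+ con 42) :* x) :+ x :* w) :+ (con 8 :* w :* x :+ con 10 :* x) := (con 10 :* ((w :+ con 1) :* x)) :+ (con 10 :* μ :+ x :* con 42)) refl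

 -- `dlo` exceeds w x by one unit x. Over Q² cells this unit pays for the 16 labels withheld from
 -- the main graph, which take at most half of it because 32 a ≤ Q, and for the edges forbidden by
 -- hosting.
 absorb : ∀ w Q μ x → 10 * μ ≤ (w + 42) * x → 32 * (w + 42) ≤ Q → Q * μ + 16 * (Q * ((w + 1) * x)) ≤ Q * Q * x
 absorb w Q μ x h₁ h₂ = *-cancelˡ-≤ 10 (linear (+-mono-≤ (*-monoʳ-≤ Q h₁) (*-monoʳ-≤ (10 * (Q * x)) h₂)) (id₁ w Q μ x))
   where
   id₁ : ∀ w Q μ x → (10 * (Q * μ + 16 * (Q * ((w + 1) * x)))) + (Q * ((w + 42) * x) + (10 * (Q * x)) * Q) + (159 * Q * w * x + 13238 * Q * x) ≡ 10 * (Q * Q * x) + (Q * (10 * μ) + (10 * (Q * x)) * (32 * (w + 42)))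
   id₁ = solve 4 (λ w Q μ x → (con 10 :* (Q :* μ :+ con 16 :* (Q :* ((w :+ con 1) :* x)))) :+ (Q :* ((w :+ con 42) :* x) :+ (con 10 :* (Q :* x)) :* Q) :+ (con 159 :* Q :* w :* x :+ con 13238 :* Q :* x) := con 10 :* (Q :* Q :* x) :+ (Q :* (con 10 :* μ) :+ (con 10 :* (Q :* x)) :* (con 32 :* (w :+ con 42)))) refl

 δ-small : ∀ w Q V μ x g → Q * μ + 16 * (Q * ((w + 1) * x)) ≤ Q * Q * x → g ≤ Q * μ → Q ≤ V + 16 → w * (Q * Q * x) + g ≤ Q * (V * ((w + 1) * x))
 δ-small w Q V μ x g h₁ h₂ h₃ = linear (+-mono-≤ (+-mono-≤ h₁ h₂) (*-monoʳ-≤ (Q * ((w + 1) * x)) h₃)) (id₁ w Q V μ x g)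
   where
   id₁ : ∀ w Q V μ x g → (w * (Q * Q * x) + g) + ((Q * Q * x + Q * μ) + (Q * ((w + 1) * x)) * (V + 16)) + 0 ≡ (Q * (V * ((w + 1) * x))) + (((Q * μ + 16 * (Q * ((w + 1) * x))) + g) + (Q * ((w + 1) * x)) * Q)
   id₁ = solve 6 (λ w Q V μ x g → (w :* (Q :* Q :* x) :+ g) :+ ((Q :* Q :* x :+ Q :* μ) :+ (Q :* ((w :+ con 1) :* x)) :* (V :+ con 16)) :+ con 0 := (Q :* (V :* ((w :+ con 1) :* x))) :+ (((Q :* μ :+ con 16 :* (Q :* ((w :+ con 1) :* x))) :+ g) :+ (Q :* ((w :+ con 1) :* x)) :* Q)) refl

 -- Lowering r from a t Z to a (t - 8) Z frees 16 a Z. One half of this is A = 8 a Z; the other half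
 -- pays for 2 B = 8 t² Z and for the 42 units by which w lies below a.
 budget-small : ∀ w v Z → 8 * ((v + 13) * (v + 13)) + 84 * (v + 13) ≤ 8 * (w + 42) → 2 * ((w + 42) * (v + 5) * Z) + 8 * ((w + 42) * Z) + 2 * (4 * ((v + 13) * (v + 13) * Z)) ≤ 2 * (w * ((v + 13) * Z))
 budget-small w v Z h = linear (*-monoʳ-≤ Z h) (id₁ w v Z)
   where
   id₁ : ∀ w v Z → (2 * ((w + 42) * (v + 5) * Z) + 8 * ((w + 42) * Z) + 2 * (4 * ((v + 13) * (v + 13) * Z))) + Z * (8 * (w + 42)) + 0 ≡ (2 * (w * ((v + 13) * Z))) + Z * (8 * ((v + 13) * (v + 13)) + 84 * (v + 13))
   id₁ = solve 3 (λ w v Z → (con 2 :* ((w :+ con 42) :* (v :+ con 5) :* Z) :+ con 8 :* ((w :+ con 42) :* Z) :+ con 2 :* (con 4 :* ((v :+ con 13) :* (v :+ con 13) :* Z))) :+ Z :* (con 8 :* (w :+ con 42)) :+ con 0 := (con 2 :* (w :* ((v :+ con 13) :* Z))) :+ Z :* (con 8 :* ((v :+ con 13) :* (v :+ con 13)) :+ con 84 :* (v :+ con 13))) refl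

 -- In units of t² Z², the codegrees exceed δ² by (w + 84)(w + 42) - w² = 126 w + 3528, and 4 A B
 -- contributes 128 (w + 42). The surplus absorbs E = 4 m, which is of lower order because 4 P ≤ t
 -- Z.
 codegree-small : ∀ w v Q m₀ χ y P → (w + 42) * m₀ * χ ≤ (w + 84) * ((w + 42) * ((v + 13) * y)) * ((w + 42) * ((v + 13) * y)) → m₀ ≤ 2 * (P * ((w + 42) * ((v + 13) * y))) → 4 * P ≤ (v + 13) * (Q * Q * y) → Q * Q * m₀ * (Q * Q * χ) + 4 * (Q * Q * m₀) ≤ 4 * (8 * ((w + 42) * (Q * Q * y)) * (4 * ((v + 13) * (v + 13) * (Q * Q * y)))) + w * ((v + 13) * (Q * Q * y)) * (w * ((v + 13) * (Q * Q * y)))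
 codegree-small w v Q m₀ χ y P h₁ h₂ h₃ = *-cancelˡ-≤ (w + 42) {{>-nonZero (≤-trans (s≤s z≤n) (m≤n+m 42 w))}} (linear (+-mono-≤ (+-mono-≤ (*-monoʳ-≤ (Q * Q * (Q * Q)) h₁) (*-monoʳ-≤ (4 * ((w + 42) * (Q * Q))) h₂)) (*-monoʳ-≤ (2 * ((w + 42) * ((w + 42) * ((v + 13) * (Q * Q * y))))) h₃)) (id₁ w v Q m₀ χ y P))
   where
   id₁ : ∀ w v Q m₀ χ y P → ((w + 42) * (Q * Q * m₀ * (Q * Q * χ) + 4 * (Q * Q * m₀))) + (((Q * Q * (Q * Q)) * ((w + 84) * ((w + 42) * ((v + 13) * y)) * ((w + 42) * ((v + 13) * y))) + (4 * ((w + 42) * (Q * Q))) * (2 * (P * ((w + 42) * ((v + 13) * y))))) + (2 * ((w + 42) * ((w + 42) * ((v + 13) * (Q * Q * y))))) * ((v + 13) * (Q * Q * y))) + (1764 * Q * Q * Q * Q * v * v * w * y * y + 74088 * Q * Q * Q * Q * v * v * y * y + 45864 * Q * Q * Q * Q * v * w * y * y + 1926288 * Q * Q * Q * Q * v * y * y + 298116 * Q * Q * Q * Q * w * y * y + 12520872 * Q * Q * Q * Q * y * y) ≡ ((w + 42) * (4 * (8 * ((w + 42) * (Q * Q * y)) * (4 * ((v + 13) * (v + 13) * (Q * Q * y)))) + w * ((v + 13) * (Q * Q * y)) * (w * ((v + 13) * (Q * Q * y))))) + (((Q * Q * (Q * Q)) * ((w + 42) * m₀ * χ) + (4 * ((w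 + 42) * (Q * Q))) * m₀) + (2 * ((w + 42) * ((w + 42) * ((v + 13) * (Q * Q * y))))) * (4 * P))
   id₁ = solve 7 (λ w v Q m₀ χ y P → ((w :+ con 42) :* (Q :* Q :* m₀ :* (Q :* Q :* χ) :+ con 4 :* (Q :* Q :* m₀))) :+ (((Q :* Q :* (Q :* Q)) :* ((w :+ con 84) :* ((w :+ con 42) :* ((v :+ con 13) :* y)) :* ((w :+ con 42) :* ((v :+ con 13) :* y))) :+ (con 4 :* ((w :+ con 42) :* (Q :* Q))) :* (con 2 :* (P :* ((w :+ con 42) :* ((v :+ con 13) :* y))))) :+ (con 2 :* ((w :+ con 42) :* ((w :+ con 42) :* ((v :+ con 13) :* (Q :* Q :* y))))) :* ((v :+ con 13) :* (Q :* Q :* y))) :+ (con 1764 :* Q :* Q :* Q :* Q :* v :* v :* w :* y :* y :+ con 74088 :* Q :* Q :* Q :* Q :* v :* v :* y :* y :+ con 45864 :* Q :* Q :* Q :* Q :* v :* w :* y :* y :+ con 1926288 :* Q :* Q :* Q :* Q :* v :* y :* y :+ con 298116 :* Q :* Q :* Q :* Q :* w :* y :* y :+ con 12520872 :* Q :* Q :* Q :* Q :* y :* y) := ((w :+ con 42) :* (con 4 :* (con 8 :* ((w :+ con 42) :* (Q :* Q :* y)) :* (con 4 :* ((v :+ con 13) :* (v :+ con 13) :* (Q :* Q :* y)))) :+ w :* ((v :+ con 13) :* (Q :* Q :* y)) :* (w :* ((v :+ con 13) :* (Q :* Q :* y))))) :+ (((Q :* Q :* (Q :* Q)) :* ((w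 :+ con 42) :* m₀ :* χ) :+ (con 4 :* ((w :+ con 42) :* (Q :* Q))) :* m₀) :+ (con 2 :* ((w :+ con 42) :* ((w :+ con 42) :* ((v :+ con 13) :* (Q :* Q :* y))))) :* (con 4 :* P))) refl

 degree-small : ∀ w x m → 42 ≤ w → m * (2 * ((w + 42) * x)) ≤ 4 * m * (w * x)
 degree-small w x m h = linear (*-monoʳ-≤ (2 * (m * x)) h) (id₁ w x m)
   where
   id₁ : ∀ w x m → (m * (2 * ((w + 42) * x))) + (2 * (m * x)) * w + 0 ≡ 4 * m * (w * x) + (2 * (m * x)) * 42
   id₁ = solve 3 (λ w x m → (m :* (con 2 :* ((w :+ con 42) :* x))) :+ (con 2 :* (m :* x)) :* w :+ con 0 := con 4 :* m :* (w :* x) :+ (con 2 :* (m :* x)) :* con 42) refl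

 m₀-upper : ∀ F m₀ n P X a t y → F * m₀ ≤ n → n ≤ P * (X + 1) → X + 1 ≤ F * (a * (t * (y + 1))) → 1 ≤ y → 0 < F → m₀ ≤ 2 * (P * (a * (t * y)))
 m₀-upper F m₀ n P X a t y h₁ h₂ h₃ h₄ F>0 = *-cancelˡ-≤ F {{>-nonZero F>0}} (linear (+-mono-≤ (+-mono-≤ (+-mono-≤ h₁ h₂) (*-monoʳ-≤ P h₃)) (*-monoʳ-≤ (F * (P * (a * t))) h₄)) (id₁ F m₀ n P X a t y))
   where
   id₁ : ∀ F m₀ n P X a t y → F * m₀ + (((n + (P * (X + 1))) + P * (F * (a * (t * (y + 1))))) + (F * (P * (a * t))) * y) + 0 ≡ F * (2 * (P * (a * (t * y)))) + (((F * m₀ + n) + P * (X + 1)) + (F * (P * (a * t))) * 1)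
   id₁ = solve 8 (λ F m₀ n P X a t y → F :* m₀ :+ (((n :+ (P :* (X :+ con 1))) :+ P :* (F :* (a :* (t :* (y :+ con 1))))) :+ (F :* (P :* (a :* t))) :* y) :+ con 0 := F :* (con 2 :* (P :* (a :* (t :* y)))) :+ (((F :* m₀ :+ n) :+ P :* (X :+ con 1)) :+ (F :* (P :* (a :* t))) :* con 1)) refl

 d-upper : ∀ F m₀ n P X d → F * d ≤ X → 9 * (P * X) ≤ 10 * n → n ≤ F * (m₀ + 1) → 2 ≤ m₀ → 0 < 9 * F → P * d ≤ 2 * m₀
 d-upper F m₀ n P X d h₁ h₂ h₃ h₄ 9F>0 = *-cancelˡ-≤ (9 * F) {{>-nonZero 9F>0}} (linear (+-mono-≤ (+-mono-≤ (+-mono-≤ (*-monoʳ-≤ (9 * P) h₁) h₂) (*-monoʳ-≤ 10 h₃)) (*-monoʳ-≤ (5 * F) h₄)) (id₁ F m₀ n P X d))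
   where
   id₁ : ∀ F m₀ n P X d → (9 * F) * (P * d) + ((((9 * P) * X + 10 * n) + 10 * (F * (m₀ + 1))) + (5 * F) * m₀) + (3 * F * m₀) ≡ (9 * F) * (2 * m₀) + ((((9 * P) * (F * d) + 9 * (P * X)) + 10 * n) + (5 * F) * 2)
   id₁ = solve 6 (λ F m₀ n P X d → (con 9 :* F) :* (P :* d) :+ ((((con 9 :* P) :* X :+ con 10 :* n) :+ con 10 :* (F :* (m₀ :+ con 1))) :+ (con 5 :* F) :* m₀) :+ (con 3 :* F :* m₀) := (con 9 :* F) :* (con 2 :* m₀) :+ ((((con 9 :* P) :* (F :* d) :+ con 9 :* (P :* X)) :+ con 10 :* n) :+ (con 5 :* F) :* con 2)) refl

 degree-floor : ∀ S₂ X c F x → (S₂ + 1) * X ≤ (S₂ + 2) * (c + F) → F * ((40 * S₂ + 38 + 42) * x) ≤ X → 40 * (S₂ + 1) * (F * x) ≤ c + F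
 degree-floor S₂ X c F x h₁ h₂ = *-cancelˡ-≤ (S₂ + 2) {{>-nonZero (≤-trans (s≤s z≤n) (m≤n+m 2 S₂))}} (linear (+-mono-≤ h₁ (*-monoʳ-≤ (S₂ + 1) h₂)) (id₁ S₂ X c F x))
   where
   id₁ : ∀ S₂ X c F x → ((S₂ + 2) * (40 * (S₂ + 1) * (F * x))) + (((S₂ + 2) * (c + F)) + (S₂ + 1) * X) + 0 ≡ ((S₂ + 2) * (c + F)) + (((S₂ + 1) * X) + (S₂ + 1) * (F * ((40 * S₂ + 38 + 42) * x)))
   id₁ = solve 5 (λ S₂ X c F x → ((S₂ :+ con 2) :* (con 40 :* (S₂ :+ con 1) :* (F :* x))) :+ (((S₂ :+ con 2) :* (c :+ F)) :+ (S₂ :+ con 1) :* X) :+ con 0 := ((S₂ :+ con 2) :* (c :+ F)) :+ (((S₂ :+ con 1) :* X) :+ (S₂ :+ con 1) :* (F :* ((con 40 :* S₂ :+ con 38 :+ con 42) :* x)))) refl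

 -- In units of x, uniformity lowers 40 S to W = 40 (S - 1). Halving costs a share 1/(σ + 1) = 1/(80
 -- S), at most half a unit; rounding and the additive error cost at most another half. This leaves
 -- 40 S - 41 = w + 1.
 low-descends : ∀ σ W F c k E x → W * (F * x) ≤ c + F → σ * c ≤ suc σ * (F * (k + E)) → 2 * W ≤ suc σ → 2 * E + 2 ≤ x → 0 < 2 * (suc σ * F) → W * x ≤ k + x
 low-descends σ W F c k E x h₁ h₂ h₃ h₄ pos>0 = *-cancelˡ-≤ (2 * (suc σ * F)) {{>-nonZero pos>0}} (linear (+-mono-≤ (+-mono-≤ (+-mono-≤ (*-monoʳ-≤ (2 * σ) h₁) (*-monoʳ-≤ 2 h₂)) (*-monoʳ-≤ (F * x) h₃)) (*-monoʳ-≤ (suc σ * F) h₄)) (id₁ σ W F c k E x))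
   where
   id₁ : ∀ σ W F c k E x → (2 * (suc σ * F)) * (W * x) + ((((2 * σ) * (c + F) + 2 * (suc σ * (F * (k + E)))) + (F * x) * (suc σ)) + (suc σ * F) * x) + (2 * F) ≡ ((2 * (suc σ * F)) * (k + x)) + ((((2 * σ) * (W * (F * x)) + 2 * (σ * c)) + (F * x) * (2 * W)) + (suc σ * F) * (2 * E + 2))
   id₁ = solve 7 (λ σ W F c k E x → (con 2 :* ((con 1 :+ σ) :* F)) :* (W :* x) :+ ((((con 2 :* σ) :* (c :+ F) :+ con 2 :* ((con 1 :+ σ) :* (F :* (k :+ E)))) :+ (F :* x) :* ((con 1 :+ σ))) :+ ((con 1 :+ σ) :* F) :* x) :+ (con 2 :* F) := ((con 2 :* ((con 1 :+ σ) :* F)) :* (k :+ x)) :+ ((((con 2 :* σ) :* (W :* (F :* x)) :+ con 2 :* (σ :* c)) :+ (F :* x) :* (con 2 :* W)) :+ ((con 1 :+ σ) :* F) :* (con 2 :* E :+ con 2))) refl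

 degree-ceiling : ∀ S X c F a t y → S * c ≤ (S + 1) * (X + 1) → X + 1 ≤ F * (S * a * (t * (y + 1))) → 0 < S → c ≤ (S + 1) * a * (t * (F * (y + 1)))
 degree-ceiling S X c F a t y h₁ h₂ S>0 = *-cancelˡ-≤ S {{>-nonZero S>0}} (linear (+-mono-≤ h₁ (*-monoʳ-≤ (S + 1) h₂)) (id₁ S X c F a t y))
   where
   id₁ : ∀ S X c F a t y → S * c + (((S + 1) * (X + 1)) + (S + 1) * (F * (S * a * (t * (y + 1))))) + 0 ≡ (S * ((S + 1) * a * (t * (F * (y + 1))))) + (S * c + (S + 1) * (X + 1))
   id₁ = solve 7 (λ S X c F a t y → S :* c :+ (((S :+ con 1) :* (X :+ con 1)) :+ (S :+ con 1) :* (F :* (S :* a :* (t :* (y :+ con 1))))) :+ con 0 := (S :* ((S :+ con 1) :* a :* (t :* (F :* (y :+ con 1))))) :+ (S :* c :+ (S :+ con 1) :* (X :+ con 1))) refl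

 high-descends : ∀ σ F c k E T → σ * (F * k) ≤ suc σ * (c + F * E) → 4 ≤ σ → c ≤ F * T → 0 < σ * F → 4 * k ≤ 5 * (T + E)
 high-descends σ F c k E T h₁ h₂ h₃ σF>0 = *-cancelˡ-≤ (σ * F) {{>-nonZero σF>0}} (linear (+-mono-≤ (+-mono-≤ (*-monoʳ-≤ 4 h₁) (*-monoʳ-≤ (c + F * E) h₂)) (*-monoʳ-≤ (5 * σ) h₃)) (id₁ σ F c k E T))
   where
   id₁ : ∀ σ F c k E T → (σ * F) * (4 * k) + ((4 * (suc σ * (c + F * E)) + (c + F * E) * σ) + (5 * σ) * (F * T)) + 0 ≡ ((σ * F) * (5 * (T + E))) + ((4 * (σ * (F * k)) + (c + F * E) * 4) + (5 * σ) * c)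
   id₁ = solve 6 (λ σ F c k E T → (σ :* F) :* (con 4 :* k) :+ ((con 4 :* ((con 1 :+ σ) :* (c :+ F :* E)) :+ (c :+ F :* E) :* σ) :+ (con 5 :* σ) :* (F :* T)) :+ con 0 := ((σ :* F) :* (con 5 :* (T :+ E))) :+ ((con 4 :* (σ :* (F :* k)) :+ (c :+ F :* E) :* con 4) :+ (con 5 :* σ) :* c)) refl

 -- A factor of two is good enough, since the upper degree bound enters the cut condition only
 -- through `degree-ok`, a term of lower order.
 degree-double : ∀ S t y E k → 4 * k ≤ 5 * ((S + 1) * 40 * (t * (y + 1)) + E) → 9 ≤ S → 3 ≤ y → 2 * E + 2 ≤ t * y → 9 ≤ S → 9 ≤ S → k ≤ 2 * (40 * S * (t * y))
 degree-double S t y E k h₁ h₂ h₃ h₄ h₅ h₆ = *-cancelˡ-≤ 4 (linear (+-mono-≤ (+-mono-≤ (+-mono-≤ (+-mono-≤ (+-mono-≤ h₁ (*-monoʳ-≤ (25 * (t * y)) h₂)) (*-monoʳ-≤ (75 * (S * t)) h₃)) (*-monoʳ-≤ 3 h₄)) (*-monoʳ-≤ (25 * t) h₅)) (*-monoʳ-≤ (t * y) h₆)) (id₁ S t y E k))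
   where
   id₁ : ∀ S t y E k → 4 * k + ((((((5 * ((S + 1) * 40 * (t * (y + 1)) + E)) + (25 * (t * y)) * S) + (75 * (S * t)) * y) + 3 * (t * y)) + (25 * t) * S) + (t * y) * S) + (6 + E + 19 * S * t * y + 25 * t + 31 * t * y) ≡ 4 * (2 * (40 * S * (t * y))) + (((((4 * k + (25 * (t * y)) * 9) + (75 * (S * t)) * 3) + 3 * (2 * E + 2)) + (25 * t) * 9) + (t * y) * 9)
   id₁ = solve 5 (λ S t y E k → con 4 :* k :+ ((((((con 5 :* ((S :+ con 1) :* con 40 :* (t :* (y :+ con 1)) :+ E)) :+ (con 25 :* (t :* y)) :* S) :+ (con 75 :* (S :* t)) :* y) :+ con 3 :* (t :* y)) :+ (con 25 :* t) :* S) :+ (t :* y) :* S) :+ (con 6 :+ E :+ con 19 :* S :* t :* y :+ con 25 :* t :+ con 31 :* t :* y) := con 4 :* (con 2 :* (con 40 :* S :* (t :* y))) :+ (((((con 4 :* k :+ (con 25 :* (t :* y)) :* con 9) :+ (con 75 :* (S :* t)) :* con 3) :+ con 3 :* (con 2 :* E :+ con 2)) :+ (con 25 :* t) :* con 9) :+ (t :* y) :* con 9)) refl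

 codegree-ceiling : ∀ S n c F m₀ Y D → S * (n * c) ≤ (S + 1) * Y → F * m₀ ≤ n → Y ≤ F * D * (F * D) → 0 < F → S * (m₀ * c) ≤ (S + 1) * (F * (D * D))
 codegree-ceiling S n c F m₀ Y D h₁ h₂ h₃ F>0 = *-cancelˡ-≤ F {{>-nonZero F>0}} (linear (+-mono-≤ (+-mono-≤ h₁ (*-monoʳ-≤ (S * c) h₂)) (*-monoʳ-≤ (S + 1) h₃)) (id₁ S n c F m₀ Y D))
   where
   id₁ : ∀ S n c F m₀ Y D → F * (S * (m₀ * c)) + ((((S + 1) * Y) + (S * c) * n) + (S + 1) * (F * D * (F * D))) + 0 ≡ (F * ((S + 1) * (F * (D * D)))) + ((S * (n * c) + (S * c) * (F * m₀)) + (S + 1) * Y)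
   id₁ = solve 7 (λ S n c F m₀ Y D → F :* (S :* (m₀ :* c)) :+ ((((S :+ con 1) :* Y) :+ (S :* c) :* n) :+ (S :+ con 1) :* (F :* D :* (F :* D))) :+ con 0 := (F :* ((S :+ con 1) :* (F :* (D :* D)))) :+ ((S :* (n :* c) :+ (S :* c) :* (F :* m₀)) :+ (S :+ con 1) :* Y)) refl

 codegree-descends : ∀ σ F S m₀ c k E Y → σ * (F * k) ≤ suc σ * (c + F * E) → S * (m₀ * c) ≤ F * Y → 0 < F → σ * (S * (m₀ * k)) ≤ suc σ * (Y + S * (m₀ * E))
 codegree-descends σ F S m₀ c k E Y h₁ h₂ F>0 = *-cancelˡ-≤ F {{>-nonZero F>0}} (linear (+-mono-≤ (*-monoʳ-≤ (S * m₀) h₁) (*-monoʳ-≤ (suc σ) h₂)) (id₁ σ F S m₀ c k E Y))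
   where
   id₁ : ∀ σ F S m₀ c k E Y → F * (σ * (S * (m₀ * k))) + ((S * m₀) * (suc σ * (c + F * E)) + (suc σ) * (F * Y)) + 0 ≡ (F * (suc σ * (Y + S * (m₀ * E)))) + ((S * m₀) * (σ * (F * k)) + (suc σ) * (S * (m₀ * c)))
   id₁ = solve 8 (λ σ F S m₀ c k E Y → F :* (σ :* (S :* (m₀ :* k))) :+ ((S :* m₀) :* ((con 1 :+ σ) :* (c :+ F :* E)) :+ ((con 1 :+ σ)) :* (F :* Y)) :+ con 0 := (F :* ((con 1 :+ σ) :* (Y :+ S :* (m₀ :* E)))) :+ ((S :* m₀) :* (σ :* (F :* k)) :+ ((con 1 :+ σ)) :* (S :* (m₀ :* c)))) refl

 -- Of the one unit in 80 S + 81 beyond 80 (S + 1), half pays for replacing y by y + 1 and half for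
 -- the additive error E; hence the constants 480 and 320.
 square-growth : ∀ S b y P m₀ E → m₀ ≤ 2 * (P * (b * y)) → 480 * (S + 1) ≤ y → 320 * (S * (P * E)) ≤ b * y → 1 ≤ y → 80 * ((S + 1) * (b * (y + 1) * (b * (y + 1))) + S * (m₀ * E)) ≤ (80 * S + 81) * (b * y * (b * y))
 square-growth S b y P m₀ E h₁ h₂ h₃ h₄ = *-cancelˡ-≤ 2 (linear (+-mono-≤ (+-mono-≤ (+-mono-≤ (*-monoʳ-≤ (160 * (S * E)) h₁) (*-monoʳ-≤ (b * b * y) h₂)) (*-monoʳ-≤ (b * y) h₃)) (*-monoʳ-≤ (160 * ((S + 1) * (b * b))) h₄)) (id₁ S b y P m₀ E))
   where
   id₁ : ∀ S b y P m₀ E → (2 * (80 * ((S + 1) * (b * (y + 1) * (b * (y + 1))) + S * (m₀ * E)))) + ((((160 * (S * E)) * (2 * (P * (b * y))) + (b * b * y) * y) + (b * y) * (b * y)) + (160 * ((S + 1) * (b * b))) * y) + 0 ≡ (2 * ((80 * S + 81) * (b * y * (b * y)))) + ((((160 * (S * E)) * m₀ + (b * b * y) * (480 * (S + 1))) + (b * y) * (320 * (S * (P * E)))) + (160 * ((S + 1) * (b * b))) * 1)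
   id₁ = solve 6 (λ S b y P m₀ E → (con 2 :* (con 80 :* ((S :+ con 1) :* (b :* (y :+ con 1) :* (b :* (y :+ con 1))) :+ S :* (m₀ :* E)))) :+ ((((con 160 :* (S :* E)) :* (con 2 :* (P :* (b :* y))) :+ (b :* b :* y) :* y) :+ (b :* y) :* (b :* y)) :+ (con 160 :* ((S :+ con 1) :* (b :* b))) :* y) :+ con 0 := (con 2 :* ((con 80 :* S :+ con 81) :* (b :* y :* (b :* y)))) :+ ((((con 160 :* (S :* E)) :* m₀ :+ (b :* b :* y) :* (con 480 :* (S :+ con 1))) :+ (b :* y) :* (con 320 :* (S :* (P :* E)))) :+ (con 160 :* ((S :+ con 1) :* (b :* b))) :* con 1)) refl

 -- The error budget of codegrees: 1/S from uniformity and about 1/(80 S) each from halving and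
 -- rounding, all within (w + 84)/(w + 42) = 1 + 42/(40 S).
 codegree-final : ∀ S₂ z Y d → (80 * S₂ + 159) * ((S₂ + 2) * z) ≤ suc (80 * S₂ + 159) * Y → 80 * Y ≤ (80 * (S₂ + 2) + 81) * (d * d) → 0 < 2 * (80 * S₂ + 159) → (40 * S₂ + 38 + 42) * z ≤ ((40 * S₂ + 38) + 84) * (d * d)
 codegree-final S₂ z Y d h₁ h₂ pos>0 = *-cancelˡ-≤ (2 * (80 * S₂ + 159)) {{>-nonZero pos>0}} (linear (+-mono-≤ (*-monoʳ-≤ 80 h₁) (*-monoʳ-≤ (suc (80 * S₂ + 159)) h₂)) (id₁ S₂ z Y d))
   where
   id₁ : ∀ S₂ z Y d → ((2 * (80 * S₂ + 159)) * ((40 * S₂ + 38 + 42) * z)) + (80 * (suc (80 * S₂ + 159) * Y) + (suc (80 * S₂ + 159)) * ((80 * (S₂ + 2) + 81) * (d * d))) + (160 * S₂ * d * d + 236 * d * d) ≡ ((2 * (80 * S₂ + 159)) * (((40 * S₂ + 38) + 84) * (d * d))) + (80 * ((80 * S₂ + 159) * ((S₂ + 2) * z)) + (suc (80 * S₂ + 159)) * (80 * Y))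
   id₁ = solve 4 (λ S₂ z Y d → ((con 2 :* (con 80 :* S₂ :+ con 159)) :* ((con 40 :* S₂ :+ con 38 :+ con 42) :* z)) :+ (con 80 :* ((con 1 :+ (con 80 :* S₂ :+ con 159)) :* Y) :+ ((con 1 :+ (con 80 :* S₂ :+ con 159))) :* ((con 80 :* (S₂ :+ con 2) :+ con 81) :* (d :* d))) :+ (con 160 :* S₂ :* d :* d :+ con 236 :* d :* d) := ((con 2 :* (con 80 :* S₂ :+ con 159)) :* (((con 40 :* S₂ :+ con 38) :+ con 84) :* (d :* d))) :+ (con 80 :* ((con 80 :* S₂ :+ con 159) :* ((S₂ :+ con 2) :* z)) :+ ((con 1 :+ (con 80 :* S₂ :+ con 159))) :* (con 80 :* Y))) refl

 square-ratio : ∀ X → 9 ≤ X → 9 ≤ X → 81 * ((X + 1) * (X + 1)) ≤ 100 * (X * X)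
 square-ratio X h₁ h₂ = linear (+-mono-≤ (*-monoʳ-≤ (19 * X) h₁) (*-monoʳ-≤ 9 h₂)) (id₁ X)
   where
   id₁ : ∀ X → (81 * ((X + 1) * (X + 1))) + ((19 * X) * X + 9 * X) + 0 ≡ 100 * (X * X) + ((19 * X) * 9 + 9 * 9)
   id₁ = solve 1 (λ X → (con 81 :* ((X :+ con 1) :* (X :+ con 1))) :+ ((con 19 :* X) :* X :+ con 9 :* X) :+ con 0 := con 100 :* (X :* X) :+ ((con 19 :* X) :* con 9 :+ con 9 :* con 9)) refl

 codegree-floor : ∀ S₂ X n P c F → (S₂ + 1) * (X * X) ≤ (S₂ + 2) * (n * (c + F)) → 7 ≤ S₂ → 81 * ((X + 1) * (X + 1)) ≤ 100 * (X * X) → n * n ≤ P * (X + 1) * (P * (X + 1)) → 0 < 36 * ((S₂ + 2) * n) → 18 * n ≤ 25 * (P * P * (c + F))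
 codegree-floor S₂ X n P c F h₁ h₂ h₃ h₄ pos>0 = *-cancelˡ-≤ (36 * ((S₂ + 2) * n)) {{>-nonZero pos>0}} (linear (+-mono-≤ (+-mono-≤ (+-mono-≤ (*-monoʳ-≤ (900 * (P * P)) h₁) (*-monoʳ-≤ (100 * (X * X * (P * P))) h₂)) (*-monoʳ-≤ (8 * ((S₂ + 2) * (P * P))) h₃)) (*-monoʳ-≤ (648 * (S₂ + 2)) h₄)) (id₁ S₂ X n P c F))
   where
   id₁ : ∀ S₂ X n P c F → ((36 * ((S₂ + 2) * n)) * (18 * n)) + ((((900 * (P * P)) * ((S₂ + 2) * (n * (c + F))) + (100 * (X * X * (P * P))) * S₂) + (8 * ((S₂ + 2) * (P * P))) * (100 * (X * X))) + (648 * (S₂ + 2)) * (P * (X + 1) * (P * (X + 1)))) + 0 ≡ ((36 * ((S₂ + 2) * n)) * (25 * (P * P * (c + F)))) + ((((900 * (P * P)) * ((S₂ + 1) * (X * X)) + (100 * (X * X * (P * P))) * 7) + (8 * ((S₂ + 2) * (P * P))) * (81 * ((X + 1) * (X + 1)))) + (648 * (S₂ + 2)) * (n * n))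
   id₁ = solve 6 (λ S₂ X n P c F → ((con 36 :* ((S₂ :+ con 2) :* n)) :* (con 18 :* n)) :+ ((((con 900 :* (P :* P)) :* ((S₂ :+ con 2) :* (n :* (c :+ F))) :+ (con 100 :* (X :* X :* (P :* P))) :* S₂) :+ (con 8 :* ((S₂ :+ con 2) :* (P :* P))) :* (con 100 :* (X :* X))) :+ (con 648 :* (S₂ :+ con 2)) :* (P :* (X :+ con 1) :* (P :* (X :+ con 1)))) :+ con 0 := ((con 36 :* ((S₂ :+ con 2) :* n)) :* (con 25 :* (P :* P :* (c :+ F)))) :+ ((((con 900 :* (P :* P)) :* ((S₂ :+ con 1) :* (X :* X)) :+ (con 100 :* (X :* X :* (P :* P))) :* con 7) :+ (con 8 :* ((S₂ :+ con 2) :* (P :* P))) :* (con 81 :* ((X :+ con 1) :* (X :+ con 1)))) :+ (con 648 :* (S₂ :+ con 2)) :* (n :* n))) refl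

 -- The greedy choices are content with half of m₀ / P², which roughly is the expected codegree, so
 -- crude factors such as 18/25 suffice.
 codegree-low : ∀ σ F c k E m₀ n P μ → 18 * n ≤ 25 * (P * P * (c + F)) → σ * c ≤ suc σ * (F * (k + E)) → 9 ≤ σ → F * m₀ ≤ n → 2 * (P * P) * μ ≤ m₀ → 7 * (P * P * (E + 1)) ≤ m₀ → 0 < 250 * (σ * F * (P * P)) → μ ≤ k
 codegree-low σ F c k E m₀ n P μ h₁ h₂ h₃ h₄ h₅ h₆ pos>0 = *-cancelˡ-≤ (250 * (σ * F * (P * P))) {{>-nonZero pos>0}} (linear (+-mono-≤ (+-mono-≤ (+-mono-≤ (+-mono-≤ (+-mono-≤ (*-monoʳ-≤ (9 * σ) h₁) (*-monoʳ-≤ (225 * (P * P)) h₂)) (*-monoʳ-≤ (25 * (P * P * (F * (k + E)))) h₃)) (*-monoʳ-≤ (162 * σ) h₄)) (*-monoʳ-≤ (125 * (σ * F)) h₅)) (*-monoʳ-≤ (36 * (σ * F)) h₆)) (id₁ σ F c k E m₀ n P μ))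
   where
   id₁ : ∀ σ F c k E m₀ n P μ → (250 * (σ * F * (P * P))) * μ + ((((((9 * σ) * (25 * (P * P * (c + F))) + (225 * (P * P)) * (suc σ * (F * (k + E)))) + (25 * (P * P * (F * (k + E)))) * σ) + (162 * σ) * n) + (125 * (σ * F)) * m₀) + (36 * (σ * F)) * m₀) + (2 * E * F * P * P * σ + 27 * F * P * P * σ + F * m₀ * σ) ≡ (250 * (σ * F * (P * P))) * k + ((((((9 * σ) * (18 * n) + (225 * (P * P)) * (σ * c)) + (25 * (P * P * (F * (k + E)))) * 9) + (162 * σ) * (F * m₀)) + (125 * (σ * F)) * (2 * (P * P) * μ)) + (36 * (σ * F)) * (7 * (P * P * (E + 1))))
   id₁ = solve 9 (λ σ F c k E m₀ n P μ → (con 250 :* (σ :* F :* (P :* P))) :* μ :+ ((((((con 9 :* σ) :* (con 25 :* (P :* P :* (c :+ F))) :+ (con 225 :* (P :* P)) :* ((con 1 :+ σ) :* (F :* (k :+ E)))) :+ (con 25 :* (P :* P :* (F :* (k :+ E)))) :* σ) :+ (con 162 :* σ) :* n) :+ (con 125 :* (σ :* F)) :* m₀) :+ (con 36 :* (σ :* F)) :* m₀) :+ (con 2 :* E :* F :* P :* P :* σ :+ con 27 :* F :* P :* P :* σ :+ F :* m₀ :* σ) := (con 250 :* (σ :* F :* (P :* P))) :* k :+ ((((((con 9 :* σ) :* (con 18 :* n) :+ (con 225 :* (P :* P)) :* (σ :* c)) :+ (con 25 :* (P :* P :* (F :* (k :+ E)))) :* con 9) :+ (con 162 :* σ) :* (F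 :* m₀)) :+ (con 125 :* (σ :* F)) :* (con 2 :* (P :* P) :* μ)) :+ (con 36 :* (σ :* F)) :* (con 7 :* (P :* P :* (E :+ con 1))))) refl

 budget-of-t : ∀ v a → 31 * ((v + 13) * (v + 13)) ≤ 16 * a → 8 * ((v + 13) * (v + 13)) + 84 * (v + 13) ≤ 8 * a
 budget-of-t v a h = *-cancelˡ-≤ 2 (linear h (id₁ v a))
   where
   id₁ : ∀ v a → (2 * (8 * ((v + 13) * (v + 13)) + 84 * (v + 13))) + 16 * a + (351 + 222 * v + 15 * v * v) ≡ 2 * (8 * a) + (31 * ((v + 13) * (v + 13)))
   id₁ = solve 2 (λ v a → (con 2 :* (con 8 :* ((v :+ con 13) :* (v :+ con 13)) :+ con 84 :* (v :+ con 13))) :+ con 16 :* a :+ (con 351 :+ con 222 :* v :+ con 15 :* v :* v) := con 2 :* (con 8 :* a) :+ (con 31 :* ((v :+ con 13) :* (v :+ con 13)))) refl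

 t-linear : ∀ v S → 31 * ((v + 13) * (v + 13)) ≤ 640 * S → v + 13 ≤ 2 * S
 t-linear v S h = *-cancelˡ-≤ 320 (linear h (id₁ v S))
   where
   id₁ : ∀ v S → (320 * (v + 13)) + 640 * S + (1079 + 486 * v + 31 * v * v) ≡ 320 * (2 * S) + (31 * ((v + 13) * (v + 13)))
   id₁ = solve 2 (λ v S → (con 320 :* (v :+ con 13)) :+ con 640 :* S :+ (con 1079 :+ con 486 :* v :+ con 31 :* v :* v) := con 320 :* (con 2 :* S) :+ (con 31 :* ((v :+ con 13) :* (v :+ con 13)))) refl

 -- The share 8/t of the degree was given up in r. Another 4/(3t) covers the upper deviation 1/S of
 -- the degrees and the rounding of y, by v + 4 ≤ S and 3 (S + 1) ≤ y. Together this is 28/(3t), and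
 -- 3 v + 11 = 3 t - 28.
 coverage : ∀ S v a y F X → X + 1 ≤ F * (a * ((v + 13) * (y + 1))) → v + 4 ≤ S → 3 * (S + 1) ≤ y → (3 * v + 11) * ((S + 1) * (X + 1)) ≤ 3 * (v + 13) * (S * (a * (v + 5) * (F * y)))
 coverage S v a y F X h₁ h₂ h₃ = linear (+-mono-≤ (+-mono-≤ (*-monoʳ-≤ ((3 * v + 11) * (S + 1)) h₁) (*-monoʳ-≤ (3 * ((y + S + 1) * ((v + 13) * (a * F)))) h₂)) (*-monoʳ-≤ (S * ((v + 13) * (a * F))) h₃)) (id₁ S v a y F X)
   where
   id₁ : ∀ S v a y F X → ((3 * v + 11) * ((S + 1) * (X + 1))) + ((((3 * v + 11) * (S + 1)) * (F * (a * ((v + 13) * (y + 1)))) + (3 * ((y + S + 1) * ((v + 13) * (a * F)))) * S) + (S * ((v + 13) * (a * F))) * y) + (13 * F * S * a + F * S * a * v + 13 * F * a + F * a * v + F * a * v * y + 13 * F * a * y) ≡ (3 * (v + 13) * (S * (a * (v + 5) * (F * y)))) + ((((3 * v + 11) * (S + 1)) * (X + 1) + (3 * ((y + S + 1) * ((v + 13) * (a * F)))) * (v + 4)) + (S * ((v + 13) * (a * F))) * (3 * (S + 1)))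
   id₁ = solve 6 (λ S v a y F X → ((con 3 :* v :+ con 11) :* ((S :+ con 1) :* (X :+ con 1))) :+ ((((con 3 :* v :+ con 11) :* (S :+ con 1)) :* (F :* (a :* ((v :+ con 13) :* (y :+ con 1)))) :+ (con 3 :* ((y :+ S :+ con 1) :* ((v :+ con 13) :* (a :* F)))) :* S) :+ (S :* ((v :+ con 13) :* (a :* F))) :* y) :+ (con 13 :* F :* S :* a :+ F :* S :* a :* v :+ con 13 :* F :* a :+ F :* a :* v :+ F :* a :* v :* y :+ con 13 :* F :* a :* y) := (con 3 :* (v :+ con 13) :* (S :* (a :* (v :+ con 5) :* (F :* y)))) :+ ((((con 3 :* v :+ con 11) :* (S :+ con 1)) :* (X :+ con 1) :+ (con 3 :* ((y :+ S :+ con 1) :* ((v :+ con 13) :* (a :* F)))) :* (v :+ con 4)) :+ (S :* ((v :+ con 13) :* (a :* F))) :* (con 3 :* (S :+ con 1)))) refl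

 uncovered : ∀ S v X N U Kr E → (3 * v + 11) * ((S + 1) * (X + 1)) ≤ 3 * (v + 13) * (S * Kr) → S * E ≤ N * ((S + 1) * (X + 1)) → U + Kr * N ≤ E → 0 < S → 3 * (v + 13) * U ≤ 28 * E
 uncovered S v X N U Kr E h₁ h₂ h₃ S>0 = *-cancelˡ-≤ S {{>-nonZero S>0}} (linear (+-mono-≤ (+-mono-≤ (*-monoʳ-≤ N h₁) (*-monoʳ-≤ (3 * v + 11) h₂)) (*-monoʳ-≤ (3 * (v + 13) * S) h₃)) (id₁ S v X N U Kr E))
   where
   id₁ : ∀ S v X N U Kr E → (S * (3 * (v + 13) * U)) + ((N * (3 * (v + 13) * (S * Kr)) + (3 * v + 11) * (N * ((S + 1) * (X + 1)))) + (3 * (v + 13) * S) * E) + 0 ≡ S * (28 * E) + ((N * ((3 * v + 11) * ((S + 1) * (X + 1))) + (3 * v + 11) * (S * E)) + (3 * (v + 13) * S) * (U + Kr * N))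
   id₁ = solve 7 (λ S v X N U Kr E → (S :* (con 3 :* (v :+ con 13) :* U)) :+ ((N :* (con 3 :* (v :+ con 13) :* (S :* Kr)) :+ (con 3 :* v :+ con 11) :* (N :* ((S :+ con 1) :* (X :+ con 1)))) :+ (con 3 :* (v :+ con 13) :* S) :* E) :+ con 0 := S :* (con 28 :* E) :+ ((N :* ((con 3 :* v :+ con 11) :* ((S :+ con 1) :* (X :+ con 1))) :+ (con 3 :* v :+ con 11) :* (S :* E)) :+ (con 3 :* (v :+ con 13) :* S) :* (U :+ Kr :* N))) refl

 F-upper : ∀ K H g Q → K ≤ 2 * (H + (4 * g + 2)) → 1 ≤ g → 6 * g ≤ H → K * Q ≤ 4 * H * Q
 F-upper K H g Q h₁ h₂ h₃ = linear (+-mono-≤ (+-mono-≤ (*-monoʳ-≤ Q h₁) (*-monoʳ-≤ (4 * Q) h₂)) (*-monoʳ-≤ (2 * Q) h₃)) (id₁ K H g Q)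
   where
   id₁ : ∀ K H g Q → K * Q + ((Q * (2 * (H + (4 * g + 2))) + (4 * Q) * g) + (2 * Q) * H) + 0 ≡ 4 * H * Q + ((Q * K + (4 * Q) * 1) + (2 * Q) * (6 * g))
   id₁ = solve 4 (λ K H g Q → K :* Q :+ ((Q :* (con 2 :* (H :+ (con 4 :* g :+ con 2))) :+ (con 4 :* Q) :* g) :+ (con 2 :* Q) :* H) :+ con 0 := con 4 :* H :* Q :+ ((Q :* K :+ (con 4 :* Q) :* con 1) :+ (con 2 :* Q) :* (con 6 :* g))) refl

 E-upper : ∀ L S → 1 ≤ L → 1 ≤ L * L * S → 2 + 160 * (L * S) * (2 * L + 6) ≤ 1282 * (L * L * S)
 E-upper L S h₁ h₂ = linear (+-mono-≤ (*-monoʳ-≤ (960 * (L * S)) h₁) (*-monoʳ-≤ 2 h₂)) (id₁ L S)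
   where
   id₁ : ∀ L S → (2 + 160 * (L * S) * (2 * L + 6)) + ((960 * (L * S)) * L + 2 * (L * L * S)) + 0 ≡ 1282 * (L * L * S) + ((960 * (L * S)) * 1 + 2 * 1)
   id₁ = solve 2 (λ L S → (con 2 :+ con 160 :* (L :* S) :* (con 2 :* L :+ con 6)) :+ ((con 960 :* (L :* S)) :* L :+ con 2 :* (L :* L :* S)) :+ con 0 := con 1282 :* (L :* L :* S) :+ ((con 960 :* (L :* S)) :* con 1 :+ con 2 :* con 1)) refl

 E-lower : ∀ L S → 1 ≤ L → 1 ≤ L * L → 1280 * S ≤ 2 + 160 * (L * S) * (2 * L + 6)
 E-lower L S h₁ h₂ = linear (+-mono-≤ (*-monoʳ-≤ (960 * S) h₁) (*-monoʳ-≤ (320 * S) h₂)) (id₁ L S)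
   where
   id₁ : ∀ L S → 1280 * S + ((960 * S) * L + (320 * S) * (L * L)) + 2 ≡ (2 + 160 * (L * S) * (2 * L + 6)) + ((960 * S) * 1 + (320 * S) * 1)
   id₁ = solve 2 (λ L S → con 1280 :* S :+ ((con 960 :* S) :* L :+ (con 320 :* S) :* (L :* L)) :+ con 2 := (con 2 :+ con 160 :* (L :* S) :* (con 2 :* L :+ con 6)) :+ ((con 960 :* S) :* con 1 :+ (con 320 :* S) :* con 1)) refl

 abstract
   quotient : ∀ d x → 0 < d → ∃ λ c → d * c ≤ x × x + 1 ≤ d * (c + 1)
   quotient d zero 0<d = 0 , ≤-reflexive (*-zeroʳ d) , ≤-trans 0<d (≤-reflexive (sym (*-identityʳ d)))
   quotient d (suc x) 0<d with quotient d x 0<d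
   ... | c , below , above with suc (suc x) ≤? d * (c + 1)
   ...   | yes p = c , ≤-trans below (n≤1+n x) , ≤-trans (≤-reflexive (+-comm (suc x) 1)) p
   ...   | no ¬p = c + 1 , ≤-pred (≰⇒> ¬p) , ≤-trans (+-mono-≤ (≤-trans (≤-reflexive (+-comm 1 x)) above) 0<d) (≤-reflexive (id₁ d (c + 1)))
     where
     id₁ : ∀ d c → d * c + d ≡ d * (c + 1)
     id₁ = solve 2 (λ d c → d :* c :+ d := d :* (c :+ con 1)) refl

   power-of-two : ∀ x → ∃ λ k → suc x ≤ 2 ^ k × 2 ^ k ≤ 2 * suc x
   power-of-two zero = 0 , ≤-refl , s≤s z≤n
   power-of-two (suc x) with power-of-two x
   ... | k , below , above with suc (suc x) ≤? 2 ^ k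
   ...   | yes p = k , p , ≤-trans above (*-monoʳ-≤ 2 (n≤1+n (suc x)))
   ...   | no ¬p = suc k , ≤-trans (≤-trans (s≤s (s≤s (m≤m+n x x))) (≤-reflexive (id₁ x))) (*-monoʳ-≤ 2 below) , *-monoʳ-≤ 2 (≤-pred (m≤n⇒m≤1+n (≰⇒> ¬p)))
     where
     id₁ : ∀ x → suc (suc (x + x)) ≡ 2 * suc x
     id₁ = solve 1 (λ x → (con 1 :+ ((con 1 :+ (x :+ x)))) := con 2 :* (con 1 :+ x)) refl

 error-small : ∀ P E y → P * E ≤ y → 10 ≤ P → 1 ≤ E → 2 * E + 2 ≤ y
 error-small P E y h₁ h₂ h₃ = linear (+-mono-≤ (+-mono-≤ h₁ (*-monoʳ-≤ E h₂)) (*-monoʳ-≤ 2 h₃)) (id₁ P E y)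
   where
   id₁ : ∀ P E y → (2 * E + 2) + ((y + E * P) + 2 * E) + (6 * E) ≡ y + ((P * E + E * 10) + 2 * 1)
   id₁ = solve 3 (λ P E y → (con 2 :* E :+ con 2) :+ ((y :+ E :* P) :+ con 2 :* E) :+ (con 6 :* E) := y :+ ((P :* E :+ E :* con 10) :+ con 2 :* con 1)) refl

 error-cubic : ∀ P E y t → P * E ≤ y → 8 ≤ t → 8 * (P * E) ≤ t * y
 error-cubic P E y t h₁ h₂ = linear (+-mono-≤ (*-monoʳ-≤ 8 h₁) (*-monoʳ-≤ y h₂)) (id₁ P E y t)
   where
   id₁ : ∀ P E y t → 8 * (P * E) + (8 * y + y * t) + 0 ≡ t * y + (8 * (P * E) + y * 8)
   id₁ = solve 4 (λ P E y t → con 8 :* (P :* E) :+ (con 8 :* y :+ y :* t) :+ con 0 := t :* y :+ (con 8 :* (P :* E) :+ y :* con 8)) refl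

 m₀-cubic : ∀ P a x y E m₀ → P * (a * x) ≤ 2 * m₀ → y ≤ x → 28 ≤ a → P * E ≤ y → 1 ≤ E → 7 * (P * P * (E + 1)) ≤ m₀
 m₀-cubic P a x y E m₀ h₁ h₂ h₃ h₄ h₅ = *-cancelˡ-≤ 2 (linear (+-mono-≤ (+-mono-≤ (+-mono-≤ (+-mono-≤ h₁ (*-monoʳ-≤ (28 * P) h₂)) (*-monoʳ-≤ (P * x) h₃)) (*-monoʳ-≤ (28 * P) h₄)) (*-monoʳ-≤ (14 * (P * P)) h₅)) (id₁ P a x y E m₀))
   where
   id₁ : ∀ P a x y E m₀ → (2 * (7 * (P * P * (E + 1)))) + ((((2 * m₀ + (28 * P) * x) + (P * x) * a) + (28 * P) * y) + (14 * (P * P)) * E) + 0 ≡ 2 * m₀ + ((((P * (a * x) + (28 * P) * y) + (P * x) * 28) + (28 * P) * (P * E)) + (14 * (P * P)) * 1)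
   id₁ = solve 6 (λ P a x y E m₀ → (con 2 :* (con 7 :* (P :* P :* (E :+ con 1)))) :+ ((((con 2 :* m₀ :+ (con 28 :* P) :* x) :+ (P :* x) :* a) :+ (con 28 :* P) :* y) :+ (con 14 :* (P :* P)) :* E) :+ con 0 := con 2 :* m₀ :+ ((((P :* (a :* x) :+ (con 28 :* P) :* y) :+ (P :* x) :* con 28) :+ (con 28 :* P) :* (P :* E)) :+ (con 14 :* (P :* P)) :* con 1)) refl

 t-below : ∀ S → 1 ≤ S → suc (640 * S) ≤ 31 * ((S + 10) * (S + 10))
 t-below S 1≤S = begin
   suc (640 * S) ≡⟨ cong suc (*-assoc 32 20 S) ⟩
   suc (32 * (20 * S)) ≤⟨ expand S (20 * S) 100 (≤-trans (*-monoˡ-≤ S (m≤m+n 20 11)) (*-monoʳ-≤ 31 (≤-trans (≤-reflexive (sym (*-identityˡ S))) (*-monoˡ-≤ S 1≤S)))) (s≤s z≤n) ⟩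
   31 * (S * S + 20 * S + 100) ≡⟨ cong (31 *_) (id₂ S) ⟩
   31 * ((S + 10) * (S + 10)) ∎
   where
   open ≤-Reasoning
   expand : ∀ S c k → c ≤ 31 * (S * S) → 1 ≤ k → suc (32 * c) ≤ 31 * (S * S + c + k)
   expand S c k h₁ h₂ = linear (+-mono-≤ h₁ h₂) (id₁ S c k)
     where
     id₁ : ∀ S c k → suc (32 * c) + (31 * (S * S) + k) + (30 * k) ≡ (31 * (S * S + c + k)) + (c + 1)
     id₁ = solve 3 (λ S c k → (con 1 :+ (con 32 :* c)) :+ (con 31 :* (S :* S) :+ k) :+ (con 30 :* k) := (con 31 :* (S :* S :+ c :+ k)) :+ (c :+ con 1)) refl
   id₂ : ∀ S → S * S + 20 * S + 100 ≡ (S + 10) * (S + 10)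
   id₂ = solve 1 (λ S → S :* S :+ con 20 :* S :+ con 100 := (S :+ con 10) :* (S :+ con 10)) refl

 S-scale : ∀ S → 1 ≤ S → 480 * (S + 1) ≤ 1280 * S
 S-scale S 1≤S = begin
   480 * (S + 1) ≤⟨ *-monoʳ-≤ 480 (+-monoʳ-≤ S 1≤S) ⟩
   480 * (S + S) ≡⟨ cong (480 *_) (cong (S +_) (sym (+-identityʳ S))) ⟩
   480 * (2 * S) ≡⟨ *-assoc 480 2 S ⟨
   960 * S ≤⟨ *-monoˡ-≤ S (m≤m+n 960 320) ⟩
   1280 * S ∎
   where open ≤-Reasoning

 -- Choice of the parameters.

 module Scaled (S₂ v P q K m₀ ℓ y μ cap e : ℕ) where

   -- a = 40 S is the resolution for degrees: d = a t y approximates the expected degree into a fine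
   -- class, so errors of relative size 1/S become whole units of t y. ω, B and h are dictated by
   -- the greedy choices, and the product B h determines how many classes are needed.
   w a t Q Z r ω B h d dlo dhi δ : ℕ
   w = 40 * S₂ + 38
   a = w + 42
   t = v + 13
   Q = q * 16
   Z = Q * Q * y
   r = a * (v + 5) * Z
   ω = 4 * (Q * Q * (P * P))
   B = 80 * (Q * P)
   h = 240 * (Q * Q * Q * (P * P * (P * P)))
   d = a * (t * y)
   dlo = (w + 1) * (t * y)
   dhi = 2 * d
   δ = w * (t * Z)

   record Scale : Set where
     field
       4≤S₂ : 4 ≤ S₂
       10≤P : 10 ≤ P
       0<y  : 0 < y
       P≤y  : P ≤ y
       t-small : 8 * (t * t) + 84 * t ≤ 8 * a
       q-large : 80 * (S₂ + 2) ≤ q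
       K≡   : K ≡ suc e + ω
       Bh≤e : B * h ≤ e
       ℓ-small : ℓ < 4 * (B * h) * (Q * Q)
       m₀-upper′ : m₀ ≤ 2 * (P * d)
       d-upper′  : P * d ≤ 2 * m₀
       μ-floor   : 2 * (P * P) * μ ≤ m₀ × m₀ + 1 ≤ 2 * (P * P) * (μ + 1)
       cap-floor : 10 * cap ≤ Q * μ × suc (Q * μ) ≤ 10 * suc cap
       μ-large   : 3200 * (Q * Q * P) ≤ μ

   module _ (sc : Scale) where
     open Scale sc

     42≤w : 42 ≤ w
     42≤w = ≤-trans (m≤m+n 42 156) (≤-trans (+-monoˡ-≤ 38 (*-monoʳ-≤ 40 4≤S₂)) ≤-refl)

     a≡ : 40 * (S₂ + 2) ≡ a
     a≡ = id₁ S₂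
       where
       id₁ : ∀ S → 40 * (S + 2) ≡ 40 * S + 38 + 42
       id₁ = solve 1 (λ S → con 40 :* (S :+ con 2) := con 40 :* S :+ con 38 :+ con 42) refl

     0<P : 0 < P
     0<P = ≤-trans (s≤s z≤n) 10≤P

     0<a : 0 < a
     0<a = ≤-trans (s≤s z≤n) (m≤n+m 42 w)

     0<t : 0 < t
     0<t = ≤-trans (s≤s z≤n) (m≤n+m 13 v)

     32a≤Q : 32 * a ≤ Q
     32a≤Q = ≤-trans (≤-reflexive (trans (cong (32 *_) (sym a≡)) (id₁ (S₂ + 2)))) (*-monoˡ-≤ 16 q-large)
       where
       id₁ : ∀ S → 32 * (40 * S) ≡ 80 * S * 16
       id₁ = solve 1 (λ S → con 32 :* (con 40 :* S) := con 80 :* S :* con 16) refl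

     16≤Q : 16 ≤ Q
     16≤Q = ≤-trans (*-monoʳ-≤ 16 (≤-trans (s≤s z≤n) q-large′)) (≤-reflexive (*-comm 16 q))
       where
       q-large′ : 1 ≤ q
       q-large′ = ≤-trans (≤-trans (s≤s z≤n) (*-monoʳ-≤ 80 (m≤n+m 2 S₂))) q-large

     0<Q : 0 < Q
     0<Q = ≤-trans (s≤s z≤n) 16≤Q

     infixl 7 _⊗_
     _⊗_ : ∀ {x y} → 0 < x → 0 < y → 0 < x * y
     p ⊗ q′ = *-mono-≤ p q′

     0<B : 0 < B
     0<B = s≤s (z≤n {79}) ⊗ (0<Q ⊗ 0<P)

     0<h : 0 < h
     0<h = s≤s (z≤n {239}) ⊗ (0<Q ⊗ 0<Q ⊗ 0<Q ⊗ (0<P ⊗ 0<P ⊗ (0<P ⊗ 0<P)))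

     instance
       B≢0 : NonZero B
       B≢0 = >-nonZero 0<B
       h≢0 : NonZero h
       h≢0 = >-nonZero 0<h

     3≤μ : 3 ≤ μ
     3≤μ = ≤-trans (≤-trans (m≤m+n 3 3197) (*-monoʳ-≤ 3200 (0<Q ⊗ 0<Q ⊗ 0<P))) μ-large

     9≤Qμ : 9 ≤ Q * μ
     9≤Qμ = *-mono-≤ {3} {Q} {3} {μ} (≤-trans (s≤s (s≤s (s≤s z≤n))) 16≤Q) 3≤μ

     m : ℕ
     m = Q * Q * m₀

     abstract
       Pr : P * r ≤ 2 * m
       Pr = Pr≤2m w v P Q m₀ y d-upper′

       connect-room : m + (r + r) < ω * μ
       connect-room = connect-small m r Q P m₀ μ (m+2r-small m r P 10≤P Pr) (proj₂ μ-floor) 3≤μ (0<Q ⊗ 0<Q)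

       balance-room : ω * m + (ω * r + ω * r) < h * suc cap
       balance-room = balance-small m r Q P μ cap (≤-trans (n≤1+n _) connect-room) (proj₂ cap-floor) (0<Q ⊗ 0<Q ⊗ 0<Q ⊗ (0<P ⊗ 0<P ⊗ (0<P ⊗ 0<P)))

       cap-room : 4 * suc cap < Q * μ
       cap-room = cap-small (Q * μ) cap (proj₁ cap-floor) 9≤Qμ

       r/B≤cap : r / B ≤ cap
       r/B≤cap = ≤-pred (m<n*o⇒m/o<n (≤-trans (r<B·cap P Q r μ cap (*-cancelˡ-≤ P {{>-nonZero 0<P}} (r-bound P Q m₀ r μ Pr (proj₂ μ-floor))) (≤-trans (s≤s z≤n) 3≤μ) (proj₂ cap-floor) (0<Q ⊗ 0<P)) (≤-reflexive (*-comm B (suc cap)))))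

       ℓ/h≤cap : ℓ / h ≤ cap
       ℓ/h≤cap = ≤-pred (m<n*o⇒m/o<n (≤-trans ℓ-small (≤-trans (≤-reflexive (id₁ Q P h)) (*-monoˡ-≤ h (cube-small P Q μ cap μ-large (proj₂ cap-floor))))))
         where
         id₁ : ∀ Q P h → 4 * (80 * (Q * P) * h) * (Q * Q) ≡ 320 * (Q * Q * Q * P) * h
         id₁ = solve 3 (λ Q P h → con 4 :* (con 80 :* (Q :* P) :* h) :* (Q :* Q) := con 320 :* (Q :* Q :* Q :* P) :* h) refl

     Th g₀ : ℕ
     Th = suc (r / B)
     g₀ = suc cap + suc (ℓ / h)

     abstract
       g₀≤ : suc cap + g₀ ≤ 3 * suc cap
       g₀≤ = ≤-trans (+-monoʳ-≤ (suc cap) (+-monoʳ-≤ (suc cap) (s≤s ℓ/h≤cap))) (≤-reflexive (id₁ (suc cap)))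
         where
         id₁ : ∀ c → c + (c + c) ≡ 3 * c
         id₁ = solve 1 (λ c → c :+ (c :+ c) := con 3 :* c) refl

       out-room : Th + (suc cap + g₀) < Q * μ
       out-room = ≤-trans (s≤s (+-mono-≤ (s≤s r/B≤cap) g₀≤)) cap-room

       10μ≤ : 10 * μ ≤ d
       10μ≤ = 10μ≤d P μ d 10≤P (*-cancelˡ-≤ P {{>-nonZero 0<P}} (Pμ≤d P a m₀ μ (t * y) (proj₁ μ-floor) m₀-upper′))

       in-room : suc cap + g₀ < Q * dlo
       in-room = ≤-trans (s≤s (m≤n+m _ Th)) (≤-trans out-room (*-monoʳ-≤ Q (μ≤dlo w μ (t * y) 10μ≤ 42≤w)))

       δ-room : δ + (Th + Th + g₀) ≤ Q * ((Q ∸ 16) * dlo)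
       δ-room = ≤-trans (≤-reflexive (cong (_+ (Th + Th + g₀)) (cong (w *_) (id₁ t Q y))))
         (δ-small w Q (Q ∸ 16) μ (t * y) (Th + Th + g₀) (absorb w Q μ (t * y) 10μ≤ 32a≤Q)
           (≤-trans (≤-reflexive (+-assoc Th Th g₀)) (≤-trans (+-monoʳ-≤ Th (+-monoˡ-≤ g₀ (s≤s r/B≤cap))) (≤-trans (n≤1+n _) out-room)))
           (≤-reflexive (sym (m∸n+n≡m 16≤Q))))
         where
         id₁ : ∀ t Q y → t * (Q * Q * y) ≡ Q * Q * (t * y)
         id₁ = solve 3 (λ t Q y → t :* (Q :* Q :* y) := Q :* Q :* (t :* y)) refl

       0<r : 0 < r
       0<r = 0<a ⊗ ≤-trans (s≤s z≤n) (m≤n+m 5 v) ⊗ (0<Q ⊗ 0<Q ⊗ 0<y)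

       0<m₀ : 0 < m₀
       0<m₀ = ≤-trans (s≤s (z≤n {1}) ⊗ (0<P ⊗ 0<P) ⊗ ≤-trans (s≤s z≤n) 3≤μ) (proj₁ μ-floor)

     parameters : ∀ χ → a * m₀ * χ ≤ (w + 84) * d * d → Parameters m δ (Q * Q * dhi) (Q * Q * χ) r
     parameters χ hχ = record
       { A = 8 * (a * Z)
       ; B = 4 * (t * t * Z)
       ; E = 4 * m
       ; budget = budget-small w v Z t-small
       ; A≤2r = ≤-trans (*-monoˡ-≤ (a * Z) (m≤n+m 8 (2 * v + 2))) (≤-reflexive (id₁ v a Z))
       ; codegree-ok = codegree-small w v Q m₀ χ y P hχ m₀-upper′ (*-mono-≤ (m≤n⇒m≤o+n v (m≤m+n 4 9)) (≤-trans P≤y (≤-trans (≤-reflexive (sym (*-identityˡ y))) (*-monoˡ-≤ y (0<Q ⊗ 0<Q)))))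
       ; degree-ok = ≤-trans (≤-reflexive (cong (m *_) (id₂ Q a t y))) (degree-small w (t * Z) m 42≤w)
       }
       where
       id₁ : ∀ v a Z → (2 * v + 2 + 8) * (a * Z) ≡ 2 * (a * (v + 5) * Z)
       id₁ = solve 3 (λ v a Z → (con 2 :* v :+ con 2 :+ con 8) :* (a :* Z) := con 2 :* (a :* (v :+ con 5) :* Z)) refl
       id₂ : ∀ Q a t y → Q * Q * (2 * (a * (t * y))) ≡ 2 * (a * (t * (Q * Q * y)))
       id₂ = solve 4 (λ Q a t y → Q :* Q :* (con 2 :* (a :* (t :* y))) := con 2 :* (a :* (t :* (Q :* Q :* y)))) refl

     room : ∀ χ → a * m₀ * χ ≤ (w + 84) * d * d → Room K q m₀ ℓ B h r ω e cap dlo dhi μ χ δ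
     room χ hχ = record
       { K≡ = K≡ ; host-room = Bh≤e ; 0<e = ≤-trans (0<B ⊗ 0<h) Bh≤e
       ; 0<q = ≤-trans (≤-trans (s≤s z≤n) (*-monoʳ-≤ 80 (m≤n+m 2 S₂))) q-large
       ; 0<m₀ = 0<m₀ ; balance-room = balance-room ; in-room = in-room ; out-room = out-room
       ; left-room = left-room ; connect-room = connect-room ; δ-room = δ-room ; par = parameters χ hχ ; 1≤r = 0<r }
       where
       open ≤-Reasoning
       left-room : r + g₀ < Q * Q * dlo
       left-room = begin
         suc (r + g₀) ≤⟨ s≤s (+-monoˡ-≤ g₀ (CutBound.r≤δ (parameters χ hχ))) ⟩
         suc (δ + g₀) ≤⟨ ≤-reflexive (sym (+-suc δ g₀)) ⟩
         δ + suc g₀ ≤⟨ +-monoʳ-≤ δ (+-monoˡ-≤ g₀ (m≤n⇒m≤o+n Th (s≤s z≤n))) ⟩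
         δ + (Th + Th + g₀) ≤⟨ δ-room ⟩
         Q * ((Q ∸ 16) * dlo) ≤⟨ *-monoʳ-≤ Q (*-monoˡ-≤ dlo (m∸n≤m Q 16)) ⟩
         Q * (Q * dlo) ≡⟨ *-assoc Q Q dlo ⟨
         Q * Q * dlo ∎

 module Counted (S₂ v P q X L A κ m₀ ℓ y μ cap e o Dlo Dhi Clo Chi χ : ℕ) where

   open Scaled S₂ v P q (2 ^ κ) m₀ ℓ y μ cap e

   -- 1/(σ + 1) = 1/(80 S) is the relative error allowed to all halvings together, half a unit out
   -- of a = 40 S. E₀ is their additive error, with 2 L + 6 binary digits for the number of tests.
   F n S S₁ σ E₀ : ℕ
   F = pw A
   n = F * m₀ + ℓ
   S = S₂ + 2
   S₁ = S₂ + 1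
   σ = 80 * S₂ + 159
   E₀ = 2 + suc (suc o) * (2 * L + 6)

   -- X is n p rounded down and 1/S replaces ε. Codegrees are multiplied by n because n · n p² = (n
   -- p)² can be compared with X² without mentioning p.
   DegreeClose CodegreeClose : ℕ → Set
   DegreeClose c = S₁ * X ≤ S * c × S * c ≤ (S + 1) * (X + 1)
   CodegreeClose c = S₁ * (X * X) ≤ S * (n * c) × S * (n * c) ≤ (S + 1) * ((X + 1) * (X + 1))

   record Counts : Set where
     field
       7≤S₂ : 7 ≤ S₂
       1≤L  : 1 ≤ L
       9≤X  : 9 ≤ X
       v-small : v + 4 ≤ S
       o≡   : suc (suc o) ≡ 160 * (L * S)
       A≤L  : A ≤ L
       n-small : n < 2 ^ suc L
       F≡   : F ≡ 2 ^ κ * (Q * Q)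
       ℓ<F  : ℓ < F
       n-upper : n ≤ P * (X + 1)
       d-floor : F * d ≤ X × X + 1 ≤ F * (a * (t * (y + 1)))
       PE≤y : P * E₀ ≤ y
       y-large : 480 * (S + 1) ≤ y
       m₀-large : 7 * (P * P * (E₀ + 1)) ≤ m₀
       Dlo-floor : S * Dlo ≤ S₁ * X × S₁ * X + 1 ≤ S * (Dlo + 1)
       Dhi-floor : S * Dhi ≤ (S + 1) * (X + 1) × (S + 1) * (X + 1) + 1 ≤ S * (Dhi + 1)
       Clo-floor : S * n * Clo ≤ S₁ * (X * X) × S₁ * (X * X) + 1 ≤ S * n * (Clo + 1)
       Chi-floor : S * n * Chi ≤ (S + 1) * ((X + 1) * (X + 1)) × (S + 1) * ((X + 1) * (X + 1)) + 1 ≤ S * n * (Chi + 1)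
       χ-floor   : a * m₀ * χ ≤ (w + 84) * d * d × (w + 84) * d * d + 1 ≤ a * m₀ * (χ + 1)

   below-floor : ∀ d {x c k} → x + 1 ≤ d * (c + 1) → d * k ≤ x → k ≤ c
   below-floor d {x} {c} {k} above le = ≤-pred (≤-trans (*-cancelˡ-< d k (c + 1) (≤-trans (≤-trans (s≤s le) (≤-reflexive (+-comm 1 x))) above)) (≤-reflexive (+-comm c 1)))

   above-floor : ∀ {d x c k} → 0 < d → d * c ≤ x → x ≤ d * k → c ≤ k
   above-floor {d} {x} {c} {k} 0<d le le′ = *-cancelˡ-≤ d {{>-nonZero 0<d}} (≤-trans le le′)

   module _ (sc : Scale) (ct : Counts) where
     open Scale sc
     open Counts ct

     0<S : 0 < S
     0<S = ≤-trans (s≤s z≤n) (m≤n+m 2 S₂)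

     9≤S : 9 ≤ S
     9≤S = +-monoˡ-≤ 2 7≤S₂

     0<F : 0 < F
     0<F = ≤-trans (s≤s z≤n) ℓ<F

     0<n : 0 < n
     0<n = ≤-trans (*-mono-≤ 0<F (0<m₀ sc)) (m≤m+n (F * m₀) ℓ)

     0<σ : 0 < σ
     0<σ = ≤-trans (s≤s z≤n) (m≤n+m 159 (80 * S₂))

     0<L*S : 0 < L * S
     0<L*S = *-mono-≤ 1≤L 0<S

     suc-σ : suc σ ≡ 80 * S
     suc-σ = id₁ S₂
       where
       id₁ : ∀ S → suc (80 * S + 159) ≡ 80 * (S + 2)
       id₁ = solve 1 (λ S → (con 1 :+ (con 80 :* S :+ con 159)) := con 80 :* (S :+ con 2)) refl

     1≤E₀ : 2 ≤ E₀
     1≤E₀ = m≤m+n 2 _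

     1≤t : 1 ≤ t
     1≤t = ≤-trans (s≤s z≤n) (m≤n+m 13 v)

     y≤ty : y ≤ t * y
     y≤ty = ≤-trans (≤-reflexive (sym (*-identityˡ y))) (*-monoˡ-≤ y 1≤t)

     2E₀+2≤ : 2 * E₀ + 2 ≤ t * y
     2E₀+2≤ = ≤-trans (error-small P E₀ y PE≤y 10≤P (≤-trans (s≤s z≤n) 1≤E₀)) y≤ty

     0<o : 0 < o
     0<o = ≤-pred (≤-pred (≤-trans (≤-trans (m≤m+n 3 157) (*-monoʳ-≤ 160 0<L*S)) (≤-reflexive (sym o≡))))

     -- The origin of 160 L S: with at most L halvings, a joint error of 1/(80 S) asks for a step
     -- precision of 2 L · 80 S.
     halving-fine : 2 * A * suc σ ≤ o + 2
     halving-fine = begin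
       2 * A * suc σ ≤⟨ *-monoˡ-≤ (suc σ) (*-monoʳ-≤ 2 A≤L) ⟩
       2 * L * suc σ ≡⟨ cong (2 * L *_) suc-σ ⟩
       2 * L * (80 * S) ≡⟨ id₁ L S ⟩
       160 * (L * S) ≡⟨ o≡ ⟨
       suc (suc o) ≡⟨ +-comm 2 o ⟩
       o + 2 ∎
       where
       open ≤-Reasoning
       id₁ : ∀ L S → 2 * L * (80 * S) ≡ 160 * (L * S)
       id₁ = solve 2 (λ L S → con 2 :* L :* (con 80 :* S) := con 160 :* (L :* S)) refl

     module Dev = Deviation {o} {A} {σ} 0<o halving-fine E₀

     Low High : ℕ → ℕ → Set
     Low c k = o ^ A * c + suc (suc o) ^ A * E₀ ≤ (2 * suc (suc o)) ^ A * (k + E₀)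
     High c k = (2 * suc (suc o)) ^ A * k + (suc (suc o) + 2) ^ A * E₀ ≤ (suc (suc o) + 2) ^ A * (c + 2 ^ A * E₀)

     low-σ : ∀ c k → Low c k → σ * c ≤ suc σ * (F * (k + E₀))
     low-σ c k low = subst (λ f → σ * c ≤ suc σ * (f * (k + E₀))) (sym (pw≡2^ A))
       (Dev.low-deviation c k (subst (λ z → o ^ A * c + z ^ A * E₀ ≤ (2 * z) ^ A * (k + E₀)) (+-comm 2 o) low))

     high-σ : ∀ c k → High c k → σ * (F * k) ≤ suc σ * (c + F * E₀)
     high-σ c k high = subst (λ f → σ * (f * k) ≤ suc σ * (c + f * E₀)) (sym (pw≡2^ A))
       (Dev.high-deviation c k (subst (λ z → (2 * z) ^ A * k + (z + 2) ^ A * E₀ ≤ (z + 2) ^ A * (c + 2 ^ A * E₀)) (+-comm 2 o) high))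

     grow : ∀ {c D} → D ≤ c + ℓ → D + 1 ≤ c + F
     grow {c} {D} le = ≤-trans (≤-reflexive (+-comm D 1)) (≤-trans (s≤s le) (≤-trans (≤-reflexive (sym (+-suc c ℓ))) (+-monoʳ-≤ c ℓ<F)))

     F*m₀≤n : F * m₀ ≤ n
     F*m₀≤n = m≤m+n (F * m₀) ℓ

     d-low : ∀ c k → Dlo ≤ c + ℓ → Low c k → dlo ≤ k
     d-low c k Dlo≤ low = +-cancelʳ-≤ x ((w + 1) * x) k (≤-trans (≤-reflexive (id₁ S₂ x))
       (low-descends σ W F c k E₀ x (degree-floor S₂ X c F x (≤-trans (≤-trans (m≤m+n _ 1) (proj₂ Dlo-floor)) (*-monoʳ-≤ S (grow Dlo≤))) (proj₁ d-floor))
         (low-σ c k low) (≤-trans (m≤m+n (2 * W) 80) (≤-reflexive (id₂ S₂))) 2E₀+2≤ (*-mono-≤ (s≤s (z≤n {1})) (*-mono-≤ (s≤s (z≤n {σ})) 0<F))))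
       where
       x W : ℕ
       x = t * y
       W = 40 * S₁
       id₁ : ∀ S x → (40 * S + 38 + 1) * x + x ≡ 40 * (S + 1) * x
       id₁ = solve 2 (λ S x → (con 40 :* S :+ con 38 :+ con 1) :* x :+ x := con 40 :* (S :+ con 1) :* x) refl
       id₂ : ∀ S → 2 * (40 * (S + 1)) + 80 ≡ suc (80 * S + 159)
       id₂ = solve 1 (λ S → con 2 :* (con 40 :* (S :+ con 1)) :+ con 80 := (con 1 :+ (con 80 :* S :+ con 159))) refl

     3≤y : 3 ≤ y
     3≤y = ≤-trans (≤-trans (m≤m+n 3 477) (*-monoʳ-≤ 480 (m≤n+m 1 S))) y-large

     X-upper : X + 1 ≤ F * (40 * S * (t * (y + 1)))
     X-upper = subst (λ z → X + 1 ≤ F * (z * (t * (y + 1)))) (sym (a≡ sc)) (proj₂ d-floor)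

     d-high : ∀ c k → c ≤ Dhi → High c k → k ≤ dhi
     d-high c k c≤ high = ≤-trans (degree-double S t y E₀ k
         (high-descends σ F c k E₀ ((S + 1) * 40 * (t * (y + 1))) (high-σ c k high) (≤-trans (m≤m+n 4 155) (m≤n+m 159 (80 * S₂)))
           (≤-trans (degree-ceiling S X c F 40 t y (≤-trans (*-monoʳ-≤ S c≤) (proj₁ Dhi-floor)) (≤-trans X-upper (≤-reflexive (cong (λ z → F * (z * (t * (y + 1)))) (*-comm 40 S)))) 0<S) (≤-reflexive (id₁ ((S + 1) * 40) t F (y + 1))))
           (*-mono-≤ 0<σ 0<F))
         9≤S 3≤y 2E₀+2≤ 9≤S 9≤S) (≤-reflexive (cong (λ z → 2 * (z * (t * y))) (a≡ sc)))
       where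
       id₁ : ∀ s t F y → s * (t * (F * y)) ≡ F * (s * (t * y))
       id₁ = solve 4 (λ s t F y → s :* (t :* (F :* y)) := F :* (s :* (t :* y))) refl

     c-low : ∀ c k → Clo ≤ c + ℓ → Low c k → μ ≤ k
     c-low c k Clo≤ low = codegree-low σ F c k E₀ m₀ n P μ
       (codegree-floor S₂ X n P c F (≤-trans (≤-trans (m≤m+n _ 1) (proj₂ Clo-floor)) (≤-trans (*-monoʳ-≤ (S * n) (grow Clo≤)) (≤-reflexive (*-assoc S n (c + F)))))
         7≤S₂ (square-ratio X 9≤X 9≤X) (*-mono-≤ n-upper n-upper) (*-mono-≤ (s≤s (z≤n {35})) (*-mono-≤ 0<S 0<n)))
       (low-σ c k low) (≤-trans (m≤m+n 9 150) (m≤n+m 159 (80 * S₂))) F*m₀≤n (proj₁ μ-floor) m₀-large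
       (*-mono-≤ (s≤s (z≤n {249})) (*-mono-≤ (*-mono-≤ 0<σ 0<F) (*-mono-≤ (0<P sc) (0<P sc))))

     c-high : ∀ c k → c ≤ Chi → High c k → k ≤ χ
     c-high c k c≤ high = below-floor (a * m₀) (proj₂ χ-floor) (≤-trans (≤-reflexive (*-assoc a m₀ k)) (≤-trans
       (codegree-final S₂ (m₀ * k) Y d (codegree-descends σ F S m₀ c k E₀ ((S + 1) * (D * D)) (high-σ c k high)
           (≤-trans (codegree-ceiling S n c F m₀ ((X + 1) * (X + 1)) D (≤-trans (≤-trans (≤-reflexive (sym (*-assoc S n c))) (*-monoʳ-≤ (S * n) c≤)) (proj₁ Chi-floor)) F*m₀≤n (*-mono-≤ (proj₂ d-floor) (proj₂ d-floor)) 0<F) (≤-reflexive (id₁ (S + 1) F (D * D)))) 0<F)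
         (subst₂ (λ D d → 80 * ((S + 1) * (D * D) + S * (m₀ * E₀)) ≤ (80 * S + 81) * (d * d)) {x = a * t * (y + 1)} {y = D} {u = a * t * y} {v = d} (*-assoc a t (y + 1)) (*-assoc a t y)
           (square-growth S (a * t) y P m₀ E₀ (≤-trans (m₀-upper′) (≤-reflexive (cong (λ z → 2 * (P * z)) (sym (*-assoc a t y))))) y-large aty (≤-trans (s≤s z≤n) 3≤y)))
         (*-mono-≤ (s≤s (z≤n {1})) 0<σ))
       (≤-reflexive (sym (*-assoc (w + 84) d d)))))
       where
       D Y : ℕ
       D = a * (t * (y + 1))
       Y = (S + 1) * (D * D) + S * (m₀ * E₀)
       id₁ : ∀ s F D → s * (F * D) ≡ F * (s * D)
       id₁ = solve 3 (λ s F D → s :* (F :* D) := F :* (s :* D)) refl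
       aty : 320 * (S * (P * E₀)) ≤ a * t * y
       aty = ≤-trans (≤-reflexive (id₂ S (P * E₀))) (≤-trans (*-mono-≤ (≤-reflexive (a≡ sc)) (error-cubic P E₀ y t PE≤y (m≤n⇒m≤o+n v (m≤m+n 8 5)))) (≤-reflexive (sym (*-assoc a t y))))
         where
         id₂ : ∀ S x → 320 * (S * x) ≡ 40 * S * (8 * x)
         id₂ = solve 2 (λ S x → con 320 :* (S :* x) := con 40 :* S :* (con 8 :* x)) refl

     M≤ : 2 * (5 * (n * n)) ≤ 2 ^ (2 * L + 6)
     M≤ = begin
       2 * (5 * (n * n)) ≤⟨ *-monoʳ-≤ 2 (*-mono-≤ (m≤m+n 5 3) (*-mono-≤ (<⇒≤ n-small) (<⇒≤ n-small))) ⟩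
       2 * (8 * (2 * 2 ^ L * (2 * 2 ^ L))) ≡⟨ id₁ (2 ^ L) ⟩
       2 ^ L * 2 ^ L * 64 ≡⟨ cong (_* 64) (^-+ 2 L L) ⟨
       2 ^ (L + L) * 64 ≡⟨ cong (λ z → 2 ^ z * 64) (cong (L +_) (sym (+-identityʳ L))) ⟩
       2 ^ (2 * L) * 64 ≡⟨ ^-+ 2 (2 * L) 6 ⟨
       2 ^ (2 * L + 6) ∎
       where
       open ≤-Reasoning
       id₁ : ∀ x → 2 * (8 * (2 * x * (2 * x))) ≡ x * x * 64
       id₁ = solve 1 (λ x → con 2 :* (con 8 :* (con 2 :* x :* (con 2 :* x))) := x :* x :* con 64) refl

     module _ (G : D.Digraph n)
       (out-degree : ∀ u → DegreeClose (cnt n (D.adj G u))) (in-degree : ∀ u → DegreeClose (cnt n (λ x → D.adj G x u)))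
       (common-out : ∀ u u′ → u ≢ u′ → CodegreeClose (cnt n (λ x → D.adj G u x ∧ D.adj G u′ x)))
       (through : ∀ u u′ → u ≢ u′ → CodegreeClose (cnt n (λ x → D.adj G u x ∧ D.adj G x u′)))
       (common-in : ∀ u u′ → u ≢ u′ → CodegreeClose (cnt n (λ x → D.adj G x u ∧ D.adj G x u′))) where

       degree-range : ∀ {c} → DegreeClose c → Dlo ≤ c × c ≤ Dhi
       degree-range (lo , hi) = above-floor 0<S (proj₁ Dlo-floor) lo , below-floor S (proj₂ Dhi-floor) hi

       codegree-range : ∀ {c} → CodegreeClose c → Clo ≤ c × c ≤ Chi
       codegree-range {c} (lo , hi) = above-floor (*-mono-≤ 0<S 0<n) (proj₁ Clo-floor) (≤-trans lo (≤-reflexive (sym (*-assoc S n c)))) ,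
         below-floor (S * n) (proj₂ Chi-floor) (≤-trans (≤-reflexive (*-assoc S n c)) hi)

       packed : ∃ λ (Cs : List (D.HamCycle n)) → ∃ λ (U : List (Fin n × Fin n)) →
         (∀ C → C ∈ Cs → D.CycleIn G C) × D.PairwiseEdgeDisjoint Cs ×
         (∀ a b → D.adj G a b ≡ true → (∃ λ C → C ∈ Cs × D.CycleEdge C a b) ⊎ ((a , b) ∈ U)) ×
         length U + 2 ^ κ * r * n ≡ D.edgeCount G
       packed = PackUniform.hamilton-packing A κ q m₀ ℓ B h r ω e cap δ (suc o) (2 * L + 6) {{B≢0 sc}} {{h≢0 sc}} (s≤s z≤n) F≡ G M≤
         dlo dhi μ χ Dlo Dhi Clo Chi (λ u → degree-range (out-degree u)) (λ u → degree-range (in-degree u))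
         (λ u u′ ne → codegree-range (common-out u u′ ne)) (λ u u′ ne → proj₁ (codegree-range (through u u′ ne)))
         (λ u u′ ne → proj₂ (codegree-range (common-in u u′ ne))) d-low d-high c-low c-high (room sc χ (proj₁ χ-floor))

       uncovered-small : ∀ U → U + 2 ^ κ * r * n ≡ D.edgeCount G → 3 * t * U ≤ 28 * D.edgeCount G
       uncovered-small U count = uncovered S v X n U (2 ^ κ * r) (D.edgeCount G)
         (≤-trans (coverage S v a y F X (proj₂ d-floor) v-small (≤-trans (*-monoˡ-≤ (S + 1) (m≤m+n 3 477)) y-large)) (≤-reflexive (cong (λ z → 3 * t * (S * z)) K*r)))
         degrees (≤-reflexive count) 0<S
         where
         K*r : a * (v + 5) * (F * y) ≡ 2 ^ κ * r
         K*r = trans (cong (λ z → a * (v + 5) * (z * y)) F≡) (id₁ (a * (v + 5)) (2 ^ κ) Q y)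
           where
           id₁ : ∀ x K Q y → x * (K * (Q * Q) * y) ≡ K * (x * (Q * Q * y))
           id₁ = solve 4 (λ x K Q y → x :* (K :* (Q :* Q) :* y) := K :* (x :* (Q :* Q :* y))) refl
         degrees : S * D.edgeCount G ≤ n * ((S + 1) * (X + 1))
         degrees = ≤-trans (≤-reflexive (trans (cong (S *_) (edgeCount≡ G)) (sym (∑-*ˡ n S _)))) (≤-trans (∑-mono n (λ u → proj₂ (out-degree u))) (≤-reflexive (∑-const n _)))

 product-dominates : ∀ α β Q P → 6 ≤ α → 1 ≤ β → 0 < Q → 0 < P → 6 * (Q * Q * (P * P)) ≤ α * (Q * P) * (β * (Q * Q * Q * (P * P * (P * P))))
 product-dominates α β Q P 6≤α 1≤β 0<Q 0<P = begin
   6 * (Q * Q * (P * P)) ≡⟨ id₁ Q P ⟩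
   6 * (Q * P) * (1 * (1 * 1 * Q * (1 * 1 * (1 * P)))) ≤⟨ *-mono-≤ (*-monoˡ-≤ (Q * P) 6≤α) (*-mono-≤ 1≤β (*-mono-≤ (*-monoˡ-≤ Q (*-mono-≤ 0<Q 0<Q)) (*-mono-≤ (*-mono-≤ 0<P 0<P) (*-monoˡ-≤ P 0<P)))) ⟩
   α * (Q * P) * (β * (Q * Q * Q * (P * P * (P * P)))) ∎
   where
   open ≤-Reasoning
   id₁ : ∀ Q P → 6 * (Q * Q * (P * P)) ≡ 6 * (Q * P) * (1 * (1 * 1 * Q * (1 * 1 * (1 * P))))
   id₁ = solve 2 (λ Q P → con 6 :* (Q :* Q :* (P :* P)) := con 6 :* (Q :* P) :* (con 1 :* (con 1 :* con 1 :* Q :* (con 1 :* con 1 :* (con 1 :* P))))) refl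

 product-monomial : ∀ α β u Q P → 4 * α * β ≡ u → 4 * (α * (Q * P) * (β * (Q * Q * Q * (P * P * (P * P))))) * (Q * Q) ≡ u * (Q ^ 6 * P ^ 5)
 product-monomial α β u Q P refl = id₁ α β Q P
   where
   id₁ : ∀ α β Q P → 4 * (α * (Q * P) * (β * (Q * Q * Q * (P * P * (P * P))))) * (Q * Q) ≡ 4 * α * β * (Q * (Q * (Q * (Q * (Q * (Q * 1))))) * (P * (P * (P * (P * (P * 1))))))
   id₁ = solve 4 (λ α β Q P → con 4 :* (α :* (Q :* P) :* (β :* (Q :* Q :* Q :* (P :* P :* (P :* P))))) :* (Q :* Q) := con 4 :* α :* β :* (Q :* (Q :* (Q :* (Q :* (Q :* (Q :* con 1))))) :* (P :* (P :* (P :* (P :* (P :* con 1))))))) refl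

 -- The lower bounds on n needed below are monomials in L, R and P dominated by L⁵ R¹¹ P⁸.
 module Growth (u v c L R P n : ℕ) (1≤c : 1 ≤ c) (1≤L : 1 ≤ L) (1≤R : 1 ≤ R) (1≤P : 1 ≤ P)
   (growth : u * (v * c ^ 8) * (L ^ 5 * (R ^ 11 * P ^ 8)) ≤ n) where

   private
     instance
       L≢0 : NonZero L
       L≢0 = >-nonZero 1≤L
       R≢0 : NonZero R
       R≢0 = >-nonZero 1≤R
       P≢0 : NonZero P
       P≢0 = >-nonZero 1≤P
       c≢0 : NonZero c
       c≢0 = >-nonZero 1≤c

   Λ : ℕ
   Λ = L ^ 5 * (R ^ 11 * P ^ 8)

   dominated : ∀ v′ x → v′ ≤ v → x ≤ c ^ 8 * Λ → u * (v′ * x) ≤ n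
   dominated v′ x v′≤v x≤ = ≤-trans (*-monoʳ-≤ u (*-mono-≤ v′≤v x≤)) (≤-trans (≤-reflexive (id₁ u v (c ^ 8) Λ)) growth)
     where
     id₁ : ∀ u v c x → u * (v * (c * x)) ≡ u * (v * c) * x
     id₁ = solve 4 (λ u v c x → u :* (v :* (c :* x)) := u :* (v :* c) :* x) refl

   module _ (Q F : ℕ) (1≤Q : 1 ≤ Q) (Q≤ : Q ≤ c * R) (F≤ : F ≤ u * (Q ^ 6 * P ^ 5)) where

     Q-power : ∀ k → Q ^ k ≤ c ^ k * R ^ k
     Q-power k = ≤-trans (^-monoˡ-≤ k Q≤) (≤-reflexive (*-^ c R k))

     -- About Q⁶ P⁵ fine classes with Q² P³ vertices each: this gives Q⁸ P⁸, with Q of the order of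
     -- R.
     enough-classes : ∀ s → suc s ≤ v → F * (s * (Q * Q * (P * P * P)) + 1) ≤ n
     enough-classes s s<v = ≤-trans (*-mono-≤ F≤ (≤-trans (+-monoʳ-≤ (s * z) (*-mono-≤ (*-mono-≤ 1≤Q 1≤Q) (*-mono-≤ (*-mono-≤ 1≤P 1≤P) 1≤P)))
         (≤-reflexive (+-comm (s * z) z))))
       (≤-trans (≤-reflexive (id₁ u (suc s) (Q ^ 6) (P ^ 5) Q P)) (dominated (suc s) (Q * (Q * Q ^ 6) * (P * (P * (P * P ^ 5)))) s<v monomial))
       where
       z : ℕ
       z = Q * Q * (P * P * P)
       id₁ : ∀ u c x y Q P → u * (x * y) * (c * (Q * Q * (P * P * P))) ≡ u * (c * (Q * (Q * x) * (P * (P * (P * y)))))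
       id₁ = solve 6 (λ u c x y Q P → u :* (x :* y) :* (c :* (Q :* Q :* (P :* P :* P))) := u :* (c :* (Q :* (Q :* x) :* (P :* (P :* (P :* y)))))) refl
       monomial : Q ^ 8 * P ^ 8 ≤ c ^ 8 * Λ
       monomial = ≤-trans (*-monoˡ-≤ (P ^ 8) (Q-power 8)) (≤-trans (≤-reflexive (*-assoc (c ^ 8) (R ^ 8) (P ^ 8))) (*-monoʳ-≤ (c ^ 8)
         (≤-trans (≤-reflexive (sym (*-identityˡ (R ^ 8 * P ^ 8)))) (*-mono-≤ (m^n>0 L 5) (*-monoˡ-≤ (P ^ 8) (^-monoʳ-≤ R (m≤m+n 8 3)))))))

     -- A degree of a t · P E₀ into each fine class, with a t of order R² and E₀ of order L² R,
     -- times the factor P between n and n p: in all R⁹ P⁷ L².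
     enough-degree : ∀ x k₁ k₂ E → x ≤ k₁ * (R * R) → E ≤ k₂ * (L * L * R) → 2 * (k₁ * k₂) ≤ v → 1 ≤ F * x * (P * E) →
       P * (F * x * (P * E) + 1) ≤ n
     enough-degree x k₁ k₂ E x≤ E≤ v≥ pos = ≤-trans (*-monoʳ-≤ P (≤-trans (+-monoʳ-≤ z pos) (≤-reflexive (cong (z +_) (sym (+-identityʳ z))))))
       (≤-trans (*-monoʳ-≤ P (*-monoʳ-≤ 2 (*-mono-≤ (*-mono-≤ F≤ x≤) (*-monoʳ-≤ P E≤))))
       (≤-trans (≤-reflexive (id₁ u k₁ k₂ (Q ^ 6) (P ^ 5) P R L)) (dominated (2 * (k₁ * k₂)) (Q ^ 6 * (P * (P * P ^ 5) * (R * R * R * (L * L)))) v≥ monomial)))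
       where
       z : ℕ
       z = F * x * (P * E)
       id₁ : ∀ u k₁ k₂ q p P R L → P * (2 * (u * (q * p) * (k₁ * (R * R)) * (P * (k₂ * (L * L * R))))) ≡ u * (2 * (k₁ * k₂) * (q * (P * (P * p) * (R * R * R * (L * L)))))
       id₁ = solve 8 (λ u k₁ k₂ q p P R L → P :* (con 2 :* (u :* (q :* p) :* (k₁ :* (R :* R)) :* (P :* (k₂ :* (L :* L :* R))))) := u :* (con 2 :* (k₁ :* k₂) :* (q :* (P :* (P :* p) :* (R :* R :* R :* (L :* L)))))) refl
       monomial : Q ^ 6 * (P ^ 7 * (R * R * R * (L * L))) ≤ c ^ 8 * Λ
       monomial = begin
         Q ^ 6 * (P ^ 7 * (R * R * R * (L * L))) ≤⟨ *-mono-≤ (Q-power 6) (*-mono-≤ (^-monoʳ-≤ P (m≤m+n 7 1)) (≤-reflexive (id₂ R L))) ⟩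
         c ^ 6 * R ^ 6 * (P ^ 8 * (R ^ 3 * L ^ 2)) ≡⟨ id₃ (c ^ 6) (R ^ 6) (P ^ 8) (R ^ 3) (L ^ 2) ⟩
         c ^ 6 * (L ^ 2 * (R ^ 6 * R ^ 3 * P ^ 8)) ≤⟨ *-mono-≤ (^-monoʳ-≤ c (m≤m+n 6 2)) (*-mono-≤ (^-monoʳ-≤ L (m≤m+n 2 3)) (*-monoˡ-≤ (P ^ 8) (≤-trans (≤-reflexive (sym (^-+ R 6 3))) (^-monoʳ-≤ R (m≤m+n 9 2))))) ⟩
         c ^ 8 * Λ ∎
         where
         open ≤-Reasoning
         id₂ : ∀ R L → R * R * R * (L * L) ≡ R * (R * (R * 1)) * (L * (L * 1))
         id₂ = solve 2 (λ R L → R :* R :* R :* (L :* L) := R :* (R :* (R :* con 1)) :* (L :* (L :* con 1))) refl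
         id₃ : ∀ c x p z l → c * x * (p * (z * l)) ≡ c * (l * (x * z * p))
         id₃ = solve 5 (λ c x p z l → c :* x :* (p :* (z :* l)) := c :* (l :* (x :* z :* p))) refl

 DegreeClose : (S₂ X c : ℕ) → Set
 DegreeClose S₂ X c = (S₂ + 1) * X ≤ (S₂ + 2) * c × (S₂ + 2) * c ≤ (S₂ + 2 + 1) * (X + 1)

 CodegreeClose : (S₂ X n c : ℕ) → Set
 CodegreeClose S₂ X n c = (S₂ + 1) * (X * X) ≤ (S₂ + 2) * (n * c) × (S₂ + 2) * (n * c) ≤ (S₂ + 2 + 1) * ((X + 1) * (X + 1))

 record CloseCounts (S₂ X : ℕ) {n : ℕ} (G : D.Digraph n) : Set where
   field
     out-degree : ∀ u → DegreeClose S₂ X (cnt n (D.adj G u))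
     in-degree  : ∀ u → DegreeClose S₂ X (cnt n (λ x → D.adj G x u))
     common-out : ∀ u u′ → u ≢ u′ → CodegreeClose S₂ X n (cnt n (λ x → D.adj G u x ∧ D.adj G u′ x))
     through    : ∀ u u′ → u ≢ u′ → CodegreeClose S₂ X n (cnt n (λ x → D.adj G u x ∧ D.adj G x u′))
     common-in  : ∀ u u′ → u ≢ u′ → CodegreeClose S₂ X n (cnt n (λ x → D.adj G x u ∧ D.adj G x u′))

 Packed : ∀ {n} → D.Digraph n → ℕ → Set
 Packed {n} G t = ∃ λ (Cs : List (D.HamCycle n)) → ∃ λ (U : List (Fin n × Fin n)) →
   (∀ C → C ∈ Cs → D.CycleIn G C) × D.PairwiseEdgeDisjoint Cs ×
   (∀ a b → D.adj G a b ≡ true → (∃ λ C → C ∈ Cs × D.CycleEdge C a b) ⊎ ((a , b) ∈ U)) ×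
   3 * t * length U ≤ 28 * D.edgeCount G

 exponent-bound : ∀ A L n m → pw A * m ≤ n → 1 ≤ m → n < 2 ^ suc L → A ≤ L
 exponent-bound A L n m le 1≤m n< with A ≤? L
 ... | yes p = p
 ... | no ¬p = ⊥-elim (<-irrefl refl (≤-trans n< (≤-trans (^-monoʳ-≤ 2 (≰⇒> ¬p)) (≤-trans (≤-reflexive (sym (pw≡2^ A))) (≤-trans (≤-trans (≤-reflexive (sym (*-identityʳ (pw A)))) (*-monoʳ-≤ (pw A) 1≤m)) le)))))

 module Choose (f g₁ c S₂ v P X L n : ℕ) (f≡ : 4 * 80 * 240 ≡ f) (g₁-large : 205120 ≤ g₁) (c-large : 2560 ≤ c) (7≤S₂ : 7 ≤ S₂) (10≤P : 10 ≤ P) (1≤L : 1 ≤ L)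
   (v-bound : 31 * ((v + 13) * (v + 13)) ≤ 640 * (S₂ + 2)) (n-upper : n ≤ P * (X + 1)) (X-upper : 9 * (P * X) ≤ 10 * n) (n-small : n < 2 ^ suc L)
   (growth : f * (g₁ * c ^ 8) * (L ^ 5 * ((S₂ + 3) ^ 11 * P ^ 8)) ≤ n) where

   private
     S R w a t x₀ : ℕ
     S = S₂ + 2
     R = S₂ + 3
     w = 40 * S₂ + 38
     a = w + 42
     t = v + 13
     x₀ = 80 * S₂ + 159

     -- The class order and the halving both call for powers of two. q lies between 80 S and 160 S,
     -- so that 32 a ≤ Q; H = B h positions host gadgets, 4 g = ω positions supply them, and 2^κ
     -- exceeds their sum by a factor of about two at most.
     γ q Q g H κ : ℕ
     γ = proj₁ (power-of-two x₀)
     q = 2 ^ γ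
     Q = q * 16
     g = Q * Q * (P * P)
     H = 80 * (Q * P) * (240 * (Q * Q * Q * (P * P * (P * P))))
     κ = proj₁ (power-of-two (H + (4 * g + 1)))

     -- κ halvings produce the classes and γ + 4 more produce each of the two labels, as Q = 2^(γ +
     -- 4). All positions before the last ω belong to the paths.
     K A F e E₀ o : ℕ
     K = 2 ^ κ
     A = κ + ((γ + 4) + (γ + 4))
     F = pw A
     e = K ∸ suc (4 * g)
     o = 160 * (L * S) ∸ 2
     E₀ = 2 + suc (suc o) * (2 * L + 6)

     0<S : 0 < S
     0<S = ≤-trans (s≤s z≤n) (m≤n+m 2 S₂)

     0<P : 0 < P
     0<P = ≤-trans (s≤s z≤n) 10≤P

     0<R : 0 < R
     0<R = ≤-trans (s≤s z≤n) (m≤n+m 3 S₂)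

     S≤R : S ≤ R
     S≤R = +-monoʳ-≤ S₂ (s≤s (s≤s z≤n))

     0<t : 0 < t
     0<t = ≤-trans (s≤s z≤n) (m≤n+m 13 v)

     0<a : 0 < a
     0<a = ≤-trans (s≤s z≤n) (m≤n+m 42 w)

     x₀≡ : suc x₀ ≡ 80 * S
     x₀≡ = id₁ S₂
       where
       id₁ : ∀ S → suc (80 * S + 159) ≡ 80 * (S + 2)
       id₁ = solve 1 (λ S → (con 1 :+ (con 80 :* S :+ con 159)) := con 80 :* (S :+ con 2)) refl

     a≡ : 40 * S ≡ a
     a≡ = id₁ S₂
       where
       id₁ : ∀ S → 40 * (S + 2) ≡ 40 * S + 38 + 42
       id₁ = solve 1 (λ S → con 40 :* (S :+ con 2) := con 40 :* S :+ con 38 :+ con 42) refl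

     q-large : 80 * S ≤ q
     q-large = ≤-trans (≤-reflexive (sym x₀≡)) (proj₁ (proj₂ (power-of-two x₀)))

     Q-small : Q ≤ c * R
     Q-small = ≤-trans (*-monoˡ-≤ 16 (≤-trans (proj₂ (proj₂ (power-of-two x₀))) (≤-reflexive (cong (2 *_) x₀≡)))) (≤-trans (≤-reflexive (id₁ 2 80 16 S)) (*-mono-≤ c-large S≤R))
       where
       id₁ : ∀ α β γ S → α * (β * S) * γ ≡ α * β * γ * S
       id₁ = solve 4 (λ α β γ S → α :* (β :* S) :* γ := α :* β :* γ :* S) refl

     0<Q : 0 < Q
     0<Q = *-mono-≤ (m^n>0 2 γ) (s≤s (z≤n {15}))

     0<g : 0 < g
     0<g = *-mono-≤ (*-mono-≤ 0<Q 0<Q) (*-mono-≤ 0<P 0<P)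

     K-lower : H + (4 * g + 2) ≤ K
     K-lower = ≤-trans (≤-reflexive (id₁ H (4 * g))) (proj₁ (proj₂ (power-of-two (H + (4 * g + 1)))))
       where
       id₁ : ∀ H g → H + (g + 2) ≡ suc (H + (g + 1))
       id₁ = solve 2 (λ H g → H :+ (g :+ con 2) := (con 1 :+ (H :+ (g :+ con 1)))) refl

     K-upper : K ≤ 2 * (H + (4 * g + 2))
     K-upper = ≤-trans (proj₂ (proj₂ (power-of-two (H + (4 * g + 1))))) (≤-reflexive (cong (2 *_) (id₁ H (4 * g))))
       where
       id₁ : ∀ H g → suc (H + (g + 1)) ≡ H + (g + 2)
       id₁ = solve 2 (λ H g → (con 1 :+ (H :+ (g :+ con 1))) := H :+ (g :+ con 2)) refl

     ω<K : suc (4 * g) ≤ K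
     ω<K = ≤-trans (≤-trans (≤-trans (n≤1+n _) (≤-reflexive (+-comm 2 (4 * g)))) (m≤n+m (4 * g + 2) H)) K-lower

     K≡ : K ≡ suc e + 4 * g
     K≡ = trans (sym (m∸n+n≡m ω<K)) (+-suc e (4 * g))

     H≤e : H ≤ e
     H≤e = ≤-trans (m+n≤o⇒m≤o∸n H (≤-trans (+-monoʳ-≤ H (≤-trans (n≤1+n _) (≤-reflexive (+-comm 2 (4 * g))))) K-lower)) ≤-refl

     F≡ : F ≡ K * (Q * Q)
     F≡ = trans (pw≡2^ A) (trans (^-+ 2 κ ((γ + 4) + (γ + 4))) (cong (K *_) (trans (^-+ 2 (γ + 4) (γ + 4)) (cong₂ _*_ (^-+ 2 γ 4) (^-+ 2 γ 4)))))

     F≤H : F ≤ 4 * H * (Q * Q)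
     F≤H = ≤-trans (≤-reflexive F≡) (F-upper K H g (Q * Q) K-upper 0<g (product-dominates 80 240 Q P (m≤m+n 6 74) (s≤s z≤n) 0<Q 0<P))

     F-monomial : F ≤ f * (Q ^ 6 * P ^ 5)
     F-monomial = ≤-trans F≤H (≤-reflexive (product-monomial 80 240 f Q P f≡))

     0<F : 0 < F
     0<F = ≤-trans (m^n>0 2 A) (≤-reflexive (sym (pw≡2^ A)))

     o≡ : suc (suc o) ≡ 160 * (L * S)
     o≡ = trans (+-comm 2 o) (m∸n+n≡m (≤-trans (m≤m+n 2 158) (*-monoʳ-≤ 160 (*-mono-≤ 1≤L 0<S))))

     E₀≡ : E₀ ≡ 2 + 160 * (L * S) * (2 * L + 6)
     E₀≡ = cong (λ z → 2 + z * (2 * L + 6)) o≡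

     t≤2S : t ≤ 2 * S
     t≤2S = t-linear v S v-bound

     module Gr = Growth f g₁ c L R P n (≤-trans (s≤s z≤n) c-large) 1≤L 0<R 0<P growth

     m₀-room : F * (6400 * (Q * Q * (P * P * P)) + 1) ≤ n
     m₀-room = Gr.enough-classes Q F 0<Q Q-small F-monomial 6400 (≤-trans (m≤m+n 6401 198719) g₁-large)

     1≤E₀ : 1 ≤ E₀
     1≤E₀ = s≤s z≤n

     y-room : P * (F * (a * t) * (P * E₀) + 1) ≤ n
     y-room = Gr.enough-degree Q F 0<Q Q-small F-monomial (a * t) 80 1282 E₀
       (≤-trans (*-mono-≤ (≤-trans (≤-reflexive (sym a≡)) (*-monoʳ-≤ 40 S≤R)) (≤-trans t≤2S (*-monoʳ-≤ 2 S≤R))) (≤-reflexive (id₁ R)))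
       (≤-trans (≤-reflexive E₀≡) (≤-trans (E-upper L S 1≤L (*-mono-≤ (*-mono-≤ 1≤L 1≤L) 0<S)) (*-monoʳ-≤ 1282 (*-monoʳ-≤ (L * L) S≤R)))) g₁-large
       (*-mono-≤ (*-mono-≤ 0<F (*-mono-≤ 0<a 0<t)) (*-mono-≤ 0<P 1≤E₀))
       where
       id₁ : ∀ R → 40 * R * (2 * R) ≡ 80 * (R * R)
       id₁ = solve 1 (λ R → con 40 :* R :* (con 2 :* R) := con 80 :* (R :* R)) refl

     m₀ ℓ n′ : ℕ
     m₀ = proj₁ (quotient F n 0<F)
     ℓ = n ∸ F * m₀
     n′ = F * m₀ + ℓ

     m₀-floor : F * m₀ ≤ n × n + 1 ≤ F * (m₀ + 1)
     m₀-floor = proj₂ (quotient F n 0<F)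

     n′≡n : n′ ≡ n
     n′≡n = m+[n∸m]≡n (proj₁ m₀-floor)

     ℓ<F : ℓ < F
     ℓ<F = +-cancelˡ-< (F * m₀) ℓ F (≤-trans (≤-reflexive (trans (cong suc n′≡n) (+-comm 1 n))) (≤-trans (proj₂ m₀-floor) (≤-reflexive (id₁ F m₀))))
       where
       id₁ : ∀ F m → F * (m + 1) ≡ F * m + F
       id₁ = solve 2 (λ F m → F :* (m :+ con 1) := F :* m :+ F) refl

     m₀-lower : 6400 * (Q * Q * (P * P * P)) ≤ m₀
     m₀-lower = +-cancelʳ-≤ 1 (6400 * (Q * Q * (P * P * P))) m₀ (*-cancelˡ-≤ F {{>-nonZero 0<F}} (≤-trans m₀-room (≤-trans (m≤m+n n 1) (proj₂ m₀-floor))))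

     0<Fat : 0 < F * (a * t)
     0<Fat = *-mono-≤ 0<F (*-mono-≤ 0<a 0<t)

     y d : ℕ
     y = proj₁ (quotient (F * (a * t)) X 0<Fat)
     d = a * (t * y)

     y-floor : F * d ≤ X × X + 1 ≤ F * (a * (t * (y + 1)))
     y-floor = ≤-trans (≤-reflexive (id₁ F a t y)) (proj₁ fl) , ≤-trans (proj₂ fl) (≤-reflexive (sym (id₁ F a t (y + 1))))
       where
       fl : F * (a * t) * y ≤ X × X + 1 ≤ F * (a * t) * (y + 1)
       fl = proj₂ (quotient (F * (a * t)) X 0<Fat)
       id₁ : ∀ F a t y → F * (a * (t * y)) ≡ F * (a * t) * y
       id₁ = solve 4 (λ F a t y → F :* (a :* (t :* y)) := F :* (a :* t) :* y) refl

     PE≤y : P * E₀ ≤ y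
     PE≤y = below (F * (a * t)) (P * E₀) (proj₂ (proj₂ (quotient (F * (a * t)) X 0<Fat)))
       (+-cancelʳ-≤ 1 (F * (a * t) * (P * E₀)) X (*-cancelˡ-≤ P {{>-nonZero 0<P}} (≤-trans y-room n-upper)))
       where
       below : ∀ d k {x c} → x + 1 ≤ d * (c + 1) → d * k ≤ x → k ≤ c
       below d k {x} {c} above le = ≤-pred (≤-trans (*-cancelˡ-< d k (c + 1) (≤-trans (≤-trans (s≤s le) (≤-reflexive (+-comm 1 x))) above)) (≤-reflexive (+-comm c 1)))

     E₀≤y : E₀ ≤ y
     E₀≤y = ≤-trans (≤-trans (≤-reflexive (sym (*-identityˡ E₀))) (*-monoˡ-≤ E₀ 0<P)) PE≤y

     y-large : 480 * (S + 1) ≤ y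
     y-large = ≤-trans (≤-trans (S-scale S 0<S) (≤-trans (E-lower L S 1≤L (*-mono-≤ 1≤L 1≤L)) (≤-reflexive (sym E₀≡)))) E₀≤y

     P≤y : P ≤ y
     P≤y = ≤-trans (≤-trans (≤-reflexive (sym (*-identityʳ P))) (*-monoʳ-≤ P 1≤E₀)) PE≤y

     9≤y : 9 ≤ y
     9≤y = ≤-trans (≤-trans (m≤m+n 9 1) 10≤P) P≤y

     9≤X : 9 ≤ X
     9≤X = ≤-trans 9≤y (≤-trans (≤-trans (≤-reflexive (trans (sym (*-identityˡ y)) (sym (*-identityˡ (1 * y))))) (*-mono-≤ 0<F (≤-trans (≤-reflexive (sym (*-identityˡ (1 * y)))) (*-mono-≤ 0<a (*-monoˡ-≤ y 0<t))))) (proj₁ y-floor))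

     2≤m₀ : 2 ≤ m₀
     2≤m₀ = ≤-trans (*-mono-≤ (m≤m+n 2 6398) (*-mono-≤ (*-mono-≤ 0<Q 0<Q) (*-mono-≤ (*-mono-≤ 0<P 0<P) 0<P))) m₀-lower

     Pd≤2m₀ : P * d ≤ 2 * m₀
     Pd≤2m₀ = d-upper F m₀ n P X d (proj₁ y-floor) X-upper (≤-trans (m≤m+n n 1) (proj₂ m₀-floor)) 2≤m₀ (*-mono-≤ (s≤s (z≤n {8})) 0<F)

     0<2P² : 0 < 2 * (P * P)
     0<2P² = *-mono-≤ (s≤s (z≤n {1})) (*-mono-≤ 0<P 0<P)

     μ cap Dlo Dhi Clo Chi χ : ℕ
     μ = proj₁ (quotient (2 * (P * P)) m₀ 0<2P²)
     cap = proj₁ (quotient 10 (Q * μ) (s≤s z≤n))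

     0<n′ : 0 < n′
     0<n′ = ≤-trans (*-mono-≤ 0<F (≤-trans (s≤s z≤n) 2≤m₀)) (m≤m+n (F * m₀) ℓ)

     0<Sn : 0 < S * n′
     0<Sn = *-mono-≤ 0<S 0<n′

     0<am : 0 < a * m₀
     0<am = *-mono-≤ 0<a (≤-trans (s≤s z≤n) 2≤m₀)

     Dlo = proj₁ (quotient S ((S₂ + 1) * X) 0<S)
     Dhi = proj₁ (quotient S ((S + 1) * (X + 1)) 0<S)
     Clo = proj₁ (quotient (S * n′) ((S₂ + 1) * (X * X)) 0<Sn)
     Chi = proj₁ (quotient (S * n′) ((S + 1) * ((X + 1) * (X + 1))) 0<Sn)
     χ = proj₁ (quotient (a * m₀) ((w + 84) * d * d) 0<am)

     t-budget : 8 * (t * t) + 84 * t ≤ 8 * a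
     t-budget = budget-of-t v a (≤-trans v-bound (≤-reflexive (trans (*-assoc 16 40 S) (cong (16 *_) a≡))))

     μ-large : 3200 * (Q * Q * P) ≤ μ
     μ-large = ≤-pred (≤-trans (*-cancelˡ-< (2 * (P * P)) (3200 * (Q * Q * P)) (μ + 1) (≤-trans (s≤s (≤-trans (≤-reflexive (id₁ 3200 P Q)) m₀-lower)) (≤-trans (≤-reflexive (+-comm 1 m₀)) (proj₂ (proj₂ (quotient (2 * (P * P)) m₀ 0<2P²)))))) (≤-reflexive (+-comm μ 1)))
       where
       id₁ : ∀ c P Q → 2 * (P * P) * (c * (Q * Q * P)) ≡ 2 * c * (Q * Q * (P * P * P))
       id₁ = solve 3 (λ c P Q → con 2 :* (P :* P) :* (c :* (Q :* Q :* P)) := con 2 :* c :* (Q :* Q :* (P :* P :* P))) refl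

     v-small : v + 4 ≤ S
     v-small with v + 4 ≤? S
     ... | yes p = p
     ... | no ¬p = ⊥-elim (<-irrefl refl (≤-trans (t-below S 0<S) (≤-trans (*-monoʳ-≤ 31 (*-mono-≤ S+10≤ S+10≤)) v-bound)))
       where
       S+10≤ : S + 10 ≤ v + 13
       S+10≤ = ≤-trans (+-monoˡ-≤ 10 (≤-pred (≤-trans (≰⇒> ¬p) (≤-reflexive (+-suc v 3))))) (≤-reflexive (+-assoc v 3 10))

     A≤L : A ≤ L
     A≤L = exponent-bound A L n m₀ (proj₁ m₀-floor) (≤-trans (s≤s z≤n) 2≤m₀) n-small

     module Sc = Scaled S₂ v P q K m₀ ℓ y μ cap e
     module Ct = Counted S₂ v P q X L A κ m₀ ℓ y μ cap e o Dlo Dhi Clo Chi χ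

     scale : Sc.Scale
     scale = record
       { 4≤S₂ = ≤-trans (m≤m+n 4 3) 7≤S₂ ; 10≤P = 10≤P ; 0<y = ≤-trans (s≤s z≤n) 9≤y ; P≤y = P≤y
       ; t-small = t-budget ; q-large = q-large ; K≡ = K≡ ; Bh≤e = H≤e ; ℓ-small = ≤-trans ℓ<F F≤H
       ; m₀-upper′ = m₀-upper F m₀ n P X a t y (proj₁ m₀-floor) n-upper (proj₂ y-floor) (≤-trans (s≤s z≤n) 9≤y) 0<F
       ; d-upper′ = Pd≤2m₀ ; μ-floor = proj₂ (quotient (2 * (P * P)) m₀ 0<2P²)
       ; cap-floor = proj₁ (proj₂ (quotient 10 (Q * μ) (s≤s z≤n))) ,
           ≤-trans (≤-reflexive (+-comm 1 (Q * μ))) (≤-trans (proj₂ (proj₂ (quotient 10 (Q * μ) (s≤s z≤n)))) (*-monoʳ-≤ 10 (≤-reflexive (+-comm cap 1))))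
       ; μ-large = μ-large }

     counts : Ct.Counts
     counts = record
       { 7≤S₂ = 7≤S₂ ; 1≤L = 1≤L ; 9≤X = 9≤X ; v-small = v-small ; o≡ = o≡ ; A≤L = A≤L
       ; n-small = subst (_< 2 ^ suc L) (sym n′≡n) n-small ; F≡ = F≡ ; ℓ<F = ℓ<F
       ; n-upper = subst (_≤ P * (X + 1)) (sym n′≡n) n-upper ; d-floor = y-floor ; PE≤y = PE≤y ; y-large = y-large
       ; m₀-large = m₀-cubic P a (t * y) y E₀ m₀ Pd≤2m₀ (≤-trans (≤-reflexive (sym (*-identityˡ y))) (*-monoˡ-≤ y 0<t)) (≤-trans (m≤m+n 28 14) (m≤n+m 42 w)) PE≤y 1≤E₀
       ; Dlo-floor = proj₂ (quotient S ((S₂ + 1) * X) 0<S)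
       ; Dhi-floor = proj₂ (quotient S ((S + 1) * (X + 1)) 0<S)
       ; Clo-floor = proj₂ (quotient (S * n′) ((S₂ + 1) * (X * X)) 0<Sn)
       ; Chi-floor = proj₂ (quotient (S * n′) ((S + 1) * ((X + 1) * (X + 1))) 0<Sn)
       ; χ-floor = proj₂ (quotient (a * m₀) ((w + 84) * d * d) 0<am) }

     packed′ : (G : D.Digraph n′) → CloseCounts S₂ X G → Packed G t
     packed′ G cc = finish (Ct.packed scale counts G out-degree in-degree common-out through common-in)
       where
       open CloseCounts cc
       finish : (∃ λ (Cs : List (D.HamCycle n′)) → ∃ λ (U : List (Fin n′ × Fin n′)) →
         (∀ C → C ∈ Cs → D.CycleIn G C) × D.PairwiseEdgeDisjoint Cs ×
         (∀ a b → D.adj G a b ≡ true → (∃ λ C → C ∈ Cs × D.CycleEdge C a b) ⊎ ((a , b) ∈ U)) ×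
         length U + K * Sc.r * n′ ≡ D.edgeCount G) → Packed G t
       finish (Cs , U , in-G , disjoint , covered , count) = Cs , U , in-G , disjoint , covered ,
         Ct.uncovered-small scale counts G out-degree in-degree common-out through common-in (length U) count

   packed : (G : D.Digraph n) → CloseCounts S₂ X G → Packed G (v + 13)
   packed = subst (λ n → (G : D.Digraph n) → CloseCounts S₂ X G → Packed G (v + 13)) n′≡n packed′

 -- The uncovered fraction.

 least : {Pr : ℕ → Set} → (∀ k → Dec (Pr k)) → ¬ Pr 0 → ∀ k → Pr k → ∃ λ j → ¬ Pr j × Pr (suc j)
 least dec ¬0 zero pr = ⊥-elim (¬0 pr)
 least dec ¬0 (suc k) pr with dec k
 ... | yes p = least dec ¬0 k p
 ... | no ¬p = k , ¬p , pr

 -- The integer t = v + 13 stands for 8/θ, where θ is the fraction of the degree left uncovered: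
 -- it is the least t with 1/ε ≤ (3t/28)⁸.
 module Threshold (α β x y h c e S : ℕ) (e≡ : e ≡ 9 ^ 3) (constants : 10 * (β ^ 4 * (y ^ 8 * c ^ 8)) < 9 * (e * (α ^ 4 * (x ^ 8 * h ^ 8))))
   (9≤S : 9 ≤ S) (start : (h * 12) ^ 8 < 10 * c ^ 8) (1≤h : 1 ≤ h) where

   private
     Large : ℕ → Set
     Large k = (S + 1) * c ^ 8 ≤ (h * (k + 12)) ^ 8

     ¬Large-0 : ¬ Large 0
     ¬Large-0 le = <-irrefl refl (≤-trans start (≤-trans (*-monoˡ-≤ (c ^ 8) (+-monoˡ-≤ 1 9≤S)) le))

     instance
       S+1≢0 : NonZero (S + 1)
       S+1≢0 = >-nonZero (m≤n+m 1 S)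

     bound : ℕ
     bound = (S + 1) * c

     Large-bound : Large bound
     Large-bound = ≤-trans (*-monoˡ-≤ (c ^ 8) (≤-trans (≤-reflexive (sym (^-identityʳ (S + 1)))) (^-monoʳ-≤ (S + 1) (m≤m+n 1 7))))
       (≤-trans (≤-reflexive (sym (*-^ (S + 1) c 8))) (^-monoˡ-≤ 8 (≤-trans (≤-reflexive (sym (*-identityˡ bound))) (*-mono-≤ 1≤h (m≤m+n bound 12)))))

   -- Compared in fourth powers: t⁸ is at most a constant times S + 1, against S⁴ ≥ 9³ S. So larger
   -- S only helps, and `constants` is the case S = 9.
   square-small : ∀ k t → (h * k) ^ 8 ≤ (S + 1) * c ^ 8 → x * t ≤ y * k → β * (t * t) ≤ α * S
   square-small k t small ratio with β * (t * t) ≤? α * S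
   ... | yes p = p
   ... | no ¬p = ⊥-elim (<⇒≱ (*-monoˡ-< S {{>-nonZero (≤-trans (s≤s z≤n) 9≤S)}} constants) (begin
     9 * (e * (α ^ 4 * (x ^ 8 * h ^ 8))) * S ≡⟨ id₁ (α ^ 4) (x ^ 8) (h ^ 8) e S ⟩
     9 * (α ^ 4 * (x ^ 8 * h ^ 8) * (S * e)) ≤⟨ *-monoʳ-≤ 9 (*-monoʳ-≤ (α ^ 4 * (x ^ 8 * h ^ 8)) (*-monoʳ-≤ S (≤-trans (≤-reflexive e≡) (^-monoˡ-≤ 3 9≤S)))) ⟩
     9 * (α ^ 4 * (x ^ 8 * h ^ 8) * S ^ 4) ≡⟨ id₂ (α ^ 4) (x ^ 8) (h ^ 8) (S ^ 4) ⟩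
     9 * (α ^ 4 * S ^ 4 * (x ^ 8 * h ^ 8)) ≡⟨ cong (λ z → 9 * (z * (x ^ 8 * h ^ 8))) (*-^ α S 4) ⟨
     9 * ((α * S) ^ 4 * (x ^ 8 * h ^ 8)) ≤⟨ *-monoʳ-≤ 9 (*-monoˡ-≤ (x ^ 8 * h ^ 8) (^-monoˡ-≤ 4 (<⇒≤ (≰⇒> ¬p)))) ⟩
     9 * ((β * (t * t)) ^ 4 * (x ^ 8 * h ^ 8)) ≡⟨ cong (λ z → 9 * (z * (x ^ 8 * h ^ 8))) (*-^ β (t * t) 4) ⟩
     9 * (β ^ 4 * (t * t) ^ 4 * (x ^ 8 * h ^ 8)) ≡⟨ cong (λ z → 9 * (β ^ 4 * z * (x ^ 8 * h ^ 8))) (trans (*-^ t t 4) (sym (^-+ t 4 4))) ⟩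
     9 * (β ^ 4 * t ^ 8 * (x ^ 8 * h ^ 8)) ≡⟨ id₃ (β ^ 4) (t ^ 8) (x ^ 8) (h ^ 8) ⟩
     9 * (β ^ 4 * (h ^ 8 * (x ^ 8 * t ^ 8))) ≡⟨ cong (λ z → 9 * (β ^ 4 * (h ^ 8 * z))) (*-^ x t 8) ⟨
     9 * (β ^ 4 * (h ^ 8 * (x * t) ^ 8)) ≤⟨ *-monoʳ-≤ 9 (*-monoʳ-≤ (β ^ 4) (*-monoʳ-≤ (h ^ 8) (^-monoˡ-≤ 8 ratio))) ⟩
     9 * (β ^ 4 * (h ^ 8 * (y * k) ^ 8)) ≡⟨ cong (λ z → 9 * (β ^ 4 * (h ^ 8 * z))) (*-^ y k 8) ⟩
     9 * (β ^ 4 * (h ^ 8 * (y ^ 8 * k ^ 8))) ≡⟨ id₄ (β ^ 4) (h ^ 8) (y ^ 8) (k ^ 8) ⟩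
     9 * (β ^ 4 * (y ^ 8 * (h ^ 8 * k ^ 8))) ≡⟨ cong (λ z → 9 * (β ^ 4 * (y ^ 8 * z))) (*-^ h k 8) ⟨
     9 * (β ^ 4 * (y ^ 8 * (h * k) ^ 8)) ≤⟨ *-monoʳ-≤ 9 (*-monoʳ-≤ (β ^ 4) (*-monoʳ-≤ (y ^ 8) small)) ⟩
     9 * (β ^ 4 * (y ^ 8 * ((S + 1) * c ^ 8))) ≡⟨ id₅ (β ^ 4) (y ^ 8) S (c ^ 8) ⟩
     β ^ 4 * (y ^ 8 * c ^ 8) * (9 * S + 9) ≤⟨ *-monoʳ-≤ (β ^ 4 * (y ^ 8 * c ^ 8)) (+-monoʳ-≤ (9 * S) 9≤S) ⟩
     β ^ 4 * (y ^ 8 * c ^ 8) * (9 * S + S) ≡⟨ id₆ (β ^ 4 * (y ^ 8 * c ^ 8)) S ⟩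
     10 * (β ^ 4 * (y ^ 8 * c ^ 8)) * S ∎))
     where
     open ≤-Reasoning
     id₁ : ∀ a x h e S → 9 * (e * (a * (x * h))) * S ≡ 9 * (a * (x * h) * (S * e))
     id₁ = solve 5 (λ a x h e S → con 9 :* (e :* (a :* (x :* h))) :* S := con 9 :* (a :* (x :* h) :* (S :* e))) refl
     id₂ : ∀ a x h S → 9 * (a * (x * h) * S) ≡ 9 * (a * S * (x * h))
     id₂ = solve 4 (λ a x h S → con 9 :* (a :* (x :* h) :* S) := con 9 :* (a :* S :* (x :* h))) refl
     id₃ : ∀ b t x h → 9 * (b * t * (x * h)) ≡ 9 * (b * (h * (x * t)))
     id₃ = solve 4 (λ b t x h → con 9 :* (b :* t :* (x :* h)) := con 9 :* (b :* (h :* (x :* t)))) refl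
     id₄ : ∀ b h y k → 9 * (b * (h * (y * k))) ≡ 9 * (b * (y * (h * k)))
     id₄ = solve 4 (λ b h y k → con 9 :* (b :* (h :* (y :* k))) := con 9 :* (b :* (y :* (h :* k)))) refl
     id₅ : ∀ b y S c → 9 * (b * (y * ((S + 1) * c))) ≡ b * (y * c) * (9 * S + 9)
     id₅ = solve 4 (λ b y S c → con 9 :* (b :* (y :* ((S :+ con 1) :* c))) := b :* (y :* c) :* (con 9 :* S :+ con 9)) refl
     id₆ : ∀ b S → b * (9 * S + S) ≡ 10 * b * S
     id₆ = solve 2 (λ b S → b :* (con 9 :* S :+ S) := con 10 :* b :* S) refl

   threshold : (∀ j → x * (j + 13) ≤ y * (j + 12)) → ∃ λ v → β * ((v + 13) * (v + 13)) ≤ α * S × (S + 1) * c ^ 8 ≤ (h * (v + 13)) ^ 8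
   threshold ratio with least {Large} (λ k → (S + 1) * c ^ 8 ≤? (h * (k + 12)) ^ 8) ¬Large-0 bound Large-bound
   ... | v , ¬large , large = v , square-small (v + 12) (v + 13) (<⇒≤ (≰⇒> ¬large)) (ratio v) ,
     subst (λ z → (S + 1) * c ^ 8 ≤ (h * z) ^ 8) (sym (+-suc v 12)) large

 eighth-power : ∀ c h t U E R → 0 < c → R * c ^ 8 ≤ (h * t) ^ 8 → h * t * U ≤ c * E → R * U ^ 8 ≤ E ^ 8
 eighth-power c h t U E R 0<c large le = *-cancelˡ-≤ (c ^ 8) {{m^n≢0 c 8 {{>-nonZero 0<c}}}} (begin
   c ^ 8 * (R * U ^ 8) ≡⟨ id₁ (c ^ 8) R (U ^ 8) ⟩
   R * c ^ 8 * U ^ 8 ≤⟨ *-monoˡ-≤ (U ^ 8) large ⟩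
   (h * t) ^ 8 * U ^ 8 ≡⟨ *-^ (h * t) U 8 ⟨
   (h * t * U) ^ 8 ≤⟨ ^-monoˡ-≤ 8 le ⟩
   (c * E) ^ 8 ≡⟨ *-^ c E 8 ⟩
   c ^ 8 * E ^ 8 ∎)
   where
   open ≤-Reasoning
   id₁ : ∀ c R U → c * (R * U) ≡ R * c * U
   id₁ = solve 3 (λ c R U → c :* (R :* U) := R :* c :* U) refl

 NearlyDecomposed : ∀ {n} → D.Digraph n → ℕ → Set
 NearlyDecomposed {n} G R = ∃ λ (Cs : List (D.HamCycle n)) → ∃ λ (U : List (Fin n × Fin n)) →
   (∀ C → C ∈ Cs → D.CycleIn G C) × D.PairwiseEdgeDisjoint Cs ×
   (∀ a b → D.adj G a b ≡ true → (∃ λ C → C ∈ Cs × D.CycleEdge C a b) ⊎ ((a , b) ∈ U)) ×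
   R * length U ^ 8 ≤ D.edgeCount G ^ 8

 abstract
   -- The absolute constant C collects 76800 = 4 · 80 · 240 from the number of fine classes, 205120
   -- = 2 · 80 · 1282 from the degree requirement, and 2560 = 2 · 80 · 16 from the bound on Q / S.
   nearly-decompose : ∃ λ C → ∀ S₂ P X L n → 7 ≤ S₂ → 10 ≤ P → 1 ≤ L → n ≤ P * (X + 1) → 9 * (P * X) ≤ 10 * n → n < 2 ^ suc L →
     C * (L ^ 5 * ((S₂ + 3) ^ 11 * P ^ 8)) ≤ n → (G : D.Digraph n) → CloseCounts S₂ X G → NearlyDecomposed G (S₂ + 2 + 1)
   nearly-decompose = go 76800 205120 2560 refl ≤-refl ≤-refl
     where
     go : ∀ f g c → 4 * 80 * 240 ≡ f → 205120 ≤ g → 2560 ≤ c → ∃ λ C → ∀ S₂ P X L n → 7 ≤ S₂ → 10 ≤ P → 1 ≤ L → n ≤ P * (X + 1) → 9 * (P * X) ≤ 10 * n → n < 2 ^ suc L →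
       C * (L ^ 5 * ((S₂ + 3) ^ 11 * P ^ 8)) ≤ n → (G : D.Digraph n) → CloseCounts S₂ X G → NearlyDecomposed G (S₂ + 2 + 1)
     go f g c f≡ g≤ c≤ = f * (g * c ^ 8) , decompose
       where
       decompose : ∀ S₂ P X L n → 7 ≤ S₂ → 10 ≤ P → 1 ≤ L → n ≤ P * (X + 1) → 9 * (P * X) ≤ 10 * n → n < 2 ^ suc L →
         f * (g * c ^ 8) * (L ^ 5 * ((S₂ + 3) ^ 11 * P ^ 8)) ≤ n → (G : D.Digraph n) → CloseCounts S₂ X G → NearlyDecomposed G (S₂ + 2 + 1)
       decompose S₂ P X L n 7≤S₂ 10≤P 1≤L n-upper X-upper n-small growth G close =
         -- 31 t² ≤ 640 S is what the cut condition requires, 28/3 is the loss factor, and 13/12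
         -- bounds t / (t - 1) for t ≥ 13. At S = 9 these constants only just fit together.
         finish (Threshold.threshold 640 31 12 13 3 28 729 (S₂ + 2) refl (≤ᵇ⇒≤ _ _ tt) (+-monoˡ-≤ 2 7≤S₂) (≤ᵇ⇒≤ _ _ tt) (s≤s z≤n) ratio)
         where
         ratio : ∀ j → 12 * (j + 13) ≤ 13 * (j + 12)
         ratio j = ≤-trans (m≤m+n _ j) (≤-reflexive (id₁ j))
           where
           id₁ : ∀ j → 12 * (j + 13) + j ≡ 13 * (j + 12)
           id₁ = solve 1 (λ j → con 12 :* (j :+ con 13) :+ j := con 13 :* (j :+ con 12)) refl
         finish : (∃ λ v → 31 * ((v + 13) * (v + 13)) ≤ 640 * (S₂ + 2) × (S₂ + 2 + 1) * 28 ^ 8 ≤ (3 * (v + 13)) ^ 8) → NearlyDecomposed G (S₂ + 2 + 1)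
         finish (v , v-bound , large) = weaken (Choose.packed f g c S₂ v P X L n f≡ g≤ c≤ 7≤S₂ 10≤P 1≤L v-bound n-upper X-upper n-small growth G close)
           where
           weaken : Packed G (v + 13) → NearlyDecomposed G (S₂ + 2 + 1)
           weaken (Cs , U , in-G , disjoint , covered , small) = Cs , U , in-G , disjoint , covered ,
             eighth-power 28 3 (v + 13) (length U) (D.edgeCount G) (S₂ + 2 + 1) (s≤s z≤n) large small

open import Defs
open import Data.Nat as ℕ using (ℕ)
open import Data.Nat.Divisibility using (_∣_)
open import Data.Fin using (Fin)
open import Data.Bool using (true)
open import Data.List using (List; length)
open import Data.List.Membership.Propositional using (_∈_)
open import Data.Product using (_×_; ∃-syntax)
open import Data.Sum using (_⊎_)
open import Data.Rational using (ℚ; _*_; _≤_; _<_; 0ℚ; _/_)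
open import Data.Integer using (+_)
open import Relation.Binary.PropositionalEquality using (_≡_)
open import Data.Bool as Bool using (false)
open import Data.Empty using (⊥-elim)
import Data.Integer as ℤ
import Data.Integer.Properties as ℤP
import Data.Nat.Properties as ℕP
import Data.Nat.Coprimality as Coprimality
open Coprimality using (1-coprimeTo)
open import Data.Nat.Logarithm using (⌊log₂_⌋; ⌊log₂⌋-mono-≤; ⌊log₂[2^n]⌋≡n)
open import Data.Product using (∃; _,_; proj₁; proj₂)
open import Data.Rational using (mkℚ; _+_; _-_; -_; 1ℚ; *≤*; *<*; nonNegative)
import Data.Rational.Properties as ℚP
open import Data.Rational.Solver using (module +-*-Solver)
open +-*-Solver using (solve; _:=_; _:+_; _:*_; _:-_; con)
import Data.Rational.Unnormalised as ℚᵘ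
import Data.Rational.Unnormalised.Properties as ℚᵘP
open import Relation.Binary.PropositionalEquality using (refl; sym; trans; cong; cong₂; subst; subst₂)
open import Relation.Nullary using (¬_; yes; no)
open import Relation.Nullary.Decidable using (from-yes; from-no)
open Combinatorics using (cnt; 𝟙; ∑-cong; count≡cnt; DegreeClose; CodegreeClose; CloseCounts; NearlyDecomposed; nearly-decompose)

-- From rational hypotheses to integer parameters.

ι-mkℚ : ∀ k → ℕ→ℚ k ≡ mkℚ (+ k) 0 (Coprimality.sym (1-coprimeTo k))
ι-mkℚ k = ℚP.normalize-coprime (Coprimality.sym (1-coprimeTo k))

ι-+ : ∀ a b → ℕ→ℚ (a ℕ.+ b) ≡ ℕ→ℚ a + ℕ→ℚ b
ι-+ a b rewrite ι-mkℚ a | ι-mkℚ b = cong (_/ 1) (cong₂ ℤ._+_ (sym (ℤP.*-identityʳ (+ a))) (sym (ℤP.*-identityʳ (+ b))))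

ι-* : ∀ a b → ℕ→ℚ (a ℕ.* b) ≡ ℕ→ℚ a * ℕ→ℚ b
ι-* a b rewrite ι-mkℚ a | ι-mkℚ b = cong (_/ 1) (ℤP.pos-* a b)

ι-mono : ∀ {a b} → a ℕ.≤ b → ℕ→ℚ a ≤ ℕ→ℚ b
ι-mono {a} {b} a≤b rewrite ι-mkℚ a | ι-mkℚ b = *≤* (ℤP.*-monoʳ-≤-nonNeg (+ 1) (ℤ.+≤+ a≤b))

ι-reflects-≤ : ∀ {a b} → ℕ→ℚ a ≤ ℕ→ℚ b → a ℕ.≤ b
ι-reflects-≤ {a} {b} le rewrite ι-mkℚ a | ι-mkℚ b = ℤP.drop‿+≤+ (ℤP.*-cancelʳ-≤-pos (+ a) (+ b) (+ 1) (ℚP.drop-*≤* le))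

0≤ι : ∀ a → 0ℚ ≤ ℕ→ℚ a
0≤ι a = ι-mono {0} {a} ℕ.z≤n

ι-suc : ∀ a → ℕ→ℚ (ℕ.suc a) ≡ ℕ→ℚ a + 1ℚ
ι-suc a = trans (cong ℕ→ℚ (ℕP.+-comm 1 a)) (ι-+ a 1)

*-monoʳ : ∀ {c a b} → 0ℚ ≤ c → a ≤ b → a * c ≤ b * c
*-monoʳ {c} 0≤c a≤b = ℚP.*-monoʳ-≤-nonNeg c {{nonNegative 0≤c}} a≤b

*-monoˡ : ∀ {c a b} → 0ℚ ≤ c → a ≤ b → c * a ≤ c * b
*-monoˡ {c} 0≤c a≤b = ℚP.*-monoˡ-≤-nonNeg c {{nonNegative 0≤c}} a≤b

*-mono : ∀ {a b c d} → 0ℚ ≤ c → 0ℚ ≤ b → a ≤ b → c ≤ d → a * c ≤ b * d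
*-mono 0≤c 0≤b a≤b c≤d = ℚP.≤-trans (*-monoʳ 0≤c a≤b) (*-monoˡ 0≤b c≤d)

0≤* : ∀ {a b} → 0ℚ ≤ a → 0ℚ ≤ b → 0ℚ ≤ a * b
0≤* {a} 0≤a 0≤b = ℚP.≤-trans (ℚP.≤-reflexive (sym (ℚP.*-zeroʳ a))) (*-monoˡ 0≤a 0≤b)

0≤^ : ∀ {a} k → 0ℚ ≤ a → 0ℚ ≤ a ^ℚ k
0≤^ ℕ.zero 0≤a = 0≤ι 1
0≤^ (ℕ.suc k) 0≤a = 0≤* 0≤a (0≤^ k 0≤a)

^-mono : ∀ {a b} k → 0ℚ ≤ a → a ≤ b → a ^ℚ k ≤ b ^ℚ k
^-mono ℕ.zero 0≤a a≤b = ℚP.≤-refl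
^-mono (ℕ.suc k) 0≤a a≤b = *-mono (0≤^ k 0≤a) (ℚP.≤-trans 0≤a a≤b) a≤b (^-mono k 0≤a a≤b)

^-* : ∀ a b k → (a * b) ^ℚ k ≡ (a ^ℚ k) * (b ^ℚ k)
^-* a b ℕ.zero = sym (ℚP.*-identityʳ 1ℚ)
^-* a b (ℕ.suc k) = trans (cong ((a * b) *_) (^-* a b k)) (solve 4 (λ a b x y → a :* b :* (x :* y) := a :* x :* (b :* y)) refl a b (a ^ℚ k) (b ^ℚ k))

ι-^ : ∀ a k → ℕ→ℚ (a ℕ.^ k) ≡ ℕ→ℚ a ^ℚ k
ι-^ a ℕ.zero = refl
ι-^ a (ℕ.suc k) = trans (ι-* a (a ℕ.^ k)) (cong (ℕ→ℚ a *_) (ι-^ a k))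

+-cancelʳ : ∀ {a b} c → a + c ≤ b + c → a ≤ b
+-cancelʳ {a} {b} c le = subst₂ _≤_ (cancel a) (cancel b) (ℚP.+-monoˡ-≤ (- c) le)
  where
  cancel : ∀ a → a + c + - c ≡ a
  cancel a = trans (ℚP.+-assoc a c (- c)) (trans (cong (λ z → a + z) (ℚP.+-inverseʳ c)) (ℚP.+-identityʳ a))

ℚ<⇒≱ : ∀ {a b} → a < b → ¬ b ≤ a
ℚ<⇒≱ a<b b≤a = ℚP.<-irrefl refl (ℚP.<-≤-trans a<b b≤a)

floor : ∀ {B} → 0ℚ ≤ B → ∀ k → B < ℕ→ℚ k → ∃ λ X → ℕ→ℚ X ≤ B × B < ℕ→ℚ (ℕ.suc X)
floor 0≤B ℕ.zero B< = ⊥-elim (ℚ<⇒≱ B< 0≤B)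
floor {B} 0≤B (ℕ.suc k) B< with ℕ→ℚ k ℚP.≤? B
... | yes k≤ = k , k≤ , B<
... | no ¬k≤ = floor 0≤B k (ℚP.≰⇒> ¬k≤)

-- The denominator of x serves as k.
archimedean : ∀ x → 0ℚ < x → ∃ λ k → 1ℚ ≤ x * ℕ→ℚ k
archimedean x@(mkℚ (+ ℕ.zero) d _) 0<x = ⊥-elim (ℚ<⇒≱ 0<x (*≤* (ℤP.≤-reflexive (sym (trans (ℤP.*-zeroˡ (+ ℕ.suc d)) refl)))))
archimedean x@(mkℚ (+ ℕ.suc a) d _) 0<x = ℕ.suc d , subst (λ z → 1ℚ ≤ x * z) (sym (ι-mkℚ (ℕ.suc d)))
  (ℚP.toℚᵘ-cancel-≤ (ℚᵘP.≤-respʳ-≃ (ℚᵘP.≃-sym (ℚP.toℚᵘ-homo-* x (mkℚ (+ ℕ.suc d) 0 (Coprimality.sym (1-coprimeTo (ℕ.suc d))))))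
    (ℚᵘ.*≤* (ℤ.+≤+ (ℕP.≤-trans (ℕP.≤-reflexive (trans (ℕP.*-identityˡ _) (ℕP.*-identityʳ (ℕ.suc d)))) (ℕP.≤-trans (ℕP.m≤m+n (ℕ.suc d) (a ℕ.* ℕ.suc d)) (ℕP.≤-reflexive (sym (ℕP.*-identityʳ _)))))))))
archimedean x@(mkℚ ℤ.-[1+ a ] d _) 0<x = ⊥-elim (ℚ<⇒≱ 0<x (ℚP.<⇒≤ (*<* ℤ.-<+)))

-- 1/x rounded up to an integer S₂ + 3.
reciprocal : ∀ x → 0ℚ < x → x ≤ + 1 / 10 → ∃ λ S₂ → 7 ℕ.≤ S₂ × x * ℕ→ℚ (S₂ ℕ.+ 2) ≤ 1ℚ × 1ℚ ≤ x * ℕ→ℚ (S₂ ℕ.+ 2 ℕ.+ 1)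
reciprocal x 0<x x≤ = shift (search (proj₁ (archimedean x 0<x)) (proj₂ (archimedean x 0<x)))
  where
  search : ∀ k → 1ℚ ≤ x * ℕ→ℚ k → ∃ λ S → x * ℕ→ℚ S ≤ 1ℚ × 1ℚ ≤ x * ℕ→ℚ (ℕ.suc S)
  search ℕ.zero le = ⊥-elim (from-no (1ℚ ℚP.≤? 0ℚ) (ℚP.≤-trans le (ℚP.≤-reflexive (ℚP.*-zeroʳ x))))
  search (ℕ.suc k) le with 1ℚ ℚP.≤? x * ℕ→ℚ k
  ... | yes le′ = search k le′
  ... | no ¬le = k , ℚP.<⇒≤ (ℚP.≰⇒> ¬le) , le
  shift : (∃ λ S → x * ℕ→ℚ S ≤ 1ℚ × 1ℚ ≤ x * ℕ→ℚ (ℕ.suc S)) → _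
  shift (S , below , above) with 9 ℕP.≤? S
  ... | yes 9≤S = S ℕ.∸ 2 , ℕP.∸-monoˡ-≤ 2 9≤S ,
    subst (λ z → x * ℕ→ℚ z ≤ 1ℚ × 1ℚ ≤ x * ℕ→ℚ (z ℕ.+ 1)) (sym (ℕP.m∸n+n≡m (ℕP.≤-trans (ℕP.m≤m+n 2 7) 9≤S))) (below , subst (λ z → 1ℚ ≤ x * ℕ→ℚ z) (ℕP.+-comm 1 S) above)
  -- S ≤ 8 would give 1 ≤ 9 x ≤ 9/10.
  ... | no ¬9≤S = ⊥-elim (from-no (1ℚ ℚP.≤? (+ 1 / 10) * ℕ→ℚ 9)
    (ℚP.≤-trans above (*-mono (0≤ι (ℕ.suc S)) (from-yes (0ℚ ℚP.≤? + 1 / 10)) x≤ (ι-mono {ℕ.suc S} {9} (ℕP.≰⇒> ¬9≤S)))))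

module Relative {ε : ℚ} {S₁ : ℕ} (εS≤1 : ε * ℕ→ℚ (ℕ.suc S₁) ≤ 1ℚ) where

  private
    S = ℕ.suc S₁

  lower-factor : ℕ→ℚ S₁ ≤ ℕ→ℚ S * (1ℚ - ε)
  lower-factor = +-cancelʳ (ε * ℕ→ℚ S) (ℚP.≤-trans (ℚP.+-monoʳ-≤ (ℕ→ℚ S₁) εS≤1)
    (ℚP.≤-reflexive (trans (sym (ι-suc S₁)) (solve 2 (λ s e → s := s :* (con 1ℚ :- e) :+ e :* s) refl (ℕ→ℚ S) ε))))

  upper-factor : ℕ→ℚ S * (1ℚ + ε) ≤ ℕ→ℚ (ℕ.suc S)
  upper-factor = ℚP.≤-trans (ℚP.≤-reflexive (solve 2 (λ s e → s :* (con 1ℚ :+ e) := s :+ e :* s) refl (ℕ→ℚ S) ε))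
    (ℚP.≤-trans (ℚP.+-monoʳ-≤ (ℕ→ℚ S) εS≤1) (ℚP.≤-reflexive (sym (ι-suc S))))

  -- By ε S ≤ 1, multiplication by S replaces 1 ± ε by S ± 1, which prepares an inequality between
  -- integers.
  close : ∀ {A B} → 0ℚ ≤ B → A ≈[1± ε ] B → ℕ→ℚ S₁ * B ≤ ℕ→ℚ S * A × ℕ→ℚ S * A ≤ ℕ→ℚ (ℕ.suc S) * B
  close {A} {B} 0≤B (lo , hi) =
    ℚP.≤-trans (*-monoʳ 0≤B lower-factor) (ℚP.≤-trans (ℚP.≤-reflexive (ℚP.*-assoc (ℕ→ℚ S) (1ℚ - ε) B)) (*-monoˡ (0≤ι S) lo)) ,
    ℚP.≤-trans (*-monoˡ (0≤ι S) hi) (ℚP.≤-trans (ℚP.≤-reflexive (sym (ℚP.*-assoc (ℕ→ℚ S) (1ℚ + ε) B))) (*-monoʳ 0≤B upper-factor))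

  close-linear : ∀ {B X Y} c → ℕ→ℚ X ≤ B → B ≤ ℕ→ℚ Y → ℕ→ℚ c ≈[1± ε ] B → S₁ ℕ.* X ℕ.≤ S ℕ.* c × S ℕ.* c ℕ.≤ ℕ.suc S ℕ.* Y
  close-linear {B} {X} {Y} c X≤B B≤Y ap =
    ι-reflects-≤ {S₁ ℕ.* X} {S ℕ.* c} (subst₂ _≤_ (sym (ι-* S₁ X)) (sym (ι-* S c)) (ℚP.≤-trans (*-monoˡ (0≤ι S₁) X≤B) (proj₁ both))) ,
    ι-reflects-≤ {S ℕ.* c} {ℕ.suc S ℕ.* Y} (subst₂ _≤_ (sym (ι-* S c)) (sym (ι-* (ℕ.suc S) Y)) (ℚP.≤-trans (proj₂ both) (*-monoˡ (0≤ι (ℕ.suc S)) B≤Y)))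
    where
    both = close {ℕ→ℚ c} {B} (ℚP.≤-trans (0≤ι X) X≤B) ap

  close-scale : ∀ {A B} m → A ≈[1± ε ] B → 0ℚ ≤ m → (m * A) ≈[1± ε ] (m * B)
  close-scale {A} {B} m (lo , hi) 0≤m = ℚP.≤-trans (ℚP.≤-reflexive (swap (1ℚ - ε) B)) (*-monoˡ 0≤m lo) , ℚP.≤-trans (*-monoˡ 0≤m hi) (ℚP.≤-reflexive (sym (swap (1ℚ + ε) B)))
    where
    swap : ∀ e B → e * (m * B) ≡ m * (e * B)
    swap e B = solve 3 (λ e m B → e :* (m :* B) := m :* (e :* B)) refl e m B

∧≡ : ∀ x y → (x ∧ y) ≡ (x Bool.∧ y)
∧≡ true  y = refl
∧≡ false y = refl

module _ {n : ℕ} {ε p : ℚ} {G : Digraph n} (uniform : Uniform ε p G) {S₂ X : ℕ} (0≤p : 0ℚ ≤ p)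
  (εS≤1 : ε * ℕ→ℚ (S₂ ℕ.+ 2) ≤ 1ℚ) (X≤ : ℕ→ℚ X ≤ ℕ→ℚ n * p) (<X : ℕ→ℚ n * p < ℕ→ℚ (ℕ.suc X)) where

  private
    open Uniform uniform

    shape : ∀ {x y c Y} → (ℕ.suc S₂ ℕ.* x ℕ.≤ (ℕ.suc (ℕ.suc S₂)) ℕ.* c × ℕ.suc (ℕ.suc S₂) ℕ.* c ℕ.≤ ℕ.suc (ℕ.suc (ℕ.suc S₂)) ℕ.* y) → y ≡ Y →
      (S₂ ℕ.+ 1) ℕ.* x ℕ.≤ (S₂ ℕ.+ 2) ℕ.* c × (S₂ ℕ.+ 2) ℕ.* c ℕ.≤ (S₂ ℕ.+ 2 ℕ.+ 1) ℕ.* Y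
    shape {x} {y} {c} (lo , hi) refl = subst₂ (λ s s′ → s ℕ.* x ℕ.≤ s′ ℕ.* c) (ℕP.+-comm 1 S₂) (ℕP.+-comm 2 S₂) lo ,
      subst₂ (λ s s′ → s ℕ.* c ℕ.≤ s′ ℕ.* y) (ℕP.+-comm 2 S₂) (trans (ℕP.+-comm 3 S₂) (sym (ℕP.+-assoc S₂ 2 1))) hi

    open Relative {ε} {ℕ.suc S₂} (subst (λ s → ε * ℕ→ℚ s ≤ 1ℚ) (ℕP.+-comm S₂ 2) εS≤1)

    degree : ∀ c → ℕ→ℚ c ≈[1± ε ] (ℕ→ℚ n * p) → DegreeClose S₂ X c
    degree c ap = shape {X} {ℕ.suc X} {c} (close-linear {ℕ→ℚ n * p} {X} {ℕ.suc X} c X≤ (ℚP.<⇒≤ <X) ap) (ℕP.+-comm 1 X)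

    codegree : ∀ c → ℕ→ℚ c ≈[1± ε ] (ℕ→ℚ n * (p ^ℚ 2)) → CodegreeClose S₂ X n c
    codegree c ap = shape {X ℕ.* X} {ℕ.suc X ℕ.* ℕ.suc X} {n ℕ.* c} (close-linear {ℕ→ℚ n * (ℕ→ℚ n * (p ^ℚ 2))} {X ℕ.* X} {ℕ.suc X ℕ.* ℕ.suc X} (n ℕ.* c)
        (subst₂ _≤_ (sym (ι-* X X)) square (*-mono (0≤ι X) (ℚP.≤-trans (0≤ι X) X≤) X≤ X≤))
        (subst₂ _≤_ square (sym (ι-* (ℕ.suc X) (ℕ.suc X))) (*-mono 0≤np (0≤ι (ℕ.suc X)) (ℚP.<⇒≤ <X) (ℚP.<⇒≤ <X)))
        (subst (λ z → z ≈[1± ε ] (ℕ→ℚ n * (ℕ→ℚ n * (p ^ℚ 2)))) (sym (ι-* n c)) (close-scale (ℕ→ℚ n) ap (0≤ι n)))) (cong₂ ℕ._*_ (ℕP.+-comm 1 X) (ℕP.+-comm 1 X))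
      where
      0≤np : 0ℚ ≤ ℕ→ℚ n * p
      0≤np = 0≤* (0≤ι n) 0≤p
      square : (ℕ→ℚ n * p) * (ℕ→ℚ n * p) ≡ ℕ→ℚ n * (ℕ→ℚ n * (p ^ℚ 2))
      square = solve 2 (λ n p → (n :* p) :* (n :* p) := n :* (n :* (p :* (p :* con 1ℚ)))) refl (ℕ→ℚ n) p

  close-counts : CloseCounts S₂ X G
  close-counts = record
    { out-degree = λ u → subst (DegreeClose S₂ X) (count≡cnt (adj G u)) (degree (outDeg G u) (outDeg-ok u))
    ; in-degree = λ u → subst (DegreeClose S₂ X) (count≡cnt (λ x → adj G x u)) (degree (inDeg G u) (inDeg-ok u))
    ; common-out = λ u u′ ne → subst (CodegreeClose S₂ X n) (both (adj G u) (adj G u′)) (codegree (count (λ x → adj G u x ∧ adj G u′ x)) (commonOut u u′ ne))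
    ; through = λ u u′ ne → subst (CodegreeClose S₂ X n) (both (adj G u) (λ x → adj G x u′)) (codegree (count (λ x → adj G u x ∧ adj G x u′)) (outIn u u′ ne))
    ; common-in = λ u u′ ne → subst (CodegreeClose S₂ X n) (both (λ x → adj G x u) (λ x → adj G x u′)) (codegree (count (λ x → adj G x u ∧ adj G x u′)) (commonIn u u′ ne))
    }
    where
    both : ∀ (f g : Fin n → Bool.Bool) → count (λ x → f x ∧ g x) ≡ cnt n (λ x → f x Bool.∧ g x)
    both f g = trans (count≡cnt (λ x → f x ∧ g x)) (∑-cong n (λ x → cong 𝟙 (∧≡ (f x) (g x))))

log-upper : ∀ n → n ℕ.< 2 ℕ.^ ℕ.suc ⌊log₂ n ⌋
log-upper n with n ℕP.<? 2 ℕ.^ ℕ.suc ⌊log₂ n ⌋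
... | yes p = p
... | no ¬p = ⊥-elim (ℕP.<-irrefl refl (ℕP.≤-trans (ℕP.≤-reflexive (sym (⌊log₂[2^n]⌋≡n (ℕ.suc ⌊log₂ n ⌋)))) (⌊log₂⌋-mono-≤ (ℕP.≮⇒≥ ¬p))))

module Sparse {n : ℕ} {ε p : ℚ} (0<ε : 0ℚ < ε) (ε≤ : ε ≤ + 1 / 10) (0<p : 0ℚ < p) (p≤ : p ≤ + 1 / 10) where

  private
    0≤ε : 0ℚ ≤ ε
    0≤ε = ℚP.<⇒≤ 0<ε
    0≤p : 0ℚ ≤ p
    0≤p = ℚP.<⇒≤ 0<p

  reciprocal-upper : ∀ {x k} → x ≤ + 1 / 10 → x * ℕ→ℚ k ≤ 1ℚ → x * ℕ→ℚ (k ℕ.+ 1) ≤ 1ℚ + (+ 1 / 10)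
  reciprocal-upper {x} {k} x≤ le = ℚP.≤-trans (ℚP.≤-reflexive (trans (cong (x *_) (ι-+ k 1)) (solve 2 (λ x k → x :* (k :+ con 1ℚ) := x :* k :+ x) refl x (ℕ→ℚ k)))) (ℚP.+-mono-≤ le x≤)

  module _ {X P : ℕ} (X≤ : ℕ→ℚ X ≤ ℕ→ℚ n * p) (<X : ℕ→ℚ n * p < ℕ→ℚ (ℕ.suc X)) (1≤pP : 1ℚ ≤ p * ℕ→ℚ P) where

    n-upper : n ℕ.≤ P ℕ.* (X ℕ.+ 1)
    n-upper = ι-reflects-≤ {n} {P ℕ.* (X ℕ.+ 1)} (ℚP.≤-trans (ℚP.≤-reflexive (sym (ℚP.*-identityʳ (ℕ→ℚ n)))) (ℚP.≤-trans (*-monoˡ (0≤ι n) 1≤pP)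
      (ℚP.≤-trans (ℚP.≤-reflexive (solve 3 (λ n p k → n :* (p :* k) := k :* (n :* p)) refl (ℕ→ℚ n) p (ℕ→ℚ P)))
      (ℚP.≤-trans (*-monoˡ (0≤ι P) (ℚP.<⇒≤ <X)) (ℚP.≤-reflexive (trans (sym (ι-* P (ℕ.suc X))) (cong (λ z → ℕ→ℚ (P ℕ.* z)) (ℕP.+-comm 1 X))))))))

    X-upper : p * ℕ→ℚ P ≤ 1ℚ + (+ 1 / 10) → 9 ℕ.* (P ℕ.* X) ℕ.≤ 10 ℕ.* n
    X-upper pP≤ = ι-reflects-≤ {9 ℕ.* (P ℕ.* X)} {10 ℕ.* n} (begin
      ℕ→ℚ (9 ℕ.* (P ℕ.* X)) ≡⟨ trans (ι-* 9 (P ℕ.* X)) (cong (ℕ→ℚ 9 *_) (ι-* P X)) ⟩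
      ℕ→ℚ 9 * (ℕ→ℚ P * ℕ→ℚ X) ≤⟨ *-monoˡ (0≤ι 9) (*-monoˡ (0≤ι P) X≤) ⟩
      ℕ→ℚ 9 * (ℕ→ℚ P * (ℕ→ℚ n * p)) ≡⟨ solve 4 (λ c k n p → c :* (k :* (n :* p)) := c :* (p :* k) :* n) refl (ℕ→ℚ 9) (ℕ→ℚ P) (ℕ→ℚ n) p ⟩
      ℕ→ℚ 9 * (p * ℕ→ℚ P) * ℕ→ℚ n ≤⟨ *-monoʳ (0≤ι n) (ℚP.≤-trans (*-monoˡ (0≤ι 9) pP≤) (from-yes (ℕ→ℚ 9 * (1ℚ + (+ 1 / 10)) ℚP.≤? ℕ→ℚ 10))) ⟩
      ℕ→ℚ 10 * ℕ→ℚ n ≡⟨ ι-* 10 n ⟨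
      ℕ→ℚ (10 ℕ.* n) ∎)
      where open ℚP.≤-Reasoning

  -- R and P are reciprocals rounded up, so ε R and p P may exceed 1 but not z. Replacing ε and p by
  -- 1/R and 1/P then costs the factor z^19, which is put into the constant of the growth
  -- hypothesis.
  growth-ℕ : ∀ z C L R P → ε * ℕ→ℚ R ≤ ℕ→ℚ z → p * ℕ→ℚ P ≤ ℕ→ℚ z → 0 ℕ.< z →
    ℕ→ℚ (z ℕ.^ 11 ℕ.* z ℕ.^ 8 ℕ.* C) * (ℕ→ℚ L ^ℚ 5) ≤ (ε ^ℚ 11) * ℕ→ℚ n * (p ^ℚ 8) →
    C ℕ.* (L ℕ.^ 5 ℕ.* (R ℕ.^ 11 ℕ.* P ℕ.^ 8)) ℕ.≤ n
  growth-ℕ z C L R P εR≤ pP≤ 0<z growth = ℕP.*-cancelˡ-≤ Z {{ℕ.>-nonZero (ℕP.*-mono-≤ (ℕP.m^n>0 z {{ℕ.>-nonZero 0<z}} 11) (ℕP.m^n>0 z {{ℕ.>-nonZero 0<z}} 8))}} (ι-reflects-≤ {Z ℕ.* (C ℕ.* W)} {Z ℕ.* n} (begin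
    ℕ→ℚ (Z ℕ.* (C ℕ.* (L ℕ.^ 5 ℕ.* (R ℕ.^ 11 ℕ.* P ℕ.^ 8)))) ≡⟨ cong ℕ→ℚ (sym (ℕP.*-assoc Z C W)) ⟩
    ℕ→ℚ (Z ℕ.* C ℕ.* (L ℕ.^ 5 ℕ.* (R ℕ.^ 11 ℕ.* P ℕ.^ 8))) ≡⟨ trans (ι-* (Z ℕ.* C) W) (cong (ℕ→ℚ (Z ℕ.* C) *_) (trans (ι-* (L ℕ.^ 5) (R ℕ.^ 11 ℕ.* P ℕ.^ 8)) (cong₂ _*_ (ι-^ L 5) (trans (ι-* (R ℕ.^ 11) (P ℕ.^ 8)) (cong₂ _*_ (ι-^ R 11) (ι-^ P 8)))))) ⟩
    ℕ→ℚ (Z ℕ.* C) * (l * (r * k)) ≡⟨ ℚP.*-assoc (ℕ→ℚ (Z ℕ.* C)) l (r * k) ⟨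
    ℕ→ℚ (Z ℕ.* C) * l * (r * k) ≤⟨ *-monoʳ (0≤* (0≤^ 11 (0≤ι R)) (0≤^ 8 (0≤ι P))) growth ⟩
    (ε ^ℚ 11) * ℕ→ℚ n * (p ^ℚ 8) * (r * k) ≡⟨ rearrange (ε ^ℚ 11) (ℕ→ℚ n) (p ^ℚ 8) r k ⟩
    ((ε ^ℚ 11) * r) * ((p ^ℚ 8) * k) * ℕ→ℚ n ≡⟨ cong (_* ℕ→ℚ n) (cong₂ _*_ (^-* ε (ℕ→ℚ R) 11) (^-* p (ℕ→ℚ P) 8)) ⟨
    ((ε * ℕ→ℚ R) ^ℚ 11) * ((p * ℕ→ℚ P) ^ℚ 8) * ℕ→ℚ n ≤⟨ *-monoʳ (0≤ι n) (*-mono (0≤^ 8 (0≤* 0≤p (0≤ι P))) (0≤^ 11 (0≤ι z)) (^-mono 11 (0≤* 0≤ε (0≤ι R)) εR≤) (^-mono 8 (0≤* 0≤p (0≤ι P)) pP≤)) ⟩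
    (ℕ→ℚ z ^ℚ 11) * (ℕ→ℚ z ^ℚ 8) * ℕ→ℚ n ≡⟨ cong (_* ℕ→ℚ n) (cong₂ _*_ (ι-^ z 11) (ι-^ z 8)) ⟨
    ℕ→ℚ (z ℕ.^ 11) * ℕ→ℚ (z ℕ.^ 8) * ℕ→ℚ n ≡⟨ cong (_* ℕ→ℚ n) (ι-* (z ℕ.^ 11) (z ℕ.^ 8)) ⟨
    ℕ→ℚ Z * ℕ→ℚ n ≡⟨ ι-* Z n ⟨
    ℕ→ℚ (Z ℕ.* n) ∎))
    where
    open ℚP.≤-Reasoning
    Z W : ℕ
    W = L ℕ.^ 5 ℕ.* (R ℕ.^ 11 ℕ.* P ℕ.^ 8)
    Z = z ℕ.^ 11 ℕ.* z ℕ.^ 8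
    l r k : ℚ
    l = ℕ→ℚ L ^ℚ 5
    r = ℕ→ℚ R ^ℚ 11
    k = ℕ→ℚ P ^ℚ 8
    rearrange : ∀ e n q r k → e * n * q * (r * k) ≡ (e * r) * (q * k) * n
    rearrange = solve 5 (λ e n q r k → e :* n :* q :* (r :* k) := (e :* r) :* (q :* k) :* n) refl

  fraction : ∀ R u E → 1ℚ ≤ ε * ℕ→ℚ R → R ℕ.* u ℕ.^ 8 ℕ.≤ E ℕ.^ 8 → ℕ→ℚ u ^ℚ 8 ≤ ε * (ℕ→ℚ E ^ℚ 8)
  fraction R u E 1≤εR le = begin
    ℕ→ℚ u ^ℚ 8 ≡⟨ ℚP.*-identityˡ (ℕ→ℚ u ^ℚ 8) ⟨
    1ℚ * (ℕ→ℚ u ^ℚ 8) ≤⟨ *-monoʳ (0≤^ 8 (0≤ι u)) 1≤εR ⟩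
    ε * ℕ→ℚ R * (ℕ→ℚ u ^ℚ 8) ≡⟨ ℚP.*-assoc ε (ℕ→ℚ R) (ℕ→ℚ u ^ℚ 8) ⟩
    ε * (ℕ→ℚ R * (ℕ→ℚ u ^ℚ 8)) ≡⟨ cong (ε *_) (trans (ι-* R (u ℕ.^ 8)) (cong (ℕ→ℚ R *_) (ι-^ u 8))) ⟨
    ε * ℕ→ℚ (R ℕ.* u ℕ.^ 8) ≤⟨ *-monoˡ 0≤ε (ι-mono {R ℕ.* u ℕ.^ 8} {E ℕ.^ 8} le) ⟩
    ε * ℕ→ℚ (E ℕ.^ 8) ≡⟨ cong (ε *_) (ι-^ E 8) ⟩
    ε * (ℕ→ℚ E ^ℚ 8) ∎
    where open ℚP.≤-Reasoning

  nearly-decomposed : ∀ z C → 1ℚ + (+ 1 / 10) ≤ ℕ→ℚ z → 0 ℕ.< z → 2 ℕ.≤ n →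
    (∀ S₂ P X L n → 7 ℕ.≤ S₂ → 10 ℕ.≤ P → 1 ℕ.≤ L → n ℕ.≤ P ℕ.* (X ℕ.+ 1) → 9 ℕ.* (P ℕ.* X) ℕ.≤ 10 ℕ.* n → n ℕ.< 2 ℕ.^ ℕ.suc L →
      C ℕ.* (L ℕ.^ 5 ℕ.* ((S₂ ℕ.+ 3) ℕ.^ 11 ℕ.* P ℕ.^ 8)) ℕ.≤ n → (G : Digraph n) → CloseCounts S₂ X G → NearlyDecomposed G (S₂ ℕ.+ 2 ℕ.+ 1)) →
    ℕ→ℚ (z ℕ.^ 11 ℕ.* z ℕ.^ 8 ℕ.* C) * (ℕ→ℚ ⌊log₂ n ⌋ ^ℚ 5) ≤ (ε ^ℚ 11) * ℕ→ℚ n * (p ^ℚ 8) →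
    (G : Digraph n) → Uniform ε p G → ∃ λ R → 1ℚ ≤ ε * ℕ→ℚ R × NearlyDecomposed G R
  nearly-decomposed z C z≥ 0<z 2≤n decompose growth G uniform =
    go (reciprocal ε 0<ε ε≤) (reciprocal p 0<p p≤) (floor (0≤* (0≤ι n) 0≤p) (ℕ.suc n) np<)
    where
    np< : ℕ→ℚ n * p < ℕ→ℚ (ℕ.suc n)
    np< = ℚP.≤-<-trans (ℚP.≤-trans (*-monoˡ (0≤ι n) (ℚP.≤-trans p≤ (from-yes (+ 1 / 10 ℚP.≤? 1ℚ)))) (ℚP.≤-reflexive (ℚP.*-identityʳ (ℕ→ℚ n)))) (ℚP.≰⇒> (λ le → ℕP.<-irrefl refl (ι-reflects-≤ {ℕ.suc n} {n} le)))
    go : (∃ λ S₂ → 7 ℕ.≤ S₂ × ε * ℕ→ℚ (S₂ ℕ.+ 2) ≤ 1ℚ × 1ℚ ≤ ε * ℕ→ℚ (S₂ ℕ.+ 2 ℕ.+ 1)) →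
      (∃ λ P₂ → 7 ℕ.≤ P₂ × p * ℕ→ℚ (P₂ ℕ.+ 2) ≤ 1ℚ × 1ℚ ≤ p * ℕ→ℚ (P₂ ℕ.+ 2 ℕ.+ 1)) →
      (∃ λ X → ℕ→ℚ X ≤ ℕ→ℚ n * p × ℕ→ℚ n * p < ℕ→ℚ (ℕ.suc X)) → ∃ λ R → 1ℚ ≤ ε * ℕ→ℚ R × NearlyDecomposed G R
    go (S₂ , 7≤S₂ , εS≤1 , 1≤εR) (P₂ , 7≤P₂ , pP≤1 , 1≤pP) (X , X≤ , <X) = S₂ ℕ.+ 2 ℕ.+ 1 , 1≤εR ,
      decompose S₂ (P₂ ℕ.+ 2 ℕ.+ 1) X ⌊log₂ n ⌋ n 7≤S₂ (ℕP.+-monoˡ-≤ 1 (ℕP.+-monoˡ-≤ 2 7≤P₂)) (⌊log₂⌋-mono-≤ 2≤n)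
        (n-upper {X} {P₂ ℕ.+ 2 ℕ.+ 1} X≤ <X 1≤pP) (X-upper {X} {P₂ ℕ.+ 2 ℕ.+ 1} X≤ <X 1≤pP (reciprocal-upper {p} {P₂ ℕ.+ 2} p≤ pP≤1)) (log-upper n)
        (growth-ℕ z C ⌊log₂ n ⌋ (S₂ ℕ.+ 3) (P₂ ℕ.+ 2 ℕ.+ 1)
          (ℚP.≤-trans (subst (λ s → ε * ℕ→ℚ s ≤ 1ℚ + (+ 1 / 10)) (ℕP.+-assoc S₂ 2 1) (reciprocal-upper {ε} {S₂ ℕ.+ 2} ε≤ εS≤1)) z≥)
          (ℚP.≤-trans (reciprocal-upper {p} {P₂ ℕ.+ 2} p≤ pP≤1) z≥) 0<z growth)
        G (close-counts uniform {S₂} {X} 0≤p εS≤1 X≤ <X)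

theorem1p6 : (ε p : ℕ → ℚ) →
    (∀ n → (0ℚ < ε n) × (ε n ≤ + 1 / 10)) →
    (∀ n → (0ℚ < p n) × (p n ≤ + 1 / 10)) →
    GrowthHyp ε p →
    ∃[ N ] ∀ n → N ℕ.≤ n → 2 ∣ n →
    ∀ (D : Digraph n) → Uniform (ε n) (p n) D →
    ∃[ Cs ] ∃[ U ]
    (∀ C → C ∈ Cs → CycleIn D C) ×
    PairwiseEdgeDisjoint Cs ×
    (∀ (a b : Fin n) → adj D a b ≡ true →
    (∃[ C ] ((C ∈ Cs) × CycleEdge C a b)) ⊎ ((a Data.Product., b) ∈ U)) ×
    ((ℕ→ℚ (length U) ^ℚ 8) ≤ ε n * (ℕ→ℚ (edgeCount D) ^ℚ 8))
theorem1p6 ε p ε-range p-range growth =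
  -- z = 2 bounds ε R and p P, which are at most 11/10 after rounding up.
  uniformly 2 (proj₁ nearly-decompose) (from-yes (1ℚ + (+ 1 / 10) ℚP.≤? ℕ→ℚ 2)) (ℕ.s≤s ℕ.z≤n) (proj₂ nearly-decompose)
  where
  Decomposes : ∀ {n} → Digraph n → Set
  Decomposes {n} D = ∃[ Cs ] ∃[ U ]
    (∀ C → C ∈ Cs → CycleIn D C) ×
    PairwiseEdgeDisjoint Cs ×
    (∀ (a b : Fin n) → adj D a b ≡ true →
    (∃[ C ] ((C ∈ Cs) × CycleEdge C a b)) ⊎ ((a Data.Product., b) ∈ U)) ×
    ((ℕ→ℚ (length U) ^ℚ 8) ≤ ε n * (ℕ→ℚ (edgeCount D) ^ℚ 8))

  conclude : ∀ {n} {G : Digraph n} → (∃ λ R → 1ℚ ≤ ε n * ℕ→ℚ R × NearlyDecomposed G R) → Decomposes G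
  conclude {n} {G} (R , 1≤εR , Cs , U , in-G , disjoint , covered , small) = Cs , U , in-G , disjoint , covered ,
    Sparse.fraction {n} (proj₁ (ε-range n)) (proj₂ (ε-range n)) (proj₁ (p-range n)) (proj₂ (p-range n)) R (length U) (edgeCount G) 1≤εR small

  uniformly : ∀ z C → 1ℚ + (+ 1 / 10) ≤ ℕ→ℚ z → 0 ℕ.< z →
    (∀ S₂ P X L n → 7 ℕ.≤ S₂ → 10 ℕ.≤ P → 1 ℕ.≤ L → n ℕ.≤ P ℕ.* (X ℕ.+ 1) → 9 ℕ.* (P ℕ.* X) ℕ.≤ 10 ℕ.* n → n ℕ.< 2 ℕ.^ ℕ.suc L →
      C ℕ.* (L ℕ.^ 5 ℕ.* ((S₂ ℕ.+ 3) ℕ.^ 11 ℕ.* P ℕ.^ 8)) ℕ.≤ n → (G : Digraph n) → CloseCounts S₂ X G → NearlyDecomposed G (S₂ ℕ.+ 2 ℕ.+ 1)) →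
    ∃[ N ] ∀ n → N ℕ.≤ n → 2 ∣ n → ∀ (D : Digraph n) → Uniform (ε n) (p n) D → Decomposes D
  -- The summand 2 ensures n ≥ 2, hence a logarithm of at least 1.
  uniformly z C z≥ 0<z decompose = N ℕ.+ 2 , λ n N≤n _ G uniform → conclude {n} {G} (Sparse.nearly-decomposed (proj₁ (ε-range n)) (proj₂ (ε-range n)) (proj₁ (p-range n)) (proj₂ (p-range n))
      z C z≥ 0<z (ℕP.≤-trans (ℕP.m≤n+m 2 N) N≤n) decompose (proj₂ (growth M) n (ℕP.≤-trans (ℕP.m≤m+n N 2) N≤n)) G uniform)
    where
    M : ℚ
    M = ℕ→ℚ (z ℕ.^ 11 ℕ.* z ℕ.^ 8 ℕ.* C)
    N : ℕ
    N = proj₁ (growth M)
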